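{- Suppose the average-case $k$-SUM conjecture (respectively, the average-case $k$-XOR conjecture) is true. Then, for $k\in\mathbb{N}$ and $\Delta\in\left(\tfrac12,1\right)$ such that $\Delta=\frac{k}{k'}$ for some $k'\in[k+1,2k-1]$, any algorithm that solves planted search $k$-SUM over the groups $\mathbb{Z}_{2^{m}}$ (respectively, over $\mathbb{F}_2^{m}$) with $m=\lceil k\log r/\Delta\rceil$ with constant success probability has to take expected time $\Omega\left(r^{\left[k\left(1-\frac{1}{2\Delta}\right)\right]-o(1)}\right)$.
   Context: All logarithms are base 2; algorithms may be randomized; brackets $[\cdot]$ in the exponent are ordinary brackets. Average-case $k$-SUM conjecture: for any $k\in\mathbb{N}$, any algorithm that, given $r$ i.i.d. uniformly random elements of $\mathbb{Z}_{2^{m}}$ with $m=\lceil k\log r\rceil$, outputs with constant probability a set of $k$ of them summing to $0$ has expected running time at least $\Omega(r^{\lceil k/2\rceil-o(1)})$. Average-case $k$-XOR conjecture: the same with $\mathbb{F}_2^{m}$, $m=\lceil k\log r\rceil$, in place of $\mathbb{Z}_{2^m}$. Planted search $k$-SUM over groups $G^{(r)}$: sample $X_1,\dots,X_r$ i.i.d. uniformly from $G^{(r)}$; choose a uniformly random $S\subseteq[r]$ with $|S|=k$; let $i=\min S$ and replace $X_i$ by $-\sum_{j\in S,j\ne i}X_j$. An algorithm solves it with success probability $\epsilon$ if, on input $X=(X_1,\dots,X_r)$ so sampled, it outputs with probability at least $\epsilon$ (over $X$ and its coins) a set $S'\subseteq[r]$, $|S'|=k$, with $\sum_{i\in S'}X_i=0$.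 -}

module Defs where

open import Algebra.Bundles.Raw using (RawGroup)
open import Algebra.Definitions.RawSemiring as RawSemiring using ()
open import Data.Bool using (Bool; true; false; if_then_else_; _xor_)
open import Data.Bool.Properties using () renaming (_≟_ to _≟ᵇ_)
open import Data.Fin using (Fin; toℕ)
import Data.Fin.Properties as Fin
open import Data.Fin.Subset using (Subset; inside; outside; ∣_∣)
open import Data.Integer as ℤ using (+_; -[1+_])
open import Data.List using (List; []; _∷_; map; length; foldr; filter; upTo; allFin; cartesianProductWith)
open import Data.Nat as ℕ using (ℕ; zero; suc; NonZero; ⌈_/2⌉)
open import Data.Nat.DivMod using (_mod_)
open import Data.Nat.Logarithm using (⌈log₂_⌉)
import Data.Nat.Properties as ℕ
open import Data.Product using (Σ; ∃; ∃-syntax; _×_; _,_)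
open import Data.Rational as ℚ using (ℚ; 0ℚ; 1ℚ; _/_; ↥_; ↧ₙ_)
open import Data.Vec using (Vec; []; _∷_; zipWith; replicate; tabulate; toList)
import Data.Vec as Vec
import Data.Vec.Properties as Vec
open import Function using (id)
open import Level using (0ℓ)
open import Relation.Binary.Definitions using (DecidableEquality)
open import Relation.Binary.PropositionalEquality using (_≡_)
open import Relation.Nullary using (Dec; does)
open import Relation.Nullary.Decidable using (_×-dec_)

open RawSemiring ℚ.+-*-rawSemiring using () renaming (_^_ to _^ℚ_)

fromℕ : ℕ → ℚ
fromℕ n = + n / 1

sumℚ : List ℚ → ℚ
sumℚ = foldr ℚ._+_ 0ℚ

-- The expectation of f at a uniformly random entry of the list; the value
-- for the empty list is a dummy.
mean : {A : Set} → List A → (A → ℚ) → ℚ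
mean []            f = 0ℚ
mean xs@(_ ∷ xs′) f = sumℚ (map f xs) ℚ.* (+ 1 / suc (length xs′))

indicator : {P : Set} → Dec P → ℚ
indicator d = if does d then 1ℚ else 0ℚ

allVecs : {A : Set} → List A → (n : ℕ) → List (Vec A n)
allVecs xs zero    = [] ∷ []
allVecs xs (suc n) = cartesianProductWith _∷_ xs (allVecs xs n)

record FiniteGroup : Set₁ where
  field
    rawGroup : RawGroup 0ℓ 0ℓ
  open RawGroup rawGroup public using (Carrier; _∙_; ε; _⁻¹)
  field
    _≟_      : DecidableEquality Carrier
    elements : List Carrier        -- every element exactly once
    code     : Carrier → ℕ

ℤ2^ : ℕ → FiniteGroup
ℤ2^ m = record
  { rawGroup = record
    { Carrier = Fin (2 ℕ.^ m)
    ; _≈_     = _≡_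
    ; _∙_     = λ x y → reduce (toℕ x ℕ.+ toℕ y)
    ; ε       = reduce 0
    ; _⁻¹     = λ x → reduce (2 ℕ.^ m ℕ.∸ toℕ x)
    }
  ; _≟_      = Fin._≟_
  ; elements = allFin (2 ℕ.^ m)
  ; code     = toℕ
  }
  where
  reduce : ℕ → Fin (2 ℕ.^ m)
  reduce n = _mod_ n (2 ℕ.^ m) {{ℕ.m^n≢0 2 m}}

-- Least significant bit first.
fromBits : ∀ {m} → Vec Bool m → ℕ
fromBits []       = 0
fromBits (b ∷ bs) = (if b then 1 else 0) ℕ.+ 2 ℕ.* fromBits bs

𝔽₂^ : ℕ → FiniteGroup
𝔽₂^ m = record
  { rawGroup = record
    { Carrier = Vec Bool m
    ; _≈_     = _≡_
    ; _∙_     = zipWith _xor_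
    ; ε       = replicate m false
    ; _⁻¹     = id
    }
  ; _≟_      = Vec.≡-dec _≟ᵇ_
  ; elements = allVecs (false ∷ true ∷ []) m
  ; code     = fromBits
  }

-- Randomized random-access machines under the logarithmic cost criterion
--
-- Programs are presented in structured form. The memory consists of arrays
-- of natural numbers (a program mentions finitely many of them), initially
-- zero everywhere. The input is a read-only list of numbers, accessible at
-- random; a program is also given its length.

data Op : Set where
  add monus mul quot xor less : Op

data Exp : Set where
  lit    : ℕ → Exp
  size   : Exp
  input  : Exp → Exp
  load   : (a : ℕ) → Exp → Exp
  op     : Op → Exp → Exp → Exp
  bitlen : Exp → Exp

infixr 5 _⨾_

data Program : Set where
  skip   : Program
  store  : (a : ℕ) (i e : Exp) → Program     -- a[i] := e
  random : (a : ℕ) (i e : Exp) → Program     -- a[i] := uniform from {0, …, e - 1}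
  _⨾_    : (p q : Program) → Program
  branch : (e : Exp) (p q : Program) → Program
  while  : (e : Exp) (p : Program) → Program

Input : Set
Input = List ℕ

Memory : Set
Memory = ℕ → ℕ → ℕ

emptyMemory : Memory
emptyMemory _ _ = 0

update : Memory → (a i v : ℕ) → Memory
update σ a i v b j =
  if does ((a ℕ.≟ b) ×-dec (i ℕ.≟ j)) then v else σ b j

nth : List ℕ → ℕ → ℕ
nth []       _       = 0
nth (x ∷ xs) zero    = x
nth (x ∷ xs) (suc i) = nth xs i

-- Bitwise exclusive or; the first argument is fuel, and any fuel that is at
-- least max(a,b) gives the same result.
xorℕ-fuel : ℕ → ℕ → ℕ → ℕ
xorℕ-fuel zero    a b = 0
xorℕ-fuel (suc f) a b =
  (a ℕ.+ b) ℕ.% 2 ℕ.+ 2 ℕ.* xorℕ-fuel f (a ℕ./ 2) (b ℕ./ 2)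

xorℕ : ℕ → ℕ → ℕ
xorℕ a b = xorℕ-fuel (a ℕ.+ b) a b

quotℕ : ℕ → ℕ → ℕ
quotℕ a zero    = 0
quotℕ a (suc b) = a ℕ./ suc b

-- The number of binary digits, with len 0 = 0.
len : ℕ → ℕ
len n = ⌈log₂ suc n ⌉

applyOp : Op → ℕ → ℕ → ℕ
applyOp add   a b = a ℕ.+ b
applyOp monus a b = a ℕ.∸ b
applyOp mul   a b = a ℕ.* b
applyOp quot  a b = quotℕ a b
applyOp xor   a b = xorℕ a b
applyOp less  a b = if a ℕ.<ᵇ b then 1 else 0

eval : Input → Memory → Exp → ℕ
eval X σ (lit n)      = n
eval X σ size         = length X
eval X σ (input e)    = nth X (eval X σ e)
eval X σ (load a e)   = σ a (eval X σ e)
eval X σ (op o e e′)  = applyOp o (eval X σ e) (eval X σ e′)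
eval X σ (bitlen e)   = len (eval X σ e)

-- Each operation is charged for the lengths of its operands (addresses
-- included) and of its result: every subexpression pays 1 plus the length
-- of its own value.
expCost : Input → Memory → Exp → ℕ
expCost X σ e = suc (len (eval X σ e) ℕ.+ sub e)
  where
  sub : Exp → ℕ
  sub (lit _)      = 0
  sub size         = 0
  sub (input e)    = expCost X σ e
  sub (load _ e)   = expCost X σ e
  sub (op _ e e′)  = expCost X σ e ℕ.+ expCost X σ e′
  sub (bitlen e)   = expCost X σ e

-- The programs still to be run, in order, and the memory. The machine has
-- halted when no program is left.
Config : Set
Config = List Program × Memory

initial : Program → Config
initial p = (p ∷ []) , emptyMemory

-- The range {0, …, n - 1}, or {0} if n = 0.
range : ℕ → List ℕ
range zero    = 0 ∷ []
range (suc n) = upTo (suc n)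

-- Running s with K left to do afterwards: the next configuration is uniform
-- on the list.
next : Input → Program → List Program → Memory → List Config
next X skip            K σ = (K , σ) ∷ []
next X (store a i e)   K σ = (K , update σ a (eval X σ i) (eval X σ e)) ∷ []
next X (random a i e)  K σ =
  map (λ v → K , update σ a (eval X σ i) v) (range (eval X σ e))
next X (p ⨾ q)         K σ = (p ∷ q ∷ K , σ) ∷ []
next X (branch e p q)  K σ with eval X σ e
... | zero             = (q ∷ K , σ) ∷ []
... | suc _            = (p ∷ K , σ) ∷ []
next X (while e p)     K σ with eval X σ e
... | zero             = (K , σ) ∷ []
... | suc _            = (p ∷ while e p ∷ K , σ) ∷ []

stepCost : Input → Program → Memory → ℕ
stepCost X skip           σ = 1
stepCost X (store a i e)  σ = 1 ℕ.+ expCost X σ i ℕ.+ expCost X σ e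
stepCost X (random a i e) σ = 1 ℕ.+ expCost X σ i ℕ.+ expCost X σ e
stepCost X (p ⨾ q)        σ = 1
stepCost X (branch e p q) σ = 1 ℕ.+ expCost X σ e
stepCost X (while e p)    σ = 1 ℕ.+ expCost X σ e

-- The expected cost of the first n steps. It is nondecreasing in n, and its
-- supremum over n is the expected running time (infinite if the machine
-- runs forever with positive probability, since each step costs at least 1).
costWithin : Input → ℕ → Config → ℚ
costWithin X zero    _             = 0ℚ
costWithin X (suc n) ([] , σ)      = 0ℚ
costWithin X (suc n) (s ∷ K , σ) =
  fromℕ (stepCost X s σ) ℚ.+ mean (next X s K σ) (costWithin X n)

-- The probability of halting within n steps with a memory satisfying P.
-- It is nondecreasing in n, and its supremum over n is the probability of
-- halting with such a memory.
haltWithin : {P : Memory → Set} → (∀ σ → Dec (P σ)) → Input → ℕ → Config → ℚ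
haltWithin P? X n       ([] , σ)      = indicator (P? σ)
haltWithin P? X zero    (s ∷ K , σ) = 0ℚ
haltWithin P? X (suc n) (s ∷ K , σ) = mean (next X s K σ) (haltWithin P? X n)

-- The numbers below r in the first k cells of array 0 of the final
-- memory form the output set. It has k elements only if those cells hold
-- k distinct numbers below r.
outputSet : (k r : ℕ) → Memory → Subset r
outputSet k r σ =
  tabulate λ i → does (Fin.any? {n = k} λ j → σ 0 (toℕ j) ℕ.≟ toℕ i)

subsetsOfSize : (k r : ℕ) → List (Subset r)
subsetsOfSize k r =
  filter (λ S → ∣ S ∣ ℕ.≟ k) (allVecs (inside ∷ outside ∷ []) r)

module _ (G : FiniteGroup) where
  open FiniteGroup G

  sumOver : ∀ {r} → Subset r → Vec Carrier r → Carrier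
  sumOver []            []      = ε
  sumOver (outside ∷ S) (x ∷ X) = sumOver S X
  sumOver (inside ∷ S)  (x ∷ X) = x ∙ sumOver S X

  -- Replace X_i, for i = min S, by -Σ_{j ∈ S, j ≠ i} X_j. After the first
  -- element of S, what is left of S is S without its minimum.
  plant : ∀ {r} → Subset r → Vec Carrier r → Vec Carrier r
  plant []            []      = []
  plant (outside ∷ S) (x ∷ X) = x ∷ plant S X
  plant (inside ∷ S)  (x ∷ X) = (sumOver S X ⁻¹) ∷ X

  IsSolution : ∀ {r} → ℕ → Vec Carrier r → Subset r → Set
  IsSolution k X S = ∣ S ∣ ≡ k × sumOver S X ≡ ε

  isSolution? : ∀ {r} k (X : Vec Carrier r) S → Dec (IsSolution k X S)
  isSolution? k X S = (∣ S ∣ ℕ.≟ k) ×-dec (sumOver S X ≟ ε)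

  encode : ∀ {r} → Vec Carrier r → Input
  encode X = toList (Vec.map code X)

  -- A distribution of instances, as its expectation operator.
  InstanceDist : ℕ → Set
  InstanceDist r = (Vec Carrier r → ℚ) → ℚ

  uniform : (r : ℕ) → InstanceDist r
  uniform r = mean (allVecs elements r)

  planted : (k r : ℕ) → InstanceDist r
  planted k r f =
    mean (subsetsOfSize k r) λ S → uniform r λ X → f (plant S X)

  -- Both expectations are over the instance and the coins of the program,
  -- for the first n steps of its execution.
  successWithin : ∀ {r} → ℕ → InstanceDist r → Program → ℕ → ℚ
  successWithin {r} k 𝔼 p n = 𝔼 λ X →
    haltWithin (λ σ → isSolution? k X (outputSet k r σ)) (encode X) n (initial p)

  timeWithin : ∀ {r} → InstanceDist r → Program → ℕ → ℚ
  timeWithin 𝔼 p n = 𝔼 λ X → costWithin (encode X) n (initial p)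

-- ⌈e log₂ r⌉, for e ≥ 0 and r ≥ 1. With e = a/d this is ⌈log₂ (r^a) / d⌉,
-- and rounding log₂ (r^a) up before the division by d does not change it.
⌈_log_⌉ : ℚ → ℕ → ℕ
⌈ e log r ⌉ =
  (⌈log₂ r ℕ.^ ℤ.∣ ↥ e ∣ ⌉ ℕ.+ (↧ₙ e ℕ.∸ 1)) ℕ./ ↧ₙ e

-- r^e ≤ y, for r ≥ 1 and y ≥ 0, with both sides raised to the power of the
-- denominator of e and a negative power of r moved to the right.
_^⟨_⟩≤_ : ℕ → ℚ → ℚ → Set
r ^⟨ e ⟩≤ y with ↥ e
... | + a      = fromℕ (r ℕ.^ a) ℚ.≤ y ^ℚ (↧ₙ e)
... | -[1+ a ] = 1ℚ ℚ.≤ fromℕ (r ℕ.^ suc a) ℚ.* y ^ℚ (↧ₙ e)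

Vanishing : (ℕ → ℚ) → Set
Vanishing g = ∀ δ → 0ℚ ℚ.< δ → ∃[ N ] (∀ r → N ℕ.≤ r → ℚ.∣ g r ∣ ℚ.< δ)

-- sup_n f r n = Ω(r^{e - o(1)}), for f r nondecreasing. Asking that some
-- f r n attain the bound, instead of the supremum, affects only C.
_isΩ-r^[_-o1] : (ℕ → ℕ → ℚ) → ℚ → Set
f isΩ-r^[ e -o1] =
  ∃[ g ] Vanishing g ×
  ∃[ C ] 0ℚ ℚ.< C ×
  ∃[ r₀ ] (∀ r → r₀ ℕ.≤ r → ∃[ n ] r ^⟨ e ℚ.- g r ⟩≤ (C ℚ.* f r n))

-- sup_n f r n ≥ ε for a constant ε > 0 and all large r, for f r
-- nondecreasing; "attained" may be assumed at the price of a smaller ε.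
BoundedBelow : (ℕ → ℕ → ℚ) → Set
BoundedBelow f =
  ∃[ ε ] 0ℚ ℚ.< ε × ∃[ r₀ ] (∀ r → r₀ ℕ.≤ r → ∃[ n ] ε ℚ.≤ f r n)

-- Every algorithm that, on r elements of G r distributed according to D r,
-- finds with constant probability k elements summing to zero takes expected
-- time Ω(r^{e - o(1)}).
TakesTime : (k : ℕ) (G : ℕ → FiniteGroup) → (∀ r → InstanceDist (G r) r) → ℚ → Set
TakesTime k G D e =
  (p : Program) →
  BoundedBelow (λ r → successWithin (G r) k (D r) p) →
  (λ r → timeWithin (G r) (D r) p) isΩ-r^[ e -o1]

AverageCaseConjecture : (ℕ → FiniteGroup) → Set
AverageCaseConjecture 𝔾 =
  (k : ℕ) →
  let G = λ r → 𝔾 ⌈ fromℕ k log r ⌉ in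
  TakesTime k G (λ r → uniform (G r) r) (fromℕ ⌈ k /2⌉)

AverageCaseSUM : Set
AverageCaseSUM = AverageCaseConjecture ℤ2^

AverageCaseXOR : Set
AverageCaseXOR = AverageCaseConjecture 𝔽₂^

-- The time lower bound with exponent e for planted search k-SUM over
-- 𝔾 m with m = ⌈k log r / Δ⌉.
PlantedTakesTime : (ℕ → FiniteGroup) → (k : ℕ) (Δ : ℚ) .{{_ : ℚ.NonZero Δ}} → ℚ → Set
PlantedTakesTime 𝔾 k Δ e =
  let G = λ r → 𝔾 ⌈ fromℕ k ℚ.÷ Δ log r ⌉ in
  TakesTime k G (λ r → planted (G r) k r) e

{-# OPTIONS --safe #-}

-- Put u = k′ - k and let M be the order of the group, so that r^k′ ≤ M ≤ 2 r^k′.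
-- A program for planted k-SUM yields one for k′-SUM on uniform instances X:
-- plant a solution in a random instance, run the program on it and measure its
-- running time t. Choose a random set B of indices and make r^u attempts, each
-- limited to time t: draw a u-tuple U of indices, add the sum of X over U to the
-- elements indexed by B, and run the program on the result. If it finds a
-- k-tuple with exactly one element in B, this tuple and U form a solution for X.
-- If t > r^k′, draw r^k′ random k′-tuples instead.
--
-- The shifted instances are uniform, and a uniform instance with a solution is
-- close to a planted one. Of two independent runs that succeed, the second is
-- no slower than the first at least half of the time, so the limit t costs a
-- constant factor. With z the expected number of successful attempts, the
-- attempts succeed with probability at least λz - λ²z² for every small λ, and
-- the second moment of the number of solutions of X is bounded, so the success
-- probability is bounded below. The expected time is r^u times that of the given
-- program, up to powers of log r, and ⌈k′/2⌉ - u ≥ k - k′/2 = k (1 - 1/(2Δ)).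

module Submission where

open import Defs
open import Data.Bool using (Bool; true; false; if_then_else_; _xor_; not; T)
import Data.Bool.Properties as Bool
open import Data.Empty using (⊥)
open import Data.Fin using (Fin; zero; suc; toℕ; fromℕ<)
import Data.Fin.Properties as Fin
open import Data.Fin.Subset using (Subset; inside; outside; ∣_∣)
open import Data.Integer as ℤ using (ℤ; +_; -[1+_])
import Data.Integer.Properties as ℤ
open import Data.List using (List; []; _∷_; map; length; _++_; filter; allFin; cartesianProductWith; applyUpTo)
import Data.List as List
import Data.List.Properties as List
open import Data.Nat using (ℕ; zero; suc; NonZero; _+_; _*_; _∸_; _^_; _≤_; _<_; _⊔_; z≤n; s≤s; _%_; _<ᵇ_; ⌈_/2⌉)
import Data.Nat as ℕ
import Data.Nat.Coprimality as Coprimality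
import Data.Nat.DivMod as DivMod
open import Data.Nat.Divisibility using (divides)
open import Data.Nat.Logarithm using (⌈log₂_⌉)
import Data.Nat.Logarithm as Log
import Data.Nat.Properties as ℕ
open import Data.Nat.Properties using (≤-trans; +-mono-≤; *-monoʳ-≤; m≤m+n; m≤n+m; ≤-refl; +-monoˡ-≤; +-identityʳ; +-monoʳ-≤; m≤n⇒m≤1+n; +-suc; m^n≢0; +-comm; n≤1+n; ≰⇒>; ≮⇒≥; *-monoˡ-≤; <-irrefl; <⇒≤; *-identityˡ; m^n>0; *-distribʳ-+; ^-monoʳ-≤; m∸n+n≡m)
open import Data.Nat.Tactic.RingSolver using (solve-∀)
open import Data.Product using (Σ; ∃-syntax; _×_; _,_; proj₁; proj₂)
open import Data.Rational as ℚ using (ℚ; 0ℚ; 1ℚ; ½; _/_; _÷_)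
import Data.Rational.Properties as ℚ
open import Data.Rational.Solver using (module +-*-Solver)
open +-*-Solver using (solve; _:=_; _:+_; _:*_; _:-_; :-_; con)
import Data.Rational.Unnormalised as ℚᵘ
import Data.Rational.Unnormalised.Properties as ℚᵘ
open import Data.Sum using (_⊎_; inj₁; inj₂; [_,_]′)
open import Data.Unit using (⊤; tt)
open import Data.Vec using (Vec; []; _∷_; lookup)
import Data.Vec as Vec
import Data.Vec.Properties as Vec
open import Function using (_∘_; id; case_of_)
open import Relation.Binary.PropositionalEquality using (_≡_; _≢_; refl; sym; trans; cong; cong₂; subst; subst₂; module ≡-Reasoning)
open import Relation.Binary.Definitions using (tri<; tri≈; tri>)
open import Relation.Nullary using (Dec; yes; no; ¬_; does; contradiction)
open import Relation.Nullary.Decidable using (_×-dec_; ¬?; dec-true; dec-false; toSum)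
open import Data.Rational using () renaming (_+_ to _+ℚ_; _*_ to _*ℚ_; _-_ to _-ℚ_; -_ to -ℚ_; _≤_ to _≤ℚ_; _<_ to _<ℚ_)
import Algebra.Definitions.RawSemiring as RawSemiring
open RawSemiring ℚ.+-*-rawSemiring using () renaming (_^_ to _^ℚ_)
open import Algebra.Bundles using (CommutativeRing)
open import Algebra.Properties.CommutativeSemiring.Exp (CommutativeRing.commutativeSemiring ℚ.+-*-commutativeRing) using (^-homo-*; ^-assocʳ; ^-distrib-*)

∑ : {A : Set} → List A → (A → ℚ) → ℚ
∑ []       f = 0ℚ
∑ (x ∷ xs) f = f x +ℚ ∑ xs f

module ℚ-Lemmas where
  respˡ : ∀ {a b c} → a ≡ b → a ≤ℚ c → b ≤ℚ c
  respˡ refl p = p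

  respʳ : ∀ {a b c} → a ≡ b → c ≤ℚ a → c ≤ℚ b
  respʳ refl p = p

  *-monoˡ : ∀ {c a b} → 0ℚ ≤ℚ c → a ≤ℚ b → c *ℚ a ≤ℚ c *ℚ b
  *-monoˡ {c} p = ℚ.*-monoˡ-≤-nonNeg c {{ℚ.nonNegative p}}

  *-monoʳ : ∀ {c a b} → 0ℚ ≤ℚ c → a ≤ℚ b → a *ℚ c ≤ℚ b *ℚ c
  *-monoʳ {c} p = ℚ.*-monoʳ-≤-nonNeg c {{ℚ.nonNegative p}}

  0≤+ : ∀ {a b} → 0ℚ ≤ℚ a → 0ℚ ≤ℚ b → 0ℚ ≤ℚ a +ℚ b
  0≤+ p q = respˡ (ℚ.+-identityˡ 0ℚ) (ℚ.+-mono-≤ p q)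

  0≤* : ∀ {a b} → 0ℚ ≤ℚ a → 0ℚ ≤ℚ b → 0ℚ ≤ℚ a *ℚ b
  0≤* {a} p q = respˡ (ℚ.*-zeroʳ a) (*-monoˡ p q)

  *-mono : ∀ {a b c d} → 0ℚ ≤ℚ a → 0ℚ ≤ℚ d → a ≤ℚ b → c ≤ℚ d → a *ℚ c ≤ℚ b *ℚ d
  *-mono 0≤a 0≤d p q = ℚ.≤-trans (*-monoˡ 0≤a q) (*-monoʳ 0≤d p)

  0≤1 : 0ℚ ≤ℚ 1ℚ
  0≤1 = ℚ.nonNegative⁻¹ 1ℚ

  ≤+ʳ : ∀ {a b} → 0ℚ ≤ℚ b → a ≤ℚ a +ℚ b
  ≤+ʳ {a} p = respˡ (ℚ.+-identityʳ a) (ℚ.+-monoʳ-≤ a p)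

  ≤+ˡ : ∀ {a b} → 0ℚ ≤ℚ b → a ≤ℚ b +ℚ a
  ≤+ˡ {a} p = respˡ (ℚ.+-identityˡ a) (ℚ.+-monoˡ-≤ a p)

  -- Inequalities are reduced to nonnegativity of a difference, which the ring
  -- solver can then rearrange.
  ≤-from-diff : ∀ {a b d} → 0ℚ ≤ℚ d → b ≡ a +ℚ d → a ≤ℚ b
  ≤-from-diff p refl = ≤+ʳ p

  diff≥0 : ∀ {a b} → a ≤ℚ b → 0ℚ ≤ℚ b -ℚ a
  diff≥0 {a} {b} p = respˡ (ℚ.+-inverseʳ a) (ℚ.+-monoˡ-≤ (-ℚ a) p)

  ≡⇒≤ : ∀ {a b} → a ≡ b → a ≤ℚ b
  ≡⇒≤ = ℚ.≤-reflexive

  0≤square : ∀ a → 0ℚ ≤ℚ a *ℚ a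
  0≤square a with ℚ.≤-total 0ℚ a
  ... | inj₁ p = 0≤* p p
  ... | inj₂ p = subst (0ℚ ≤ℚ_) (solve 1 (λ x → (:- x) :* (:- x) := x :* x) refl a)
                       (0≤* (ℚ.neg-antimono-≤ p) (ℚ.neg-antimono-≤ p))

open ℚ-Lemmas

fromℕ-+ : ∀ m n → fromℕ (m + n) ≡ fromℕ m +ℚ fromℕ n
fromℕ-+ m n = ℚ.toℚᵘ-injective (begin
  ℚ.toℚᵘ (fromℕ (m + n))                        ≈⟨ ℚ.toℚᵘ-fromℚᵘ (ℚᵘ.mkℚᵘ (+ (m + n)) 0) ⟩
  ℚᵘ.mkℚᵘ (+ (m + n)) 0                         ≈⟨ ℚᵘ.*≡* (cong (λ z → z ℤ.* + 1) (sym (cong₂ ℤ._+_ (ℤ.*-identityʳ (+ m)) (ℤ.*-identityʳ (+ n))))) ⟩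
  ℚᵘ.mkℚᵘ (+ m) 0 ℚᵘ.+ ℚᵘ.mkℚᵘ (+ n) 0          ≈⟨ ℚᵘ.+-cong (ℚᵘ.≃-sym (ℚ.toℚᵘ-fromℚᵘ (ℚᵘ.mkℚᵘ (+ m) 0))) (ℚᵘ.≃-sym (ℚ.toℚᵘ-fromℚᵘ (ℚᵘ.mkℚᵘ (+ n) 0))) ⟩
  ℚ.toℚᵘ (fromℕ m) ℚᵘ.+ ℚ.toℚᵘ (fromℕ n)        ≈⟨ ℚᵘ.≃-sym (ℚ.toℚᵘ-homo-+ (fromℕ m) (fromℕ n)) ⟩
  ℚ.toℚᵘ (fromℕ m +ℚ fromℕ n) ∎)
  where open ℚᵘ.≃-Reasoning

fromℕ-merge : ∀ a b x → fromℕ a +ℚ (fromℕ b +ℚ x) ≡ fromℕ (a + b) +ℚ x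
fromℕ-merge a b x = trans (sym (ℚ.+-assoc (fromℕ a) (fromℕ b) x)) (cong (_+ℚ x) (sym (fromℕ-+ a b)))

fromℕ-* : ∀ m n → fromℕ (m * n) ≡ fromℕ m *ℚ fromℕ n
fromℕ-* zero    n = sym (ℚ.*-zeroˡ (fromℕ n))
fromℕ-* (suc m) n = begin
  fromℕ (n + m * n) ≡⟨ fromℕ-+ n (m * n) ⟩
  fromℕ n +ℚ fromℕ (m * n) ≡⟨ cong₂ _+ℚ_ (sym (ℚ.*-identityˡ (fromℕ n))) (fromℕ-* m n) ⟩
  1ℚ *ℚ fromℕ n +ℚ fromℕ m *ℚ fromℕ n ≡⟨ sym (ℚ.*-distribʳ-+ (fromℕ n) 1ℚ (fromℕ m)) ⟩
  (1ℚ +ℚ fromℕ m) *ℚ fromℕ n ≡⟨ cong (_*ℚ fromℕ n) (sym (fromℕ-+ 1 m)) ⟩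
  fromℕ (suc m) *ℚ fromℕ n ∎
  where open ≡-Reasoning

0≤fromℕ : ∀ n → 0ℚ ≤ℚ fromℕ n
0≤fromℕ n = ℚ.nonNegative⁻¹ (fromℕ n) {{ℚ.normalize-nonNeg n 1}}

0<fromℕ : ∀ n .{{_ : NonZero n}} → 0ℚ <ℚ fromℕ n
0<fromℕ n = ℚ.positive⁻¹ (fromℕ n) {{ℚ.normalize-pos n 1}}

fromℕ-mono : ∀ {m n} → m ≤ n → fromℕ m ≤ℚ fromℕ n
fromℕ-mono {m} {n} p = subst (fromℕ m ≤ℚ_) (trans (sym (fromℕ-+ m (n ∸ m))) (cong fromℕ (ℕ.m+[n∸m]≡n p))) (≤+ʳ (0≤fromℕ (n ∸ m)))

1≤fromℕ : ∀ n .{{_ : NonZero n}} → 1ℚ ≤ℚ fromℕ n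
1≤fromℕ (suc n) = fromℕ-mono {1} {suc n} (s≤s z≤n)

inv : ℕ → ℚ
inv zero    = 0ℚ
inv (suc n) = + 1 ℚ./ suc n

0≤inv : ∀ n → 0ℚ ≤ℚ inv n
0≤inv zero    = ℚ.≤-refl
0≤inv (suc n) = ℚ.nonNegative⁻¹ (inv (suc n)) {{ℚ.normalize-nonNeg 1 (suc n)}}

0<inv : ∀ n .{{_ : NonZero n}} → 0ℚ <ℚ inv n
0<inv (suc n) = ℚ.positive⁻¹ (inv (suc n)) {{ℚ.normalize-pos 1 (suc n)}}

fromℕ*inv : ∀ n .{{_ : NonZero n}} → fromℕ n *ℚ inv n ≡ 1ℚ
fromℕ*inv (suc n) = ℚ.toℚᵘ-injective (begin
  ℚ.toℚᵘ (fromℕ (suc n) *ℚ inv (suc n))                ≈⟨ ℚ.toℚᵘ-homo-* (fromℕ (suc n)) (inv (suc n)) ⟩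
  ℚ.toℚᵘ (fromℕ (suc n)) ℚᵘ.* ℚ.toℚᵘ (inv (suc n))     ≈⟨ ℚᵘ.*-cong (ℚ.toℚᵘ-fromℚᵘ (ℚᵘ.mkℚᵘ (+ suc n) 0)) (ℚ.toℚᵘ-fromℚᵘ (ℚᵘ.mkℚᵘ (+ 1) n)) ⟩
  ℚᵘ.mkℚᵘ (+ suc n) 0 ℚᵘ.* ℚᵘ.mkℚᵘ (+ 1) n             ≈⟨ ℚᵘ.*≡* (cong +_ (cong suc (lem n))) ⟩
  ℚᵘ.1ℚᵘ ∎)
  where
  open ℚᵘ.≃-Reasoning
  lem : ∀ n → n * 1 * 1 ≡ n + 0 + 0
  lem = solve-∀

inv*fromℕ : ∀ n .{{_ : NonZero n}} → inv n *ℚ fromℕ n ≡ 1ℚ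
inv*fromℕ n = trans (ℚ.*-comm (inv n) (fromℕ n)) (fromℕ*inv n)

-- Finite sums and means

module _ {A : Set} where
  ∑-cong : (xs : List A) {f g : A → ℚ} → (∀ x → f x ≡ g x) → ∑ xs f ≡ ∑ xs g
  ∑-cong []       h = refl
  ∑-cong (x ∷ xs) h = cong₂ _+ℚ_ (h x) (∑-cong xs h)

  ∑-mono : (xs : List A) {f g : A → ℚ} → (∀ x → f x ≤ℚ g x) → ∑ xs f ≤ℚ ∑ xs g
  ∑-mono []       h = ℚ.≤-refl
  ∑-mono (x ∷ xs) h = ℚ.+-mono-≤ (h x) (∑-mono xs h)

  ∑-+ : (xs : List A) (f g : A → ℚ) → ∑ xs (λ x → f x +ℚ g x) ≡ ∑ xs f +ℚ ∑ xs g
  ∑-+ []       f g = refl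
  ∑-+ (x ∷ xs) f g = trans (cong (f x +ℚ g x +ℚ_) (∑-+ xs f g))
    (solve 4 (λ a b c d → (a :+ b) :+ (c :+ d) := (a :+ c) :+ (b :+ d)) refl (f x) (g x) (∑ xs f) (∑ xs g))

  ∑-*ˡ : (xs : List A) (c : ℚ) (f : A → ℚ) → ∑ xs (λ x → c *ℚ f x) ≡ c *ℚ ∑ xs f
  ∑-*ˡ []       c f = sym (ℚ.*-zeroʳ c)
  ∑-*ˡ (x ∷ xs) c f = trans (cong (c *ℚ f x +ℚ_) (∑-*ˡ xs c f)) (sym (ℚ.*-distribˡ-+ c (f x) (∑ xs f)))

  ∑-*ʳ : (xs : List A) (c : ℚ) (f : A → ℚ) → ∑ xs (λ x → f x *ℚ c) ≡ ∑ xs f *ℚ c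
  ∑-*ʳ xs c f = trans (∑-cong xs (λ x → ℚ.*-comm (f x) c)) (trans (∑-*ˡ xs c f) (ℚ.*-comm c (∑ xs f)))

  ∑-zero : (xs : List A) → ∑ xs (λ _ → 0ℚ) ≡ 0ℚ
  ∑-zero []       = refl
  ∑-zero (x ∷ xs) = trans (ℚ.+-identityˡ _) (∑-zero xs)

  ∑-nonNeg : (xs : List A) {f : A → ℚ} → (∀ x → 0ℚ ≤ℚ f x) → 0ℚ ≤ℚ ∑ xs f
  ∑-nonNeg xs h = respˡ (∑-zero xs) (∑-mono xs h)

  ∑-const : (xs : List A) (c : ℚ) → ∑ xs (λ _ → c) ≡ fromℕ (length xs) *ℚ c
  ∑-const []       c = sym (ℚ.*-zeroˡ c)
  ∑-const (x ∷ xs) c = begin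
    c +ℚ ∑ xs (λ _ → c) ≡⟨ cong₂ _+ℚ_ (sym (ℚ.*-identityˡ c)) (∑-const xs c) ⟩
    1ℚ *ℚ c +ℚ fromℕ (length xs) *ℚ c ≡⟨ sym (ℚ.*-distribʳ-+ c 1ℚ (fromℕ (length xs))) ⟩
    (1ℚ +ℚ fromℕ (length xs)) *ℚ c ≡⟨ cong (_*ℚ c) (sym (fromℕ-+ 1 (length xs))) ⟩
    fromℕ (suc (length xs)) *ℚ c ∎
    where open ≡-Reasoning

  ∑-++ : (xs ys : List A) (f : A → ℚ) → ∑ (xs ++ ys) f ≡ ∑ xs f +ℚ ∑ ys f
  ∑-++ []       ys f = sym (ℚ.+-identityˡ _)
  ∑-++ (x ∷ xs) ys f = trans (cong (f x +ℚ_) (∑-++ xs ys f)) (sym (ℚ.+-assoc (f x) _ _))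

  ∑-map : {B : Set} (h : B → A) (xs : List B) (f : A → ℚ) → ∑ (map h xs) f ≡ ∑ xs (f ∘ h)
  ∑-map h []       f = refl
  ∑-map h (x ∷ xs) f = cong (f (h x) +ℚ_) (∑-map h xs f)

  sum-map : (xs : List A) (f : A → ℚ) → sumℚ (map f xs) ≡ ∑ xs f
  sum-map []       f = refl
  sum-map (x ∷ xs) f = cong (f x +ℚ_) (sum-map xs f)

  mean-∑ : (xs : List A) (f : A → ℚ) → mean xs f ≡ inv (length xs) *ℚ ∑ xs f
  mean-∑ []       f = refl
  mean-∑ (x ∷ xs) f = trans (cong (_*ℚ inv (suc (length xs))) (sum-map (x ∷ xs) f)) (ℚ.*-comm (∑ (x ∷ xs) f) (inv (suc (length xs))))

∑-swap : {A B : Set} (xs : List A) (ys : List B) (f : A → B → ℚ) →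
  ∑ xs (λ x → ∑ ys (f x)) ≡ ∑ ys (λ y → ∑ xs (λ x → f x y))
∑-swap []       ys f = sym (∑-zero ys)
∑-swap (x ∷ xs) ys f = trans (cong (∑ ys (f x) +ℚ_) (∑-swap xs ys f)) (sym (∑-+ ys (f x) _))

∑-cartesian : {A B C : Set} (h : A → B → C) (xs : List A) (ys : List B) (f : C → ℚ) →
  ∑ (cartesianProductWith h xs ys) f ≡ ∑ xs (λ x → ∑ ys (λ y → f (h x y)))
∑-cartesian h []       ys f = refl
∑-cartesian h (x ∷ xs) ys f = begin
  ∑ (map (h x) ys ++ cartesianProductWith h xs ys) f ≡⟨ ∑-++ (map (h x) ys) _ f ⟩
  ∑ (map (h x) ys) f +ℚ ∑ (cartesianProductWith h xs ys) f ≡⟨ cong₂ _+ℚ_ (∑-map (h x) ys f) (∑-cartesian h xs ys f) ⟩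
  ∑ ys (f ∘ h x) +ℚ ∑ xs (λ x → ∑ ys (λ y → f (h x y))) ∎
  where open ≡-Reasoning

inv-* : ∀ m n → inv (m * n) ≡ inv m *ℚ inv n
inv-* zero    n       = sym (ℚ.*-zeroˡ (inv n))
inv-* (suc m) zero    = trans (cong inv (ℕ.*-zeroʳ (suc m))) (sym (ℚ.*-zeroʳ (inv (suc m))))
inv-* (suc m) (suc n) = begin
  i ≡⟨ sym (ℚ.*-identityʳ i) ⟩
  i *ℚ 1ℚ ≡⟨ cong (i *ℚ_) (sym (trans (cong₂ _*ℚ_ (fromℕ*inv (suc m)) (fromℕ*inv (suc n))) (ℚ.*-identityˡ 1ℚ))) ⟩
  i *ℚ ((a *ℚ a′) *ℚ (b *ℚ b′)) ≡⟨ solve 5 (λ i a a′ b b′ → i :* ((a :* a′) :* (b :* b′)) := ((a :* b) :* i) :* (a′ :* b′)) refl i a a′ b b′ ⟩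
  ((a *ℚ b) *ℚ i) *ℚ (a′ *ℚ b′) ≡⟨ cong (λ z → (z *ℚ i) *ℚ (a′ *ℚ b′)) (sym (fromℕ-* (suc m) (suc n))) ⟩
  (fromℕ (suc m * suc n) *ℚ i) *ℚ (a′ *ℚ b′) ≡⟨ cong (_*ℚ (a′ *ℚ b′)) (fromℕ*inv (suc m * suc n)) ⟩
  1ℚ *ℚ (a′ *ℚ b′) ≡⟨ ℚ.*-identityˡ _ ⟩
  a′ *ℚ b′ ∎
  where
  open ≡-Reasoning
  i = inv (suc m * suc n)
  a = fromℕ (suc m)
  a′ = inv (suc m)
  b = fromℕ (suc n)
  b′ = inv (suc n)

∑-filter : {A : Set} {P : A → Set} (P? : ∀ x → Dec (P x)) (xs : List A) (f : A → ℚ) →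
  ∑ (filter P? xs) f ≡ ∑ xs (λ x → indicator (P? x) *ℚ f x)
∑-filter P? []       f = refl
∑-filter P? (x ∷ xs) f with does (P? x)
... | true  = cong₂ _+ℚ_ (sym (ℚ.*-identityˡ (f x))) (∑-filter P? xs f)
... | false = trans (∑-filter P? xs f) (sym (trans (cong (_+ℚ _) (ℚ.*-zeroˡ (f x))) (ℚ.+-identityˡ _)))

0≤indicator : {P : Set} (d : Dec P) → 0ℚ ≤ℚ indicator d
0≤indicator d with does d
... | true  = 0≤1
... | false = ℚ.≤-refl

indicator≤1 : {P : Set} (d : Dec P) → indicator d ≤ℚ 1ℚ
indicator≤1 d with does d
... | true  = ℚ.≤-refl
... | false = 0≤1

indicator-mono : {P Q : Set} (d : Dec P) (e : Dec Q) → (P → Q) → indicator d ≤ℚ indicator e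
indicator-mono (no _)  e       h = 0≤indicator e
indicator-mono (yes p) (yes _) h = ℚ.≤-refl
indicator-mono (yes p) (no ¬q) h = contradiction (h p) ¬q

indicator-cong : {P Q : Set} (d : Dec P) (e : Dec Q) → (P → Q) → (Q → P) → indicator d ≡ indicator e
indicator-cong d e h k = ℚ.≤-antisym (indicator-mono d e h) (indicator-mono e d k)

indicator-true : {P : Set} (d : Dec P) → P → indicator d ≡ 1ℚ
indicator-true (yes _) p = refl
indicator-true (no ¬p) p = contradiction p ¬p

indicator-false : {P : Set} (d : Dec P) → ¬ P → indicator d ≡ 0ℚ
indicator-false (yes p) ¬p = contradiction p ¬p
indicator-false (no _)  ¬p = refl

indicator-× : {P Q : Set} (d : Dec P) (e : Dec Q) → indicator (d ×-dec e) ≡ indicator d *ℚ indicator e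
indicator-× (yes _) (yes _) = sym (ℚ.*-identityˡ 1ℚ)
indicator-× (yes _) (no _)  = sym (ℚ.*-identityˡ 0ℚ)
indicator-× (no _)  e       = sym (ℚ.*-zeroˡ (indicator e))

-- Functionals that are finite sums with nonnegative weights: iterated means,
-- in particular expectations over the coins of a bounded run.
record FinSum {A : Set} (Φ : (A → ℚ) → ℚ) : Set where
  field
    support : List ((∃[ w ] 0ℚ ≤ℚ w) × A)
    as-sum  : ∀ f → Φ f ≡ ∑ support (λ (w , a) → proj₁ w *ℚ f a)

  Φ-cong : ∀ {f g} → (∀ a → f a ≡ g a) → Φ f ≡ Φ g
  Φ-cong {f} {g} h = trans (as-sum f) (trans (∑-cong support (λ (w , a) → cong (proj₁ w *ℚ_) (h a))) (sym (as-sum g)))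

  Φ-mono : ∀ {f g} → (∀ a → f a ≤ℚ g a) → Φ f ≤ℚ Φ g
  Φ-mono {f} {g} h = subst₂ _≤ℚ_ (sym (as-sum f)) (sym (as-sum g)) (∑-mono support (λ (w , a) → *-monoˡ (proj₂ w) (h a)))

  Φ-+ : ∀ f g → Φ (λ a → f a +ℚ g a) ≡ Φ f +ℚ Φ g
  Φ-+ f g = trans (as-sum _) (trans (∑-cong support (λ (w , a) → ℚ.*-distribˡ-+ (proj₁ w) (f a) (g a)))
              (trans (∑-+ support _ _) (sym (cong₂ _+ℚ_ (as-sum f) (as-sum g)))))

  Φ-*ˡ : ∀ c f → Φ (λ a → c *ℚ f a) ≡ c *ℚ Φ f
  Φ-*ˡ c f = trans (as-sum _) (trans (∑-cong support (λ (w , a) → lem (proj₁ w) (f a)))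
              (trans (∑-*ˡ support c _) (cong (c *ℚ_) (sym (as-sum f)))))
    where
    lem : ∀ w x → w *ℚ (c *ℚ x) ≡ c *ℚ (w *ℚ x)
    lem w x = solve 3 (λ w c x → w :* (c :* x) := c :* (w :* x)) refl w c x

  Φ-zero : Φ (λ _ → 0ℚ) ≡ 0ℚ
  Φ-zero = trans (as-sum _) (trans (∑-cong support (λ (w , a) → ℚ.*-zeroʳ (proj₁ w))) (∑-zero support))

  Φ-nonNeg : ∀ {f} → (∀ a → 0ℚ ≤ℚ f a) → 0ℚ ≤ℚ Φ f
  Φ-nonNeg h = respˡ Φ-zero (Φ-mono h)

  Φ-*ʳ : ∀ c f → Φ (λ a → f a *ℚ c) ≡ Φ f *ℚ c
  Φ-*ʳ c f = trans (Φ-cong (λ a → ℚ.*-comm (f a) c)) (trans (Φ-*ˡ c f) (ℚ.*-comm c (Φ f)))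

open FinSum

FinSum-swap : {A B : Set} {Φ : (A → ℚ) → ℚ} {Ψ : (B → ℚ) → ℚ} → FinSum Φ → FinSum Ψ → (f : A → B → ℚ) →
  Φ (λ a → Ψ (f a)) ≡ Ψ (λ b → Φ (λ a → f a b))
FinSum-swap {Φ = Φ} {Ψ} S T f = begin
  Φ (λ a → Ψ (f a)) ≡⟨ as-sum S _ ⟩
  ∑ (support S) (λ (w , a) → proj₁ w *ℚ Ψ (f a)) ≡⟨ ∑-cong (support S) (λ (w , a) → trans (cong (proj₁ w *ℚ_) (as-sum T (f a))) (sym (∑-*ˡ (support T) (proj₁ w) _))) ⟩
  ∑ (support S) (λ (w , a) → ∑ (support T) (λ (v , b) → proj₁ w *ℚ (proj₁ v *ℚ f a b)))
    ≡⟨ ∑-swap (support S) (support T) _ ⟩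
  ∑ (support T) (λ (v , b) → ∑ (support S) (λ (w , a) → proj₁ w *ℚ (proj₁ v *ℚ f a b)))
    ≡⟨ ∑-cong (support T) (λ (v , b) → trans (∑-cong (support S) (λ (w , a) → lem (proj₁ w) (proj₁ v) (f a b))) (trans (∑-*ˡ (support S) (proj₁ v) _) (cong (proj₁ v *ℚ_) (sym (as-sum S _))))) ⟩
  ∑ (support T) (λ (v , b) → proj₁ v *ℚ Φ (λ a → f a b)) ≡⟨ sym (as-sum T _) ⟩
  Ψ (λ b → Φ (λ a → f a b)) ∎
  where
  open ≡-Reasoning
  lem : ∀ w v x → w *ℚ (v *ℚ x) ≡ v *ℚ (w *ℚ x)
  lem w v x = solve 3 (λ w v x → w :* (v :* x) := v :* (w :* x)) refl w v x

FinSum-point : {A : Set} (a : A) → FinSum (λ f → f a)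
FinSum-point a = record
  { support = ((1ℚ , 0≤1) , a) ∷ []
  ; as-sum = λ f → sym (trans (ℚ.+-identityʳ _) (ℚ.*-identityˡ (f a))) }

FinSum-zero : {A : Set} → FinSum {A} (λ _ → 0ℚ)
FinSum-zero = record { support = [] ; as-sum = λ _ → refl }

FinSum-∑ : {A : Set} (xs : List A) → FinSum (∑ xs)
FinSum-∑ xs = record
  { support = map ((1ℚ , 0≤1) ,_) xs
  ; as-sum = λ f → sym (trans (∑-map _ xs _) (∑-cong xs (λ x → ℚ.*-identityˡ (f x)))) }

FinSum-scale : {A : Set} {c : ℚ} {Φ : (A → ℚ) → ℚ} → 0ℚ ≤ℚ c → FinSum Φ → FinSum (λ f → c *ℚ Φ f)
FinSum-scale {c = c} 0≤c S = record
  { support = map (λ (w , a) → (c *ℚ proj₁ w , 0≤* 0≤c (proj₂ w)) , a) (support S)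
  ; as-sum = λ f → trans (cong (c *ℚ_) (as-sum S f)) (trans (sym (∑-*ˡ (support S) c _))
      (sym (trans (∑-map _ (support S) _) (∑-cong (support S) (λ (w , a) → ℚ.*-assoc c (proj₁ w) (f a)))))) }

FinSum-resp : {A : Set} {Φ Ψ : (A → ℚ) → ℚ} → (∀ f → Ψ f ≡ Φ f) → FinSum Φ → FinSum Ψ
FinSum-resp h S = record { support = support S ; as-sum = λ f → trans (h f) (as-sum S f) }

FinSum-bind : {A B : Set} {Φ : (A → ℚ) → ℚ} {Ψ : A → (B → ℚ) → ℚ} →
  FinSum Φ → (∀ a → FinSum (Ψ a)) → FinSum (λ f → Φ (λ a → Ψ a f))
FinSum-bind {A} {B} {Φ} {Ψ} S T = record
  { support = go (support S)
  ; as-sum = λ f → trans (as-sum S _) (sum-go (support S) f) }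
  where
  go : List ((∃[ w ] 0ℚ ≤ℚ w) × A) → List ((∃[ w ] 0ℚ ≤ℚ w) × B)
  go []             = []
  go ((w , a) ∷ ws) = support (FinSum-scale (proj₂ w) (T a)) ++ go ws

  sum-go : ∀ ws f → ∑ ws (λ (w , a) → proj₁ w *ℚ Ψ a f) ≡ ∑ (go ws) (λ (w , a) → proj₁ w *ℚ f a)
  sum-go []             f = refl
  sum-go ((w , a) ∷ ws) f = trans (cong₂ _+ℚ_ (as-sum (FinSum-scale (proj₂ w) (T a)) f) (sum-go ws f))
    (sym (∑-++ (support (FinSum-scale (proj₂ w) (T a))) (go ws) _))

FinSum-map : {A B : Set} (h : A → B) {Φ : (A → ℚ) → ℚ} → FinSum Φ → FinSum (λ f → Φ (f ∘ h))
FinSum-map h S = FinSum-bind S (λ a → FinSum-point (h a))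

FinSum-mean : {A : Set} (xs : List A) → FinSum (mean xs)
FinSum-mean xs = FinSum-resp (mean-∑ xs) (FinSum-scale (0≤inv (length xs)) (FinSum-∑ xs))

module _ {A : Set} (xs : List A) where
  private S = FinSum-mean xs

  mean-cong : {f g : A → ℚ} → (∀ x → f x ≡ g x) → mean xs f ≡ mean xs g
  mean-cong = Φ-cong S

  mean-mono : {f g : A → ℚ} → (∀ x → f x ≤ℚ g x) → mean xs f ≤ℚ mean xs g
  mean-mono = Φ-mono S

  mean-map : {B : Set} (h : A → B) (f : B → ℚ) → mean (map h xs) f ≡ mean xs (f ∘ h)
  mean-map h f = begin
    mean (map h xs) f ≡⟨ mean-∑ (map h xs) f ⟩
    inv (length (map h xs)) *ℚ ∑ (map h xs) f ≡⟨ cong₂ _*ℚ_ (cong inv (List.length-map h xs)) (∑-map h xs f) ⟩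
    inv (length xs) *ℚ ∑ xs (f ∘ h) ≡⟨ sym (mean-∑ xs (f ∘ h)) ⟩
    mean xs (f ∘ h) ∎
    where open ≡-Reasoning

mean-single : {A : Set} (x : A) (f : A → ℚ) → mean (x ∷ []) f ≡ f x
mean-single x f = trans (ℚ.*-identityʳ _) (ℚ.+-identityʳ (f x))

mean-const : {A : Set} (xs : List A) .{{_ : NonZero (length xs)}} (c : ℚ) → mean xs (λ _ → c) ≡ c
mean-const xs c = begin
  mean xs (λ _ → c) ≡⟨ mean-∑ xs _ ⟩
  inv (length xs) *ℚ ∑ xs (λ _ → c) ≡⟨ cong (inv (length xs) *ℚ_) (∑-const xs c) ⟩
  inv (length xs) *ℚ (fromℕ (length xs) *ℚ c) ≡⟨ sym (ℚ.*-assoc (inv (length xs)) _ c) ⟩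
  inv (length xs) *ℚ fromℕ (length xs) *ℚ c ≡⟨ cong (_*ℚ c) (inv*fromℕ (length xs)) ⟩
  1ℚ *ℚ c ≡⟨ ℚ.*-identityˡ c ⟩
  c ∎
  where open ≡-Reasoning

mean-const-≤ : {A : Set} (xs : List A) {c : ℚ} → 0ℚ ≤ℚ c → mean xs (λ _ → c) ≤ℚ c
mean-const-≤ []       0≤c = 0≤c
mean-const-≤ (x ∷ xs) 0≤c = ≡⇒≤ (mean-const (x ∷ xs) _)

length-cartesian : {A B C : Set} (h : A → B → C) (xs : List A) (ys : List B) →
  length (cartesianProductWith h xs ys) ≡ length xs * length ys
length-cartesian h []       ys = refl
length-cartesian h (x ∷ xs) ys = trans (List.length-++ (map (h x) ys)) (cong₂ _+_ (List.length-map (h x) ys) (length-cartesian h xs ys))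

mean-cartesian : {A B C : Set} (h : A → B → C) (xs : List A) (ys : List B) (f : C → ℚ) →
  mean (cartesianProductWith h xs ys) f ≡ mean xs (λ x → mean ys (λ y → f (h x y)))
mean-cartesian h xs ys f = begin
  mean (cartesianProductWith h xs ys) f ≡⟨ mean-∑ (cartesianProductWith h xs ys) f ⟩
  inv (length (cartesianProductWith h xs ys)) *ℚ ∑ (cartesianProductWith h xs ys) f
    ≡⟨ cong₂ _*ℚ_ (trans (cong inv (length-cartesian h xs ys)) (inv-* (length xs) (length ys))) (∑-cartesian h xs ys f) ⟩
  (i *ℚ j) *ℚ ∑ xs (λ x → ∑ ys (λ y → f (h x y))) ≡⟨ ℚ.*-assoc i j _ ⟩
  i *ℚ (j *ℚ ∑ xs (λ x → ∑ ys (λ y → f (h x y)))) ≡⟨ cong (i *ℚ_) (sym (∑-*ˡ xs j _)) ⟩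
  i *ℚ ∑ xs (λ x → j *ℚ ∑ ys (λ y → f (h x y))) ≡⟨ cong (i *ℚ_) (∑-cong xs (λ x → sym (mean-∑ ys _))) ⟩
  i *ℚ ∑ xs (λ x → mean ys (λ y → f (h x y))) ≡⟨ sym (mean-∑ xs _) ⟩
  mean xs (λ x → mean ys (λ y → f (h x y))) ∎
  where
  open ≡-Reasoning
  i = inv (length xs)
  j = inv (length ys)

length-allVecs : {A : Set} (xs : List A) (n : ℕ) → length (allVecs xs n) ≡ length xs ^ n
length-allVecs xs zero    = refl
length-allVecs xs (suc n) = trans (length-cartesian _∷_ xs (allVecs xs n)) (cong (length xs *_) (length-allVecs xs n))

allVecs-nonZero : {A : Set} (xs : List A) .{{_ : NonZero (length xs)}} (n : ℕ) → NonZero (length (allVecs xs n))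
allVecs-nonZero xs n = subst NonZero (sym (length-allVecs xs n)) (m^n≢0 (length xs) n)

-- Expected rewards and expected cost of runs

halt : Input → ℕ → (Memory → ℚ) → Config → ℚ
halt X n       φ ([] , σ)    = φ σ
halt X zero    φ (s ∷ K , σ) = 0ℚ
halt X (suc n) φ (s ∷ K , σ) = mean (next X s K σ) (halt X n φ)

haltWithin≡halt : ∀ {P : Memory → Set} (P? : ∀ σ → Dec (P σ)) X n c → haltWithin P? X n c ≡ halt X n (λ σ → indicator (P? σ)) c
haltWithin≡halt P? X zero    ([] , σ)    = refl
haltWithin≡halt P? X (suc n) ([] , σ)    = refl
haltWithin≡halt P? X zero    (s ∷ K , σ) = refl
haltWithin≡halt P? X (suc n) (s ∷ K , σ) = mean-cong (next X s K σ) (haltWithin≡halt P? X n)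

NonNeg : {A : Set} → (A → ℚ) → Set
NonNeg f = ∀ a → 0ℚ ≤ℚ f a

mean-nonNeg : {A : Set} (xs : List A) {f : A → ℚ} → NonNeg f → 0ℚ ≤ℚ mean xs f
mean-nonNeg xs = Φ-nonNeg (FinSum-mean xs)

module _ (X : Input) where
  halt-nonNeg : ∀ n {φ} → NonNeg φ → NonNeg (halt X n φ)
  halt-nonNeg zero    h ([] , σ)    = h σ
  halt-nonNeg (suc n) h ([] , σ)    = h σ
  halt-nonNeg zero    h (s ∷ K , σ) = ℚ.≤-refl
  halt-nonNeg (suc n) h (s ∷ K , σ) = mean-nonNeg (next X s K σ) (halt-nonNeg n h)

  halt-mono : ∀ {m n φ} → NonNeg φ → m ≤ n → ∀ c → halt X m φ c ≤ℚ halt X n φ c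
  halt-mono {zero}  {zero}  h _       ([] , σ)    = ℚ.≤-refl
  halt-mono {zero}  {suc n} h _       ([] , σ)    = ℚ.≤-refl
  halt-mono {suc m} {suc n} h _       ([] , σ)    = ℚ.≤-refl
  halt-mono {zero}  {n}     h _       (s ∷ K , σ) = halt-nonNeg n h (s ∷ K , σ)
  halt-mono {suc m} {suc n} h (s≤s p) (s ∷ K , σ) = mean-mono (next X s K σ) (halt-mono h p)

  cost-nonNeg : ∀ n → NonNeg (costWithin X n)
  cost-nonNeg zero    _           = ℚ.≤-refl
  cost-nonNeg (suc n) ([] , σ)    = ℚ.≤-refl
  cost-nonNeg (suc n) (s ∷ K , σ) = 0≤+ (0≤fromℕ (stepCost X s σ)) (mean-nonNeg (next X s K σ) (cost-nonNeg n))

  cost-suc : ∀ n c → costWithin X n c ≤ℚ costWithin X (suc n) c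
  cost-suc zero    c           = cost-nonNeg 1 c
  cost-suc (suc n) ([] , σ)    = ℚ.≤-refl
  cost-suc (suc n) (s ∷ K , σ) = ℚ.+-monoʳ-≤ (fromℕ (stepCost X s σ)) (mean-mono (next X s K σ) (cost-suc n))

  cost-mono : ∀ {m n} → m ≤ n → ∀ c → costWithin X m c ≤ℚ costWithin X n c
  cost-mono {m} {n} p c = go (ℕ.≤⇒≤′ p)
    where
    go : ∀ {n} → m ℕ.≤′ n → costWithin X m c ≤ℚ costWithin X n c
    go ℕ.≤′-refl         = ℚ.≤-refl
    go (ℕ.≤′-step {n} p) = ℚ.≤-trans (go p) (cost-suc n c)

  cost-det : ∀ n {s K σ c} → next X s K σ ≡ c ∷ [] → costWithin X (suc n) (s ∷ K , σ) ≡ fromℕ (stepCost X s σ) +ℚ costWithin X n c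
  cost-det n {s} {K} {σ} {c} eq rewrite eq = cong (fromℕ (stepCost X s σ) +ℚ_) (mean-single c (costWithin X n))

  Reaches : (Memory → ℚ) → Config → ℚ → Set
  Reaches φ c v = ∃[ n ] v ≤ℚ halt X n φ c

  Reaches-≤ : ∀ {φ c v v′} → v′ ≤ℚ v → Reaches φ c v → Reaches φ c v′
  Reaches-≤ p (n , q) = n , ℚ.≤-trans p q

  -- From c the machine reaches conf a for a uniform entry a of the list, at a
  -- cost of at most b and in at most delay steps.
  record Run (c : Config) (b delay : ℕ) {A : Set} (xs : List A) (conf : A → Config) : Set where
    field
      cost  : ∀ n → costWithin X n c ≤ℚ fromℕ b +ℚ mean xs (λ a → costWithin X n (conf a))
      reach : ∀ {φ} → NonNeg φ → ∀ n → mean xs (λ a → halt X n φ (conf a)) ≤ℚ halt X (delay + n) φ c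

  record Det (c : Config) (b : ℕ) (c′ : Config) : Set where
    field
      cost  : ∀ n → costWithin X n c ≤ℚ fromℕ b +ℚ costWithin X n c′
      delay : ℕ
      reach : ∀ {φ} → NonNeg φ → ∀ n → halt X n φ c′ ≤ℚ halt X (delay + n) φ c

  Det-refl : ∀ {c} → Det c 0 c
  Det-refl {c} = record { cost = λ n → ≡⇒≤ (sym (ℚ.+-identityˡ (costWithin X n c))) ; delay = 0 ; reach = λ _ n → ℚ.≤-refl }

  Det-step : ∀ {s K σ c b c′} → next X s K σ ≡ c ∷ [] → Det c b c′ → Det (s ∷ K , σ) (stepCost X s σ + b) c′
  Det-step {s} {K} {σ} {c} {b} {c′} eq D = record
    { cost = λ where
        zero    → respˡ (ℚ.+-identityˡ 0ℚ) (ℚ.+-mono-≤ (0≤fromℕ (stepCost X s σ + b)) (cost-nonNeg 0 c′))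
        (suc n) → begin
          costWithin X (suc n) (s ∷ K , σ) ≡⟨ cost-det n {s} {K} {σ} eq ⟩
          fromℕ (stepCost X s σ) +ℚ costWithin X n c ≤⟨ ℚ.+-monoʳ-≤ (fromℕ (stepCost X s σ)) (ℚ.≤-trans (Det.cost D n) (ℚ.+-monoʳ-≤ (fromℕ b) (cost-suc n c′))) ⟩
          fromℕ (stepCost X s σ) +ℚ (fromℕ b +ℚ costWithin X (suc n) c′) ≡⟨ fromℕ-merge (stepCost X s σ) b (costWithin X (suc n) c′) ⟩
          fromℕ (stepCost X s σ + b) +ℚ costWithin X (suc n) c′ ∎
    ; delay = suc (Det.delay D)
    ; reach = λ {φ} h n → ℚ.≤-trans (Det.reach D h n) (≡⇒≤ (sym (halt-det (Det.delay D + n) φ))) }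
    where
    open ℚ.≤-Reasoning
    halt-det : ∀ n φ → halt X (suc n) φ (s ∷ K , σ) ≡ halt X n φ c
    halt-det n φ rewrite eq = mean-single c (halt X n φ)

  Det-weaken : ∀ {c b b′ c′} → b ≤ b′ → Det c b c′ → Det c b′ c′
  Det-weaken {c′ = c′} p D = record
    { cost = λ n → ℚ.≤-trans (Det.cost D n) (ℚ.+-monoˡ-≤ (costWithin X n c′) (fromℕ-mono p))
    ; delay = Det.delay D ; reach = Det.reach D }

  Det-trans : ∀ {c b c′ b′ c″} → Det c b c′ → Det c′ b′ c″ → Det c (b + b′) c″
  Det-trans {c} {b} {c′} {b′} {c″} D E = record
    { cost = λ n → ℚ.≤-trans (Det.cost D n) (ℚ.≤-trans (ℚ.+-monoʳ-≤ (fromℕ b) (Det.cost E n))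
        (≡⇒≤ (fromℕ-merge b b′ (costWithin X n c″))))
    ; delay = Det.delay D + Det.delay E
    ; reach = λ {φ} h n → ℚ.≤-trans (Det.reach E h n) (ℚ.≤-trans (Det.reach D h (Det.delay E + n))
        (≡⇒≤ (cong (λ m → halt X m φ c) (sym (ℕ.+-assoc (Det.delay D) (Det.delay E) n))))) }

  Reaches-det : ∀ {φ c b c′ v} → NonNeg φ → Det c b c′ → Reaches φ c′ v → Reaches φ c v
  Reaches-det h D (n , p) = Det.delay D + n , ℚ.≤-trans p (Det.reach D h n)

  Run-weaken : ∀ {c b b′ d A} {xs : List A} {conf} → b ≤ b′ → Run c b d xs conf → Run c b′ d xs conf
  Run-weaken {xs = xs} p D = record
    { cost = λ n → ℚ.≤-trans (Run.cost D n) (ℚ.+-monoˡ-≤ (mean xs _) (fromℕ-mono p))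
    ; reach = Run.reach D }

  Det-Run : ∀ {c b c′ b′ d A} {xs : List A} {conf} (D : Det c b c′) → Run c′ b′ d xs conf → Run c (b + b′) (Det.delay D + d) xs conf
  Det-Run {c} {b} {c′} {b′} {d} {xs = xs} D E = record
    { cost = λ n → ℚ.≤-trans (Det.cost D n) (ℚ.≤-trans (ℚ.+-monoʳ-≤ (fromℕ b) (Run.cost E n))
        (≡⇒≤ (fromℕ-merge b b′ (mean xs _))))
    ; reach = λ {φ} h n → ℚ.≤-trans (Run.reach E h n) (ℚ.≤-trans (Det.reach D h (d + n))
        (≡⇒≤ (cong (λ m → halt X m φ c) (sym (ℕ.+-assoc (Det.delay D) d n))))) }

  private
    mean-shift : ∀ {A : Set} (xs : List A) (b : ℕ) (f : A → ℚ) → mean xs (λ a → fromℕ b +ℚ f a) ≤ℚ fromℕ b +ℚ mean xs f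
    mean-shift xs b f = respˡ (sym (Φ-+ (FinSum-mean xs) (λ _ → fromℕ b) f)) (ℚ.+-monoˡ-≤ (mean xs f) (mean-const-≤ xs (0≤fromℕ b)))

  Run-vec : ∀ {c b b′ d d′ k A} {xs : List A} {conf : A → Config} {conf′ : Vec A (suc k) → Config} →
    Run c b d xs conf → (∀ x → Run (conf x) b′ d′ (allVecs xs k) (λ v → conf′ (x ∷ v))) → Run c (b + b′) (d + d′) (allVecs xs (suc k)) conf′
  Run-vec {c} {b} {b′} {d} {d′} {k} {xs = xs} {conf} {conf′} D E = record
    { cost = λ n → begin
        costWithin X n c ≤⟨ Run.cost D n ⟩
        fromℕ b +ℚ mean xs (λ x → costWithin X n (conf x)) ≤⟨ ℚ.+-monoʳ-≤ (fromℕ b) (mean-mono xs (λ x → Run.cost (E x) n)) ⟩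
        fromℕ b +ℚ mean xs (λ x → fromℕ b′ +ℚ M n x) ≤⟨ ℚ.+-monoʳ-≤ (fromℕ b) (mean-shift xs b′ (M n)) ⟩
        fromℕ b +ℚ (fromℕ b′ +ℚ mean xs (M n)) ≡⟨ trans (fromℕ-merge b b′ (mean xs (M n))) (cong (fromℕ (b + b′) +ℚ_) (sym (mean-cartesian _∷_ xs (allVecs xs k) _))) ⟩
        fromℕ (b + b′) +ℚ mean (allVecs xs (suc k)) (λ v → costWithin X n (conf′ v)) ∎
    ; reach = λ {φ} h n → begin
        mean (allVecs xs (suc k)) (λ v → halt X n φ (conf′ v)) ≡⟨ mean-cartesian _∷_ xs (allVecs xs k) _ ⟩
        mean xs (λ x → mean (allVecs xs k) (λ v → halt X n φ (conf′ (x ∷ v)))) ≤⟨ mean-mono xs (λ x → Run.reach (E x) h n) ⟩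
        mean xs (λ x → halt X (d′ + n) φ (conf x)) ≤⟨ Run.reach D h (d′ + n) ⟩
        halt X (d + (d′ + n)) φ c ≡⟨ cong (λ m → halt X m φ c) (sym (ℕ.+-assoc d d′ n)) ⟩
        halt X (d + d′ + n) φ c ∎ }
    where
    open ℚ.≤-Reasoning
    M : ℕ → _ → ℚ
    M n x = mean (allVecs xs k) (λ v → costWithin X n (conf′ (x ∷ v)))

  Run-change : ∀ {c b d A B} {xs : List A} {conf} {ys : List B} {ι : B → A} →
    (∀ f → mean xs f ≡ mean ys (f ∘ ι)) → Run c b d xs conf → Run c b d ys (conf ∘ ι)
  Run-change {b = b} h D = record
    { cost = λ n → respʳ (cong (fromℕ b +ℚ_) (h _)) (Run.cost D n)
    ; reach = λ p n → respˡ (h _) (Run.reach D p n) }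

  Run-random : ∀ {a i e K σ} → Run (random a i e ∷ K , σ) (stepCost X (random a i e) σ) 1 (range (eval X σ e)) (λ v → K , update σ a (eval X σ i) v)
  Run-random {a} {i} {e} {K} {σ} = record
    { cost = λ where
        zero    → respˡ (ℚ.+-identityˡ 0ℚ) (ℚ.+-mono-≤ (0≤fromℕ (stepCost X (random a i e) σ)) (mean-nonNeg (range (eval X σ e)) (λ v → cost-nonNeg 0 (K , update σ a (eval X σ i) v))))
        (suc n) → ℚ.+-monoʳ-≤ (fromℕ (stepCost X (random a i e) σ)) (ℚ.≤-trans (≡⇒≤ (mean-map (range (eval X σ e)) (λ v → K , update σ a (eval X σ i) v) (costWithin X n))) (mean-mono (range (eval X σ e)) (λ v → cost-suc n (K , update σ a (eval X σ i) v))))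
    ; reach = λ {φ} _ n → ≡⇒≤ (sym (mean-map (range (eval X σ e)) _ (halt X n φ))) }

  Reaches-run : ∀ {φ c b d A} {xs : List A} {conf : A → Config} (v : A → ℚ) → NonNeg φ → Run c b d xs conf →
    (∀ a → Reaches φ (conf a) (v a)) → Reaches φ c (mean xs v)
  Reaches-run {φ} {d = d} {xs = xs} {conf} v h D r =
    let (N , p) = common xs in
    d + N , ℚ.≤-trans (subst₂ _≤ℚ_ (sym (mean-∑ xs v)) (sym (mean-∑ xs _)) (*-monoˡ (0≤inv (length xs)) p)) (Run.reach D h N)
    where
    common : ∀ xs → ∃[ N ] ∑ xs v ≤ℚ ∑ xs (λ a → halt X N φ (conf a))
    common []       = 0 , ℚ.≤-refl
    common (x ∷ xs) =
      let (N , p) = common xs ; (M , q) = r x in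
      M ⊔ N , ℚ.+-mono-≤ (ℚ.≤-trans q (halt-mono h (ℕ.m≤m⊔n M N) (conf x)))
                          (ℚ.≤-trans p (∑-mono xs (λ a → halt-mono h (ℕ.m≤n⊔m M N) (conf a))))

-- Binary lengths

module ≤-Lemmas where
  ≡⇒≤ⁿ : ∀ {a b : ℕ} → a ≡ b → a ≤ b
  ≡⇒≤ⁿ = ℕ.≤-reflexive

  1≤* : ∀ {a b} → 1 ≤ a → 1 ≤ b → 1 ≤ a * b
  1≤* = ℕ.*-mono-≤ {1} {_} {1}

  ≤*ˡ : ∀ {a b} → 1 ≤ b → a ≤ b * a
  ≤*ˡ {a} {b} p = ≤-trans (≡⇒≤ⁿ (sym (*-identityˡ a))) (*-monoˡ-≤ a p)

  ≤*ʳ : ∀ {a b} → 1 ≤ b → a ≤ a * b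
  ≤*ʳ {a} {b} p = ≤-trans (≤*ˡ p) (≡⇒≤ⁿ (ℕ.*-comm b a))

open ≤-Lemmas

n≤2^⌈log⌉ : ∀ n → n ≤ 2 ^ ⌈log₂ n ⌉
n≤2^⌈log⌉ n = go n n ≤-refl
  where
  half : ∀ m → m ≤ 2 * ⌈ m /2⌉
  half zero          = z≤n
  half (suc zero)    = s≤s z≤n
  half (suc (suc m)) = ≤-trans (s≤s (s≤s (half m))) (≡⇒≤ⁿ (lem ⌈ m /2⌉))
    where
    lem : ∀ h → suc (suc (2 * h)) ≡ 2 * suc h
    lem = solve-∀
  go : ∀ f m → m ≤ f → m ≤ 2 ^ ⌈log₂ m ⌉
  go f       zero          _ = z≤n
  go f       (suc zero)    _ = s≤s z≤n
  go (suc f) (suc (suc m)) (s≤s p) = begin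
    suc (suc m) ≤⟨ half (suc (suc m)) ⟩
    2 * suc ⌈ m /2⌉ ≤⟨ *-monoʳ-≤ 2 (go f (suc ⌈ m /2⌉) (≤-trans (s≤s (ℕ.⌈n/2⌉≤n m)) p)) ⟩
    2 * 2 ^ ⌈log₂ ⌈ suc (suc m) /2⌉ ⌉ ≡⟨ cong (λ z → 2 ^ suc z) (Log.⌈log₂⌈n/2⌉⌉≡⌈log₂n⌉∸1 (suc (suc m))) ⟩
    2 ^ suc (⌈log₂ suc (suc m) ⌉ ∸ 1) ≡⟨ cong (2 ^_) (ℕ.m+[n∸m]≡n {1} (Log.⌈log₂⌉-mono-≤ (s≤s (s≤s (z≤n {m}))))) ⟩
    2 ^ ⌈log₂ suc (suc m) ⌉ ∎
    where open ℕ.≤-Reasoning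

⌈log⌉-≤ : ∀ {n j} → n ≤ 2 ^ j → ⌈log₂ n ⌉ ≤ j
⌈log⌉-≤ {n} {j} p = ≤-trans (Log.⌈log₂⌉-mono-≤ p) (≡⇒≤ⁿ (Log.⌈log₂2^n⌉≡n j))

2^⌈log⌉≤2n : ∀ n → 1 ≤ n → 2 ^ ⌈log₂ n ⌉ ≤ 2 * n
2^⌈log⌉≤2n n p with ⌈log₂ n ⌉ in eq
... | zero  = ≤-trans p (m≤m+n n _)
... | suc j = *-monoʳ-≤ 2 (≮⇒≥ λ n<2^j → <-irrefl refl (subst (_≤ j) eq (⌈log⌉-≤ {n} {j} (<⇒≤ n<2^j))))

n<2^len : ∀ n → n < 2 ^ len n
n<2^len n = n≤2^⌈log⌉ (suc n)

len-≤ : ∀ {n j} → n < 2 ^ j → len n ≤ j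
len-≤ = ⌈log⌉-≤

len-mono : ∀ {m n} → m ≤ n → len m ≤ len n
len-mono p = Log.⌈log₂⌉-mono-≤ (s≤s p)

n<2^n : ∀ n → n < 2 ^ n
n<2^n zero    = s≤s z≤n
n<2^n (suc n) = +-mono-≤ (m^n>0 2 n) (≤-trans (n<2^n n) (≡⇒≤ⁿ (sym (+-identityʳ _))))

len≤n : ∀ n → len n ≤ n
len≤n n = len-≤ (n<2^n n)

1≤len : ∀ {n} → 1 ≤ n → 1 ≤ len n
1≤len {n} p = Log.⌈log₂⌉-mono-≤ (s≤s p)

len-+ : ∀ a b → len (a + b) ≤ suc (len a + len b)
len-+ a b = len-≤ {a + b} {suc (len a + len b)} (begin-strict
  a + b <⟨ ℕ.+-mono-<-≤ (n<2^len a) (<⇒≤ (n<2^len b)) ⟩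
  2 ^ len a + 2 ^ len b ≤⟨ +-mono-≤ (≤*ʳ (m^n>0 2 (len b))) (≤*ˡ (m^n>0 2 (len a))) ⟩
  2 ^ len a * 2 ^ len b + 2 ^ len a * 2 ^ len b ≡⟨ cong₂ _+_ e (trans e (sym (+-identityʳ _))) ⟩
  2 ^ suc (len a + len b) ∎)
  where
  open ℕ.≤-Reasoning
  e = sym (ℕ.^-distribˡ-+-* 2 (len a) (len b))

len-* : ∀ a b → len (a * b) ≤ len a + len b
len-* a b = len-≤ {a * b} {len a + len b} (ℕ.<-≤-trans (lem (n<2^len a) (n<2^len b)) (≡⇒≤ⁿ (sym (ℕ.^-distribˡ-+-* 2 (len a) (len b)))))
  where
  lem : ∀ {a b c d} → a < c → b < d → a * b < c * d
  lem p q = ℕ.*-mono-< p q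

xorℕ≤ : ∀ a b → xorℕ a b ≤ a + b
xorℕ≤ a b = go (a + b) a b
  where
  open ℕ.≤-Reasoning
  regroup : ∀ x y u v → (x + y) + 2 * (u + v) ≡ (x + u * 2) + (y + v * 2)
  regroup = solve-∀
  go : ∀ f a b → xorℕ-fuel f a b ≤ a + b
  go zero    a b = z≤n
  go (suc f) a b = begin
    (a + b) % 2 + 2 * xorℕ-fuel f (a ℕ./ 2) (b ℕ./ 2) ≤⟨ +-mono-≤ (≤-trans (≡⇒≤ⁿ (DivMod.%-distribˡ-+ a b 2)) (DivMod.m%n≤m (a % 2 + b % 2) 2)) (*-monoʳ-≤ 2 (go f (a ℕ./ 2) (b ℕ./ 2))) ⟩
    (a % 2 + b % 2) + 2 * (a ℕ./ 2 + b ℕ./ 2) ≡⟨ regroup (a % 2) (b % 2) (a ℕ./ 2) (b ℕ./ 2) ⟩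
    (a % 2 + a ℕ./ 2 * 2) + (b % 2 + b ℕ./ 2 * 2) ≡⟨ cong₂ _+_ (sym (DivMod.m≡m%n+[m/n]*n a 2)) (sym (DivMod.m≡m%n+[m/n]*n b 2)) ⟩
    a + b ∎

len-op : ∀ o a b → len (applyOp o a b) ≤ suc (len a + len b)
len-op add   a b = len-+ a b
len-op monus a b = ≤-trans (len-mono (ℕ.m∸n≤m a b)) (m≤n⇒m≤1+n (m≤m+n (len a) (len b)))
len-op mul   a b = m≤n⇒m≤1+n (len-* a b)
len-op quot  a zero    = z≤n
len-op quot  a (suc b) = ≤-trans (len-mono (DivMod.m/n≤m a (suc b))) (m≤n⇒m≤1+n (m≤m+n (len a) (len (suc b))))
len-op xor   a b = ≤-trans (len-mono (xorℕ≤ a b)) (len-+ a b)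
len-op less  a b with a <ᵇ b
... | true  = s≤s z≤n
... | false = z≤n

-- The cost of expressions

len≤cost : ∀ X σ e → len (eval X σ e) ≤ expCost X σ e
len≤cost X σ e = m≤n⇒m≤1+n (m≤m+n (len (eval X σ e)) _)

Loads : (ℕ → Set) → Exp → Set
Loads P (lit n)     = ⊤
Loads P size        = ⊤
Loads P (input e)   = Loads P e
Loads P (load a e)  = P a × Loads P e
Loads P (op o e f)  = Loads P e × Loads P f
Loads P (bitlen e)  = Loads P e

κ : Exp → ℕ
κ (lit n)    = 1 + len n
κ size       = 2
κ (input e)  = 2 + κ e
κ (load a e) = 2 + κ e
κ (op o e f) = 2 * (1 + κ e + κ f)
κ (bitlen e) = 1 + 2 * κ e

module _ {P : ℕ → Set} {X : Input} {σ : Memory} {L : ℕ} (1≤L : 1 ≤ L) (size≤ : len (length X) ≤ L)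
         (input≤ : ∀ i → len (nth X i) ≤ L) (load≤ : ∀ a i → P a → len (σ a i) ≤ L) where
  open ℕ.≤-Reasoning

  cost≤κ : ∀ e → Loads P e → expCost X σ e ≤ κ e * L
  cost≤κ (lit n) _ = begin
    suc (len n + 0) ≡⟨ cong suc (+-identityʳ (len n)) ⟩
    suc (len n) ≤⟨ ≤*ʳ 1≤L ⟩
    suc (len n) * L ∎
  cost≤κ size _ = begin
    suc (len (length X) + 0) ≤⟨ +-mono-≤ 1≤L (+-monoˡ-≤ 0 size≤) ⟩
    2 * L ∎
  cost≤κ (input e) l = begin
    suc (len (nth X (eval X σ e)) + expCost X σ e) ≤⟨ +-mono-≤ 1≤L (+-mono-≤ (input≤ (eval X σ e)) (cost≤κ e l)) ⟩
    (2 + κ e) * L ∎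
  cost≤κ (load a e) (p , l) = begin
    suc (len (σ a (eval X σ e)) + expCost X σ e) ≤⟨ +-mono-≤ 1≤L (+-mono-≤ (load≤ a (eval X σ e) p) (cost≤κ e l)) ⟩
    (2 + κ e) * L ∎
  cost≤κ (op o e f) (l , l′) = begin
    suc (len (applyOp o x y) + (c + d)) ≤⟨ s≤s (+-monoˡ-≤ (c + d) (≤-trans (len-op o x y) (s≤s (+-mono-≤ (len≤cost X σ e) (len≤cost X σ f))))) ⟩
    suc (suc (c + d) + (c + d)) ≡⟨ eq₁ c d ⟩
    2 * (1 + c + d) ≤⟨ *-monoʳ-≤ 2 (+-mono-≤ (+-mono-≤ 1≤L (cost≤κ e l)) (cost≤κ f l′)) ⟩
    2 * (L + κ e * L + κ f * L) ≡⟨ eq₂ L (κ e) (κ f) ⟩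
    2 * (1 + κ e + κ f) * L ∎
    where
    x = eval X σ e
    y = eval X σ f
    c = expCost X σ e
    d = expCost X σ f
    eq₁ : ∀ c d → suc (suc (c + d) + (c + d)) ≡ 2 * (1 + c + d)
    eq₁ = solve-∀
    eq₂ : ∀ L k l → 2 * (L + k * L + l * L) ≡ 2 * (1 + k + l) * L
    eq₂ = solve-∀
  cost≤κ (bitlen e) l = begin
    suc (len (len x) + c) ≤⟨ +-mono-≤ 1≤L (+-mono-≤ (≤-trans (len≤n (len x)) (≤-trans (len≤cost X σ e) (cost≤κ e l))) (cost≤κ e l)) ⟩
    L + (κ e * L + κ e * L) ≡⟨ eq L (κ e) ⟩
    (1 + 2 * κ e) * L ∎
    where
    x = eval X σ e
    c = expCost X σ e
    eq : ∀ L k → L + (k * L + k * L) ≡ (1 + 2 * k) * L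
    eq = solve-∀

κₛ : Program → ℕ
κₛ skip            = 1
κₛ (store a i e)   = 1 + κ i + κ e
κₛ (random a i e)  = 1 + κ i + κ e
κₛ (p ⨾ q)         = 1
κₛ (branch e p q)  = 1 + κ e
κₛ (while e p)     = 1 + κ e

LoadsStep : (ℕ → Set) → Program → Set
LoadsStep P skip            = ⊤
LoadsStep P (store a i e)   = Loads P i × Loads P e
LoadsStep P (random a i e)  = Loads P i × Loads P e
LoadsStep P (p ⨾ q)         = ⊤
LoadsStep P (branch e p q)  = Loads P e
LoadsStep P (while e p)     = Loads P e

module _ {P : ℕ → Set} {X : Input} {σ : Memory} {L : ℕ} (1≤L : 1 ≤ L) (size≤ : len (length X) ≤ L)
         (input≤ : ∀ i → len (nth X i) ≤ L) (load≤ : ∀ a i → P a → len (σ a i) ≤ L) where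
  open ℕ.≤-Reasoning
  private
    c≤ = cost≤κ {P} {X} {σ} {L} 1≤L size≤ input≤ load≤
    two : ∀ L x y → L + x * L + y * L ≡ (1 + x + y) * L
    two = solve-∀

  stepCost≤κ : ∀ s → LoadsStep P s → stepCost X s σ ≤ κₛ s * L
  stepCost≤κ skip            _        = ≤-trans 1≤L (≡⇒≤ⁿ (sym (*-identityˡ L)))
  stepCost≤κ (store a i e)   (l , l′) = ≤-trans (+-mono-≤ (+-mono-≤ 1≤L (c≤ i l)) (c≤ e l′)) (≡⇒≤ⁿ (two L (κ i) (κ e)))
  stepCost≤κ (random a i e)  (l , l′) = ≤-trans (+-mono-≤ (+-mono-≤ 1≤L (c≤ i l)) (c≤ e l′)) (≡⇒≤ⁿ (two L (κ i) (κ e)))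
  stepCost≤κ (p ⨾ q)         _        = ≤-trans 1≤L (≡⇒≤ⁿ (sym (*-identityˡ L)))
  stepCost≤κ (branch e p q)  l        = +-mono-≤ 1≤L (c≤ e l)
  stepCost≤κ (while e p)     l        = +-mono-≤ 1≤L (c≤ e l)

1≤stepCost : ∀ X s σ → 1 ≤ stepCost X s σ
1≤stepCost X skip           σ = s≤s z≤n
1≤stepCost X (store a i e)  σ = s≤s z≤n
1≤stepCost X (random a i e) σ = s≤s z≤n
1≤stepCost X (p ⨾ q)        σ = s≤s z≤n
1≤stepCost X (branch e p q) σ = s≤s z≤n
1≤stepCost X (while e p)    σ = s≤s z≤n

-- Memory updates

update-≡ : ∀ σ a i v → update σ a i v a i ≡ v
update-≡ σ a i v rewrite dec-true ((a ℕ.≟ a) ×-dec (i ℕ.≟ i)) (refl , refl) = refl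

update-≢ : ∀ σ a i v b j → a ≢ b ⊎ i ≢ j → update σ a i v b j ≡ σ b j
update-≢ σ a i v b j h rewrite dec-false ((a ℕ.≟ b) ×-dec (i ℕ.≟ j)) (λ (p , q) → [ (λ n → n p) , (λ n → n q) ]′ h) = refl

update-array : ∀ σ a i v b j → a ≢ b → update σ a i v b j ≡ σ b j
update-array σ a i v b j h = update-≢ σ a i v b j (inj₁ h)

update-≤ : ∀ {P : ℕ → Set} {σ a i v L} → len v ≤ L → (∀ b j → P b → len (σ b j) ≤ L) → ∀ b j → P b → len (update σ a i v b j) ≤ L
update-≤ {σ = σ} {a} {i} {v} p h b j q with does ((a ℕ.≟ b) ×-dec (i ℕ.≟ j))
... | true  = p
... | false = h b j q

next-true : ∀ X σ e {p q K} → 1 ≤ eval X σ e → next X (branch e p q) K σ ≡ (p ∷ K , σ) ∷ []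
next-true X σ e h with eval X σ e
next-true X σ e (s≤s _) | suc _ = refl

next-false : ∀ X σ e {p q K} → eval X σ e ≡ 0 → next X (branch e p q) K σ ≡ (q ∷ K , σ) ∷ []
next-false X σ e h with eval X σ e
next-false X σ e refl | zero = refl

next-loop : ∀ X σ e {p K} → 1 ≤ eval X σ e → next X (while e p) K σ ≡ (p ∷ while e p ∷ K , σ) ∷ []
next-loop X σ e h with eval X σ e
next-loop X σ e (s≤s _) | suc _ = refl

next-exit : ∀ X σ e {p K} → eval X σ e ≡ 0 → next X (while e p) K σ ≡ (K , σ) ∷ []
next-exit X σ e h with eval X σ e
next-exit X σ e refl | zero = refl

less-true : ∀ {a b} → a < b → applyOp less a b ≡ 1
less-true {a} {b} p with a <ᵇ b | ℕ.<⇒<ᵇ p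
... | true | _ = refl

less-false : ∀ {a b} → b ≤ a → applyOp less a b ≡ 0
less-false {a} {b} p with a <ᵇ b | ℕ.<ᵇ⇒< a b
... | false | _ = refl
... | true  | f = contradiction (f tt) (ℕ.≤⇒≯ p)

-- Layout of the arrays of the reduction: 0 holds the candidate solution,
-- 1 a flag, 2 the order 2^m of the group, 3 the stride of the simulated
-- memories, 4 the number of the current simulation, 5 its clock, 6 the clock
-- limit, 7 the target shift, 8 the loop bound, 9 the random shift pattern,
-- 10 a planted instance, 11 a loop index. Array a of the simulated program is
-- interleaved into array 12 + a.

cell : ℕ → Exp
cell a = load a (lit 0)

isControl : ℕ → Bool
isControl a = a <ᵇ 12

Control : ℕ → Set
Control a = T (isControl a)

-- The control arrays that a simulation does not modify.
Frozen : ℕ → Set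
Frozen 1 = ⊥
Frozen 5 = ⊥
Frozen (suc (suc (suc (suc (suc (suc (suc (suc (suc (suc (suc (suc _)))))))))))) = ⊥
Frozen _ = ⊤

Frozen≢ : ∀ {b} → Frozen b → ∀ a → 12 + a ≢ b
Frozen≢ p a refl = p

Frozen≢1 : ∀ {b} → Frozen b → 1 ≢ b
Frozen≢1 p refl = p

Frozen≢5 : ∀ {b} → Frozen b → 5 ≢ b
Frozen≢5 p refl = p

Control≢ : ∀ {b} → Control b → ∀ a → 12 + a ≢ b
Control≢ p a refl = p

guard : Exp
guard = op less (cell 5) (op add (lit 1) (cell 6))

-- The clocked form of a program, with its input accesses replaced by inp.
-- Before each step the flag is set to 0 if the clock exceeds the limit;
-- otherwise the clock is charged with the cost of the step.
module Clocked (inp : Exp → Exp) where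
  addr : Exp → Exp
  addr e = op add (op mul e (cell 3)) (cell 4)

  ⟦_⟧ : Exp → Exp
  ⟦ lit n ⟧    = lit n
  ⟦ size ⟧     = size
  ⟦ input e ⟧  = inp ⟦ e ⟧
  ⟦ load a e ⟧ = load (12 + a) (addr ⟦ e ⟧)
  ⟦ op o e f ⟧ = op o ⟦ e ⟧ ⟦ f ⟧
  ⟦ bitlen e ⟧ = bitlen ⟦ e ⟧

  costᴱ subᴱ : Exp → Exp
  costᴱ e = op add (op add (lit 1) (bitlen ⟦ e ⟧)) (subᴱ e)
  subᴱ (lit _)    = lit 0
  subᴱ size       = lit 0
  subᴱ (input e)  = costᴱ e
  subᴱ (load _ e) = costᴱ e
  subᴱ (op _ e f) = op add (costᴱ e) (costᴱ f)
  subᴱ (bitlen e) = costᴱ e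

  stepᴱ : Program → Exp
  stepᴱ skip           = lit 1
  stepᴱ (store a i e)  = op add (op add (lit 1) (costᴱ i)) (costᴱ e)
  stepᴱ (random a i e) = op add (op add (lit 1) (costᴱ i)) (costᴱ e)
  stepᴱ (p ⨾ q)        = lit 1
  stepᴱ (branch e p q) = op add (lit 1) (costᴱ e)
  stepᴱ (while e p)    = op add (lit 1) (costᴱ e)

  flagᴱ : Program → Exp
  flagᴱ (while e p) = op less (lit 0) ⟦ e ⟧
  flagᴱ _           = lit 1

  charge : Program → Program
  charge s = store 5 (lit 0) (op add (cell 5) (stepᴱ s)) ⨾ store 1 (lit 0) (flagᴱ s)

  pre : Program → Program
  pre s = branch guard (charge s) (store 1 (lit 0) (lit 0))

  T⟦_⟧ act : Program → Program
  T⟦ s ⟧ = pre s ⨾ act s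
  act skip           = branch (cell 1) skip skip
  act (store a i e)  = branch (cell 1) (store (12 + a) (addr ⟦ i ⟧) ⟦ e ⟧) skip
  act (random a i e) = branch (cell 1) (random (12 + a) (addr ⟦ i ⟧) ⟦ e ⟧) skip
  act (p ⨾ q)        = branch (cell 1) (T⟦ p ⟧ ⨾ T⟦ q ⟧) skip
  act (branch e p q) = branch (cell 1) (branch ⟦ e ⟧ T⟦ p ⟧ T⟦ q ⟧) skip
  act (while e p)    = while (cell 1) (T⟦ p ⟧ ⨾ pre (while e p))

stride-injective : ∀ {R d i j} → d < R → i * R + d ≡ j * R + d → i ≡ j
stride-injective {suc R} {d} {i} {j} p e = ℕ.*-cancelʳ-≡ i j (suc R) (ℕ.+-cancelʳ-≡ d (i * suc R) (j * suc R) e)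

stride-disjoint : ∀ {R c d i j} → c < R → d < R → i * R + c ≡ j * R + d → c ≡ d
stride-disjoint {suc R} {c} {d} {i} {j} p q e = begin
  c ≡⟨ sym (lem c i p) ⟩
  (i * suc R + c) % suc R ≡⟨ cong (_% suc R) e ⟩
  (j * suc R + d) % suc R ≡⟨ lem d j q ⟩
  d ∎
  where
  open ≡-Reasoning
  lem : ∀ c i → c < suc R → (i * suc R + c) % suc R ≡ c
  lem c i p = trans (cong (_% suc R) (+-comm (i * suc R) c)) (trans (DivMod.[m+kn]%n≡m%n c i (suc R)) (DivMod.m<n⇒m%n≡m p))

module Overhead (kin : ℕ) where
  kᴱ : Exp → ℕ
  kᴱ (lit n)    = 1
  kᴱ size       = 1
  kᴱ (input e)  = kin * (1 + kᴱ e)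
  kᴱ (load a e) = 13 + 3 * kᴱ e
  kᴱ (op o e f) = 1 + kᴱ e + kᴱ f
  kᴱ (bitlen e) = 1 + kᴱ e

  kᶜ kˢ : Exp → ℕ
  kᶜ e = 8 + kᴱ e + kˢ e
  kˢ (lit n)    = 1
  kˢ size       = 1
  kˢ (input e)  = kᶜ e
  kˢ (load a e) = kᶜ e
  kˢ (op o e f) = 2 + kᶜ e + kᶜ f
  kˢ (bitlen e) = kᶜ e

  kᴾ kᶠ kᵃ D : Program → ℕ
  kᴾ (store a i e)  = 6 + kᶜ i + kᶜ e
  kᴾ (random a i e) = 6 + kᶜ i + kᶜ e
  kᴾ (branch e p q) = 4 + kᶜ e
  kᴾ (while e p)    = 4 + kᶜ e
  kᴾ _              = 2
  kᶠ (while e p)    = 3 + kᴱ e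
  kᶠ _              = 2
  kᵃ (store a i e)  = 13 + 3 * kᴱ i + kᴱ e
  kᵃ (random a i e) = 13 + 3 * kᴱ i + kᴱ e
  kᵃ (branch e p q) = 1 + kᴱ e
  kᵃ _              = 1
  D s = 1 + ((1 + κ guard) + (1 + ((7 + kᴾ s) + (2 + kᶠ s))) + ((1 + κ (cell 1)) + kᵃ s))

-- The data of one simulation: X and X′ are the inputs of the reduction and of
-- the simulated program, σ₀ the memory at the start.
record Setup : Set where
  field
    inp         : Exp → Exp
    X X′        : Input
    σ₀          : Memory
    stride this limit Λ C : ℕ
    kin         : ℕ

  overrun : ℕ
  overrun = limit + C * (limit + Λ)

  field
    1≤Λ         : 1 ≤ Λ
    this<       : this < stride
    stride≡     : σ₀ 3 0 ≡ stride
    this≡       : σ₀ 4 0 ≡ this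
    limit≡      : σ₀ 6 0 ≡ limit
    size≡       : length X ≡ length X′
    size≤       : len (length X) ≤ Λ
    input≤      : ∀ i → len (nth X i) ≤ Λ
    input≤′     : ∀ i → len (nth X′ i) ≤ Λ
    overrun≤    : len overrun ≤ Λ
    inp-eval    : ∀ σ → (∀ b j → Frozen b → σ b j ≡ σ₀ b j) → ∀ e → eval X σ (inp e) ≡ nth X′ (eval X σ e)
    inp-cost    : ∀ σ → (∀ b j → Frozen b → σ b j ≡ σ₀ b j) → (∀ b j → Control b → len (σ b j) ≤ Λ) →
                  ∀ e → expCost X σ (inp e) ≤ kin * (Λ + expCost X σ e)

  open Clocked inp public
  open Overhead kin public

  record View (σ τ : Memory) : Set where
    field
      mem    : ∀ a i → σ (12 + a) (i * stride + this) ≡ τ a i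
      others : ∀ a i j → j < stride → j ≢ this → σ (12 + a) (i * stride + j) ≡ σ₀ (12 + a) (i * stride + j)
      ctl    : ∀ b j → Frozen b → σ b j ≡ σ₀ b j
      small  : ∀ b j → Control b → len (σ b j) ≤ Λ

  module Expressions {σ τ} (V : View σ τ) where
    open View V
    open ℕ.≤-Reasoning

    ⟦⟧-eval : ∀ e → eval X σ ⟦ e ⟧ ≡ eval X′ τ e
    ⟦⟧-eval (lit n)    = refl
    ⟦⟧-eval size       = size≡
    ⟦⟧-eval (input e)  = trans (inp-eval σ ctl ⟦ e ⟧) (cong (nth X′) (⟦⟧-eval e))
    ⟦⟧-eval (load a e) = trans (cong (σ (12 + a)) (cong₂ _+_ (cong₂ _*_ (⟦⟧-eval e) (trans (ctl 3 0 tt) stride≡)) (trans (ctl 4 0 tt) this≡))) (mem a (eval X′ τ e))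
    ⟦⟧-eval (op o e f) = cong₂ (applyOp o) (⟦⟧-eval e) (⟦⟧-eval f)
    ⟦⟧-eval (bitlen e) = cong len (⟦⟧-eval e)

    costᴱ-eval : ∀ e → eval X σ (costᴱ e) ≡ expCost X′ τ e
    subᴱ-eval  : ∀ e → suc (len (eval X′ τ e)) + eval X σ (subᴱ e) ≡ expCost X′ τ e
    costᴱ-eval e = trans (cong (λ z → suc (len z) + eval X σ (subᴱ e)) (⟦⟧-eval e)) (subᴱ-eval e)
    subᴱ-eval (lit n)    = refl
    subᴱ-eval size       = refl
    subᴱ-eval (input e)  = cong (λ z → suc (len (nth X′ (eval X′ τ e)) + z)) (costᴱ-eval e)
    subᴱ-eval (load a e) = cong (λ z → suc (len (τ a (eval X′ τ e)) + z)) (costᴱ-eval e)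
    subᴱ-eval (op o e f) = cong (λ z → suc (len (eval X′ τ (op o e f)) + z)) (cong₂ _+_ (costᴱ-eval e) (costᴱ-eval f))
    subᴱ-eval (bitlen e) = cong (λ z → suc (len (len (eval X′ τ e)) + z)) (costᴱ-eval e)

    private
      cellCost : ∀ a → Control a → expCost X σ (cell a) ≤ 2 + Λ
      cellCost a p = s≤s (≤-trans (+-monoˡ-≤ 1 (small a 0 p)) (≡⇒≤ⁿ (+-comm Λ 1)))

      scale : ∀ {x c} → x ≤ c → x ≤ Λ * c
      scale {x} {c} p = ≤-trans p (≤*ˡ 1≤Λ)

    addr-cost : ∀ e → expCost X σ (addr e) ≤ 3 * expCost X σ e + 12 * Λ
    addr-cost e = begin
      suc (len (x * R + d) + (suc (len (x * R) + (c + expCost X σ (cell 3))) + expCost X σ (cell 4)))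
        ≤⟨ s≤s (+-mono-≤ (≤-trans (len-+ (x * R) d) (s≤s (+-mono-≤ xR (small 4 0 tt))))
                           (+-mono-≤ (s≤s (+-mono-≤ xR (+-monoʳ-≤ c (cellCost 3 tt)))) (cellCost 4 tt))) ⟩
      suc (suc (c + Λ + Λ) + (suc (c + Λ + (c + (2 + Λ))) + (2 + Λ))) ≡⟨ eq c Λ ⟩
      3 * c + (5 * Λ + 7 * 1) ≤⟨ +-monoʳ-≤ (3 * c) (≤-trans (+-monoʳ-≤ (5 * Λ) (*-monoʳ-≤ 7 1≤Λ)) (≡⇒≤ⁿ (eq′ Λ))) ⟩
      3 * c + 12 * Λ ∎
      where
      x = eval X σ e
      R = σ 3 0
      d = σ 4 0
      c = expCost X σ e
      xR : len (x * R) ≤ c + Λ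
      xR = ≤-trans (len-* x R) (+-mono-≤ (len≤cost X σ e) (small 3 0 tt))
      eq : ∀ c Λ → suc (suc (c + Λ + Λ) + (suc (c + Λ + (c + (2 + Λ))) + (2 + Λ))) ≡ 3 * c + (5 * Λ + 7 * 1)
      eq = solve-∀
      eq′ : ∀ Λ → 5 * Λ + 7 * Λ ≡ 12 * Λ
      eq′ = solve-∀

    ⟦⟧-cost : ∀ e → expCost X σ ⟦ e ⟧ ≤ kᴱ e * (Λ * expCost X′ τ e)
    ⟦⟧-cost (lit n)    = ≤-trans (scale ≤-refl) (≡⇒≤ⁿ (sym (*-identityˡ _)))
    ⟦⟧-cost size       = ≤-trans (scale (≡⇒≤ⁿ (cong (λ z → suc (len z + 0)) size≡))) (≡⇒≤ⁿ (sym (*-identityˡ _)))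
    ⟦⟧-cost (input e)  = begin
      expCost X σ (inp ⟦ e ⟧) ≤⟨ inp-cost σ ctl small ⟦ e ⟧ ⟩
      kin * (Λ + expCost X σ ⟦ e ⟧) ≤⟨ *-monoʳ-≤ kin (+-mono-≤ (≤*ʳ (s≤s z≤n)) (≤-trans (⟦⟧-cost e) (*-monoʳ-≤ (kᴱ e) (*-monoʳ-≤ Λ (m≤n⇒m≤1+n (m≤n+m c (len v))))))) ⟩
      kin * (Λ * c′ + kᴱ e * (Λ * c′)) ≡⟨ eq kin (Λ * c′) (kᴱ e) ⟩
      kin * (1 + kᴱ e) * (Λ * c′) ∎
      where
      c = expCost X′ τ e
      v = nth X′ (eval X′ τ e)
      c′ = expCost X′ τ (input e)
      eq : ∀ k u l → k * (u + l * u) ≡ k * (1 + l) * u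
      eq = solve-∀
    ⟦⟧-cost (load a e) = begin
      suc (len (eval X σ ⟦ load a e ⟧) + expCost X σ (addr ⟦ e ⟧)) ≤⟨ s≤s (+-mono-≤ (≡⇒≤ⁿ (cong len (⟦⟧-eval (load a e)))) (≤-trans (addr-cost ⟦ e ⟧) (+-monoˡ-≤ _ (*-monoʳ-≤ 3 (⟦⟧-cost e))))) ⟩
      suc (v + (3 * (kᴱ e * (Λ * c)) + 12 * Λ)) ≡⟨ eq₁ v (kᴱ e) (Λ * c) Λ ⟩
      suc v + 12 * Λ + 3 * kᴱ e * (Λ * c) ≤⟨ +-mono-≤ (+-mono-≤ (scale {suc v} {c′} (s≤s (m≤m+n v c))) (*-monoʳ-≤ 12 (≤*ʳ {Λ} {c′} (s≤s z≤n)))) (*-monoʳ-≤ (3 * kᴱ e) (*-monoʳ-≤ Λ (m≤n⇒m≤1+n (m≤n+m c v)))) ⟩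
      Λ * c′ + 12 * (Λ * c′) + 3 * kᴱ e * (Λ * c′) ≡⟨ eq₂ (Λ * c′) (kᴱ e) ⟩
      (13 + 3 * kᴱ e) * (Λ * c′) ∎
      where
      v = len (τ a (eval X′ τ e))
      c = expCost X′ τ e
      c′ = expCost X′ τ (load a e)
      eq₁ : ∀ v k u Λ → suc (v + (3 * (k * u) + 12 * Λ)) ≡ suc v + 12 * Λ + 3 * k * u
      eq₁ = solve-∀
      eq₂ : ∀ u k → u + 12 * u + 3 * k * u ≡ (13 + 3 * k) * u
      eq₂ = solve-∀
    ⟦⟧-cost (op o e f) = begin
      suc (len (eval X σ ⟦ op o e f ⟧) + (expCost X σ ⟦ e ⟧ + expCost X σ ⟦ f ⟧)) ≤⟨ s≤s (+-mono-≤ (≡⇒≤ⁿ (cong len (⟦⟧-eval (op o e f)))) (+-mono-≤ (⟦⟧-cost e) (⟦⟧-cost f))) ⟩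
      suc v + (kᴱ e * (Λ * c) + kᴱ f * (Λ * d)) ≤⟨ +-mono-≤ (scale {suc v} {c′} (s≤s (m≤m+n v _))) (+-mono-≤ (*-monoʳ-≤ (kᴱ e) (*-monoʳ-≤ Λ (m≤n⇒m≤1+n (≤-trans (m≤m+n c d) (m≤n+m _ v))))) (*-monoʳ-≤ (kᴱ f) (*-monoʳ-≤ Λ (m≤n⇒m≤1+n (≤-trans (m≤n+m d c) (m≤n+m _ v)))))) ⟩
      Λ * c′ + (kᴱ e * (Λ * c′) + kᴱ f * (Λ * c′)) ≡⟨ eq (Λ * c′) (kᴱ e) (kᴱ f) ⟩
      (1 + kᴱ e + kᴱ f) * (Λ * c′) ∎
      where
      v = len (eval X′ τ (op o e f))
      c = expCost X′ τ e
      d = expCost X′ τ f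
      c′ = expCost X′ τ (op o e f)
      eq : ∀ u k l → u + (k * u + l * u) ≡ (1 + k + l) * u
      eq = solve-∀
    ⟦⟧-cost (bitlen e) = begin
      suc (len (len (eval X σ ⟦ e ⟧)) + expCost X σ ⟦ e ⟧) ≤⟨ s≤s (+-mono-≤ (≡⇒≤ⁿ (cong (len ∘ len) (⟦⟧-eval e))) (⟦⟧-cost e)) ⟩
      suc v + kᴱ e * (Λ * c) ≤⟨ +-mono-≤ (scale {suc v} {c′} (s≤s (m≤m+n v c))) (*-monoʳ-≤ (kᴱ e) (*-monoʳ-≤ Λ (m≤n⇒m≤1+n (m≤n+m c v)))) ⟩
      Λ * c′ + kᴱ e * (Λ * c′) ∎
      where
      v = len (len (eval X′ τ e))
      c = expCost X′ τ e
      c′ = expCost X′ τ (bitlen e)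

    costᴱ-cost : ∀ e → expCost X σ (costᴱ e) ≤ kᶜ e * (Λ * expCost X′ τ e)
    subᴱ-cost  : ∀ e → expCost X σ (subᴱ e) ≤ kˢ e * (Λ * expCost X′ τ e)
    costᴱ-cost e = begin
      suc (len (eval X σ (costᴱ e)) + (suc (len (suc (len x)) + (2 + suc (len (len x) + expCost X σ ⟦ e ⟧))) + expCost X σ (subᴱ e)))
        ≤⟨ s≤s (+-mono-≤ (≤-trans (≡⇒≤ⁿ (cong len (costᴱ-eval e))) (len≤n c))
             (+-mono-≤ (s≤s (+-mono-≤ (≤-trans (len≤n _) x≤) (s≤s (s≤s (s≤s (+-mono-≤ (≤-trans (len≤n _) (≤-trans (n≤1+n _) x≤)) (⟦⟧-cost e))))))) (subᴱ-cost e))) ⟩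
      suc (c + (suc (c + (2 + suc (c + kᴱ e * u))) + kˢ e * u)) ≡⟨ eq₁ c (kᴱ e * u) (kˢ e * u) ⟩
      5 * 1 + 3 * c + kᴱ e * u + kˢ e * u ≤⟨ +-monoˡ-≤ (kˢ e * u) (+-monoˡ-≤ (kᴱ e * u) (+-mono-≤ (*-monoʳ-≤ 5 (scale {1} {c} (s≤s z≤n))) (*-monoʳ-≤ 3 (scale {c} {c} ≤-refl)))) ⟩
      5 * u + 3 * u + kᴱ e * u + kˢ e * u ≡⟨ eq₂ u (kᴱ e) (kˢ e) ⟩
      (8 + kᴱ e + kˢ e) * u ∎
      where
      x = eval X σ ⟦ e ⟧
      c = expCost X′ τ e
      u = Λ * c
      x≤ : suc (len x) ≤ c
      x≤ = ≤-trans (≡⇒≤ⁿ (cong (suc ∘ len) (⟦⟧-eval e))) (s≤s (m≤m+n _ _))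
      eq₁ : ∀ c k s → suc (c + (suc (c + (2 + suc (c + k))) + s)) ≡ 5 * 1 + 3 * c + k + s
      eq₁ = solve-∀
      eq₂ : ∀ u k s → 5 * u + 3 * u + k * u + s * u ≡ (8 + k + s) * u
      eq₂ = solve-∀
    subᴱ-cost (lit n)    = ≤-trans (scale {1} {expCost X′ τ (lit n)} (s≤s z≤n)) (≡⇒≤ⁿ (sym (*-identityˡ _)))
    subᴱ-cost size       = ≤-trans (scale {1} {expCost X′ τ size} (s≤s z≤n)) (≡⇒≤ⁿ (sym (*-identityˡ _)))
    subᴱ-cost (input e)  = ≤-trans (costᴱ-cost e) (*-monoʳ-≤ (kᶜ e) (*-monoʳ-≤ Λ (m≤n⇒m≤1+n (m≤n+m _ (len (eval X′ τ (input e)))))))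
    subᴱ-cost (load a e) = ≤-trans (costᴱ-cost e) (*-monoʳ-≤ (kᶜ e) (*-monoʳ-≤ Λ (m≤n⇒m≤1+n (m≤n+m _ (len (eval X′ τ (load a e)))))))
    subᴱ-cost (bitlen e) = ≤-trans (costᴱ-cost e) (*-monoʳ-≤ (kᶜ e) (*-monoʳ-≤ Λ (m≤n⇒m≤1+n (m≤n+m _ (len (eval X′ τ (bitlen e)))))))
    subᴱ-cost (op o e f) = begin
      suc (len (eval X σ (costᴱ e) + eval X σ (costᴱ f)) + (expCost X σ (costᴱ e) + expCost X σ (costᴱ f)))
        ≤⟨ s≤s (+-mono-≤ (≤-trans (≡⇒≤ⁿ (cong len (cong₂ _+_ (costᴱ-eval e) (costᴱ-eval f)))) (≤-trans (len≤n (c + d)) c+d≤)) (+-mono-≤ (costᴱ-cost e) (costᴱ-cost f))) ⟩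
      suc c′ + (kᶜ e * (Λ * c) + kᶜ f * (Λ * d)) ≤⟨ +-mono-≤ (+-mono-≤ (scale {1} {c′} (s≤s z≤n)) (scale {c′} ≤-refl)) (+-mono-≤ (*-monoʳ-≤ (kᶜ e) (*-monoʳ-≤ Λ (≤-trans (m≤m+n c d) c+d≤))) (*-monoʳ-≤ (kᶜ f) (*-monoʳ-≤ Λ (≤-trans (m≤n+m d c) c+d≤)))) ⟩
      Λ * c′ + Λ * c′ + (kᶜ e * (Λ * c′) + kᶜ f * (Λ * c′)) ≡⟨ eq (Λ * c′) (kᶜ e) (kᶜ f) ⟩
      (2 + kᶜ e + kᶜ f) * (Λ * c′) ∎
      where
      c = expCost X′ τ e
      d = expCost X′ τ f
      c′ = expCost X′ τ (op o e f)
      c+d≤ : c + d ≤ c′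
      c+d≤ = m≤n⇒m≤1+n (m≤n+m (c + d) (len (eval X′ τ (op o e f))))
      eq : ∀ u k l → u + u + (k * u + l * u) ≡ (2 + k + l) * u
      eq = solve-∀

-- Step-by-step correctness of the simulation

module _ (X : Input) where
  -- As Det, but the first step has been taken off the budget of steps.
  record Det⁺ (c : Config) (b : ℕ) (c′ : Config) : Set where
    field
      cost  : ∀ n → costWithin X (suc n) c ≤ℚ fromℕ b +ℚ costWithin X n c′
      delay : ℕ
      reach : ∀ {φ} → NonNeg φ → ∀ n → halt X n φ c′ ≤ℚ halt X (delay + n) φ c

  Det-step⁺ : ∀ {s K σ c b c′} → next X s K σ ≡ c ∷ [] → Det X c b c′ → Det⁺ (s ∷ K , σ) (stepCost X s σ + b) c′
  Det-step⁺ {s} {K} {σ} {c} {b} {c′} eq D = record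
    { cost = λ n → begin
        costWithin X (suc n) (s ∷ K , σ) ≡⟨ cost-det X n {s} {K} {σ} eq ⟩
        fromℕ (stepCost X s σ) +ℚ costWithin X n c ≤⟨ ℚ.+-monoʳ-≤ (fromℕ (stepCost X s σ)) (Det.cost D n) ⟩
        fromℕ (stepCost X s σ) +ℚ (fromℕ b +ℚ costWithin X n c′) ≡⟨ fromℕ-merge (stepCost X s σ) b (costWithin X n c′) ⟩
        fromℕ (stepCost X s σ + b) +ℚ costWithin X n c′ ∎
    ; delay = Det.delay D′ ; reach = Det.reach D′ }
    where
    open ℚ.≤-Reasoning
    D′ = Det-step X {s} {K} {σ} eq D

  Det⁺⇒Det : ∀ {c b c′} → Det⁺ c b c′ → Det X c b c′
  Det⁺⇒Det {c} {b} {c′} D = record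
    { cost = λ where
        zero    → respˡ (ℚ.+-identityˡ 0ℚ) (ℚ.+-mono-≤ (0≤fromℕ b) (cost-nonNeg X 0 c′))
        (suc n) → ℚ.≤-trans (Det⁺.cost D n) (ℚ.+-monoʳ-≤ (fromℕ b) (cost-suc X n c′))
    ; delay = Det⁺.delay D ; reach = Det⁺.reach D }

  Det⁺-trans : ∀ {c b c′ b′ c″} → Det⁺ c b c′ → Det X c′ b′ c″ → Det⁺ c (b + b′) c″
  Det⁺-trans {c} {b} {c′} {b′} {c″} D E = record
    { cost = λ n → ℚ.≤-trans (Det⁺.cost D n) (ℚ.≤-trans (ℚ.+-monoʳ-≤ (fromℕ b) (Det.cost E n))
        (≡⇒≤ (fromℕ-merge b b′ (costWithin X n c″))))
    ; delay = Det.delay F ; reach = Det.reach F }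
    where F = Det-trans X (Det⁺⇒Det D) E

  Det⁺-weaken : ∀ {c b b′ c′} → b ≤ b′ → Det⁺ c b c′ → Det⁺ c b′ c′
  Det⁺-weaken {c′ = c′} p D = record
    { cost = λ n → ℚ.≤-trans (Det⁺.cost D n) (ℚ.+-monoˡ-≤ (costWithin X n c′) (fromℕ-mono p))
    ; delay = Det⁺.delay D ; reach = Det⁺.reach D }

AllSub : (Program → ℕ) → ℕ → Program → Set
AllSub f N (p ⨾ q)        = f (p ⨾ q) ≤ N × AllSub f N p × AllSub f N q
AllSub f N (branch e p q) = f (branch e p q) ≤ N × AllSub f N p × AllSub f N q
AllSub f N (while e p)    = f (while e p) ≤ N × AllSub f N p
AllSub f N s              = f s ≤ N

AllSub-head : ∀ {f N} s → AllSub f N s → f s ≤ N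
AllSub-head skip           p = p
AllSub-head (store a i e)  p = p
AllSub-head (random a i e) p = p
AllSub-head (s ⨾ t)        p = proj₁ p
AllSub-head (branch e s t) p = proj₁ p
AllSub-head (while e s)    p = proj₁ p

maxSub : (Program → ℕ) → Program → ℕ
maxSub f (p ⨾ q)        = f (p ⨾ q) + (maxSub f p + maxSub f q)
maxSub f (branch e p q) = f (branch e p q) + (maxSub f p + maxSub f q)
maxSub f (while e p)    = f (while e p) + maxSub f p
maxSub f s              = f s

AllSub-mono : ∀ {f M N} s → M ≤ N → AllSub f M s → AllSub f N s
AllSub-mono skip           p q           = ≤-trans q p
AllSub-mono (store a i e)  p q           = ≤-trans q p
AllSub-mono (random a i e) p q           = ≤-trans q p
AllSub-mono (s ⨾ t)        p (q , u , v) = ≤-trans q p , AllSub-mono s p u , AllSub-mono t p v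
AllSub-mono (branch e s t) p (q , u , v) = ≤-trans q p , AllSub-mono s p u , AllSub-mono t p v
AllSub-mono (while e s)    p (q , u)     = ≤-trans q p , AllSub-mono s p u

AllSub-max₂ : ∀ f x s t → let m = x + (maxSub f s + maxSub f t) in
  AllSub f (maxSub f s) s → AllSub f (maxSub f t) t → x ≤ m × AllSub f m s × AllSub f m t
AllSub-max₂ f x s t p q =
    m≤m+n x (a + b)
  , AllSub-mono s (≤-trans (m≤m+n a b) (m≤n+m (a + b) x)) p
  , AllSub-mono t (≤-trans (m≤n+m b a) (m≤n+m (a + b) x)) q
  where
  a = maxSub f s
  b = maxSub f t

AllSub-max : ∀ f s → AllSub f (maxSub f s) s
AllSub-max f skip           = ≤-refl
AllSub-max f (store a i e)  = ≤-refl
AllSub-max f (random a i e) = ≤-refl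
AllSub-max f (s ⨾ t)        = AllSub-max₂ f (f (s ⨾ t)) s t (AllSub-max f s) (AllSub-max f t)
AllSub-max f (branch e s t) = AllSub-max₂ f (f (branch e s t)) s t (AllSub-max f s) (AllSub-max f t)
AllSub-max f (while e s)    = m≤m+n (f (while e s)) (maxSub f s) , AllSub-mono s (m≤n+m (maxSub f s) (f (while e s))) (AllSub-max f s)

LoadsAny : ∀ e → Loads (λ _ → ⊤) e
LoadsAny (lit n)    = tt
LoadsAny size       = tt
LoadsAny (input e)  = LoadsAny e
LoadsAny (load a e) = tt , LoadsAny e
LoadsAny (op o e f) = LoadsAny e , LoadsAny f
LoadsAny (bitlen e) = LoadsAny e

LoadsStepAny : ∀ s → LoadsStep (λ _ → ⊤) s
LoadsStepAny skip           = tt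
LoadsStepAny (store a i e)  = LoadsAny i , LoadsAny e
LoadsStepAny (random a i e) = LoadsAny i , LoadsAny e
LoadsStepAny (p ⨾ q)        = tt
LoadsStepAny (branch e p q) = LoadsAny e
LoadsStepAny (while e p)    = LoadsAny e

module Simulation (S : Setup) where
  open Setup S

  record Sim (σ τ : Memory) (clk : ℕ) : Set where
    field
      view  : View σ τ
      clock : σ 5 0 ≡ clk
      bits  : ∀ a i → len (τ a i) ≤ clk
      bound : clk ≤ overrun
    open View view public

  View-ctl : ∀ {σ τ v} b x → b ≡ 1 ⊎ b ≡ 5 → View σ τ → len v ≤ Λ → View (update σ b x v) τ
  View-ctl {σ} {τ} {v} b x h V p = record
    { mem    = λ a i → trans (u (12 + a) _ (λ e → big h e)) (View.mem V a i)
    ; others = λ a i j l n → trans (u (12 + a) _ (λ e → big h e)) (View.others V a i j l n)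
    ; ctl    = λ c j f → trans (u c j (frz h f)) (View.ctl V c j f)
    ; small  = update-≤ {P = Control} {σ = σ} {b} {x} {v} p (View.small V) }
    where
    u : ∀ c j → b ≢ c → update σ b x v c j ≡ σ c j
    u c j n = update-array σ b x v c j n
    big : ∀ {b a} → b ≡ 1 ⊎ b ≡ 5 → b ≢ 12 + a
    big (inj₁ refl) ()
    big (inj₂ refl) ()
    frz : ∀ {b c} → b ≡ 1 ⊎ b ≡ 5 → Frozen c → b ≢ c
    frz (inj₁ refl) = Frozen≢1
    frz (inj₂ refl) = Frozen≢5

  View-store : ∀ {σ τ a i x v v′} → View σ τ → x ≡ i * stride + this → v ≡ v′ → View (update σ (12 + a) x v) (update τ a i v′)
  View-store {σ} {τ} {a} {i} {x} {v} V refl refl = record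
    { mem    = mem′
    ; others = λ b j d l n → trans (update-≢ σ (12 + a) (i * stride + this) v (12 + b) (j * stride + d) (inj₂ (λ e → n (sym (stride-disjoint {i = i} {j} this< l e))))) (View.others V b j d l n)
    ; ctl    = λ c j f → trans (update-array σ (12 + a) (i * stride + this) v c j (Frozen≢ f a)) (View.ctl V c j f)
    ; small  = λ c j f → subst (λ z → len z ≤ Λ) (sym (update-array σ (12 + a) (i * stride + this) v c j (Control≢ f a))) (View.small V c j f) }
    where
    mem′ : ∀ b j → update σ (12 + a) x v (12 + b) (j * stride + this) ≡ update τ a i v b j
    mem′ b j with a ℕ.≟ b | i ℕ.≟ j
    ... | yes refl | yes refl = trans (update-≡ σ (12 + a) x v) (sym (update-≡ τ a i v))
    ... | no n     | _        = trans (update-array σ (12 + a) x v (12 + b) _ (λ e → n (ℕ.+-cancelˡ-≡ 12 a b e))) (trans (View.mem V b j) (sym (update-array τ a i v b j n)))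
    ... | yes refl | no n     = trans (update-≢ σ (12 + a) x v (12 + b) _ (inj₂ (λ e → n (stride-injective {stride} {this} this< e)))) (trans (View.mem V b j) (sym (update-≢ τ a i v b j (inj₂ n))))

  module Live {σ τ clk} (I : Sim σ τ clk) (s : Program) (fits : κₛ s ≤ C) (live : clk ≤ limit) where
    open Sim I
    open Expressions view
    c = stepCost X′ s τ
    U = Λ * c
    1≤U : 1 ≤ U
    1≤U = 1≤* 1≤Λ (1≤stepCost X′ s τ)
    Λ≤U : Λ ≤ U
    Λ≤U = ≤*ʳ (1≤stepCost X′ s τ)
    c≤U : c ≤ U
    c≤U = ≤*ˡ 1≤Λ

    infixr 5 _⊞_
    _⊞_ : ∀ {a b m n} → a ≤ m * U → b ≤ n * U → a + b ≤ (m + n) * U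
    _⊞_ {m = m} {n} p q = ≤-trans (+-mono-≤ p q) (≡⇒≤ⁿ (sym (*-distribʳ-+ U m n)))

    lit≤ : ∀ n → n ≤ n * U
    lit≤ n = ≤*ʳ 1≤U

    1U : ∀ {a} → a ≤ U → a ≤ 1 * U
    1U p = ≤-trans p (≡⇒≤ⁿ (sym (*-identityˡ U)))

    ΛU : ∀ {n} → n * Λ ≤ n * U
    ΛU {n} = *-monoʳ-≤ n Λ≤U

    sub≤ : ∀ {d e} (k : ℕ) → expCost X σ d ≤ k * (Λ * expCost X′ τ e) → expCost X′ τ e ≤ c → expCost X σ d ≤ k * U
    sub≤ k p q = ≤-trans p (*-monoʳ-≤ k (*-monoʳ-≤ Λ q))

    step-eval : ∀ s → eval X σ (stepᴱ s) ≡ stepCost X′ s τ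
    step-eval skip           = refl
    step-eval (store a i e)  = cong₂ (λ x y → suc x + y) (costᴱ-eval i) (costᴱ-eval e)
    step-eval (random a i e) = cong₂ (λ x y → suc x + y) (costᴱ-eval i) (costᴱ-eval e)
    step-eval (p ⨾ q)        = refl
    step-eval (branch e p q) = cong suc (costᴱ-eval e)
    step-eval (while e p)    = cong suc (costᴱ-eval e)

    c≤ : c ≤ C * (limit + Λ)
    c≤ = ≤-trans (stepCost≤κ {P = λ _ → ⊤} {X = X′} {σ = τ} {L = clk + Λ} (≤-trans 1≤Λ (m≤n+m Λ clk))
           (≤-trans (≡⇒≤ⁿ (cong len (sym size≡))) (≤-trans size≤ (m≤n+m Λ clk)))
           (λ i → ≤-trans (input≤′ i) (m≤n+m Λ clk)) (λ a i _ → ≤-trans (bits a i) (m≤m+n clk Λ)) s (LoadsStepAny s))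
         (ℕ.*-mono-≤ fits (+-monoˡ-≤ Λ live))

    new : clk + c ≤ overrun
    new = +-mono-≤ live c≤

    private
      two : ∀ i e → c ≡ 1 + expCost X′ τ i + expCost X′ τ e →
        expCost X σ (op add (op add (lit 1) (costᴱ i)) (costᴱ e)) ≤ (6 + kᶜ i + kᶜ e) * U
      two i e h = ≤-trans
        (s≤s (+-mono-≤ (≤-trans (≡⇒≤ⁿ (cong len (trans (cong₂ (λ x y → suc x + y) (costᴱ-eval i) (costᴱ-eval e)) (sym h)))) (len≤n c))
          (+-mono-≤ (s≤s (+-mono-≤ (≤-trans (len≤n _) (≤-trans (≡⇒≤ⁿ (cong suc (costᴱ-eval i))) (back (m≤m+n (suc (expCost X′ τ i)) (expCost X′ τ e))))) (+-monoʳ-≤ 2 (sub≤ {costᴱ i} {i} (kᶜ i) (costᴱ-cost i) (back (m≤n⇒m≤1+n (m≤m+n (expCost X′ τ i) (expCost X′ τ e))))))))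
            (sub≤ {costᴱ e} {e} (kᶜ e) (costᴱ-cost e) (back (m≤n⇒m≤1+n (m≤n+m (expCost X′ τ e) (expCost X′ τ i))))))))
        (≤-trans (≡⇒≤ⁿ (eq c (kᶜ i * U) (kᶜ e * U))) (_⊞_ {m = 6 + kᶜ i} {kᶜ e} (_⊞_ {m = 6} {kᶜ i} (_⊞_ {m = 4} {2} (lit≤ 4) (_⊞_ {m = 1} {1} (1U c≤U) (1U c≤U))) ≤-refl) ≤-refl))
        where
        back : ∀ {x} → x ≤ 1 + expCost X′ τ i + expCost X′ τ e → x ≤ c
        back p = ≤-trans p (≡⇒≤ⁿ (sym h))
        eq : ∀ c x y → suc (c + (suc (c + (2 + x)) + y)) ≡ 4 + (c + c) + x + y
        eq = solve-∀
      single : ∀ e → c ≡ 1 + expCost X′ τ e → expCost X σ (op add (lit 1) (costᴱ e)) ≤ (4 + kᶜ e) * U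
      single e h = ≤-trans
        (s≤s (+-mono-≤ (≤-trans (len≤n _) (≡⇒≤ⁿ (trans (cong suc (costᴱ-eval e)) (sym h)))) (+-monoʳ-≤ 2 (sub≤ {costᴱ e} {e} (kᶜ e) (costᴱ-cost e) (≤-trans (n≤1+n _) (≡⇒≤ⁿ (sym h)))))))
        (≤-trans (≡⇒≤ⁿ (eq c (kᶜ e * U))) (_⊞_ {m = 4} {kᶜ e} (_⊞_ {m = 3} {1} (lit≤ 3) (1U c≤U)) ≤-refl))
        where
        eq : ∀ c x → suc (c + (2 + x)) ≡ 3 + c + x
        eq = solve-∀

    step-cost : expCost X σ (stepᴱ s) ≤ kᴾ s * U
    step-cost = go s refl
      where
      go : ∀ t → c ≡ stepCost X′ t τ → expCost X σ (stepᴱ t) ≤ kᴾ t * U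
      go skip           h = lit≤ 2
      go (store a i e)  h = two i e h
      go (random a i e) h = two i e h
      go (p ⨾ q)        h = lit≤ 2
      go (branch e p q) h = single e h
      go (while e p)    h = single e h

    σ₁ σ₂ : Memory
    σ₁ = update σ 5 0 (eval X σ (op add (cell 5) (stepᴱ s)))
    σ₂ = update σ₁ 1 0 (eval X σ₁ (flagᴱ s))

    clock₁ : eval X σ (op add (cell 5) (stepᴱ s)) ≡ clk + c
    clock₁ = cong₂ _+_ clock (step-eval s)

    view₁ : View σ₁ τ
    view₁ = View-ctl 5 0 (inj₂ refl) view (≤-trans (≡⇒≤ⁿ (cong len clock₁)) (≤-trans (len-mono new) overrun≤))

    flag-small : ∀ t → eval X σ₁ (flagᴱ t) ≤ 1
    flag-small skip           = ≤-refl
    flag-small (store a i e)  = ≤-refl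
    flag-small (random a i e) = ≤-refl
    flag-small (p ⨾ q)        = ≤-refl
    flag-small (branch e p q) = ≤-refl
    flag-small (while e p) with 0 <ᵇ eval X σ₁ ⟦ e ⟧
    ... | true  = ≤-refl
    ... | false = z≤n

    view₂ : View σ₂ τ
    view₂ = View-ctl 1 0 (inj₁ refl) view₁ (≤-trans (len≤n _) (≤-trans (flag-small s) 1≤Λ))

    sim₂ : Sim σ₂ τ (clk + c)
    sim₂ = record { view = view₂ ; clock = clock₁ ; bits = λ a i → ≤-trans (bits a i) (m≤m+n clk c) ; bound = new }

    module E₁ = Expressions view₁
    module E₂ = Expressions view₂

    ctl-cost : ∀ {σ′ t} → View σ′ τ → LoadsStep Control t → stepCost X t σ′ ≤ κₛ t * U
    ctl-cost {σ′} {t} V l = ≤-trans (stepCost≤κ {P = Control} {X = X} {σ = σ′} 1≤Λ size≤ input≤ (View.small V) t l) (*-monoʳ-≤ (κₛ t) Λ≤U)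

    charge-cost : stepCost X (store 5 (lit 0) (op add (cell 5) (stepᴱ s))) σ ≤ (7 + kᴾ s) * U
    charge-cost = ≤-trans
      (s≤s (s≤s (s≤s (+-mono-≤ (≤-trans (≡⇒≤ⁿ (cong len clock₁)) (≤-trans (len-mono new) overrun≤))
         (+-mono-≤ (s≤s (+-monoˡ-≤ 1 (small 5 0 tt))) step-cost)))))
      (≤-trans (≡⇒≤ⁿ (eq Λ (kᴾ s * U))) (_⊞_ {m = 7} {kᴾ s} (_⊞_ {m = 5} {2} (lit≤ 5) (_⊞_ {m = 1} {1} (1U Λ≤U) (1U Λ≤U))) ≤-refl))
      where
      eq : ∀ l x → suc (suc (suc (l + (suc (l + 1) + x)))) ≡ 5 + (l + l) + x
      eq = solve-∀

    flag-cost : stepCost X (store 1 (lit 0) (flagᴱ s)) σ₁ ≤ (2 + kᶠ s) * U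
    flag-cost = _⊞_ {m = 2} {kᶠ s} (lit≤ 2) (go s refl)
      where
      go : ∀ t → c ≡ stepCost X′ t τ → expCost X σ₁ (flagᴱ t) ≤ kᶠ t * U
      go skip           h = lit≤ 2
      go (store a i e)  h = lit≤ 2
      go (random a i e) h = lit≤ 2
      go (p ⨾ q)        h = lit≤ 2
      go (branch e p q) h = lit≤ 2
      go (while e p)    h = ≤-trans (s≤s (+-mono-≤ (≤-trans (len≤n _) (flag-small (while e p))) (s≤s (≤-trans (E₁.⟦⟧-cost e) (*-monoʳ-≤ (kᴱ e) (*-monoʳ-≤ Λ (≤-trans (n≤1+n _) (≡⇒≤ⁿ (sym h)))))))))
        (_⊞_ {m = 3} {kᴱ e} (lit≤ 3) ≤-refl)

    guard-true : 1 ≤ eval X σ guard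
    guard-true = ≡⇒≤ⁿ (sym (less-true (≤-trans (s≤s (≡⇒≤ⁿ clock)) (≤-trans (s≤s live) (s≤s (≡⇒≤ⁿ (sym (trans (ctl 6 0 tt) limit≡))))))))

    preDet : ∀ {R} → Det⁺ X (pre s ∷ R , σ) (((1 + κ guard) + (1 + ((7 + kᴾ s) + (2 + kᶠ s)))) * U) (R , σ₂)
    preDet {R} = Det⁺-weaken X
      (_⊞_ {m = 1 + κ guard} {1 + ((7 + kᴾ s) + (2 + kᶠ s))} (ctl-cost {t = branch guard skip skip} view _)
        (_⊞_ {m = 1} {(7 + kᴾ s) + (2 + kᶠ s)} (lit≤ 1) (_⊞_ {m = 7 + kᴾ s} {2 + kᶠ s} charge-cost (≤-trans (≡⇒≤ⁿ (+-identityʳ _)) flag-cost))))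
      (Det-step⁺ X {pre s} (next-true X σ guard guard-true) (Det-step X {charge s} refl (Det-step X {store 5 (lit 0) (op add (cell 5) (stepᴱ s))} refl (Det-step X {store 1 (lit 0) (flagᴱ s)} refl (Det-refl X)))))

    cell-cost : stepCost X (branch (cell 1) skip skip) σ₂ ≤ (1 + κ (cell 1)) * U
    cell-cost = ctl-cost {t = branch (cell 1) skip skip} view₂ _

  -- The simulated stack: an item is the form of s as it was pushed, or, for
  -- the remaining iterations of a loop, the two halves of that form.
  data Items (N : ℕ) : List Program → List Program → Set where
    []  : Items N [] []
    tr  : ∀ {s Ks Qs} → AllSub D N s × AllSub κₛ C s → Items N Ks Qs → Items N (s ∷ Ks) (T⟦ s ⟧ ∷ Qs)
    on  : ∀ {s Ks Qs} → AllSub D N s × AllSub κₛ C s → Items N Ks Qs → Items N (s ∷ Ks) (pre s ∷ act s ∷ Qs)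

rng : ℕ → ℕ
rng zero    = 1
rng (suc n) = suc n

mean-range : ∀ n (f : ℕ → ℚ) → mean (range n) f ≡ mean (allFin (rng n)) (f ∘ toℕ)
mean-range n f = trans (cong (λ xs → mean xs f) (lists n)) (mean-map (allFin (rng n)) toℕ f)
  where
  apply≡tabulate : ∀ n (g : ℕ → ℕ) → applyUpTo g n ≡ List.tabulate {n = n} (g ∘ toℕ)
  apply≡tabulate zero    g = refl
  apply≡tabulate (suc n) g = cong (g 0 ∷_) (apply≡tabulate n (g ∘ suc))
  lists : ∀ n → range n ≡ map toℕ (allFin (rng n))
  lists zero    = refl
  lists (suc n) = trans (apply≡tabulate (suc n) id) (sym (List.map-tabulate id toℕ))

toℕ≤rng : ∀ n (i : Fin (rng n)) → toℕ i ≤ n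
toℕ≤rng zero    zero = z≤n
toℕ≤rng (suc n) i    = <⇒≤ (Fin.toℕ<n i)

-- The run of a clocked program, in terms of the program itself: ψ is the
-- reward on halting within n steps and within the limit, and d the reward as
-- soon as the limit is exceeded.
module _ (X : Input) (limit : ℕ) (ψ : Memory → ℕ → ℚ) (d : ℚ) where
  clocked : ℕ → ℕ → Config → ℚ
  clocked n       clk ([] , τ) with clk ℕ.≤? limit
  ... | yes _ = ψ τ clk
  ... | no  _ = d
  clocked n       clk (s ∷ Ks , τ) with clk ℕ.≤? limit
  clocked n       clk (s ∷ Ks , τ) | no _ = d
  clocked zero    clk (s ∷ Ks , τ) | yes _ = 0ℚ
  clocked (suc n) clk (s ∷ Ks , τ) | yes _ = mean (next X s Ks τ) (clocked n (clk + stepCost X s τ))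

-- Kept abstract so that costs are not normalised to unary numerals.
abstract
  dead : ℕ
  dead = 1 + ((1 + κ guard) + (3 + ((1 + κ (cell 1)) + 1)))

  dead≡ : dead ≡ 1 + ((1 + κ guard) + (3 + ((1 + κ (cell 1)) + 1)))
  dead≡ = refl

module SimulationRuns (S : Setup) (N : ℕ) (K : List Program) where
  open Setup S
  open Simulation S

  Related : List Program → Memory → ℕ → List Program → Memory → Set
  Related Ks τ clk Qs σ = Items N Ks Qs × Sim σ τ clk

  record LiveStep (Q : Config) (s : Program) (Ks : List Program) (τ : Memory) (clk : ℕ) : Set where
    clk′ : ℕ
    clk′ = clk + stepCost X′ s τ
    field
      cost  : ∀ n (H : Config → ℚ) → (∀ {Ks′ τ′ Qs σ} → Related Ks′ τ′ clk′ Qs σ → costWithin X n (Qs ++ K , σ) ≤ℚ H (Ks′ , τ′)) →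
              costWithin X (suc n) Q ≤ℚ fromℕ (N * (Λ * stepCost X′ s τ)) +ℚ mean (next X′ s Ks τ) H
      reach : ∀ {φ} → NonNeg φ → (V : Config → ℚ) → (∀ {Ks′ τ′ Qs σ} → Related Ks′ τ′ clk′ Qs σ → Reaches X φ (Qs ++ K , σ) (V (Ks′ , τ′))) →
              Reaches X φ Q (mean (next X′ s Ks τ) V)

  live-det : ∀ {Q s Ks τ clk b Ks′ τ′ Qs σ} → Det⁺ X Q b (Qs ++ K , σ) → b ≤ N * (Λ * stepCost X′ s τ) →
    next X′ s Ks τ ≡ (Ks′ , τ′) ∷ [] → Related Ks′ τ′ (clk + stepCost X′ s τ) Qs σ → LiveStep Q s Ks τ clk
  live-det {Q} {s} {Ks} {τ} {b = b} {Ks′} {τ′} {Qs} {σ} O p e R = record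
    { cost  = λ n H h → ℚ.≤-trans (Det⁺.cost O n) (ℚ.+-mono-≤ (fromℕ-mono p) (ℚ.≤-trans (h R) (≡⇒≤ (sym (single H)))))
    ; reach = λ {φ} h V r → Reaches-≤ X {φ} {Q} (≡⇒≤ (single V)) (Reaches-det X h (Det⁺⇒Det X O) (r R)) }
    where
    single : ∀ H → mean (next X′ s Ks τ) H ≡ H (Ks′ , τ′)
    single H = trans (cong (λ xs → mean xs H) e) (mean-single (Ks′ , τ′) H)

  module Inner {s σ τ clk Ks Qs} (fits : AllSub D N s × AllSub κₛ C s) (items : Items N Ks Qs) (I : Sim σ τ clk) (live : clk ≤ limit) where
    open Live I s (AllSub-head s (proj₂ fits)) live

    opening : ℕ
    opening = 1 + ((1 + κ guard) + (1 + ((7 + kᴾ s) + (2 + kᶠ s))))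

    Opened : Config → Set
    Opened Q = Det⁺ X Q (opening * U) (act s ∷ Qs ++ K , σ₂)

    finish : ∀ {Q b Ks′ τ′ Qs′ σ′} → Opened Q → Det X (act s ∷ Qs ++ K , σ₂) b (Qs′ ++ K , σ′) → b ≤ ((1 + κ (cell 1)) + kᵃ s) * U →
      next X′ s Ks τ ≡ (Ks′ , τ′) ∷ [] → Related Ks′ τ′ (clk + c) Qs′ σ′ → LiveStep Q s Ks τ clk
    finish O A p e R = live-det {s = s} (Det⁺-trans X O A)
      (≤-trans (_⊞_ {m = opening} {(1 + κ (cell 1)) + kᵃ s} ≤-refl p) (*-monoˡ-≤ U (AllSub-head s (proj₁ fits)))) e R

  liveOpened : ∀ {Q} s {σ τ clk Ks Qs} (fits : AllSub D N s × AllSub κₛ C s) (items : Items N Ks Qs) (I : Sim σ τ clk) (live : clk ≤ limit) →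
    Inner.Opened fits items I live Q → LiveStep Q s Ks τ clk
  liveOpened skip {Ks = Ks} {Qs} fits items I live O =
    finish O (Det-step X {branch (cell 1) skip skip} refl (Det-step X {skip} refl (Det-refl X)))
      (_⊞_ {m = 1 + κ (cell 1)} {1} cell-cost (lit≤ 1)) refl (items , sim₂)
    where
    open Inner {skip} fits items I live
    open Live I skip (proj₂ fits) live
  liveOpened (store a i e) {τ = τ} {clk} {Ks} {Qs} fits items I live O =
    finish O (Det-step X {act (store a i e)} refl (Det-step X {store (12 + a) (addr ⟦ i ⟧) ⟦ e ⟧} refl (Det-refl X)))
      (_⊞_ {m = 1 + κ (cell 1)} {kᵃ (store a i e)} cell-cost (≤-trans (≡⇒≤ⁿ (+-identityʳ _)) inner)) refl
      (items , record
        { view  = View-store {i = eval X′ τ i} view₂ addr-eval (E₂.⟦⟧-eval e)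
        ; clock = Sim.clock sim₂
        ; bits  = λ b j → update-≤ {P = λ _ → ⊤} {σ = τ} {a} {eval X′ τ i} {eval X′ τ e} (≤-trans (len≤cost X′ τ e) (≤-trans (m≤n+m _ (1 + expCost X′ τ i)) (m≤n+m c clk))) (λ b j _ → Sim.bits sim₂ b j) b j tt
        ; bound = new })
    where
    open Inner {store a i e} fits items I live
    open Live I (store a i e) (proj₂ fits) live
    addr-eval : eval X σ₂ (addr ⟦ i ⟧) ≡ eval X′ τ i * stride + this
    addr-eval = cong₂ _+_ (cong₂ _*_ (E₂.⟦⟧-eval i) (trans (View.ctl view₂ 3 0 tt) stride≡)) (trans (View.ctl view₂ 4 0 tt) this≡)
    inner : 1 + expCost X σ₂ (addr ⟦ i ⟧) + expCost X σ₂ ⟦ e ⟧ ≤ kᵃ (store a i e) * U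
    inner = _⊞_ {m = 13 + 3 * kᴱ i} {kᴱ e} (≤-trans (s≤s (E₂.addr-cost ⟦ i ⟧)) (≤-trans
        (+-mono-≤ 1≤U (+-mono-≤ (*-monoʳ-≤ 3 (≤-trans (E₂.⟦⟧-cost i) (*-monoʳ-≤ (kᴱ i) (*-monoʳ-≤ Λ (m≤n⇒m≤1+n (m≤m+n _ _)))))) (ΛU {12})))
        (≡⇒≤ⁿ (eq U (kᴱ i)))))
      (≤-trans (E₂.⟦⟧-cost e) (*-monoʳ-≤ (kᴱ e) (*-monoʳ-≤ Λ (m≤n+m (expCost X′ τ e) (1 + expCost X′ τ i)))))
      where
      eq : ∀ u k → u + (3 * (k * u) + 12 * u) ≡ (13 + 3 * k) * u
      eq = solve-∀
  liveOpened {Q} (random a i e) {τ = τ} {clk} {Ks} {Qs} fits items I live O = record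
    { cost = λ n H h → begin
        costWithin X (suc n) Q ≤⟨ Det⁺.cost O′ n ⟩
        fromℕ b₁ +ℚ costWithin X n (r ∷ Qs ++ K , σ₂) ≤⟨ ℚ.+-monoʳ-≤ (fromℕ b₁) (Run.cost R n) ⟩
        fromℕ b₁ +ℚ (fromℕ b₂ +ℚ mean (allFin (rng E)) (λ v → costWithin X n (conf v))) ≡⟨ fromℕ-merge b₁ b₂ (mean (allFin (rng E)) (λ v → costWithin X n (conf v))) ⟩
        fromℕ (b₁ + b₂) +ℚ mean (allFin (rng E)) (λ v → costWithin X n (conf v)) ≤⟨ ℚ.+-mono-≤ (fromℕ-mono total) (ℚ.≤-trans (mean-mono (allFin (rng E)) (λ v → h (related v))) (≡⇒≤ (sym (split H)))) ⟩
        fromℕ (N * (Λ * c)) +ℚ mean (next X′ (random a i e) Ks τ) H ∎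
    ; reach = λ {φ} p V h → Reaches-≤ X {φ} {Q} (≡⇒≤ (split V)) (Reaches-det X p (Det⁺⇒Det X O′) (Reaches-run X (λ v → V (Ks , update τ a (eval X′ τ i) (toℕ v))) p R (λ v → h (related v)))) }
    where
    open ℚ.≤-Reasoning
    open Inner {random a i e} fits items I live
    open Live I (random a i e) (proj₂ fits) live
    r = random (12 + a) (addr ⟦ i ⟧) ⟦ e ⟧
    E = eval X′ τ e
    conf : Fin (rng E) → Config
    conf v = Qs ++ K , update σ₂ (12 + a) (eval X σ₂ (addr ⟦ i ⟧)) (toℕ v)
    R : Run X (r ∷ Qs ++ K , σ₂) (stepCost X r σ₂) 1 (allFin (rng E)) conf
    R = Run-change X (λ f → trans (cong (λ z → mean (range z) f) (E₂.⟦⟧-eval e)) (mean-range E f)) (Run-random X {12 + a} {addr ⟦ i ⟧} {⟦ e ⟧})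
    b₁ = opening * U + (stepCost X (act (random a i e)) σ₂ + 0)
    b₂ = stepCost X r σ₂
    O′ : Det⁺ X Q b₁ (r ∷ Qs ++ K , σ₂)
    O′ = Det⁺-trans X O (Det-step X {act (random a i e)} refl (Det-refl X))
    addr-eval : eval X σ₂ (addr ⟦ i ⟧) ≡ eval X′ τ i * stride + this
    addr-eval = cong₂ _+_ (cong₂ _*_ (E₂.⟦⟧-eval i) (trans (View.ctl view₂ 3 0 tt) stride≡)) (trans (View.ctl view₂ 4 0 tt) this≡)
    inner : 1 + expCost X σ₂ (addr ⟦ i ⟧) + expCost X σ₂ ⟦ e ⟧ ≤ kᵃ (random a i e) * U
    inner = _⊞_ {m = 13 + 3 * kᴱ i} {kᴱ e} (≤-trans (s≤s (E₂.addr-cost ⟦ i ⟧)) (≤-trans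
        (+-mono-≤ 1≤U (+-mono-≤ (*-monoʳ-≤ 3 (≤-trans (E₂.⟦⟧-cost i) (*-monoʳ-≤ (kᴱ i) (*-monoʳ-≤ Λ (m≤n⇒m≤1+n (m≤m+n _ _)))))) (ΛU {12})))
        (≡⇒≤ⁿ (eq U (kᴱ i)))))
      (≤-trans (E₂.⟦⟧-cost e) (*-monoʳ-≤ (kᴱ e) (*-monoʳ-≤ Λ (m≤n+m (expCost X′ τ e) (1 + expCost X′ τ i)))))
      where
      eq : ∀ u k → u + (3 * (k * u) + 12 * u) ≡ (13 + 3 * k) * u
      eq = solve-∀
    total : b₁ + b₂ ≤ N * (Λ * c)
    total = ≤-trans (≡⇒≤ⁿ (trans (cong (_+ b₂) (cong (λ z → opening * U + z) (+-identityʳ _))) (ℕ.+-assoc (opening * U) _ b₂)))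
      (≤-trans (_⊞_ {m = opening} {(1 + κ (cell 1)) + kᵃ (random a i e)} ≤-refl (_⊞_ {m = 1 + κ (cell 1)} {kᵃ (random a i e)} cell-cost inner)) (*-monoˡ-≤ U (proj₁ fits)))
    split : ∀ H → mean (next X′ (random a i e) Ks τ) H ≡ mean (allFin (rng E)) (λ v → H (Ks , update τ a (eval X′ τ i) (toℕ v)))
    split H = trans (mean-map (range E) (λ v → Ks , update τ a (eval X′ τ i) v) H) (mean-range E _)
    related : ∀ v → Related Ks (update τ a (eval X′ τ i) (toℕ v)) (clk + c) Qs (proj₂ (conf v))
    related v = items , record
      { view  = View-store {i = eval X′ τ i} view₂ addr-eval refl
      ; clock = Sim.clock sim₂
      ; bits  = λ b j → update-≤ {P = λ _ → ⊤} {σ = τ} {a} {eval X′ τ i} {toℕ v} (≤-trans (len-mono (toℕ≤rng E v)) (≤-trans (len≤cost X′ τ e) (≤-trans (m≤n+m _ (1 + expCost X′ τ i)) (m≤n+m c clk)))) (λ b j _ → Sim.bits sim₂ b j) b j tt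
      ; bound = new }
  liveOpened (p ⨾ q) {Ks = Ks} {Qs} fits@((_ , dp , dq) , (_ , cp , cq)) items I live O =
    finish O (Det-step X {act (p ⨾ q)} refl (Det-step X {T⟦ p ⟧ ⨾ T⟦ q ⟧} refl (Det-refl X)))
      (_⊞_ {m = 1 + κ (cell 1)} {1} cell-cost (lit≤ 1)) refl (tr (dp , cp) (tr (dq , cq) items) , sim₂)
    where
    open Inner {p ⨾ q} fits items I live
    open Live I (p ⨾ q) (proj₁ (proj₂ fits)) live
  liveOpened {Q} (branch e p q) {τ = τ} {clk} {Ks} {Qs} fits@((_ , dp , dq) , (_ , cp , cq)) items I live O = go (eval X′ τ e) refl
    where
    open Inner {branch e p q} fits items I live
    open Live I (branch e p q) (proj₁ (proj₂ fits)) live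
    inner : (1 + expCost X σ₂ ⟦ e ⟧) + 0 ≤ (1 + kᴱ e) * U
    inner = ≤-trans (≡⇒≤ⁿ (+-identityʳ _)) (_⊞_ {m = 1} {kᴱ e} (lit≤ 1) (≤-trans (E₂.⟦⟧-cost e) (*-monoʳ-≤ (kᴱ e) (*-monoʳ-≤ Λ (n≤1+n _)))))
    go : ∀ z → eval X′ τ e ≡ z → LiveStep Q (branch e p q) Ks τ clk
    go zero    eq = finish O (Det-step X {act (branch e p q)} refl (Det-step X {branch ⟦ e ⟧ T⟦ p ⟧ T⟦ q ⟧} (next-false X σ₂ ⟦ e ⟧ (trans (E₂.⟦⟧-eval e) eq)) (Det-refl X)))
      (_⊞_ {m = 1 + κ (cell 1)} {1 + kᴱ e} cell-cost inner) (next-false X′ τ e eq) (tr (dq , cq) items , sim₂)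
    go (suc x) eq = finish O (Det-step X {act (branch e p q)} refl (Det-step X {branch ⟦ e ⟧ T⟦ p ⟧ T⟦ q ⟧} (next-true X σ₂ ⟦ e ⟧ (≤-trans (s≤s z≤n) (≡⇒≤ⁿ (sym (trans (E₂.⟦⟧-eval e) eq))))) (Det-refl X)))
      (_⊞_ {m = 1 + κ (cell 1)} {1 + kᴱ e} cell-cost inner) (next-true X′ τ e (≤-trans (s≤s z≤n) (≡⇒≤ⁿ (sym eq)))) (tr (dp , cp) items , sim₂)
  liveOpened {Q} (while e p) {τ = τ} {clk} {Ks} {Qs} fits@((_ , dp) , (_ , cp)) items I live O = go (eval X′ τ e) refl
    where
    open Inner {while e p} fits items I live
    open Live I (while e p) (proj₁ (proj₂ fits)) live
    go : ∀ z → eval X′ τ e ≡ z → LiveStep Q (while e p) Ks τ clk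
    go zero    eq = finish O (Det-step X {act (while e p)} (next-exit X σ₂ (cell 1) (cong (applyOp less 0) (trans (E₁.⟦⟧-eval e) eq))) (Det-refl X))
      (_⊞_ {m = 1 + κ (cell 1)} {1} cell-cost z≤n) (next-exit X′ τ e eq) (items , sim₂)
    go (suc x) eq = finish O (Det-step X {act (while e p)} (next-loop X σ₂ (cell 1) (≡⇒≤ⁿ (sym (cong (applyOp less 0) (trans (E₁.⟦⟧-eval e) eq))))) (Det-step X {T⟦ p ⟧ ⨾ pre (while e p)} refl (Det-refl X)))
      (_⊞_ {m = 1 + κ (cell 1)} {1} cell-cost (lit≤ 1)) (next-loop X′ τ e (≤-trans (s≤s z≤n) (≡⇒≤ⁿ (sym eq)))) (tr (dp , cp) (on fits items) , sim₂)

  liveStep : ∀ {s Ks Qs σ τ clk} → Items N (s ∷ Ks) Qs → Sim σ τ clk → clk ≤ limit → LiveStep (Qs ++ K , σ) s Ks τ clk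
  liveStep {s} {Ks} (tr {Qs = Qs} fits items) I live = liveOpened s fits items I live
    (Det⁺-weaken X (+-monoˡ-≤ (((1 + κ guard) + (1 + ((7 + kᴾ s) + (2 + kᶠ s)))) * U) 1≤U) (Det-step⁺ X {T⟦ s ⟧} refl (Det⁺⇒Det X preDet)))
    where open Live I s (AllSub-head s (proj₂ fits)) live
  liveStep {s} {Ks} (on {Qs = Qs} fits items) I live = liveOpened s fits items I live (Det⁺-weaken X (m≤n+m _ U) preDet)
    where open Live I s (AllSub-head s (proj₂ fits)) live

  deadStep : ∀ {s Ks Qs σ τ clk} → Items N (s ∷ Ks) Qs → Sim σ τ clk → limit < clk →
    ∃[ Qs′ ] ∃[ σ′ ] Related Ks τ clk Qs′ σ′ × Det X (Qs ++ K , σ) (dead * Λ) (Qs′ ++ K , σ′)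
  deadStep {s₀} {Ks₀} {Qs₀} {σ} {τ} {clk} it I over = go it
    where
    open Sim I
    σ′ = update σ 1 0 0
    unfold : Λ + ((1 + κ guard) + (3 + ((1 + κ (cell 1)) + 1))) * Λ ≤ dead * Λ
    unfold = ≡⇒≤ⁿ (cong (_* Λ) (sym dead≡))
    I′ : Sim σ′ τ clk
    I′ = record { view = View-ctl 1 0 (inj₁ refl) view z≤n ; clock = clock ; bits = bits ; bound = bound }
    guard-false : eval X σ guard ≡ 0
    guard-false = less-false (≤-trans (s≤s (≡⇒≤ⁿ (trans (ctl 6 0 tt) limit≡))) (≤-trans over (≡⇒≤ⁿ (sym clock))))
    ctl-cost : ∀ {σ t} → View σ τ → LoadsStep Control t → stepCost X t σ ≤ κₛ t * Λ
    ctl-cost {σ} {t} V l = stepCost≤κ {P = Control} {X = X} {σ = σ} 1≤Λ size≤ input≤ (View.small V) t l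
    infixr 5 _⊞_
    _⊞_ : ∀ {a b m n} → a ≤ m * Λ → b ≤ n * Λ → a + b ≤ (m + n) * Λ
    _⊞_ {m = m} {n} p q = ≤-trans (+-mono-≤ p q) (≡⇒≤ⁿ (sym (*-distribʳ-+ Λ m n)))
    lit≤ : ∀ n → n ≤ n * Λ
    lit≤ n = ≤*ʳ 1≤Λ
    actDead : ∀ s R → Det X (act s ∷ R , σ′) (((1 + κ (cell 1)) + 1) * Λ) (R , σ′)
    actDead s R = Det-weaken X (_⊞_ {m = 1 + κ (cell 1)} {1} (ctl-cost {σ′} {branch (cell 1) skip skip} (Sim.view I′) _) (lit≤ 1)) (body s)
      where
      cost′ = stepCost X (branch (cell 1) skip skip) σ′
      body : ∀ s → Det X (act s ∷ R , σ′) (cost′ + 1) (R , σ′)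
      body skip           = Det-step X {act skip} refl (Det-step X {skip} refl (Det-refl X))
      body (store a i e)  = Det-step X {act (store a i e)} refl (Det-step X {skip} refl (Det-refl X))
      body (random a i e) = Det-step X {act (random a i e)} refl (Det-step X {skip} refl (Det-refl X))
      body (p ⨾ q)        = Det-step X {act (p ⨾ q)} refl (Det-step X {skip} refl (Det-refl X))
      body (branch e p q) = Det-step X {act (branch e p q)} refl (Det-step X {skip} refl (Det-refl X))
      body (while e p)    = Det-weaken X (+-monoʳ-≤ cost′ z≤n) (Det-step X {act (while e p)} refl (Det-refl X))
    opened : ∀ s R → Det X (pre s ∷ act s ∷ R , σ) (((1 + κ guard) + (3 + ((1 + κ (cell 1)) + 1))) * Λ) (R , σ′)
    opened s R = Det-weaken X (_⊞_ {m = 1 + κ guard} {3 + ((1 + κ (cell 1)) + 1)} (ctl-cost {σ} {branch guard skip skip} view _)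
        (_⊞_ {m = 3} {(1 + κ (cell 1)) + 1} (lit≤ 3) ≤-refl))
      (Det-step X {pre s} (next-false X σ guard guard-false) (Det-step X {store 1 (lit 0) (lit 0)} refl (actDead s R)))
    go : ∀ {s Ks Qs} → Items N (s ∷ Ks) Qs → ∃[ Qs′ ] ∃[ σ′ ] Related Ks τ clk Qs′ σ′ × Det X (Qs ++ K , σ) (dead * Λ) (Qs′ ++ K , σ′)
    go {s} (tr {Qs = Qs} _ items) = Qs , σ′ , (items , I′) , Det-weaken X (≤-trans (+-monoˡ-≤ _ 1≤Λ) unfold) (Det-step X {T⟦ s ⟧} refl (opened s (Qs ++ K)))
    go {s} (on {Qs = Qs} _ items) = Qs , σ′ , (items , I′) , Det-weaken X (≤-trans (m≤n+m _ Λ) unfold) (opened s (Qs ++ K))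

  upper : (n₀ : ℕ) (Ψ : ℕ → List Program → Memory → ℕ → ℚ) →
    (∀ n Ks τ clk → 0ℚ ≤ℚ Ψ n Ks τ clk) →
    (∀ n s Ks τ clk → clk ≤ limit → clk + stepCost X′ s τ ≤ overrun →
       fromℕ (N * (Λ * stepCost X′ s τ)) +ℚ mean (next X′ s Ks τ) (λ (Ks′ , τ′) → Ψ n Ks′ τ′ (clk + stepCost X′ s τ)) ≤ℚ Ψ (suc n) (s ∷ Ks) τ clk) →
    (∀ n s Ks τ clk → limit < clk → fromℕ (dead * Λ) +ℚ Ψ n Ks τ clk ≤ℚ Ψ n (s ∷ Ks) τ clk) →
    (∀ n τ clk σ → n ≤ n₀ → Sim σ τ clk → costWithin X n (K , σ) ≤ℚ Ψ n [] τ clk) →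
    ∀ n → n ≤ n₀ → ∀ {Ks τ clk Qs σ} → Related Ks τ clk Qs σ → costWithin X n (Qs ++ K , σ) ≤ℚ Ψ n Ks τ clk
  upper n₀ Ψ nonneg liveΨ deadΨ finΨ = go
    where
    go : ∀ n → n ≤ n₀ → ∀ {Ks τ clk Qs σ} → Related Ks τ clk Qs σ → costWithin X n (Qs ++ K , σ) ≤ℚ Ψ n Ks τ clk
    go n le {[]} {τ} {clk} {.[]} {σ} ([] , I) = finΨ n τ clk σ le I
    go n le {s ∷ Ks} {τ} {clk} {Qs} {σ} (it , I) with clk ℕ.≤? limit
    go n le {s ∷ Ks} {τ} {clk} {Qs} {σ} (it , I) | no over =
      let (Qs′ , σ′ , R , A) = deadStep it I (≰⇒> over) in
      ℚ.≤-trans (Det.cost A n) (ℚ.≤-trans (ℚ.+-monoʳ-≤ (fromℕ (dead * Λ)) (go n le R)) (deadΨ n s Ks τ clk (≰⇒> over)))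
    go zero le {s ∷ Ks} {τ} {clk} (it , I) | yes _ = nonneg zero (s ∷ Ks) τ clk
    go (suc n) le {s ∷ Ks} {τ} {clk} {Qs} {σ} (it , I) | yes live =
      ℚ.≤-trans (LiveStep.cost (liveStep it I live) n (λ (Ks′ , τ′) → Ψ n Ks′ τ′ (clk + stepCost X′ s τ)) (go n (≤-trans (n≤1+n n) le)))
                (liveΨ n s Ks τ clk live (Live.new I s (head-fits it) live))
      where
      head-fits : ∀ {s Ks Qs} → Items N (s ∷ Ks) Qs → κₛ s ≤ C
      head-fits {s} (tr (_ , f) _) = AllSub-head s f
      head-fits {s} (on (_ , f) _) = AllSub-head s f

  lower : ∀ {φ} → NonNeg φ → (ψ : Memory → ℕ → ℚ) (d : ℚ) →
    (∀ τ clk σ → Sim σ τ clk → clk ≤ limit → Reaches X φ (K , σ) (ψ τ clk)) →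
    (∀ τ clk σ → Sim σ τ clk → limit < clk → Reaches X φ (K , σ) d) →
    ∀ n {Ks τ clk Qs σ} → Related Ks τ clk Qs σ → Reaches X φ (Qs ++ K , σ) (clocked X′ limit ψ d n clk (Ks , τ))
  lower {φ} φ≥0 ψ d alive over = go
    where
    doomed : ∀ {Ks τ clk Qs σ} → limit < clk → Related Ks τ clk Qs σ → Reaches X φ (Qs ++ K , σ) d
    doomed {[]} {τ} {clk} {.[]} {σ} l ([] , I) = over τ clk σ I l
    doomed {s ∷ Ks} l (it , I) =
      let (Qs′ , σ′ , R , A) = deadStep it I l in Reaches-det X φ≥0 A (doomed l R)
    go : ∀ n {Ks τ clk Qs σ} → Related Ks τ clk Qs σ → Reaches X φ (Qs ++ K , σ) (clocked X′ limit ψ d n clk (Ks , τ))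
    go n {[]} {τ} {clk} {.[]} {σ} ([] , I) with clk ℕ.≤? limit
    ... | yes live = alive τ clk σ I live
    ... | no l     = over τ clk σ I (≰⇒> l)
    go n {s ∷ Ks} {τ} {clk} {Qs} {σ} R@(it , I) with clk ℕ.≤? limit
    go n       {s ∷ Ks} R        | no l = doomed (≰⇒> l) R
    go zero    {s ∷ Ks} {τ} {clk} {Qs} {σ} R | yes _ = 0 , halt-nonNeg X 0 φ≥0 (Qs ++ K , σ)
    go (suc n) {s ∷ Ks} {τ} {clk} (it , I) | yes live =
      LiveStep.reach (liveStep it I live) φ≥0 (clocked X′ limit ψ d n (clk + stepCost X′ s τ)) (go n)

-- Outcomes of a run: final memory and accumulated cost

outcome : Input → ℕ → ℕ → Config → (Memory × ℕ → ℚ) → ℚ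
outcome X n       clk ([] , τ)     f = f (τ , clk)
outcome X zero    clk (s ∷ Ks , τ) f = 0ℚ
outcome X (suc n) clk (s ∷ Ks , τ) f = mean (next X s Ks τ) (λ c → outcome X n (clk + stepCost X s τ) c f)

FinSum-outcome : ∀ X n clk c → FinSum (outcome X n clk c)
FinSum-outcome X zero    clk ([] , τ)     = FinSum-point (τ , clk)
FinSum-outcome X (suc n) clk ([] , τ)     = FinSum-point (τ , clk)
FinSum-outcome X zero    clk (s ∷ Ks , τ) = FinSum-zero
FinSum-outcome X (suc n) clk (s ∷ Ks , τ) = FinSum-bind (FinSum-mean (next X s Ks τ)) (FinSum-outcome X n (clk + stepCost X s τ))

outcome-halt : ∀ X n clk c (φ : Memory → ℚ) → outcome X n clk c (φ ∘ proj₁) ≡ halt X n φ c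
outcome-halt X zero    clk ([] , τ)     φ = refl
outcome-halt X (suc n) clk ([] , τ)     φ = refl
outcome-halt X zero    clk (s ∷ Ks , τ) φ = refl
outcome-halt X (suc n) clk (s ∷ Ks , τ) φ = mean-cong (next X s Ks τ) (λ c → outcome-halt X n (clk + stepCost X s τ) c φ)

range-nonZero : ∀ n → NonZero (length (range n))
range-nonZero zero    = _
range-nonZero (suc n) = _

next-nonZero : ∀ X s K σ → NonZero (length (next X s K σ))
next-nonZero X skip           K σ = _
next-nonZero X (store a i e)  K σ = _
next-nonZero X (random a i e) K σ = subst NonZero (sym (List.length-map _ (range (eval X σ e)))) (range-nonZero (eval X σ e))
next-nonZero X (p ⨾ q)        K σ = _
next-nonZero X (branch e p q) K σ with eval X σ e
... | zero  = _
... | suc _ = _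
next-nonZero X (while e p)    K σ with eval X σ e
... | zero  = _
... | suc _ = _

next-const : ∀ X s K σ c → mean (next X s K σ) (λ _ → c) ≡ c
next-const X s K σ c = mean-const (next X s K σ) {{next-nonZero X s K σ}} c

outcome-after : ∀ X (f : Memory × ℕ → ℚ) {m v} → 0ℚ ≤ℚ v → (∀ τ t → m < t → f (τ , t) ≤ℚ v) →
  ∀ n clk c → m < clk → outcome X n clk c f ≤ℚ v
outcome-after X f 0≤v h zero    clk ([] , τ)     p = h τ clk p
outcome-after X f 0≤v h (suc n) clk ([] , τ)     p = h τ clk p
outcome-after X f 0≤v h zero    clk (s ∷ Ks , τ) p = 0≤v
outcome-after X f 0≤v h (suc n) clk (s ∷ Ks , τ) p = ℚ.≤-trans
  (mean-mono (next X s Ks τ) (λ c → outcome-after X f 0≤v h n (clk + stepCost X s τ) c (≤-trans p (m≤m+n clk _))))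
  (≡⇒≤ (next-const X s Ks τ _))

outcome≤clocked : ∀ X limit ψ d (f : Memory × ℕ → ℚ) → 0ℚ ≤ℚ d → (∀ τ t → t ≤ limit → f (τ , t) ≤ℚ ψ τ t) → (∀ τ t → limit < t → f (τ , t) ≤ℚ d) →
  ∀ n clk c → outcome X n clk c f ≤ℚ clocked X limit ψ d n clk c
outcome≤clocked X limit ψ d f 0≤d below above = go
  where
  go : ∀ n clk c → outcome X n clk c f ≤ℚ clocked X limit ψ d n clk c
  go zero clk ([] , τ) with clk ℕ.≤? limit
  ... | yes p = below τ clk p
  ... | no p  = above τ clk (≰⇒> p)
  go (suc n) clk ([] , τ) with clk ℕ.≤? limit
  ... | yes p = below τ clk p
  ... | no p  = above τ clk (≰⇒> p)
  go zero clk (s ∷ Ks , τ) with clk ℕ.≤? limit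
  ... | yes p = ℚ.≤-refl
  ... | no p  = 0≤d
  go (suc n) clk (s ∷ Ks , τ) with clk ℕ.≤? limit
  ... | yes p = mean-mono (next X s Ks τ) (go n (clk + stepCost X s τ))
  ... | no p  = outcome-after X f 0≤d above (suc n) clk (s ∷ Ks , τ) (≰⇒> p)

-- Given enough steps the limit is always reached, so that a clocked run
-- earns at least d, and the rest if it succeeds in time.
clocked-terminates : ∀ X limit (s : Memory → ℚ) d → NonNeg s → d ≤ℚ 1ℚ → ∀ n′ n clk c → limit < n + clk →
  d +ℚ (1ℚ -ℚ d) *ℚ outcome X n′ clk c (λ (τ , t) → s τ *ℚ indicator (t ℕ.≤? limit)) ≤ℚ clocked X limit (λ τ _ → d +ℚ (1ℚ -ℚ d) *ℚ s τ) d n clk c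
clocked-terminates X limit s d 0≤s d≤1 = go
  where
  f : Memory × ℕ → ℚ
  f (τ , t) = s τ *ℚ indicator (t ℕ.≤? limit)
  f≥0 : NonNeg f
  f≥0 (τ , t) = 0≤* (0≤s τ) (0≤indicator (t ℕ.≤? limit))
  f≤0 : ∀ τ t → limit < t → f (τ , t) ≤ℚ 0ℚ
  f≤0 τ t p = ≡⇒≤ (trans (cong (s τ *ℚ_) (indicator-false (t ℕ.≤? limit) (ℕ.<⇒≱ p))) (ℚ.*-zeroʳ (s τ)))
  d+0 : ∀ {x} → x ≤ℚ 0ℚ → d +ℚ (1ℚ -ℚ d) *ℚ x ≤ℚ d
  d+0 {x} p = ℚ.≤-trans (ℚ.+-monoʳ-≤ d (*-monoˡ (diff≥0 d≤1) p)) (≡⇒≤ (trans (cong (d +ℚ_) (ℚ.*-zeroʳ (1ℚ -ℚ d))) (ℚ.+-identityʳ d)))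
  d≤ : ∀ {x} → 0ℚ ≤ℚ x → d ≤ℚ d +ℚ (1ℚ -ℚ d) *ℚ x
  d≤ p = ≤+ʳ (0≤* (diff≥0 d≤1) p)
  G : Config → ℕ → ℕ → ℚ
  G c n′ clk = d +ℚ (1ℚ -ℚ d) *ℚ outcome X n′ clk c f
  mean-G : ∀ s′ Ks τ n′ clk → mean (next X s′ Ks τ) (λ c → G c n′ clk) ≡ d +ℚ (1ℚ -ℚ d) *ℚ mean (next X s′ Ks τ) (λ c → outcome X n′ clk c f)
  mean-G s′ Ks τ n′ clk = trans (Φ-+ (FinSum-mean (next X s′ Ks τ)) (λ _ → d) _)
    (cong₂ _+ℚ_ (next-const X s′ Ks τ d) (Φ-*ˡ (FinSum-mean (next X s′ Ks τ)) (1ℚ -ℚ d) _))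
  halted : ∀ n′ n clk τ → G ([] , τ) n′ clk ≤ℚ clocked X limit (λ τ _ → d +ℚ (1ℚ -ℚ d) *ℚ s τ) d n clk ([] , τ)
  halted n′ n clk τ with clk ℕ.≤? limit
  ... | yes p = ≡⇒≤ (cong (λ z → d +ℚ (1ℚ -ℚ d) *ℚ z) (trans (out n′) (trans (cong (s τ *ℚ_) (indicator-true (clk ℕ.≤? limit) p)) (ℚ.*-identityʳ (s τ)))))
    where
    out : ∀ n′ → outcome X n′ clk ([] , τ) f ≡ f (τ , clk)
    out zero    = refl
    out (suc _) = refl
  ... | no p  = d+0 (outcome-after X f ℚ.≤-refl f≤0 n′ clk ([] , τ) (≰⇒> p))
  go : ∀ n′ n clk c → limit < n + clk → G c n′ clk ≤ℚ clocked X limit (λ τ _ → d +ℚ (1ℚ -ℚ d) *ℚ s τ) d n clk c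
  go n′ n clk ([] , τ) p = halted n′ n clk τ
  go n′ n clk (s′ ∷ Ks , τ) p with clk ℕ.≤? limit
  go n′ n clk (s′ ∷ Ks , τ) p | no q = d+0 (outcome-after X f ℚ.≤-refl f≤0 n′ clk (s′ ∷ Ks , τ) (≰⇒> q))
  go n′ zero clk (s′ ∷ Ks , τ) p | yes q = contradiction q (ℕ.<⇒≱ p)
  go zero (suc n) clk (s′ ∷ Ks , τ) p | yes q = begin
    G (s′ ∷ Ks , τ) zero clk ≤⟨ d+0 ℚ.≤-refl ⟩
    d ≡⟨ sym (next-const X s′ Ks τ d) ⟩
    mean (next X s′ Ks τ) (λ _ → d) ≤⟨ mean-mono (next X s′ Ks τ) (λ c → ℚ.≤-trans (d≤ (Φ-nonNeg (FinSum-outcome X zero (clk + stepCost X s′ τ) c) f≥0)) (go zero n (clk + stepCost X s′ τ) c (further n clk p))) ⟩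
    mean (next X s′ Ks τ) (clocked X limit _ d n (clk + stepCost X s′ τ)) ∎
    where
    open ℚ.≤-Reasoning
    further : ∀ n clk → limit < suc n + clk → limit < n + (clk + stepCost X s′ τ)
    further n clk p = ≤-trans p (≤-trans (≡⇒≤ⁿ (sym (+-suc n clk))) (+-monoʳ-≤ n (≤-trans (≡⇒≤ⁿ (+-comm 1 clk)) (+-monoʳ-≤ clk (1≤stepCost X s′ τ)))))
  go (suc n′) (suc n) clk (s′ ∷ Ks , τ) p | yes q = begin
    G (s′ ∷ Ks , τ) (suc n′) clk ≡⟨ sym (mean-G s′ Ks τ n′ (clk + stepCost X s′ τ)) ⟩
    mean (next X s′ Ks τ) (λ c → G c n′ (clk + stepCost X s′ τ)) ≤⟨ mean-mono (next X s′ Ks τ) (λ c → go n′ n (clk + stepCost X s′ τ) c (further n clk p)) ⟩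
    mean (next X s′ Ks τ) (clocked X limit _ d n (clk + stepCost X s′ τ)) ∎
    where
    open ℚ.≤-Reasoning
    further : ∀ n clk → limit < suc n + clk → limit < n + (clk + stepCost X s′ τ)
    further n clk p = ≤-trans p (≤-trans (≡⇒≤ⁿ (sym (+-suc n clk))) (+-monoʳ-≤ n (≤-trans (≡⇒≤ⁿ (+-comm 1 clk)) (+-monoʳ-≤ clk (1≤stepCost X s′ τ)))))

-- Two independent runs succeed with the second one no slower than the first
-- at least half of the time they both succeed.
no-slower : {A : Set} {Φ : (A → ℚ) → ℚ} → FinSum Φ → (s : A → ℚ) (t : A → ℕ) → NonNeg s →
  ½ *ℚ (Φ s *ℚ Φ s) ≤ℚ Φ (λ a → s a *ℚ Φ (λ b → s b *ℚ indicator (t b ℕ.≤? t a)))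
no-slower {A} {Φ} S s t 0≤s = begin
  ½ *ℚ (Φ s *ℚ Φ s) ≤⟨ *-monoˡ (ℚ.nonNegative⁻¹ ½) total ⟩
  ½ *ℚ (D +ℚ D) ≡⟨ half D ⟩
  D ∎
  where
  open ℚ.≤-Reasoning
  half : ∀ x → ½ *ℚ (x +ℚ x) ≡ x
  half x = trans (ℚ.*-distribˡ-+ ½ x x) (trans (sym (ℚ.*-distribʳ-+ x ½ ½)) (ℚ.*-identityˡ x))
  I : ℕ → ℕ → ℚ
  I x y = indicator (x ℕ.≤? y)
  D = Φ (λ a → s a *ℚ Φ (λ b → s b *ℚ I (t b) (t a)))
  D-sym : D ≡ Φ (λ a → s a *ℚ Φ (λ b → s b *ℚ I (t a) (t b)))
  D-sym = trans (Φ-cong S (λ a → sym (Φ-*ˡ S (s a) _)))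
    (trans (FinSum-swap S S _) (Φ-cong S (λ b → trans (Φ-cong S (λ a → solve 3 (λ x y z → x :* (y :* z) := y :* (x :* z)) refl (s a) (s b) (I (t b) (t a)))) (Φ-*ˡ S (s b) _))))
  one≤ : ∀ x y → 1ℚ ≤ℚ I y x +ℚ I x y
  one≤ x y with ℕ.≤-total x y
  ... | inj₁ p = ℚ.≤-trans (≡⇒≤ (sym (indicator-true (x ℕ.≤? y) p))) (≤+ˡ (0≤indicator (y ℕ.≤? x)))
  ... | inj₂ p = ℚ.≤-trans (≡⇒≤ (sym (indicator-true (y ℕ.≤? x) p))) (≤+ʳ (0≤indicator (x ℕ.≤? y)))
  total : Φ s *ℚ Φ s ≤ℚ D +ℚ D
  total = begin
    Φ s *ℚ Φ s ≡⟨ sym (Φ-*ʳ S (Φ s) s) ⟩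
    Φ (λ a → s a *ℚ Φ s) ≤⟨ Φ-mono S (λ a → *-monoˡ (0≤s a) (Φ-mono S (λ b → ℚ.≤-trans (≡⇒≤ (sym (ℚ.*-identityʳ (s b)))) (*-monoˡ (0≤s b) (one≤ (t a) (t b)))))) ⟩
    Φ (λ a → s a *ℚ Φ (λ b → s b *ℚ (I (t b) (t a) +ℚ I (t a) (t b)))) ≡⟨ Φ-cong S (λ a → trans (cong (s a *ℚ_) (trans (Φ-cong S (λ b → ℚ.*-distribˡ-+ (s b) (I (t b) (t a)) (I (t a) (t b)))) (Φ-+ S _ _))) (ℚ.*-distribˡ-+ (s a) _ _)) ⟩
    Φ (λ a → s a *ℚ Φ (λ b → s b *ℚ I (t b) (t a)) +ℚ s a *ℚ Φ (λ b → s b *ℚ I (t a) (t b))) ≡⟨ Φ-+ S _ _ ⟩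
    D +ℚ Φ (λ a → s a *ℚ Φ (λ b → s b *ℚ I (t a) (t b))) ≡⟨ cong (D +ℚ_) (sym D-sym) ⟩
    D +ℚ D ∎

-- A quadratic lower bound for 1 - Π (1 - fᵢ) in terms of z = Σ fᵢ.
module Quadratic (ℓ : ℚ) (0≤ℓ : 0ℚ ≤ℚ ℓ) (ℓ≤½ : ℓ ≤ℚ ½) where
  open ℚ.≤-Reasoning

  h h⁺ : ℚ → ℚ
  h z = ℓ *ℚ z -ℚ (ℓ *ℚ ℓ) *ℚ (z *ℚ z)
  h⁺ z = 0ℚ ℚ.⊔ h z

  h⁺≥0 : ∀ z → 0ℚ ≤ℚ h⁺ z
  h⁺≥0 z = ℚ.p≤p⊔q 0ℚ (h z)

  h≤h⁺ : ∀ z → h z ≤ℚ h⁺ z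
  h≤h⁺ z = ℚ.p≤q⊔p 0ℚ (h z)

  ¼ = ½ *ℚ ½

  h≤1 : ∀ z → h z ≤ℚ 1ℚ
  h≤1 z = ≤-from-diff {d = (ℓ *ℚ z -ℚ ½) *ℚ (ℓ *ℚ z -ℚ ½) +ℚ (1ℚ -ℚ ¼)} (0≤+ (0≤square (ℓ *ℚ z -ℚ ½)) (ℚ.nonNegative⁻¹ (1ℚ -ℚ ¼)))
    (solve 2 (λ l z → con 1ℚ := (l :* z :- (l :* l) :* (z :* z)) :+ ((l :* z :- con ½) :* (l :* z :- con ½) :+ con (1ℚ -ℚ ¼))) refl ℓ z)

  h⁺≤1 : ∀ z → h⁺ z ≤ℚ 1ℚ
  h⁺≤1 z = ℚ.⊔-lub 0≤1 (h≤1 z)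

  h⁺-zero : h⁺ 0ℚ ≡ 0ℚ
  h⁺-zero = trans (cong (0ℚ ℚ.⊔_) (solve 1 (λ l → l :* con 0ℚ :- (l :* l) :* con 0ℚ := con 0ℚ) refl ℓ)) refl

  h-step : ∀ {f z} → 0ℚ ≤ℚ f → 0ℚ ≤ℚ z → h (z +ℚ f) ≤ℚ f +ℚ (1ℚ -ℚ f) *ℚ h z
  h-step {f} {z} 0≤f 0≤z = ≤-from-diff {d = f *ℚ d} (0≤* 0≤f 0≤d)
    (solve 3 (λ l f z → f :+ (con 1ℚ :- f) :* (l :* z :- (l :* l) :* (z :* z)) :=
       (l :* (z :+ f) :- (l :* l) :* ((z :+ f) :* (z :+ f))) :+
       f :* ((l :* z :- con ½) :* (l :* z :- con ½) :+ (con ½ :- l :+ con ¼) :+ (l :* l :* z :+ l :* l :* z) :+ l :* l :* f)) refl ℓ f z)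
    where
    d = (ℓ *ℚ z -ℚ ½) *ℚ (ℓ *ℚ z -ℚ ½) +ℚ (½ -ℚ ℓ +ℚ ¼) +ℚ (ℓ *ℚ ℓ *ℚ z +ℚ ℓ *ℚ ℓ *ℚ z) +ℚ ℓ *ℚ ℓ *ℚ f
    0≤llz = 0≤* (0≤* 0≤ℓ 0≤ℓ) 0≤z
    0≤d : 0ℚ ≤ℚ d
    0≤d = 0≤+ (0≤+ (0≤+ (0≤square (ℓ *ℚ z -ℚ ½)) (0≤+ (diff≥0 ℓ≤½) (ℚ.nonNegative⁻¹ ¼))) (0≤+ 0≤llz 0≤llz)) (0≤* (0≤* 0≤ℓ 0≤ℓ) 0≤f)

  h⁺-step : ∀ {f z} → 0ℚ ≤ℚ f → f ≤ℚ 1ℚ → 0ℚ ≤ℚ z → h⁺ (z +ℚ f) ≤ℚ h⁺ z +ℚ (1ℚ -ℚ h⁺ z) *ℚ f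
  h⁺-step {f} {z} 0≤f f≤1 0≤z = ℚ.≤-trans (ℚ.⊔-lub
      (0≤+ 0≤f (0≤* (diff≥0 f≤1) (h⁺≥0 z)))
      (ℚ.≤-trans (h-step 0≤f 0≤z) (ℚ.+-monoʳ-≤ f (*-monoˡ (diff≥0 f≤1) (h≤h⁺ z)))))
    (≡⇒≤ (solve 2 (λ f y → f :+ (con 1ℚ :- f) :* y := y :+ (con 1ℚ :- y) :* f) refl f (h⁺ z)))

outcome≤1 : ∀ X n clk c → outcome X n clk c (λ _ → 1ℚ) ≤ℚ 1ℚ
outcome≤1 X zero    clk ([] , τ)     = ℚ.≤-refl
outcome≤1 X (suc n) clk ([] , τ)     = ℚ.≤-refl
outcome≤1 X zero    clk (s ∷ Ks , τ) = 0≤1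
outcome≤1 X (suc n) clk (s ∷ Ks , τ) = ℚ.≤-trans (mean-mono (next X s Ks τ) (outcome≤1 X n (clk + stepCost X s τ))) (mean-const-≤ (next X s Ks τ) 0≤1)

-- Enumerations

record Enum {A : Set} (xs : List A) : Set where
  field
    _≟_  : (x y : A) → Dec (x ≡ y)
    once : ∀ c → ∑ xs (λ x → indicator (x ≟ c)) ≡ 1ℚ

  ∑-pick : ∀ c (f : A → ℚ) → ∑ xs (λ x → indicator (x ≟ c) *ℚ f x) ≡ f c
  ∑-pick c f = begin
    ∑ xs (λ x → indicator (x ≟ c) *ℚ f x) ≡⟨ ∑-cong xs same ⟩
    ∑ xs (λ x → indicator (x ≟ c) *ℚ f c) ≡⟨ ∑-*ʳ xs (f c) _ ⟩
    ∑ xs (λ x → indicator (x ≟ c)) *ℚ f c ≡⟨ cong (_*ℚ f c) (once c) ⟩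
    1ℚ *ℚ f c ≡⟨ ℚ.*-identityˡ (f c) ⟩
    f c ∎
    where
    open ≡-Reasoning
    same : ∀ x → indicator (x ≟ c) *ℚ f x ≡ indicator (x ≟ c) *ℚ f c
    same x with x ≟ c
    ... | yes refl = refl
    ... | no _     = trans (ℚ.*-zeroˡ (f x)) (sym (ℚ.*-zeroˡ (f c)))

  term≤∑ : ∀ c {f : A → ℚ} → NonNeg f → f c ≤ℚ ∑ xs f
  term≤∑ c {f} p = ℚ.≤-trans (≡⇒≤ (sym (∑-pick c f)))
    (∑-mono xs (λ x → ℚ.≤-trans (*-monoʳ (p x) (indicator≤1 (x ≟ c))) (≡⇒≤ (ℚ.*-identityˡ (f x)))))

  ∑-bijection : (φ ψ : A → A) → (∀ x → ψ (φ x) ≡ x) → (∀ x → φ (ψ x) ≡ x) → ∀ f → ∑ xs (f ∘ φ) ≡ ∑ xs f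
  ∑-bijection φ ψ ψφ φψ f = begin
    ∑ xs (f ∘ φ) ≡⟨ ∑-cong xs (λ x → sym (∑-pick (φ x) f)) ⟩
    ∑ xs (λ x → ∑ xs (λ y → indicator (y ≟ φ x) *ℚ f y)) ≡⟨ ∑-swap xs xs _ ⟩
    ∑ xs (λ y → ∑ xs (λ x → indicator (y ≟ φ x) *ℚ f y)) ≡⟨ ∑-cong xs (λ y → ∑-*ʳ xs (f y) _) ⟩
    ∑ xs (λ y → ∑ xs (λ x → indicator (y ≟ φ x)) *ℚ f y) ≡⟨ ∑-cong xs (λ y → cong (_*ℚ f y) (trans (∑-cong xs (λ x → flip x y)) (once (ψ y)))) ⟩
    ∑ xs (λ y → 1ℚ *ℚ f y) ≡⟨ ∑-cong xs (λ y → ℚ.*-identityˡ (f y)) ⟩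
    ∑ xs f ∎
    where
    open ≡-Reasoning
    flip : ∀ x y → indicator (y ≟ φ x) ≡ indicator (x ≟ ψ y)
    flip x y = indicator-cong (y ≟ φ x) (x ≟ ψ y) (λ { refl → sym (ψφ x) }) (λ { refl → sym (φψ y) })

Enum-allFin : ∀ n → Enum (allFin n)
Enum-allFin n = record { _≟_ = Fin._≟_ ; once = go n }
  where
  open ≡-Reasoning
  tail : ∀ n (f : Fin (suc n) → ℚ) → ∑ (List.tabulate {n = n} suc) f ≡ ∑ (allFin n) (f ∘ suc)
  tail n f = trans (cong (λ xs → ∑ xs f) (sym (List.map-tabulate id suc))) (∑-map suc (allFin n) f)
  go : ∀ n c → ∑ (allFin n) (λ x → indicator (x Fin.≟ c)) ≡ 1ℚ
  go (suc n) zero = begin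
    1ℚ +ℚ ∑ (List.tabulate {n = n} suc) (λ x → indicator (x Fin.≟ zero)) ≡⟨ cong (1ℚ +ℚ_) (tail n _) ⟩
    1ℚ +ℚ ∑ (allFin n) (λ x → 0ℚ) ≡⟨ cong (1ℚ +ℚ_) (∑-zero (allFin n)) ⟩
    1ℚ +ℚ 0ℚ ≡⟨ ℚ.+-identityʳ 1ℚ ⟩
    1ℚ ∎
  go (suc n) (suc c) = begin
    0ℚ +ℚ ∑ (List.tabulate {n = n} suc) (λ x → indicator (x Fin.≟ suc c)) ≡⟨ ℚ.+-identityˡ _ ⟩
    ∑ (List.tabulate {n = n} suc) (λ x → indicator (x Fin.≟ suc c)) ≡⟨ tail n _ ⟩
    ∑ (allFin n) (λ x → indicator (suc x Fin.≟ suc c)) ≡⟨ ∑-cong (allFin n) (λ x → indicator-cong (suc x Fin.≟ suc c) (x Fin.≟ c) Fin.suc-injective (cong suc)) ⟩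
    ∑ (allFin n) (λ x → indicator (x Fin.≟ c)) ≡⟨ go n c ⟩
    1ℚ ∎

Enum-allVecs : {A : Set} {xs : List A} → Enum xs → ∀ n → Enum (allVecs xs n)
Enum-allVecs {A} {xs} E n = record { _≟_ = Vec.≡-dec (Enum._≟_ E) ; once = go n }
  where
  open Enum E
  open ≡-Reasoning
  go : ∀ n (c : Vec A n) → ∑ (allVecs xs n) (λ x → indicator (Vec.≡-dec _≟_ x c)) ≡ 1ℚ
  go zero    []      = ℚ.+-identityʳ 1ℚ
  go (suc n) (c ∷ v) = begin
    ∑ (allVecs xs (suc n)) (λ x → indicator (Vec.≡-dec _≟_ x (c ∷ v))) ≡⟨ ∑-cartesian _∷_ xs (allVecs xs n) _ ⟩
    ∑ xs (λ x → ∑ (allVecs xs n) (λ w → indicator (Vec.≡-dec _≟_ (x ∷ w) (c ∷ v)))) ≡⟨ ∑-cong xs (λ x → trans (∑-cong (allVecs xs n) (λ w → split x w)) (∑-*ˡ (allVecs xs n) (indicator (x ≟ c)) _)) ⟩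
    ∑ xs (λ x → indicator (x ≟ c) *ℚ ∑ (allVecs xs n) (λ w → indicator (Vec.≡-dec _≟_ w v))) ≡⟨ ∑-cong xs (λ x → trans (cong (indicator (x ≟ c) *ℚ_) (go n v)) (ℚ.*-identityʳ _)) ⟩
    ∑ xs (λ x → indicator (x ≟ c)) ≡⟨ once c ⟩
    1ℚ ∎
    where
    split : ∀ x w → indicator (Vec.≡-dec _≟_ (x ∷ w) (c ∷ v)) ≡ indicator (x ≟ c) *ℚ indicator (Vec.≡-dec _≟_ w v)
    split x w = trans (indicator-cong (Vec.≡-dec _≟_ (x ∷ w) (c ∷ v)) ((x ≟ c) ×-dec (Vec.≡-dec _≟_ w v)) (λ e → Vec.∷-injective e) (λ (p , q) → cong₂ _∷_ p q)) (indicator-× (x ≟ c) (Vec.≡-dec _≟_ w v))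

bools : List Bool
bools = false ∷ true ∷ []

Enum-bools : Enum bools
Enum-bools = record { _≟_ = Bool._≟_ ; once = λ { false → refl ; true → refl } }

Enum-sides : Enum (inside ∷ outside ∷ [])
Enum-sides = record { _≟_ = Bool._≟_ ; once = λ { false → refl ; true → refl } }

mean-resample : {A : Set} (xs : List A) .{{_ : NonZero (length xs)}} → ∀ {n} (i : Fin n) (f : Vec A n → ℚ) →
  mean (allVecs xs n) f ≡ mean (allVecs xs n) (λ v → mean xs (λ x → f (v Vec.[ i ]≔ x)))
mean-resample xs {suc n} zero f = begin
  mean (allVecs xs (suc n)) f ≡⟨ mean-cartesian _∷_ xs (allVecs xs n) f ⟩
  mean xs (λ x → mean (allVecs xs n) (λ v → f (x ∷ v))) ≡⟨ FinSum-swap (FinSum-mean xs) (FinSum-mean (allVecs xs n)) (λ x v → f (x ∷ v)) ⟩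
  mean (allVecs xs n) (λ v → mean xs (λ x → f (x ∷ v))) ≡⟨ sym (mean-const xs _) ⟩
  mean xs (λ _ → mean (allVecs xs n) (λ v → mean xs (λ x → f (x ∷ v)))) ≡⟨ sym (mean-cartesian _∷_ xs (allVecs xs n) _) ⟩
  mean (allVecs xs (suc n)) (λ v → mean xs (λ x → f (v Vec.[ zero ]≔ x))) ∎
  where open ≡-Reasoning
mean-resample xs {suc n} (suc i) f = begin
  mean (allVecs xs (suc n)) f ≡⟨ mean-cartesian _∷_ xs (allVecs xs n) f ⟩
  mean xs (λ x → mean (allVecs xs n) (λ v → f (x ∷ v))) ≡⟨ mean-cong xs (λ x → mean-resample xs i (λ v → f (x ∷ v))) ⟩
  mean xs (λ x → mean (allVecs xs n) (λ v → mean xs (λ y → f (x ∷ (v Vec.[ i ]≔ y))))) ≡⟨ sym (mean-cartesian _∷_ xs (allVecs xs n) _) ⟩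
  mean (allVecs xs (suc n)) (λ v → mean xs (λ y → f (v Vec.[ suc i ]≔ y))) ∎
  where open ≡-Reasoning

-- Tuples of indices

length-allFin : ∀ n → length (allFin n) ≡ n
length-allFin n = List.length-tabulate id

fromℕ-^ : ∀ m n → fromℕ (m ^ suc n) ≡ fromℕ m *ℚ fromℕ (m ^ n)
fromℕ-^ m n = fromℕ-* m (m ^ n)

tuples : (r j : ℕ) → List (Vec (Fin r) j)
tuples r = allVecs (allFin r)

module _ {r : ℕ} where
  In : ∀ {j} → Fin r → Vec (Fin r) j → Set
  In i []      = ⊥
  In i (x ∷ w) = i ≡ x ⊎ In i w

  In? : ∀ {j} i (w : Vec (Fin r) j) → Dec (In i w)
  In? i []      = no (λ ())
  In? i (x ∷ w) with i Fin.≟ x | In? i w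
  ... | yes p | _     = yes (inj₁ p)
  ... | no _  | yes q = yes (inj₂ q)
  ... | no p  | no q  = no [ p , q ]′

  Distinct : ∀ {j} → Vec (Fin r) j → Set
  Distinct []      = ⊤
  Distinct (x ∷ w) = ¬ In x w × Distinct w

  Distinct? : ∀ {j} (w : Vec (Fin r) j) → Dec (Distinct w)
  Distinct? []      = yes tt
  Distinct? (x ∷ w) = ¬? (In? x w) ×-dec Distinct? w

  Within : ∀ {i j} → Vec (Fin r) i → Vec (Fin r) j → Set
  Within []      w = ⊤
  Within (x ∷ v) w = In x w × Within v w

  Within? : ∀ {i j} (v : Vec (Fin r) i) (w : Vec (Fin r) j) → Dec (Within v w)
  Within? []      w = yes tt
  Within? (x ∷ v) w = In? x w ×-dec Within? v w

  ∑-In≤ : ∀ {j} (w : Vec (Fin r) j) → ∑ (allFin r) (λ i → indicator (In? i w)) ≤ℚ fromℕ j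
  ∑-In≤ []                = ≡⇒≤ (∑-zero (allFin r))
  ∑-In≤ {suc j} (x ∷ w) = begin
    ∑ (allFin r) (λ i → indicator (In? i (x ∷ w))) ≤⟨ ∑-mono (allFin r) split ⟩
    ∑ (allFin r) (λ i → indicator (i Fin.≟ x) +ℚ indicator (In? i w)) ≡⟨ ∑-+ (allFin r) _ _ ⟩
    ∑ (allFin r) (λ i → indicator (i Fin.≟ x)) +ℚ ∑ (allFin r) (λ i → indicator (In? i w)) ≤⟨ ℚ.+-mono-≤ (≡⇒≤ (Enum.once (Enum-allFin r) x)) (∑-In≤ w) ⟩
    1ℚ +ℚ fromℕ j ≡⟨ sym (fromℕ-+ 1 j) ⟩
    fromℕ (suc j) ∎
    where
    open ℚ.≤-Reasoning
    split : ∀ i → indicator (In? i (x ∷ w)) ≤ℚ indicator (i Fin.≟ x) +ℚ indicator (In? i w)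
    split i with i Fin.≟ x | In? i w
    ... | yes _ | yes _ = ≤+ʳ 0≤1
    ... | yes _ | no _  = ≤+ʳ ℚ.≤-refl
    ... | no _  | yes _ = ≤+ˡ ℚ.≤-refl
    ... | no _  | no _  = ℚ.≤-refl

  ∑-all≤ : {P : Fin r → Set} (P? : ∀ i → Dec (P i)) (m : ℕ) → ∑ (allFin r) (λ i → indicator (P? i)) ≤ℚ fromℕ m →
    {Q : ∀ {j} → Vec (Fin r) j → Set} (Q? : ∀ {j} (w : Vec (Fin r) j) → Dec (Q w)) → (∀ {j i} {w : Vec (Fin r) j} → Q (i ∷ w) → P i × Q w) →
    ∀ j → ∑ (tuples r j) (λ w → indicator (Q? w)) ≤ℚ fromℕ (m ^ j)
  ∑-all≤ P? m h Q? dest zero    = ℚ.≤-trans (≡⇒≤ (ℚ.+-identityʳ _)) (indicator≤1 (Q? []))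
  ∑-all≤ P? m h {Q} Q? dest (suc j) = begin
    ∑ (tuples r (suc j)) (λ w → indicator (Q? w)) ≡⟨ ∑-cartesian _∷_ (allFin r) (tuples r j) _ ⟩
    ∑ (allFin r) (λ i → ∑ (tuples r j) (λ w → indicator (Q? (i ∷ w)))) ≤⟨ ∑-mono (allFin r) (λ i → ℚ.≤-trans (∑-mono (tuples r j) (λ w → ℚ.≤-trans (indicator-mono (Q? (i ∷ w)) (P? i ×-dec Q? w) dest) (≡⇒≤ (indicator-× (P? i) (Q? w))))) (≡⇒≤ (∑-*ˡ (tuples r j) (indicator (P? i)) _))) ⟩
    ∑ (allFin r) (λ i → indicator (P? i) *ℚ ∑ (tuples r j) (λ w → indicator (Q? w))) ≡⟨ ∑-*ʳ (allFin r) _ _ ⟩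
    ∑ (allFin r) (λ i → indicator (P? i)) *ℚ ∑ (tuples r j) (λ w → indicator (Q? w)) ≤⟨ *-mono (∑-nonNeg (allFin r) (λ i → 0≤indicator (P? i))) (0≤fromℕ (m ^ j)) h (∑-all≤ P? m h {Q} Q? dest j) ⟩
    fromℕ m *ℚ fromℕ (m ^ j) ≡⟨ sym (fromℕ-^ m j) ⟩
    fromℕ (m ^ suc j) ∎
    where open ℚ.≤-Reasoning

  ∑-Within≤ : ∀ {i} (w : Vec (Fin r) i) j → ∑ (tuples r j) (λ v → indicator (Within? v w)) ≤ℚ fromℕ (i ^ j)
  ∑-Within≤ {i} w j = ∑-all≤ (λ x → In? x w) i (∑-In≤ w) {λ v → Within v w} (λ v → Within? v w) id j

  ∑-notIn≥ : ∀ {j} (w : Vec (Fin r) j) m → m + j ≤ r → fromℕ m ≤ℚ ∑ (allFin r) (λ i → indicator (¬? (In? i w)))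
  ∑-notIn≥ {j} w m p = ≤-from-diff {d = (fromℕ j -ℚ I) +ℚ fromℕ (r ∸ (m + j))} (0≤+ (diff≥0 (∑-In≤ w)) (0≤fromℕ (r ∸ (m + j)))) (begin
    O ≡⟨ solve 2 (λ o i → o := (i :+ o) :- i) refl O I ⟩
    (I +ℚ O) -ℚ I ≡⟨ cong (_-ℚ I) total ⟩
    fromℕ r -ℚ I ≡⟨ cong (_-ℚ I) (trans (cong fromℕ (sym (ℕ.m+[n∸m]≡n p))) (trans (fromℕ-+ (m + j) (r ∸ (m + j))) (cong (_+ℚ fromℕ (r ∸ (m + j))) (fromℕ-+ m j)))) ⟩
    (fromℕ m +ℚ fromℕ j +ℚ fromℕ (r ∸ (m + j))) -ℚ I ≡⟨ solve 4 (λ a b c d → (a :+ b :+ c) :- d := a :+ ((b :- d) :+ c)) refl (fromℕ m) (fromℕ j) (fromℕ (r ∸ (m + j))) I ⟩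
    fromℕ m +ℚ ((fromℕ j -ℚ I) +ℚ fromℕ (r ∸ (m + j))) ∎)
    where
    open ≡-Reasoning
    I = ∑ (allFin r) (λ i → indicator (In? i w))
    O = ∑ (allFin r) (λ i → indicator (¬? (In? i w)))
    comp : ∀ i → indicator (In? i w) +ℚ indicator (¬? (In? i w)) ≡ 1ℚ
    comp i with In? i w
    ... | yes _ = refl
    ... | no _  = refl
    total : I +ℚ O ≡ fromℕ r
    total = trans (sym (∑-+ (allFin r) _ _)) (trans (∑-cong (allFin r) comp) (trans (∑-const (allFin r) 1ℚ) (trans (ℚ.*-identityʳ (fromℕ (length (allFin r)))) (cong fromℕ (length-allFin r)))))

  ∑-Distinct≥ : ∀ {j} (v : Vec (Fin r) j) m u → m + (u + j) ≤ r → Distinct v → fromℕ (m ^ u) ≤ℚ ∑ (tuples r u) (λ w → indicator (Distinct? (w Vec.++ v)))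
  ∑-Distinct≥ v m zero    p D = ≡⇒≤ (sym (trans (ℚ.+-identityʳ _) (indicator-true (Distinct? v) D)))
  ∑-Distinct≥ {j} v m (suc u) p D = begin
    fromℕ (m ^ suc u) ≡⟨ fromℕ-^ m u ⟩
    fromℕ m *ℚ fromℕ (m ^ u) ≤⟨ *-monoˡ (0≤fromℕ m) (∑-Distinct≥ v m u (≤-trans (+-monoʳ-≤ m (n≤1+n (u + j))) p) D) ⟩
    fromℕ m *ℚ ∑ (tuples r u) (λ w → indicator (Distinct? (w Vec.++ v))) ≡⟨ sym (∑-*ˡ (tuples r u) (fromℕ m) _) ⟩
    ∑ (tuples r u) (λ w → fromℕ m *ℚ indicator (Distinct? (w Vec.++ v))) ≤⟨ ∑-mono (tuples r u) (λ w → ℚ.≤-trans (*-monoʳ (0≤indicator (Distinct? (w Vec.++ v))) (∑-notIn≥ (w Vec.++ v) m (≤-trans (+-monoʳ-≤ m (n≤1+n (u + j))) p))) (≡⇒≤ (sym (∑-*ʳ (allFin r) _ _)))) ⟩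
    ∑ (tuples r u) (λ w → ∑ (allFin r) (λ i → indicator (¬? (In? i (w Vec.++ v))) *ℚ indicator (Distinct? (w Vec.++ v)))) ≡⟨ ∑-swap (tuples r u) (allFin r) _ ⟩
    ∑ (allFin r) (λ i → ∑ (tuples r u) (λ w → indicator (¬? (In? i (w Vec.++ v))) *ℚ indicator (Distinct? (w Vec.++ v)))) ≡⟨ ∑-cong (allFin r) (λ i → ∑-cong (tuples r u) (λ w → sym (indicator-× (¬? (In? i (w Vec.++ v))) (Distinct? (w Vec.++ v))))) ⟩
    ∑ (allFin r) (λ i → ∑ (tuples r u) (λ w → indicator (Distinct? ((i ∷ w) Vec.++ v)))) ≡⟨ sym (∑-cartesian _∷_ (allFin r) (tuples r u) _) ⟩
    ∑ (tuples r (suc u)) (λ w → indicator (Distinct? (w Vec.++ v))) ∎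
    where open ℚ.≤-Reasoning

∑-const-tuples : ∀ r j c → ∑ (tuples r j) (λ _ → c) ≡ fromℕ (r ^ j) *ℚ c
∑-const-tuples r j c = trans (∑-const (tuples r j) c) (cong (λ n → fromℕ n *ℚ c) (trans (length-allVecs (allFin r) j) (cong (_^ j) (length-allFin r))))

-- Counting solutions over a finite abelian group

record Abelian (G : FiniteGroup) : Set where
  open FiniteGroup G
  field
    ∙-assoc  : ∀ x y z → (x ∙ y) ∙ z ≡ x ∙ (y ∙ z)
    ∙-comm   : ∀ x y → x ∙ y ≡ y ∙ x
    ε-idˡ    : ∀ x → ε ∙ x ≡ x
    ⁻¹-invˡ  : ∀ x → (x ⁻¹) ∙ x ≡ ε
    all-once : ∀ c → ∑ elements (λ x → indicator (x ≟ c)) ≡ 1ℚ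

  ε-idʳ : ∀ x → x ∙ ε ≡ x
  ε-idʳ x = trans (∙-comm x ε) (ε-idˡ x)

  ⁻¹-invʳ : ∀ x → x ∙ (x ⁻¹) ≡ ε
  ⁻¹-invʳ x = trans (∙-comm x (x ⁻¹)) (⁻¹-invˡ x)

  ∙-swap : ∀ x y z → x ∙ (y ∙ z) ≡ y ∙ (x ∙ z)
  ∙-swap x y z = trans (sym (∙-assoc x y z)) (trans (cong (_∙ z) (∙-comm x y)) (∙-assoc y x z))

  cancel : ∀ x y → (x ∙ y) ∙ (y ⁻¹) ≡ x
  cancel x y = trans (∙-assoc x y (y ⁻¹)) (trans (cong (x ∙_) (⁻¹-invʳ y)) (ε-idʳ x))

  ⁻¹-unique : ∀ x y → x ∙ y ≡ ε → x ≡ y ⁻¹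
  ⁻¹-unique x y p = trans (sym (cancel x y)) (trans (cong (_∙ (y ⁻¹)) p) (ε-idˡ (y ⁻¹)))

  enum : Enum elements
  enum = record { _≟_ = _≟_ ; once = all-once }

  order : ℕ
  order = length elements

  order≢0 : NonZero order
  order≢0 = nonEmpty elements refl
    where
    nonEmpty : ∀ xs → elements ≡ xs → NonZero (length xs)
    nonEmpty []       e = contradiction (trans (cong (λ ys → ∑ ys (λ x → indicator (x ≟ ε))) (sym e)) (all-once ε)) (λ ())
    nonEmpty (_ ∷ _)  e = _

module Counting (G : FiniteGroup) (A : Abelian G) (r : ℕ) where
  open FiniteGroup G
  open Abelian A

  q⁻¹ : ℚ
  q⁻¹ = inv order

  0≤q⁻¹ : 0ℚ ≤ℚ q⁻¹
  0≤q⁻¹ = 0≤inv order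

  Xs : List (Vec Carrier r)
  Xs = allVecs elements r

  Bs : List (Vec Bool r)
  Bs = allVecs bools r

  𝔼-swap : ∀ {A : Set} (ys : List A) (f : Vec Carrier r → A → ℚ) → mean Xs (λ X → ∑ ys (f X)) ≡ ∑ ys (λ y → mean Xs (λ X → f X y))
  𝔼-swap ys = FinSum-swap (FinSum-mean Xs) (FinSum-∑ ys)

  𝔼-const : ∀ c → mean Xs (λ _ → c) ≡ c
  𝔼-const = mean-const Xs {{allVecs-nonZero elements {{order≢0}} r}}

  sumT : ∀ {j} → Vec (Fin r) j → Vec Carrier r → Carrier
  sumT []      X = ε
  sumT (i ∷ w) X = lookup X i ∙ sumT w X

  sumT-++ : ∀ {i j} (u : Vec (Fin r) i) (v : Vec (Fin r) j) X → sumT (u Vec.++ v) X ≡ sumT u X ∙ sumT v X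
  sumT-++ []      v X = sym (ε-idˡ _)
  sumT-++ (i ∷ u) v X = trans (cong (lookup X i ∙_) (sumT-++ u v X)) (sym (∙-assoc _ _ _))

  sumT-∉ : ∀ {j} {i} (w : Vec (Fin r) j) → ¬ In i w → ∀ X x → sumT w (X Vec.[ i ]≔ x) ≡ sumT w X
  sumT-∉ []      n X x = refl
  sumT-∉ (l ∷ w) n X x = cong₂ _∙_ (Vec.lookup∘update′ (λ e → n (inj₁ (sym e))) X x) (sumT-∉ w (n ∘ inj₂) X x)

  sumT-∈ : ∀ {j} {i} (w : Vec (Fin r) j) → In i w → Distinct w → ∀ X → ∃[ c ] (∀ x → sumT w (X Vec.[ i ]≔ x) ≡ x ∙ c)
  sumT-∈ {i = i} (l ∷ w) (inj₁ refl) (n , D) X = sumT w X , λ x → cong₂ _∙_ (Vec.lookup∘update i X x) (sumT-∉ w n X x)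
  sumT-∈ {i = i} (l ∷ w) (inj₂ p)    (n , D) X =
    let (c , h) = sumT-∈ w p D X in
    lookup X l ∙ c , λ x → trans (cong₂ _∙_ (Vec.lookup∘update′ (λ { refl → n p }) X x) (h x)) (∙-swap _ x c)

  hits : ∀ {j} → Vec (Fin r) j → Vec Carrier r → ℚ
  hits w X = indicator (sumT w X ≟ ε)

  0≤hits : ∀ {j} (w : Vec (Fin r) j) → NonNeg (hits w)
  0≤hits w X = 0≤indicator (sumT w X ≟ ε)

  mean-hit : ∀ c → mean elements (λ x → indicator ((x ∙ c) ≟ ε)) ≡ q⁻¹
  mean-hit c = trans (mean-∑ elements _) (trans (cong (q⁻¹ *ℚ_) (trans (∑-cong elements (λ x → indicator-cong ((x ∙ c) ≟ ε) (x ≟ (c ⁻¹)) (⁻¹-unique x c) (λ { refl → ⁻¹-invˡ c }))) (all-once (c ⁻¹)))) (ℚ.*-identityʳ q⁻¹))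

  -- A tuple of distinct indices sums to zero independently of anything that
  -- does not depend on one of its coordinates.
  hits-independent : ∀ {j i} (w : Vec (Fin r) j) → In i w → Distinct w → (F : Vec Carrier r → ℚ) → (∀ X x → F (X Vec.[ i ]≔ x) ≡ F X) →
    mean Xs (λ X → hits w X *ℚ F X) ≡ q⁻¹ *ℚ mean Xs F
  hits-independent {i = i} w p D F h = begin
    mean Xs (λ X → hits w X *ℚ F X) ≡⟨ mean-resample elements {{order≢0}} i _ ⟩
    mean Xs (λ X → mean elements (λ x → hits w (X Vec.[ i ]≔ x) *ℚ F (X Vec.[ i ]≔ x))) ≡⟨ mean-cong Xs (λ X → trans (mean-cong elements (λ x → cong (hits w (X Vec.[ i ]≔ x) *ℚ_) (h X x))) (Φ-*ʳ (FinSum-mean elements) (F X) _)) ⟩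
    mean Xs (λ X → mean elements (λ x → hits w (X Vec.[ i ]≔ x)) *ℚ F X) ≡⟨ mean-cong Xs (λ X → cong (_*ℚ F X) (let (c , e) = sumT-∈ w p D X in trans (mean-cong elements (λ x → cong (λ y → indicator (y ≟ ε)) (e x))) (mean-hit c))) ⟩
    mean Xs (λ X → q⁻¹ *ℚ F X) ≡⟨ Φ-*ˡ (FinSum-mean Xs) q⁻¹ F ⟩
    q⁻¹ *ℚ mean Xs F ∎
    where open ≡-Reasoning

  𝔼-hits : ∀ {j} (w : Vec (Fin r) (suc j)) → Distinct w → mean Xs (hits w) ≡ q⁻¹
  𝔼-hits w@(i ∷ _) D = trans (mean-cong Xs (λ X → sym (ℚ.*-identityʳ (hits w X)))) (trans (hits-independent w (inj₁ refl) D (λ _ → 1ℚ) (λ _ _ → refl)) (trans (cong (q⁻¹ *ℚ_) (𝔼-const 1ℚ)) (ℚ.*-identityʳ q⁻¹)))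

  𝔼-hits² : ∀ {j i l} (w : Vec (Fin r) (suc j)) (w′ : Vec (Fin r) i) → Distinct w → Distinct w′ → In l w′ → ¬ In l w → mean Xs (λ X → hits w′ X *ℚ hits w X) ≡ q⁻¹ *ℚ q⁻¹
  𝔼-hits² w w′ D D′ p n = trans (hits-independent w′ p D′ (hits w) (λ X x → cong (λ y → indicator (y ≟ ε)) (sumT-∉ w n X x))) (cong (q⁻¹ *ℚ_) (𝔼-hits w D))

  Sol : ∀ {j} → Vec (Fin r) j → Vec Carrier r → Set
  Sol w X = Distinct w × sumT w X ≡ ε

  Sol? : ∀ {j} (w : Vec (Fin r) j) X → Dec (Sol w X)
  Sol? w X = Distinct? w ×-dec (sumT w X ≟ ε)

  sol : ∀ {j} → Vec (Fin r) j → Vec Carrier r → ℚ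
  sol w X = indicator (Sol? w X)

  0≤sol : ∀ {j} (w : Vec (Fin r) j) X → 0ℚ ≤ℚ sol w X
  0≤sol w X = 0≤indicator (Sol? w X)

  sol≡ : ∀ {j} (w : Vec (Fin r) j) X → sol w X ≡ indicator (Distinct? w) *ℚ hits w X
  sol≡ w X = indicator-× (Distinct? w) (sumT w X ≟ ε)

  N : ℕ → Vec Carrier r → ℚ
  N j X = ∑ (tuples r j) (λ w → sol w X)

  0≤N : ∀ j X → 0ℚ ≤ℚ N j X
  0≤N j X = ∑-nonNeg (tuples r j) (λ w → 0≤sol w X)

  -- Pairs of solutions using different sets of elements.
  pair : ∀ {j} → Vec (Fin r) j → Vec (Fin r) j → Vec Carrier r → ℚ
  pair w w′ X = sol w X *ℚ (sol w′ X *ℚ indicator (¬? (Within? w′ w)))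

  P : ℕ → Vec Carrier r → ℚ
  P j X = ∑ (tuples r j) (λ w → ∑ (tuples r j) (λ w′ → pair w w′ X))

  0≤P : ∀ j X → 0ℚ ≤ℚ P j X
  0≤P j X = ∑-nonNeg (tuples r j) (λ w → ∑-nonNeg (tuples r j) (λ w′ → 0≤* (0≤sol w X) (0≤* (0≤sol w′ X) (0≤indicator (¬? (Within? w′ w))))))

  𝔼-N : ∀ j → mean Xs (N (suc j)) ≡ ∑ (tuples r (suc j)) (λ w → indicator (Distinct? w)) *ℚ q⁻¹
  𝔼-N j = trans (𝔼-swap (tuples r (suc j)) (λ X w → sol w X)) (trans (∑-cong (tuples r (suc j)) term) (∑-*ʳ (tuples r (suc j)) q⁻¹ (λ w → indicator (Distinct? w))))
    where
    term : ∀ w → mean Xs (sol w) ≡ indicator (Distinct? w) *ℚ q⁻¹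
    term w = [ good , bad ]′ (toSum (Distinct? w))
      where
      good : Distinct w → mean Xs (sol w) ≡ indicator (Distinct? w) *ℚ q⁻¹
      good D = trans (mean-cong Xs (λ X → trans (sol≡ w X) (trans (cong (_*ℚ hits w X) (indicator-true (Distinct? w) D)) (ℚ.*-identityˡ (hits w X)))))
        (trans (𝔼-hits w D) (sym (trans (cong (_*ℚ q⁻¹) (indicator-true (Distinct? w) D)) (ℚ.*-identityˡ q⁻¹))))
      bad : ¬ Distinct w → mean Xs (sol w) ≡ indicator (Distinct? w) *ℚ q⁻¹
      bad n = trans (mean-cong Xs (λ X → indicator-false (Sol? w X) (n ∘ proj₁)))
        (trans (𝔼-const 0ℚ) (sym (trans (cong (_*ℚ q⁻¹) (indicator-false (Distinct? w) n)) (ℚ.*-zeroˡ q⁻¹))))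

  𝔼-N≤ : ∀ j → mean Xs (N (suc j)) ≤ℚ fromℕ (r ^ suc j) *ℚ q⁻¹
  𝔼-N≤ j = ℚ.≤-trans (≡⇒≤ (𝔼-N j)) (*-monoʳ {q⁻¹} {∑ (tuples r (suc j)) (λ w → indicator (Distinct? w))} {fromℕ (r ^ suc j)} 0≤q⁻¹ (ℚ.≤-trans (∑-mono (tuples r (suc j)) (λ w → indicator≤1 (Distinct? w))) (≡⇒≤ (trans (∑-const-tuples r (suc j) 1ℚ) (ℚ.*-identityʳ (fromℕ (r ^ suc j)))))))

  outsider : ∀ {i j} (w′ : Vec (Fin r) i) (w : Vec (Fin r) j) → ¬ Within w′ w → ∃[ l ] In l w′ × ¬ In l w
  outsider []       w n = contradiction tt n
  outsider (x ∷ w′) w n with In? x w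
  ... | no p  = x , inj₁ refl , p
  ... | yes p = let (l , q , m) = outsider w′ w (λ s → n (p , s)) in l , inj₂ q , m

  𝔼-pair : ∀ {j} (w w′ : Vec (Fin r) (suc j)) → mean Xs (pair w w′) ≤ℚ q⁻¹ *ℚ q⁻¹
  𝔼-pair w w′ = [ first , vanish ]′ (toSum (Distinct? w ×-dec (Distinct? w′ ×-dec ¬? (Within? w′ w))))
    where
    weaken : ∀ {j} (w : Vec (Fin r) j) X → sol w X ≤ℚ hits w X
    weaken w X = indicator-mono (Sol? w X) (sumT w X ≟ ε) proj₂
    pair≡ : ∀ X → pair w w′ X ≡ indicator (Sol? w X ×-dec (Sol? w′ X ×-dec ¬? (Within? w′ w)))
    pair≡ X = sym (trans (indicator-× (Sol? w X) (Sol? w′ X ×-dec ¬? (Within? w′ w))) (cong (sol w X *ℚ_) (indicator-× (Sol? w′ X) (¬? (Within? w′ w)))))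
    first : Distinct w × Distinct w′ × ¬ Within w′ w → mean Xs (pair w w′) ≤ℚ q⁻¹ *ℚ q⁻¹
    first (D , D′ , n) = let (l , p , m) = outsider w′ w n in ℚ.≤-trans
      (mean-mono Xs (λ X → ℚ.≤-trans (*-monoˡ (0≤sol w X) (ℚ.≤-trans (*-monoˡ (0≤sol w′ X) (indicator≤1 (¬? (Within? w′ w)))) (≡⇒≤ (ℚ.*-identityʳ (sol w′ X)))))
        (ℚ.≤-trans (≡⇒≤ (ℚ.*-comm (sol w X) (sol w′ X))) (*-mono (0≤sol w′ X) (0≤hits w X) (weaken w′ X) (weaken w X)))))
      (≡⇒≤ (𝔼-hits² w w′ D D′ p m))
    vanish : ¬ (Distinct w × Distinct w′ × ¬ Within w′ w) → mean Xs (pair w w′) ≤ℚ q⁻¹ *ℚ q⁻¹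
    vanish n = ℚ.≤-trans (≡⇒≤ (trans (mean-cong Xs (λ X → trans (pair≡ X) (indicator-false (Sol? w X ×-dec (Sol? w′ X ×-dec ¬? (Within? w′ w))) (λ (s , s′ , m) → n (proj₁ s , proj₁ s′ , m))))) (𝔼-const 0ℚ))) (0≤* 0≤q⁻¹ 0≤q⁻¹)

  𝔼-P : ∀ j → mean Xs (P (suc j)) ≤ℚ (fromℕ (r ^ suc j) *ℚ q⁻¹) *ℚ (fromℕ (r ^ suc j) *ℚ q⁻¹)
  𝔼-P j = begin
    mean Xs (P (suc j)) ≡⟨ trans (𝔼-swap TT _) (∑-cong TT (λ w → 𝔼-swap TT _)) ⟩
    ∑ TT (λ w → ∑ TT (λ w′ → mean Xs (pair w w′))) ≤⟨ ∑-mono TT (λ w → ∑-mono TT (𝔼-pair w)) ⟩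
    ∑ TT (λ w → ∑ TT (λ w′ → q⁻¹ *ℚ q⁻¹)) ≡⟨ trans (∑-cong TT (λ w → ∑-const-tuples r (suc j) _)) (∑-const-tuples r (suc j) _) ⟩
    fromℕ (r ^ suc j) *ℚ (fromℕ (r ^ suc j) *ℚ (q⁻¹ *ℚ q⁻¹)) ≡⟨ solve 2 (λ a b → a :* (a :* (b :* b)) := (a :* b) :* (a :* b)) refl (fromℕ (r ^ suc j)) q⁻¹ ⟩
    (fromℕ (r ^ suc j) *ℚ q⁻¹) *ℚ (fromℕ (r ^ suc j) *ℚ q⁻¹) ∎
    where
    open ℚ.≤-Reasoning
    TT = tuples r (suc j)

  N² : ∀ j X → N j X *ℚ N j X ≤ℚ fromℕ (j ^ j) *ℚ N j X +ℚ P j X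
  N² j X = begin
    N j X *ℚ N j X ≡⟨ sym (∑-*ʳ TT (N j X) _) ⟩
    ∑ TT (λ w → sol w X *ℚ N j X) ≤⟨ ∑-mono TT (λ w → *-monoˡ (0≤sol w X) (bound w)) ⟩
    ∑ TT (λ w → sol w X *ℚ (fromℕ (j ^ j) +ℚ ∑ TT (λ w′ → sol w′ X *ℚ out w′ w))) ≡⟨ ∑-cong TT (λ w → trans (ℚ.*-distribˡ-+ (sol w X) _ _) (cong₂ _+ℚ_ (ℚ.*-comm (sol w X) (fromℕ (j ^ j))) (sym (∑-*ˡ TT (sol w X) _)))) ⟩
    ∑ TT (λ w → fromℕ (j ^ j) *ℚ sol w X +ℚ ∑ TT (λ w′ → pair w w′ X)) ≡⟨ trans (∑-+ TT _ _) (cong (_+ℚ P j X) (∑-*ˡ TT (fromℕ (j ^ j)) _)) ⟩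
    fromℕ (j ^ j) *ℚ N j X +ℚ P j X ∎
    where
    open ℚ.≤-Reasoning
    TT = tuples r j
    out : Vec (Fin r) j → Vec (Fin r) j → ℚ
    out w′ w = indicator (¬? (Within? w′ w))
    split : ∀ w w′ → sol w′ X ≤ℚ indicator (Within? w′ w) +ℚ sol w′ X *ℚ out w′ w
    split w w′ with Within? w′ w
    ... | yes _ = ℚ.≤-trans (indicator≤1 (Sol? w′ X)) (≤+ʳ (≡⇒≤ (sym (ℚ.*-zeroʳ (sol w′ X)))))
    ... | no _  = ℚ.≤-trans (≡⇒≤ (sym (ℚ.*-identityʳ (sol w′ X)))) (≤+ˡ ℚ.≤-refl)
    bound : ∀ w → N j X ≤ℚ fromℕ (j ^ j) +ℚ ∑ TT (λ w′ → sol w′ X *ℚ out w′ w)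
    bound w = ℚ.≤-trans (∑-mono TT (split w)) (ℚ.≤-trans (≡⇒≤ (∑-+ TT _ _)) (ℚ.+-monoˡ-≤ (∑ TT (λ w′ → sol w′ X *ℚ out w′ w)) (∑-Within≤ w j)))

  -- Hence most instances with a solution have few of them.
  N-few : ∀ j X {s} → 1 ≤ j → 0ℚ ≤ℚ s → s ≤ℚ 1ℚ → N j X *ℚ s ≤ℚ fromℕ (j ^ j) *ℚ s +ℚ P j X
  N-few j X {s} 1≤j 0≤s s≤1 = [ few , many ]′ (ℚ.≤-total (N j X) K)
    where
    open ℚ.≤-Reasoning
    K = fromℕ (j ^ j)
    few : N j X ≤ℚ K → N j X *ℚ s ≤ℚ K *ℚ s +ℚ P j X
    few p = ℚ.≤-trans (*-monoʳ 0≤s p) (≤+ʳ (0≤P j X))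
    many : K ≤ℚ N j X → N j X *ℚ s ≤ℚ K *ℚ s +ℚ P j X
    many p = begin
      N j X *ℚ s ≡⟨ solve 3 (λ n k s → n :* s := k :* s :+ (n :- k) :* s) refl (N j X) K s ⟩
      K *ℚ s +ℚ (N j X -ℚ K) *ℚ s ≤⟨ ℚ.+-monoʳ-≤ (K *ℚ s) (*-mono (diff≥0 p) 0≤1 ℚ.≤-refl s≤1) ⟩
      K *ℚ s +ℚ (N j X -ℚ K) *ℚ 1ℚ ≤⟨ ℚ.+-monoʳ-≤ (K *ℚ s) (*-monoˡ (diff≥0 p) (ℚ.≤-trans (1≤fromℕ (j ^ j) {{m^n≢0 j j {{ℕ.>-nonZero 1≤j}}}}) p)) ⟩
      K *ℚ s +ℚ (N j X -ℚ K) *ℚ N j X ≡⟨ solve 3 (λ n k s → k :* s :+ (n :- k) :* n := k :* s :+ (n :* n :- k :* n)) refl (N j X) K s ⟩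
      K *ℚ s +ℚ (N j X *ℚ N j X -ℚ K *ℚ N j X) ≤⟨ ℚ.+-monoʳ-≤ (K *ℚ s) (ℚ.≤-trans (ℚ.+-monoˡ-≤ (-ℚ (K *ℚ N j X)) (N² j X)) (≡⇒≤ (solve 2 (λ a b → (a :+ b) :- a := b) refl (K *ℚ N j X) (P j X)))) ⟩
      K *ℚ s +ℚ P j X ∎

  order*q⁻¹ : fromℕ order *ℚ q⁻¹ ≡ 1ℚ
  order*q⁻¹ = fromℕ*inv order {{order≢0}}

  mean-pick : ∀ {h : Carrier → ℚ} c → fromℕ order *ℚ mean elements (λ x → indicator (x ≟ c) *ℚ h x) ≡ h c
  mean-pick {h} c = trans (cong (fromℕ order *ℚ_) (mean-∑ elements (λ x → indicator (x ≟ c) *ℚ h x))) (trans (sym (ℚ.*-assoc (fromℕ order) q⁻¹ (∑ elements (λ x → indicator (x ≟ c) *ℚ h x))))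
    (trans (cong₂ _*ℚ_ order*q⁻¹ (Enum.∑-pick enum c h)) (ℚ.*-identityˡ (h c))))

  plantT : ∀ {j} → Vec (Fin r) (suc j) → Vec Carrier r → Vec Carrier r
  plantT (i ∷ w) X = X Vec.[ i ]≔ (sumT w X ⁻¹)

  mean-plantT : ∀ {j} (w : Vec (Fin r) (suc j)) → Distinct w → (f : Vec Carrier r → ℚ) → mean Xs (λ X → f (plantT w X)) ≡ fromℕ order *ℚ mean Xs (λ X → hits w X *ℚ f X)
  mean-plantT (i ∷ w) (n , D) f = sym (begin
    fromℕ order *ℚ mean Xs (λ X → hits (i ∷ w) X *ℚ f X) ≡⟨ cong (fromℕ order *ℚ_) (mean-resample elements {{order≢0}} i (λ X → hits (i ∷ w) X *ℚ f X)) ⟩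
    fromℕ order *ℚ mean Xs (λ X → mean elements (F X)) ≡⟨ sym (Φ-*ˡ (FinSum-mean Xs) (fromℕ order) (λ X → mean elements (F X))) ⟩
    mean Xs (λ X → fromℕ order *ℚ mean elements (F X)) ≡⟨ mean-cong Xs (λ X → trans (cong (fromℕ order *ℚ_) (mean-cong elements {F X} {λ x → indicator (x ≟ (sumT w X ⁻¹)) *ℚ f (X Vec.[ i ]≔ x)} (λ x → cong (_*ℚ f (X Vec.[ i ]≔ x)) (same X x)))) (mean-pick {λ x → f (X Vec.[ i ]≔ x)} (sumT w X ⁻¹))) ⟩
    mean Xs (λ X → f (plantT (i ∷ w) X)) ∎)
    where
    open ≡-Reasoning
    F : Vec Carrier r → Carrier → ℚ
    F X x = hits (i ∷ w) (X Vec.[ i ]≔ x) *ℚ f (X Vec.[ i ]≔ x)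
    same : ∀ X x → hits (i ∷ w) (X Vec.[ i ]≔ x) ≡ indicator (x ≟ (sumT w X ⁻¹))
    same X x = trans (cong (λ y → indicator (y ≟ ε)) (cong₂ _∙_ (Vec.lookup∘update i X x) (sumT-∉ w n X x)))
      (indicator-cong ((x ∙ sumT w X) ≟ ε) (x ≟ (sumT w X ⁻¹)) (⁻¹-unique x (sumT w X)) (λ { refl → ⁻¹-invˡ (sumT w X) }))

  shift : Vec Bool r → Carrier → Vec Carrier r → Vec Carrier r
  shift B s X = Vec.zipWith (λ b x → x ∙ (if b then s else ε)) B X

  lookup-shift : ∀ B s X i → lookup (shift B s X) i ≡ lookup X i ∙ (if lookup B i then s else ε)
  lookup-shift B s X i = Vec.lookup-zipWith _ i B X

  shift-cancel : ∀ {n} (B : Vec Bool n) s s′ → s ∙ s′ ≡ ε → ∀ (X : Vec Carrier n) →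
    Vec.zipWith (λ b x → x ∙ (if b then s′ else ε)) B (Vec.zipWith (λ b x → x ∙ (if b then s else ε)) B X) ≡ X
  shift-cancel []          s s′ e []      = refl
  shift-cancel (true ∷ B)  s s′ e (x ∷ X) = cong₂ _∷_ (trans (∙-assoc x s s′) (trans (cong (x ∙_) e) (ε-idʳ x))) (shift-cancel B s s′ e X)
  shift-cancel (false ∷ B) s s′ e (x ∷ X) = cong₂ _∷_ (trans (ε-idʳ _) (ε-idʳ x)) (shift-cancel B s s′ e X)

  Match : ∀ {j} → Vec (Fin r) j → Vec Bool j → Vec Bool r → Set
  Match []      []       B = ⊤
  Match (i ∷ w) (b ∷ bs) B = lookup B i ≡ b × Match w bs B

  Match? : ∀ {j} (w : Vec (Fin r) j) bs B → Dec (Match w bs B)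
  Match? []      []       B = yes tt
  Match? (i ∷ w) (b ∷ bs) B = (lookup B i Bool.≟ b) ×-dec Match? w bs B

  Match-++ : ∀ {i j} (u : Vec (Fin r) i) (v : Vec (Fin r) j) bs cs B → Match (u Vec.++ v) (bs Vec.++ cs) B → Match u bs B × Match v cs B
  Match-++ []      v []       cs B m       = tt , m
  Match-++ (i ∷ u) v (b ∷ bs) cs B (e , m) = let (m₁ , m₂) = Match-++ u v bs cs B m in (e , m₁) , m₂

  none : ∀ j → Vec Bool j
  none j = Vec.replicate j false

  sumT-unshifted : ∀ {j} (w : Vec (Fin r) j) B s X → Match w (none j) B → sumT w (shift B s X) ≡ sumT w X
  sumT-unshifted []      B s X m       = refl
  sumT-unshifted (i ∷ w) B s X (e , m) = cong₂ _∙_ (trans (lookup-shift B s X i) (trans (cong (λ b → lookup X i ∙ (if b then s else ε)) e) (ε-idʳ _))) (sumT-unshifted w B s X m)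

  sumT-shifted : ∀ {j} (w : Vec (Fin r) (suc j)) B s X → Match w (true ∷ none j) B → sumT w (shift B s X) ≡ s ∙ sumT w X
  sumT-shifted (i ∷ w) B s X (e , m) = trans (cong₂ _∙_ (trans (lookup-shift B s X i) (trans (cong (λ b → lookup X i ∙ (if b then s else ε)) e) (∙-comm _ s))) (sumT-unshifted w B s X m)) (∙-assoc s _ _)

  mean-Match : ∀ {j} (w : Vec (Fin r) j) bs → Distinct w → mean Bs (λ B → indicator (Match? w bs B)) ≡ inv (2 ^ j)
  mean-Match []      []       D       = mean-const Bs {{allVecs-nonZero bools r}} 1ℚ
  mean-Match {suc j} (i ∷ w) (b ∷ bs) (n , D) = begin
    mean Bs (λ B → indicator (Match? (i ∷ w) (b ∷ bs) B)) ≡⟨ mean-resample bools i (λ B → indicator (Match? (i ∷ w) (b ∷ bs) B)) ⟩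
    mean Bs (λ B → mean bools (λ c → indicator (Match? (i ∷ w) (b ∷ bs) (B Vec.[ i ]≔ c)))) ≡⟨ mean-cong Bs (λ B → trans (mean-cong bools (λ c → term B c)) (trans (Φ-*ʳ (FinSum-mean bools) (indicator (Match? w bs B)) (λ c → indicator (c Bool.≟ b))) (cong (_*ℚ indicator (Match? w bs B)) (half b)))) ⟩
    mean Bs (λ B → inv 2 *ℚ indicator (Match? w bs B)) ≡⟨ Φ-*ˡ (FinSum-mean Bs) (inv 2) (λ B → indicator (Match? w bs B)) ⟩
    inv 2 *ℚ mean Bs (λ B → indicator (Match? w bs B)) ≡⟨ cong (inv 2 *ℚ_) (mean-Match w bs D) ⟩
    inv 2 *ℚ inv (2 ^ j) ≡⟨ sym (inv-* 2 (2 ^ j)) ⟩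
    inv (2 ^ suc j) ∎
    where
    open ≡-Reasoning
    half : ∀ b → mean bools (λ c → indicator (c Bool.≟ b)) ≡ inv 2
    half false = refl
    half true  = refl
    Match-∉ : ∀ {j} (w : Vec (Fin r) j) bs B c → ¬ In i w → Match w bs (B Vec.[ i ]≔ c) → Match w bs B
    Match-∉ []      []       B c n m       = tt
    Match-∉ (l ∷ w) (b ∷ bs) B c n (e , m) = trans (sym (Vec.lookup∘update′ (λ e → n (inj₁ (sym e))) B c)) e , Match-∉ w bs B c (n ∘ inj₂) m
    Match-∉′ : ∀ {j} (w : Vec (Fin r) j) bs B c → ¬ In i w → Match w bs B → Match w bs (B Vec.[ i ]≔ c)
    Match-∉′ []      []       B c n m       = tt
    Match-∉′ (l ∷ w) (b ∷ bs) B c n (e , m) = trans (Vec.lookup∘update′ (λ e → n (inj₁ (sym e))) B c) e , Match-∉′ w bs B c (n ∘ inj₂) m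
    term : ∀ B c → indicator (Match? (i ∷ w) (b ∷ bs) (B Vec.[ i ]≔ c)) ≡ indicator (c Bool.≟ b) *ℚ indicator (Match? w bs B)
    term B c = trans (indicator-cong (Match? (i ∷ w) (b ∷ bs) (B Vec.[ i ]≔ c)) ((c Bool.≟ b) ×-dec Match? w bs B)
      (λ (e , m) → trans (sym (Vec.lookup∘update i B c)) e , Match-∉ w bs B c n m)
      (λ (e , m) → trans (Vec.lookup∘update i B c) e , Match-∉′ w bs B c n m))
      (indicator-× (c Bool.≟ b) (Match? w bs B))

  mean-bijection : (φ ψ : Vec Carrier r → Vec Carrier r) → (∀ X → ψ (φ X) ≡ X) → (∀ X → φ (ψ X) ≡ X) → ∀ f → mean Xs (f ∘ φ) ≡ mean Xs f
  mean-bijection φ ψ p q f = trans (mean-∑ Xs _) (trans (cong (inv (length Xs) *ℚ_) (Enum.∑-bijection (Enum-allVecs enum r) φ ψ p q f)) (sym (mean-∑ Xs f)))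

  -- Let J Y be the distribution of the tuple found on the instance Y. The
  -- solutions found on the instances shifted by the sums of u-tuples U, when
  -- completed by U, are at least a constant fraction of those found on
  -- uniform instances, for each of the m^u tuples U: the shift is a bijection
  -- if U avoids B, and it turns the equation of a tuple with one element in B
  -- into that of the tuple completed by U.
  module Completion {k₁ u m : ℕ} (m≤ : m + (u + suc k₁) ≤ r)
    (J : Vec Carrier r → (Vec (Fin r) (suc k₁) → ℚ) → ℚ) (FS : ∀ Y → FinSum (J Y)) where
    bits : Vec Bool (u + suc k₁)
    bits = none u Vec.++ (true ∷ none k₁)

    pat : Vec (Fin r) u → Vec (Fin r) (suc k₁) → Vec Bool r → ℚ
    pat U v B = indicator (Distinct? (U Vec.++ v)) *ℚ indicator (Match? (U Vec.++ v) bits B)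

    completed : Vec (Fin r) u → Vec Bool r → Vec Carrier r → ℚ
    completed U B X = J (shift B (sumT U X) X) (λ v → sol (U Vec.++ v) X)

    one-shift : ∀ U B → mean Xs (λ Y → J Y (λ v → pat U v B *ℚ sol v Y)) ≤ℚ mean Xs (completed U B)
    one-shift U B with Match? U (none u) B
    ... | no n  = ℚ.≤-trans (≡⇒≤ (trans (mean-cong Xs (λ Y → trans (Φ-cong (FS Y) (λ v → trans (cong (_*ℚ sol v Y) (zero-pat v)) (ℚ.*-zeroˡ (sol v Y)))) (Φ-zero (FS Y)))) (𝔼-const 0ℚ)))
        (mean-nonNeg Xs (λ X → Φ-nonNeg (FS (shift B (sumT U X) X)) (λ v → 0≤sol (U Vec.++ v) X)))
      where
      zero-pat : ∀ v → pat U v B ≡ 0ℚ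
      zero-pat v = trans (cong (indicator (Distinct? (U Vec.++ v)) *ℚ_) (indicator-false (Match? (U Vec.++ v) bits B) (λ m → n (proj₁ (Match-++ U v (none u) (true ∷ none k₁) B m))))) (ℚ.*-zeroʳ (indicator (Distinct? (U Vec.++ v))))
    ... | yes M = ℚ.≤-trans (≡⇒≤ (sym (mean-bijection φ ψ ψφ φψ _))) (mean-mono Xs (λ X → Φ-mono (FS (φ X)) (λ v → transfer X v)))
      where
      φ ψ : Vec Carrier r → Vec Carrier r
      φ X = shift B (sumT U X) X
      ψ Y = shift B (sumT U Y ⁻¹) Y
      ψφ : ∀ X → ψ (φ X) ≡ X
      ψφ X = trans (cong (λ s → shift B (s ⁻¹) (φ X)) (sumT-unshifted U B (sumT U X) X M)) (shift-cancel B (sumT U X) (sumT U X ⁻¹) (⁻¹-invʳ _) X)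
      φψ : ∀ Y → φ (ψ Y) ≡ Y
      φψ Y = trans (cong (λ s → shift B s (ψ Y)) (sumT-unshifted U B (sumT U Y ⁻¹) Y M)) (shift-cancel B (sumT U Y ⁻¹) (sumT U Y) (⁻¹-invˡ _) Y)
      transfer : ∀ X v → pat U v B *ℚ sol v (φ X) ≤ℚ sol (U Vec.++ v) X
      transfer X v = ℚ.≤-trans (≡⇒≤ (trans (cong (_*ℚ sol v (φ X)) (sym (indicator-× (Distinct? (U Vec.++ v)) (Match? (U Vec.++ v) bits B)))) (sym (indicator-× (Distinct? (U Vec.++ v) ×-dec Match? (U Vec.++ v) bits B) (Sol? v (φ X))))))
        (indicator-mono ((Distinct? (U Vec.++ v) ×-dec Match? (U Vec.++ v) bits B) ×-dec Sol? v (φ X)) (Sol? (U Vec.++ v) X)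
          (λ ((D , m) , (_ , e)) → D , trans (sumT-++ U v X) (trans (sym (sumT-shifted v B (sumT U X) X (proj₂ (Match-++ U v (none u) _ B m)))) e)))

    c : ℚ
    c = inv (2 ^ (u + suc k₁)) *ℚ fromℕ (m ^ u)

    patterns : ∀ v → Distinct v → c ≤ℚ mean Bs (λ B → ∑ (tuples r u) (λ U → pat U v B))
    patterns v D = begin
      inv (2 ^ (u + suc k₁)) *ℚ fromℕ (m ^ u) ≤⟨ *-monoˡ (0≤inv (2 ^ (u + suc k₁))) (∑-Distinct≥ v m u m≤ D) ⟩
      inv (2 ^ (u + suc k₁)) *ℚ ∑ (tuples r u) (λ U → indicator (Distinct? (U Vec.++ v))) ≡⟨ sym (∑-*ˡ (tuples r u) (inv (2 ^ (u + suc k₁))) _) ⟩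
      ∑ (tuples r u) (λ U → inv (2 ^ (u + suc k₁)) *ℚ indicator (Distinct? (U Vec.++ v))) ≡⟨ ∑-cong (tuples r u) term ⟩
      ∑ (tuples r u) (λ U → mean Bs (pat U v)) ≡⟨ FinSum-swap (FinSum-∑ (tuples r u)) (FinSum-mean Bs) (λ U B → pat U v B) ⟩
      mean Bs (λ B → ∑ (tuples r u) (λ U → pat U v B)) ∎
      where
      open ℚ.≤-Reasoning
      term : ∀ U → inv (2 ^ (u + suc k₁)) *ℚ indicator (Distinct? (U Vec.++ v)) ≡ mean Bs (pat U v)
      term U = [ good , bad ]′ (toSum (Distinct? (U Vec.++ v)))
        where
        i₀ = inv (2 ^ (u + suc k₁))
        d = indicator (Distinct? (U Vec.++ v))
        pulled : mean Bs (pat U v) ≡ d *ℚ mean Bs (λ B → indicator (Match? (U Vec.++ v) bits B))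
        pulled = Φ-*ˡ (FinSum-mean Bs) d _
        good : Distinct (U Vec.++ v) → i₀ *ℚ d ≡ mean Bs (pat U v)
        good D′ = trans (ℚ.*-comm i₀ d) (trans (cong (d *ℚ_) (sym (mean-Match (U Vec.++ v) bits D′))) (sym pulled))
        bad : ¬ Distinct (U Vec.++ v) → i₀ *ℚ d ≡ mean Bs (pat U v)
        bad n = trans (cong (i₀ *ℚ_) d≡0) (trans (ℚ.*-zeroʳ i₀) (sym (trans pulled (trans (cong (_*ℚ mean Bs (λ B → indicator (Match? (U Vec.++ v) bits B))) d≡0) (ℚ.*-zeroˡ (mean Bs (λ B → indicator (Match? (U Vec.++ v) bits B))))))))
          where
          d≡0 : d ≡ 0ℚ
          d≡0 = indicator-false (Distinct? (U Vec.++ v)) n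

    completion : c *ℚ mean Xs (λ Y → J Y (λ v → sol v Y)) ≤ℚ mean Xs (λ X → mean Bs (λ B → ∑ (tuples r u) (λ U → completed U B X)))
    completion = begin
      c *ℚ mean Xs (λ Y → J Y (λ v → sol v Y)) ≡⟨ sym (trans (mean-cong Xs (λ Y → Φ-*ˡ (FS Y) c _)) (Φ-*ˡ (FinSum-mean Xs) c _)) ⟩
      mean Xs (λ Y → J Y (λ v → c *ℚ sol v Y)) ≤⟨ mean-mono Xs (λ Y → Φ-mono (FS Y) (λ v → weigh v Y)) ⟩
      mean Xs (λ Y → J Y (λ v → mean Bs (λ B → ∑ (tuples r u) (λ U → pat U v B *ℚ sol v Y)))) ≡⟨ mean-cong Xs (λ Y → trans (FinSum-swap (FS Y) (FinSum-mean Bs) _) (mean-cong Bs (λ B → FinSum-swap (FS Y) (FinSum-∑ (tuples r u)) _))) ⟩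
      mean Xs (λ Y → mean Bs (λ B → ∑ (tuples r u) (λ U → J Y (λ v → pat U v B *ℚ sol v Y)))) ≡⟨ trans (FinSum-swap (FinSum-mean Xs) (FinSum-mean Bs) _) (mean-cong Bs (λ B → 𝔼-swap (tuples r u) _)) ⟩
      mean Bs (λ B → ∑ (tuples r u) (λ U → mean Xs (λ Y → J Y (λ v → pat U v B *ℚ sol v Y)))) ≤⟨ mean-mono Bs (λ B → ∑-mono (tuples r u) (λ U → one-shift U B)) ⟩
      mean Bs (λ B → ∑ (tuples r u) (λ U → mean Xs (completed U B))) ≡⟨ sym (trans (FinSum-swap (FinSum-mean Xs) (FinSum-mean Bs) _) (mean-cong Bs (λ B → 𝔼-swap (tuples r u) _))) ⟩
      mean Xs (λ X → mean Bs (λ B → ∑ (tuples r u) (λ U → completed U B X))) ∎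
      where
      open ℚ.≤-Reasoning
      weigh : ∀ v Y → c *ℚ sol v Y ≤ℚ mean Bs (λ B → ∑ (tuples r u) (λ U → pat U v B *ℚ sol v Y))
      weigh v Y = ℚ.≤-trans by-case (≡⇒≤ (sym (trans (mean-cong Bs (λ B → ∑-*ʳ (tuples r u) (sol v Y) _)) (Φ-*ʳ (FinSum-mean Bs) (sol v Y) _))))
        where
        by-case : c *ℚ sol v Y ≤ℚ mean Bs (λ B → ∑ (tuples r u) (λ U → pat U v B)) *ℚ sol v Y
        by-case = [ (λ s → *-monoʳ (0≤sol v Y) (patterns v (proj₁ s)))
                  , (λ n → ≡⇒≤ (trans (cong (c *ℚ_) (indicator-false (Sol? v Y) n)) (trans (ℚ.*-zeroʳ c) (sym (trans (cong (mean Bs (λ B → ∑ (tuples r u) (λ U → pat U v B)) *ℚ_) (indicator-false (Sol? v Y) n)) (ℚ.*-zeroʳ (mean Bs (λ B → ∑ (tuples r u) (λ U → pat U v B)))))))))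
                  ]′ (toSum (Sol? v Y))

-- Subsets and tuples

does-true : {P : Set} (d : Dec P) → does d ≡ true → P
does-true (yes p) _ = p

subset-ext : ∀ {n} (S S′ : Subset n) → (∀ i → lookup S i ≡ true → lookup S′ i ≡ true) → (∀ i → lookup S′ i ≡ true → lookup S i ≡ true) → S ≡ S′
subset-ext []      []       f g = refl
subset-ext (b ∷ S) (c ∷ S′) f g = cong₂ _∷_ (heads b c (f zero) (g zero)) (subset-ext S S′ (f ∘ suc) (g ∘ suc))
  where
  heads : ∀ b c → (b ≡ true → c ≡ true) → (c ≡ true → b ≡ true) → b ≡ c
  heads true  c     f g = sym (f refl)
  heads false true  f g = g refl
  heads false false f g = refl

setOf : ∀ {k} r → (Fin k → ℕ) → Subset r
setOf r g = Vec.tabulate λ i → does (Fin.any? (λ j → g j ℕ.≟ toℕ i))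

module _ {r : ℕ} where
  setOf⇒ : ∀ {k} (g : Fin k → ℕ) i → lookup (setOf r g) i ≡ true → ∃[ j ] g j ≡ toℕ i
  setOf⇒ g i e = does-true (Fin.any? (λ j → g j ℕ.≟ toℕ i)) (trans (sym (Vec.lookup∘tabulate _ i)) e)

  setOf⇐ : ∀ {k} (g : Fin k → ℕ) i → ∃[ j ] g j ≡ toℕ i → lookup (setOf r g) i ≡ true
  setOf⇐ g i p = trans (Vec.lookup∘tabulate _ i) (dec-true (Fin.any? (λ j → g j ℕ.≟ toℕ i)) p)

  setOf-zero : ∀ (g : Fin 0 → ℕ) → setOf r g ≡ Vec.replicate r false
  setOf-zero g = subset-ext _ _ (λ i e → case setOf⇒ g i e of λ ()) (λ i e → case trans (sym e) (Vec.lookup-replicate i false) of λ ())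

  setOf-old : ∀ {k} (g : Fin (suc k) → ℕ) → (∀ a → g zero ≡ toℕ a → lookup (setOf r (g ∘ suc)) a ≡ true) → setOf r g ≡ setOf r (g ∘ suc)
  setOf-old g h = subset-ext _ _ to (λ i e → let (j , p) = setOf⇒ (g ∘ suc) i e in setOf⇐ g i (suc j , p))
    where
    to : ∀ i → lookup (setOf r g) i ≡ true → lookup (setOf r (g ∘ suc)) i ≡ true
    to i e with setOf⇒ g i e
    ... | zero  , p = h i p
    ... | suc j , p = setOf⇐ (g ∘ suc) i (j , p)

  setOf-new : ∀ {k} (g : Fin (suc k) → ℕ) a → g zero ≡ toℕ a → setOf r g ≡ setOf r (g ∘ suc) Vec.[ a ]≔ true
  setOf-new g a h = subset-ext _ _ to from
    where
    S = setOf r (g ∘ suc)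
    to : ∀ i → lookup (setOf r g) i ≡ true → lookup (S Vec.[ a ]≔ true) i ≡ true
    to i e with i Fin.≟ a | setOf⇒ g i e
    ... | yes refl | _         = Vec.lookup∘update i S true
    ... | no n     | zero , p  = contradiction (Fin.toℕ-injective (trans (sym p) h)) n
    ... | no n     | suc j , p = trans (Vec.lookup∘update′ n S true) (setOf⇐ (g ∘ suc) i (j , p))
    from : ∀ i → lookup (S Vec.[ a ]≔ true) i ≡ true → lookup (setOf r g) i ≡ true
    from i e with i Fin.≟ a
    ... | yes refl = setOf⇐ g i (zero , h)
    ... | no n     = let (j , p) = setOf⇒ (g ∘ suc) i (trans (sym (Vec.lookup∘update′ n S true)) e) in setOf⇐ g i (suc j , p)

∣∣-insert : ∀ {n} (S : Subset n) i → lookup S i ≡ false → ∣ S Vec.[ i ]≔ true ∣ ≡ suc ∣ S ∣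
∣∣-insert (false ∷ S) zero    e = refl
∣∣-insert (true ∷ S)  (suc i) e = cong suc (∣∣-insert S i e)
∣∣-insert (false ∷ S) (suc i) e = ∣∣-insert S i e

∣∣-none : ∀ n → ∣ Vec.replicate n false ∣ ≡ 0
∣∣-none zero    = refl
∣∣-none (suc n) = ∣∣-none n

∣∣-setOf≤ : ∀ {k} r (g : Fin k → ℕ) → ∣ setOf r g ∣ ≤ k
∣∣-setOf≤ {zero}  r g = ≡⇒≤ⁿ (trans (cong ∣_∣ (setOf-zero {r} g)) (∣∣-none r))
∣∣-setOf≤ {suc k} r g with g zero ℕ.<? r
... | no n  = ≤-trans (≡⇒≤ⁿ (cong ∣_∣ (setOf-old {r} g (λ a e → contradiction (subst (_< r) (sym e) (Fin.toℕ<n a)) n)))) (m≤n⇒m≤1+n (∣∣-setOf≤ r (g ∘ suc)))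
... | yes p with lookup (setOf r (g ∘ suc)) (fromℕ< p) in eq
...   | true  = ≤-trans (≡⇒≤ⁿ (cong ∣_∣ (setOf-old {r} g (λ a e → trans (cong (lookup (setOf r (g ∘ suc))) (Fin.toℕ-injective (trans (sym e) (sym (Fin.toℕ-fromℕ< p))))) eq)))) (m≤n⇒m≤1+n (∣∣-setOf≤ r (g ∘ suc)))
...   | false = ≤-trans (≡⇒≤ⁿ (trans (cong ∣_∣ (setOf-new {r} g (fromℕ< p) (sym (Fin.toℕ-fromℕ< p)))) (∣∣-insert (setOf r (g ∘ suc)) (fromℕ< p) eq))) (s≤s (∣∣-setOf≤ r (g ∘ suc)))

toSet : ∀ {r k} → Vec (Fin r) k → Subset r
toSet {r} w = setOf r (λ j → toℕ (lookup w j))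

In⇒lookup : ∀ {r k} {i : Fin r} (w : Vec (Fin r) k) → In i w → ∃[ j ] lookup w j ≡ i
In⇒lookup (x ∷ w) (inj₁ refl) = zero , refl
In⇒lookup (x ∷ w) (inj₂ p)    = let (j , e) = In⇒lookup w p in suc j , e

lookup⇒In : ∀ {r k} (w : Vec (Fin r) k) j → In (lookup w j) w
lookup⇒In (x ∷ w) zero    = inj₁ refl
lookup⇒In (x ∷ w) (suc j) = inj₂ (lookup⇒In w j)

toSet⇒In : ∀ {r k} (w : Vec (Fin r) k) i → lookup (toSet w) i ≡ true → In i w
toSet⇒In w i e = let (j , p) = setOf⇒ (λ j → toℕ (lookup w j)) i e in subst (λ x → In x w) (Fin.toℕ-injective p) (lookup⇒In w j)

In⇒toSet : ∀ {r k} (w : Vec (Fin r) k) i → In i w → lookup (toSet w) i ≡ true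
In⇒toSet w i p = let (j , e) = In⇒lookup w p in setOf⇐ (λ j → toℕ (lookup w j)) i (j , cong toℕ e)

listing : ∀ {r} (S : Subset r) k → ∣ S ∣ ≡ k → ∃[ w ] Distinct {r} {k} w × toSet w ≡ S
listing {r} S k e = let (w , D , f , g) = go S k e in w , D , subset-ext _ _ (λ i p → f i (toSet⇒In w i p)) (λ i p → In⇒toSet w i (g i p))
  where
  In-suc : ∀ {r k} {i : Fin r} (w : Vec (Fin r) k) → In i w → In (Fin.suc i) (Vec.map suc w)
  In-suc (x ∷ w) (inj₁ refl) = inj₁ refl
  In-suc (x ∷ w) (inj₂ p)    = inj₂ (In-suc w p)
  In-suc⁻ : ∀ {r k} {i : Fin r} (w : Vec (Fin r) k) → In (Fin.suc i) (Vec.map suc w) → In i w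
  In-suc⁻ (x ∷ w) (inj₁ p) = inj₁ (Fin.suc-injective p)
  In-suc⁻ (x ∷ w) (inj₂ p) = inj₂ (In-suc⁻ w p)
  no-zero : ∀ {r k} (w : Vec (Fin r) k) → ¬ In zero (Vec.map suc w)
  no-zero (x ∷ w) (inj₂ p) = no-zero w p
  Distinct-suc : ∀ {r k} (w : Vec (Fin r) k) → Distinct w → Distinct (Vec.map suc w)
  Distinct-suc []      D       = tt
  Distinct-suc (x ∷ w) (n , D) = (λ p → n (In-suc⁻ w p)) , Distinct-suc w D
  go : ∀ {r} (S : Subset r) k → ∣ S ∣ ≡ k → ∃[ w ] Distinct {r} {k} w × (∀ i → In i w → lookup S i ≡ true) × (∀ i → lookup S i ≡ true → In i w)
  go []          zero    e = [] , tt , (λ i ()) , (λ ())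
  go (true ∷ S)  (suc k) e =
    let (w , D , f , g) = go S k (ℕ.suc-injective e) in
    zero ∷ Vec.map suc w , (no-zero w , Distinct-suc w D) ,
    (λ { zero _ → refl ; (suc i) (inj₂ p) → f i (In-suc⁻ w p) }) ,
    (λ { zero _ → inj₁ refl ; (suc i) p → inj₂ (In-suc w (g i p)) })
  go (false ∷ S) k e =
    let (w , D , f , g) = go S k e in
    Vec.map suc w , Distinct-suc w D ,
    (λ { zero p → contradiction p (no-zero w) ; (suc i) p → f i (In-suc⁻ w p) }) ,
    (λ { (suc i) p → In-suc w (g i p) })

^-distribʳ-* : ∀ n a b → (a * b) ^ n ≡ a ^ n * b ^ n
^-distribʳ-* zero    a b = refl
^-distribʳ-* (suc n) a b = trans (cong (a * b *_) (^-distribʳ-* n a b)) (ℕ.[m*n]*[o*p]≡[m*o]*[n*p] a b (a ^ n) (b ^ n))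

half-power : ∀ {k r n} → k + k ≤ r → fromℕ (r ^ n) ≤ℚ fromℕ (2 ^ n) *ℚ fromℕ ((r ∸ k) ^ n)
half-power {k} {r} {n} p = ℚ.≤-trans (fromℕ-mono (≤-trans (ℕ.^-monoˡ-≤ n (≤-trans (≡⇒≤ⁿ (sym (m∸n+n≡m {r} {k} (≤-trans (m≤m+n k k) p)))) (≤-trans (+-monoʳ-≤ (r ∸ k) (ℕ.m+n≤o⇒m≤o∸n k p)) (≡⇒≤ⁿ (cong (λ z → r ∸ k + z) (sym (+-identityʳ (r ∸ k)))))))) (≡⇒≤ⁿ (^-distribʳ-* n 2 (r ∸ k))))) (≡⇒≤ (fromℕ-* (2 ^ n) ((r ∸ k) ^ n)))

inv-anti : ∀ m n → NonZero m → fromℕ m ≤ℚ fromℕ n → inv n ≤ℚ inv m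
inv-anti m zero    m≢0 p = 0≤inv m
inv-anti m (suc n) m≢0 p = begin
  inv (suc n) ≡⟨ sym (trans (cong (inv (suc n) *ℚ_) (fromℕ*inv m {{m≢0}})) (ℚ.*-identityʳ (inv (suc n)))) ⟩
  inv (suc n) *ℚ (fromℕ m *ℚ inv m) ≤⟨ *-monoˡ (0≤inv (suc n)) (*-monoʳ (0≤inv m) p) ⟩
  inv (suc n) *ℚ (fromℕ (suc n) *ℚ inv m) ≡⟨ sym (ℚ.*-assoc (inv (suc n)) (fromℕ (suc n)) (inv m)) ⟩
  inv (suc n) *ℚ fromℕ (suc n) *ℚ inv m ≡⟨ cong (_*ℚ inv m) (inv*fromℕ (suc n)) ⟩
  1ℚ *ℚ inv m ≡⟨ ℚ.*-identityˡ (inv m) ⟩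
  inv m ∎
  where open ℚ.≤-Reasoning

module _ (G : FiniteGroup) (A : Abelian G) where
  open FiniteGroup G
  open Abelian A
  open Counting G A

  sumOver-none : ∀ {r} (X : Vec Carrier r) → sumOver G (Vec.replicate r false) X ≡ ε
  sumOver-none []      = refl
  sumOver-none (x ∷ X) = sumOver-none X

  sumOver-insert : ∀ {r} (S : Subset r) i → lookup S i ≡ false → ∀ X → sumOver G (S Vec.[ i ]≔ true) X ≡ lookup X i ∙ sumOver G S X
  sumOver-insert (false ∷ S) zero    e (x ∷ X) = refl
  sumOver-insert (true ∷ S)  (suc i) e (x ∷ X) = trans (cong (x ∙_) (sumOver-insert S i e X)) (∙-swap x _ _)
  sumOver-insert (false ∷ S) (suc i) e (x ∷ X) = sumOver-insert S i e X

  setOf-Distinct : ∀ {r k} (g : Fin k → ℕ) (w : Vec (Fin r) k) → Distinct w → (∀ j → g j ≡ toℕ (lookup w j)) →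
    ∣ setOf r g ∣ ≡ k × (∀ X → sumOver G (setOf r g) X ≡ sumT r w X)
  setOf-Distinct {r} g []      D       h = trans (cong ∣_∣ (setOf-zero {r} g)) (∣∣-none r) , λ X → trans (cong (λ S → sumOver G S X) (setOf-zero {r} g)) (sumOver-none X)
  setOf-Distinct {r} {suc k} g (a ∷ w) (n , D) h =
    let (c , s) = setOf-Distinct (g ∘ suc) w D (h ∘ suc) ; new = setOf-new {r} g a (h zero) in
    trans (cong ∣_∣ new) (trans (∣∣-insert (setOf r (g ∘ suc)) a fresh) (cong suc c)) ,
    λ X → trans (cong (λ S → sumOver G S X) new) (trans (sumOver-insert (setOf r (g ∘ suc)) a fresh X) (cong (lookup X a ∙_) (s X)))
    where
    fresh : lookup (setOf r (g ∘ suc)) a ≡ false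
    fresh with lookup (setOf r (g ∘ suc)) a in eq
    ... | false = refl
    ... | true  = let (j , p) = setOf⇒ {r} (g ∘ suc) a eq in contradiction (subst (λ x → In x w) (Fin.toℕ-injective (trans (sym (h (suc j))) p)) (lookup⇒In w j)) n

  setOf-full : ∀ {r k} (g : Fin k → ℕ) → ∣ setOf r g ∣ ≡ k → ∃[ w ] Distinct {r} {k} w × (∀ j → g j ≡ toℕ (lookup w j))
  setOf-full {r} {zero}  g e = [] , tt , λ ()
  setOf-full {r} {suc k} g e with g zero ℕ.<? r
  ... | no n  = contradiction (≤-trans (≡⇒≤ⁿ (trans (sym e) (cong ∣_∣ (setOf-old {r} g (λ a e → contradiction (subst (_< r) (sym e) (Fin.toℕ<n a)) n))))) (∣∣-setOf≤ r (g ∘ suc))) (<-irrefl refl)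
  ... | yes p with lookup (setOf r (g ∘ suc)) (fromℕ< p) in eq
  ...   | true  = contradiction (≤-trans (≡⇒≤ⁿ (trans (sym e) (cong ∣_∣ (setOf-old {r} g (λ a e → trans (cong (lookup (setOf r (g ∘ suc))) (Fin.toℕ-injective (trans (sym e) (sym (Fin.toℕ-fromℕ< p))))) eq))))) (∣∣-setOf≤ r (g ∘ suc))) (<-irrefl refl)
  ...   | false =
    let new = setOf-new {r} g (fromℕ< p) (sym (Fin.toℕ-fromℕ< p))
        (w , D , h) = setOf-full (g ∘ suc) (ℕ.suc-injective (trans (sym (∣∣-insert (setOf r (g ∘ suc)) (fromℕ< p) eq)) (trans (sym (cong ∣_∣ new)) e)))
        n = λ q → let (j , l) = In⇒lookup w q in contradiction (trans (sym eq) (setOf⇐ {r} (g ∘ suc) (fromℕ< p) (j , trans (h j) (cong toℕ l)))) (λ ())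
    in fromℕ< p ∷ w , (n , D) , λ { zero → sym (Fin.toℕ-fromℕ< p) ; (suc j) → h j }

  mean-plant : ∀ {r j} (S : Subset r) → ∣ S ∣ ≡ suc j → (f : Vec Carrier r → ℚ) →
    mean (Xs r) (f ∘ plant G S) ≡ fromℕ order *ℚ mean (Xs r) (λ X → indicator (sumOver G S X ≟ ε) *ℚ f X)
  mean-plant {suc r} (false ∷ S) e f = begin
    mean (Xs (suc r)) (f ∘ plant G (false ∷ S)) ≡⟨ mean-cartesian _∷_ elements (Xs r) _ ⟩
    mean elements (λ x → mean (Xs r) (λ X → f (x ∷ plant G S X))) ≡⟨ mean-cong elements (λ x → mean-plant S e (λ X → f (x ∷ X))) ⟩
    mean elements (λ x → fromℕ order *ℚ mean (Xs r) (λ X → indicator (sumOver G S X ≟ ε) *ℚ f (x ∷ X))) ≡⟨ Φ-*ˡ (FinSum-mean elements) (fromℕ order) _ ⟩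
    fromℕ order *ℚ mean elements (λ x → mean (Xs r) (λ X → indicator (sumOver G S X ≟ ε) *ℚ f (x ∷ X))) ≡⟨ cong (fromℕ order *ℚ_) (sym (mean-cartesian _∷_ elements (Xs r) (λ X → indicator (sumOver G (false ∷ S) X ≟ ε) *ℚ f X))) ⟩
    fromℕ order *ℚ mean (Xs (suc r)) (λ X → indicator (sumOver G (false ∷ S) X ≟ ε) *ℚ f X) ∎
    where open ≡-Reasoning
  mean-plant {suc r} (true ∷ S) e f = begin
    mean (Xs (suc r)) (f ∘ plant G (true ∷ S)) ≡⟨ mean-cartesian _∷_ elements (Xs r) _ ⟩
    mean elements (λ x → mean (Xs r) (λ X → f ((sumOver G S X ⁻¹) ∷ X))) ≡⟨ mean-const elements {{order≢0}} _ ⟩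
    mean (Xs r) (λ X → f ((sumOver G S X ⁻¹) ∷ X)) ≡⟨ mean-cong (Xs r) (λ X → sym (trans (cong (fromℕ order *ℚ_) (mean-cong elements (λ x → cong (_*ℚ f (x ∷ X)) (same X x)))) (mean-pick r {λ x → f (x ∷ X)} (sumOver G S X ⁻¹)))) ⟩
    mean (Xs r) (λ X → fromℕ order *ℚ mean elements (λ x → F x X)) ≡⟨ Φ-*ˡ (FinSum-mean (Xs r)) (fromℕ order) _ ⟩
    fromℕ order *ℚ mean (Xs r) (λ X → mean elements (λ x → F x X)) ≡⟨ cong (fromℕ order *ℚ_) (FinSum-swap (FinSum-mean (Xs r)) (FinSum-mean elements) (λ X x → F x X)) ⟩
    fromℕ order *ℚ mean elements (λ x → mean (Xs r) (F x)) ≡⟨ cong (fromℕ order *ℚ_) (sym (mean-cartesian _∷_ elements (Xs r) (λ X → indicator (sumOver G (true ∷ S) X ≟ ε) *ℚ f X))) ⟩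
    fromℕ order *ℚ mean (Xs (suc r)) (λ X → indicator (sumOver G (true ∷ S) X ≟ ε) *ℚ f X) ∎
    where
    open ≡-Reasoning
    F : Carrier → Vec Carrier r → ℚ
    F x X = indicator ((x ∙ sumOver G S X) ≟ ε) *ℚ f (x ∷ X)
    same : ∀ X x → indicator ((x ∙ sumOver G S X) ≟ ε) ≡ indicator (x ≟ (sumOver G S X ⁻¹))
    same X x = indicator-cong ((x ∙ sumOver G S X) ≟ ε) (x ≟ (sumOver G S X ⁻¹)) (⁻¹-unique x (sumOver G S X)) (λ { refl → ⁻¹-invˡ (sumOver G S X) })

  -- The planted distribution, with the planted set drawn as a tuple; nothing
  -- is produced if its entries are not distinct.
  plantedT : (j r : ℕ) → (Vec Carrier r → ℚ) → ℚ
  plantedT j r f = mean (tuples r (suc j)) (λ w → indicator (Distinct? w) *ℚ mean (Xs r) (f ∘ plantT r w))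

  FinSum-plantedT : ∀ j r → FinSum (plantedT j r)
  FinSum-plantedT j r = FinSum-bind (FinSum-mean (tuples r (suc j))) (λ w → FinSum-scale (0≤indicator (Distinct? w)) (FinSum-map (plantT r w) (FinSum-mean (Xs r))))

  module SetsAndTuples (j r : ℕ) where
    k : ℕ
    k = suc j

    sides : List Bool
    sides = inside ∷ outside ∷ []

    subs : List (Subset r)
    subs = subsetsOfSize k r

    private
      ES = Enum-allVecs Enum-sides r
      All = allVecs sides r
      _≟ˢ_ = Enum._≟_ ES

    ∑-subs : ∀ H → ∑ subs H ≡ ∑ All (λ S → indicator (∣ S ∣ ℕ.≟ k) *ℚ H S)
    ∑-subs H = ∑-filter (λ S → ∣ S ∣ ℕ.≟ k) All H

    byTuples : (Subset r → ℚ) → ℚ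
    byTuples H = ∑ (tuples r k) (λ w → indicator (Distinct? w) *ℚ H (toSet w))

    byTuples≡ : ∀ H → byTuples H ≡ ∑ All (λ S → ∑ (tuples r k) (λ w → indicator (Distinct? w ×-dec (S ≟ˢ toSet w))) *ℚ H S)
    byTuples≡ H = begin
      byTuples H ≡⟨ ∑-cong (tuples r k) (λ w → trans (cong (indicator (Distinct? w) *ℚ_) (sym (Enum.∑-pick ES (toSet w) H))) (sym (∑-*ˡ All (indicator (Distinct? w)) _))) ⟩
      ∑ (tuples r k) (λ w → ∑ All (λ S → indicator (Distinct? w) *ℚ (indicator (S ≟ˢ toSet w) *ℚ H S))) ≡⟨ ∑-cong (tuples r k) (λ w → ∑-cong All (λ S → trans (sym (ℚ.*-assoc (indicator (Distinct? w)) (indicator (S ≟ˢ toSet w)) (H S))) (cong (_*ℚ H S) (sym (indicator-× (Distinct? w) (S ≟ˢ toSet w)))))) ⟩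
      ∑ (tuples r k) (λ w → ∑ All (λ S → indicator (Distinct? w ×-dec (S ≟ˢ toSet w)) *ℚ H S)) ≡⟨ ∑-swap (tuples r k) All _ ⟩
      ∑ All (λ S → ∑ (tuples r k) (λ w → indicator (Distinct? w ×-dec (S ≟ˢ toSet w)) *ℚ H S)) ≡⟨ ∑-cong All (λ S → ∑-*ʳ (tuples r k) (H S) _) ⟩
      ∑ All (λ S → ∑ (tuples r k) (λ w → indicator (Distinct? w ×-dec (S ≟ˢ toSet w))) *ℚ H S) ∎
      where open ≡-Reasoning

    subs≤tuples : ∀ {H} → NonNeg H → ∑ subs H ≤ℚ byTuples H
    subs≤tuples {H} p = respʳ (sym (byTuples≡ H)) (respˡ (sym (∑-subs H)) (∑-mono All (λ S → *-monoʳ (p S) (present S))))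
      where
      present : ∀ S → indicator (∣ S ∣ ℕ.≟ k) ≤ℚ ∑ (tuples r k) (λ w → indicator (Distinct? w ×-dec (S ≟ˢ toSet w)))
      present S = [ (λ e → let (w , D , q) = listing S k e in ℚ.≤-trans (indicator≤1 (∣ S ∣ ℕ.≟ k)) (ℚ.≤-trans (≡⇒≤ (sym (indicator-true (Distinct? w ×-dec (S ≟ˢ toSet w)) (D , sym q)))) (Enum.term≤∑ (Enum-allVecs (Enum-allFin r) k) w (λ w → 0≤indicator (Distinct? w ×-dec (S ≟ˢ toSet w))))))
                  , (λ n → ℚ.≤-trans (≡⇒≤ (indicator-false (∣ S ∣ ℕ.≟ k) n)) (∑-nonNeg (tuples r k) (λ w → 0≤indicator (Distinct? w ×-dec (S ≟ˢ toSet w)))))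
                  ]′ (toSum (∣ S ∣ ℕ.≟ k))

    tuples≤subs : ∀ {H} → NonNeg H → byTuples H ≤ℚ fromℕ (k ^ k) *ℚ ∑ subs H
    tuples≤subs {H} p = respˡ (sym (byTuples≡ H)) (respʳ (trans (∑-*ˡ All (fromℕ (k ^ k)) _) (cong (fromℕ (k ^ k) *ℚ_) (sym (∑-subs H))))
        (∑-mono All (λ S → ℚ.≤-trans (*-monoʳ (p S) (few S)) (≡⇒≤ (ℚ.*-assoc (fromℕ (k ^ k)) (indicator (∣ S ∣ ℕ.≟ k)) (H S))))))
      where
      few : ∀ S → ∑ (tuples r k) (λ w → indicator (Distinct? w ×-dec (S ≟ˢ toSet w))) ≤ℚ fromℕ (k ^ k) *ℚ indicator (∣ S ∣ ℕ.≟ k)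
      few S = [ yes-case , no-case ]′ (toSum (∣ S ∣ ℕ.≟ k))
        where
        within : ∀ {i} (w : Vec (Fin r) i) (w₀ : Vec (Fin r) k) → (∀ l → In l w → In l w₀) → Within w w₀
        within []      w₀ h = tt
        within (x ∷ w) w₀ h = h x (inj₁ refl) , within w w₀ (λ l q → h l (inj₂ q))
        yes-case : ∣ S ∣ ≡ k → ∑ (tuples r k) (λ w → indicator (Distinct? w ×-dec (S ≟ˢ toSet w))) ≤ℚ fromℕ (k ^ k) *ℚ indicator (∣ S ∣ ℕ.≟ k)
        yes-case e = let (w₀ , _ , q) = listing S k e in
          ℚ.≤-trans (∑-mono (tuples r k) (λ w → indicator-mono (Distinct? w ×-dec (S ≟ˢ toSet w)) (Within? w w₀)
              (λ (_ , e′) → within w w₀ (λ l i → toSet⇒In w₀ l (trans (cong (λ S → lookup S l) (trans q e′)) (In⇒toSet w l i))))))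
            (ℚ.≤-trans (∑-Within≤ w₀ k) (≡⇒≤ (sym (trans (cong (fromℕ (k ^ k) *ℚ_) (indicator-true (∣ S ∣ ℕ.≟ k) e)) (ℚ.*-identityʳ (fromℕ (k ^ k)))))))
        no-case : ¬ ∣ S ∣ ≡ k → ∑ (tuples r k) (λ w → indicator (Distinct? w ×-dec (S ≟ˢ toSet w))) ≤ℚ fromℕ (k ^ k) *ℚ indicator (∣ S ∣ ℕ.≟ k)
        no-case n = ℚ.≤-trans (≡⇒≤ (trans (∑-cong (tuples r k) (λ w → indicator-false (Distinct? w ×-dec (S ≟ˢ toSet w)) (λ (D , e) → n (trans (cong ∣_∣ e) (proj₁ (setOf-Distinct _ w D (λ _ → refl))))))) (∑-zero (tuples r k))))
          (0≤* (0≤fromℕ (k ^ k)) (0≤indicator (∣ S ∣ ℕ.≟ k)))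

    private
      c = length subs

      ∑-ones : ∑ subs (λ _ → 1ℚ) ≡ fromℕ c
      ∑-ones = trans (∑-const subs 1ℚ) (ℚ.*-identityʳ (fromℕ c))

      c≤ : fromℕ c ≤ℚ fromℕ (r ^ k)
      c≤ = ℚ.≤-trans (≡⇒≤ (sym ∑-ones)) (ℚ.≤-trans (subs≤tuples (λ _ → 0≤1))
        (ℚ.≤-trans (∑-mono (tuples r k) (λ w → ℚ.≤-trans (≡⇒≤ (ℚ.*-identityʳ (indicator (Distinct? w)))) (indicator≤1 (Distinct? w)))) (≡⇒≤ (trans (∑-const-tuples r k 1ℚ) (ℚ.*-identityʳ (fromℕ (r ^ k)))))))

      many : k + k ≤ r → fromℕ (r ^ k) ≤ℚ fromℕ (2 ^ k) *ℚ (fromℕ (k ^ k) *ℚ fromℕ c)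
      many p = begin
        fromℕ (r ^ k) ≤⟨ half-power {k} {r} {k} p ⟩
        fromℕ (2 ^ k) *ℚ fromℕ ((r ∸ k) ^ k) ≤⟨ *-monoˡ (0≤fromℕ (2 ^ k)) enough ⟩
        fromℕ (2 ^ k) *ℚ (fromℕ (k ^ k) *ℚ fromℕ c) ∎
        where
        open ℚ.≤-Reasoning
        drop-[] : ∀ w → indicator (Distinct? (w Vec.++ [])) ≤ℚ indicator (Distinct? {r} {k} w) *ℚ 1ℚ
        drop-[] w = respʳ (sym (ℚ.*-identityʳ (indicator (Distinct? w)))) (indicator-mono (Distinct? (w Vec.++ [])) (Distinct? w) (go w))
          where
          In-++ : ∀ {i x} (w : Vec (Fin r) i) → In x w → In x (w Vec.++ [])
          In-++ (_ ∷ w) (inj₁ q) = inj₁ q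
          In-++ (_ ∷ w) (inj₂ q) = inj₂ (In-++ w q)
          go : ∀ {i} (w : Vec (Fin r) i) → Distinct (w Vec.++ []) → Distinct w
          go []      D       = tt
          go (x ∷ w) (n , D) = (λ q → n (In-++ w q)) , go w D
        enough : fromℕ ((r ∸ k) ^ k) ≤ℚ fromℕ (k ^ k) *ℚ fromℕ c
        enough = ℚ.≤-trans (∑-Distinct≥ {r} [] (r ∸ k) k (≡⇒≤ⁿ (trans (cong (λ z → r ∸ k + z) (+-identityʳ k)) (m∸n+n≡m (≤-trans (m≤m+n k k) p)))) tt)
          (ℚ.≤-trans (∑-mono (tuples r k) drop-[]) (ℚ.≤-trans (tuples≤subs {λ _ → 1ℚ} (λ _ → 0≤1)) (≡⇒≤ (cong (fromℕ (k ^ k) *ℚ_) ∑-ones))))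

    subs≢0 : k + k ≤ r → NonZero (length subs)
    subs≢0 p = ℕ.≢-nonZero λ e → contradiction (subst (λ z → fromℕ (r ^ k) ≤ℚ fromℕ (2 ^ k) *ℚ (fromℕ (k ^ k) *ℚ fromℕ z)) e (many p)) (λ q → ℚ.<-irrefl refl (ℚ.<-≤-trans (0<fromℕ (r ^ k) {{m^n≢0 r k {{ℕ.>-nonZero (≤-trans (s≤s z≤n) p)}}}})
          (ℚ.≤-trans q (≡⇒≤ (trans (cong (fromℕ (2 ^ k) *ℚ_) (ℚ.*-zeroʳ (fromℕ (k ^ k)))) (ℚ.*-zeroʳ (fromℕ (2 ^ k))))))))

    module _ (f : Vec Carrier r → ℚ) (f≥0 : NonNeg f) where
      private
        H : Subset r → ℚ
        H S = mean (Xs r) (f ∘ plant G S)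

        H≥0 : NonNeg H
        H≥0 S = mean-nonNeg (Xs r) (λ X → f≥0 (plant G S X))

        plantedT≡ : plantedT j r f ≡ inv (r ^ k) *ℚ byTuples H
        plantedT≡ = trans (mean-∑ (tuples r k) _) (cong₂ _*ℚ_ (cong inv (trans (length-allVecs (allFin r) k) (cong (_^ k) (length-allFin r))))
          (∑-cong (tuples r k) (λ w → [ same w , (λ n → trans (cong (_*ℚ mean (Xs r) (f ∘ plantT r w)) (indicator-false (Distinct? w) n)) (trans (ℚ.*-zeroˡ (mean (Xs r) (f ∘ plantT r w))) (sym (trans (cong (_*ℚ H (toSet w)) (indicator-false (Distinct? w) n)) (ℚ.*-zeroˡ (H (toSet w))))))) ]′ (toSum (Distinct? w)))))
          where
          same : ∀ w → Distinct w → indicator (Distinct? w) *ℚ mean (Xs r) (f ∘ plantT r w) ≡ indicator (Distinct? w) *ℚ H (toSet w)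
          same w D = cong (indicator (Distinct? w) *ℚ_) (let (e , s) = setOf-Distinct _ w D (λ _ → refl) in
            trans (mean-plantT r w D f) (sym (trans (mean-plant (toSet w) e f) (cong (fromℕ order *ℚ_) (mean-cong (Xs r) (λ X → cong (λ y → indicator (y ≟ ε) *ℚ f X) (s X)))))))

        planted≡ : planted G k r f ≡ inv c *ℚ ∑ subs H
        planted≡ = mean-∑ subs H

        0≤∑H : 0ℚ ≤ℚ ∑ subs H
        0≤∑H = ∑-nonNeg subs H≥0

      open ℚ.≤-Reasoning

      plantedT≤planted : k + k ≤ r → plantedT j r f ≤ℚ fromℕ (k ^ k) *ℚ planted G k r f
      plantedT≤planted p = begin
        plantedT j r f ≡⟨ plantedT≡ ⟩
        inv (r ^ k) *ℚ byTuples H ≤⟨ *-monoˡ (0≤inv (r ^ k)) (tuples≤subs H≥0) ⟩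
        inv (r ^ k) *ℚ (fromℕ (k ^ k) *ℚ ∑ subs H) ≤⟨ *-monoʳ (0≤* (0≤fromℕ (k ^ k)) 0≤∑H) (inv-anti c (r ^ k) (subs≢0 p) c≤) ⟩
        inv c *ℚ (fromℕ (k ^ k) *ℚ ∑ subs H) ≡⟨ solve 3 (λ a b x → a :* (b :* x) := b :* (a :* x)) refl (inv c) (fromℕ (k ^ k)) (∑ subs H) ⟩
        fromℕ (k ^ k) *ℚ (inv c *ℚ ∑ subs H) ≡⟨ cong (fromℕ (k ^ k) *ℚ_) (sym planted≡) ⟩
        fromℕ (k ^ k) *ℚ planted G k r f ∎

      planted≤plantedT : k + k ≤ r → planted G k r f ≤ℚ fromℕ (2 ^ k) *ℚ fromℕ (k ^ k) *ℚ plantedT j r f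
      planted≤plantedT p = begin
        planted G k r f ≡⟨ planted≡ ⟩
        inv c *ℚ ∑ subs H ≤⟨ *-monoˡ (0≤inv c) (subs≤tuples H≥0) ⟩
        inv c *ℚ byTuples H ≡⟨ cong (λ z → inv c *ℚ z) (sym (trans (cong (_*ℚ byTuples H) (fromℕ*inv (r ^ k) {{r^k≢0}})) (ℚ.*-identityˡ (byTuples H)))) ⟩
        inv c *ℚ ((fromℕ (r ^ k) *ℚ inv (r ^ k)) *ℚ byTuples H) ≡⟨ solve 4 (λ a b c d → a :* ((b :* c) :* d) := a :* (b :* (c :* d))) refl (inv c) (fromℕ (r ^ k)) (inv (r ^ k)) (byTuples H) ⟩
        inv c *ℚ (fromℕ (r ^ k) *ℚ (inv (r ^ k) *ℚ byTuples H)) ≤⟨ *-monoˡ (0≤inv c) (*-monoʳ (0≤* (0≤inv (r ^ k)) 0≤byTuples) (many p)) ⟩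
        inv c *ℚ ((fromℕ (2 ^ k) *ℚ (fromℕ (k ^ k) *ℚ fromℕ c)) *ℚ (inv (r ^ k) *ℚ byTuples H)) ≡⟨ solve 5 (λ a b k c d → a :* ((b :* (k :* c)) :* d) := (a :* c) :* ((b :* k) :* d)) refl (inv c) (fromℕ (2 ^ k)) (fromℕ (k ^ k)) (fromℕ c) (inv (r ^ k) *ℚ byTuples H) ⟩
        (inv c *ℚ fromℕ c) *ℚ (fromℕ (2 ^ k) *ℚ fromℕ (k ^ k) *ℚ (inv (r ^ k) *ℚ byTuples H)) ≡⟨ cong₂ (λ x y → x *ℚ (fromℕ (2 ^ k) *ℚ fromℕ (k ^ k) *ℚ y)) (inv*fromℕ c {{subs≢0 p}}) (sym plantedT≡) ⟩
        1ℚ *ℚ (fromℕ (2 ^ k) *ℚ fromℕ (k ^ k) *ℚ plantedT j r f) ≡⟨ ℚ.*-identityˡ _ ⟩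
        fromℕ (2 ^ k) *ℚ fromℕ (k ^ k) *ℚ plantedT j r f ∎
        where
        r^k≢0 : NonZero (r ^ k)
        r^k≢0 = m^n≢0 r k {{ℕ.>-nonZero (≤-trans (s≤s z≤n) p)}}
        0≤byTuples : 0ℚ ≤ℚ byTuples H
        0≤byTuples = ∑-nonNeg (tuples r k) (λ w → 0≤* (0≤indicator (Distinct? w)) (H≥0 (toSet w)))

-- Control programs of the reduction

Small : ℕ → Memory → Set
Small Λ σ = ∀ b j → Control b → len (σ b j) ≤ Λ

fillStep : ℕ → Exp → Program
fillStep a e = random a (cell 11) e ⨾ store 11 (lit 0) (op add (cell 11) (lit 1))

fillLoop fill : ℕ → Exp → Exp → Program
fillLoop a cnt e = while (op less (cell 11) cnt) (fillStep a e)
fill a cnt e = store 11 (lit 0) (lit 0) ⨾ fillLoop a cnt e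

filled : ℕ → ∀ {n} → Vec ℕ n → Memory → Memory
filled a []      σ = σ
filled a (x ∷ v) σ = filled a v (update σ′ 11 0 (σ′ 11 0 + 1))
  where σ′ = update σ a (σ 11 0) x

filled-other : ∀ a {n} (v : Vec ℕ n) σ b j → a ≢ b → 11 ≢ b → filled a v σ b j ≡ σ b j
filled-other a []      σ b j p q = refl
filled-other a (x ∷ v) σ b j p q = trans (filled-other a v _ b j p q) (trans (update-array (update σ a (σ 11 0) x) 11 0 _ b j q) (update-array σ a (σ 11 0) x b j p))

module _ (a : ℕ) (a≢11 : a ≢ 11) where
  private
    counter : ∀ σ x → update σ a (σ 11 0) x 11 0 ≡ σ 11 0
    counter σ x = update-array σ a (σ 11 0) x 11 0 a≢11

    after : Memory → ℕ → Memory
    after σ x = update (update σ a (σ 11 0) x) 11 0 (update σ a (σ 11 0) x 11 0 + 1)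

    after-counter : ∀ σ x i → σ 11 0 ≡ i → after σ x 11 0 ≡ suc i
    after-counter σ x i e = trans (cong (_+ 1) (trans (counter σ x) e)) (+-comm i 1)

  filled-counter : ∀ {n} (v : Vec ℕ n) σ i → σ 11 0 ≡ i → filled a v σ 11 0 ≡ i + n
  filled-counter []      σ i e = trans e (sym (+-identityʳ i))
  filled-counter {suc n} (x ∷ v) σ i e = trans (filled-counter v (after σ x) (suc i) (after-counter σ x i e)) (sym (+-suc i n))

  filled-out : ∀ {n} (v : Vec ℕ n) σ i j → σ 11 0 ≡ i → j < i ⊎ i + n ≤ j → filled a v σ a j ≡ σ a j
  filled-out []      σ i j e h = refl
  filled-out {suc n} (x ∷ v) σ i j e h = trans (filled-out v (after σ x) (suc i) j (after-counter σ x i e) (next-range h))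
    (trans (update-array (update σ a (σ 11 0) x) 11 0 _ a j (a≢11 ∘ sym)) (update-≢ σ a (σ 11 0) x a j (inj₂ (λ q → differ h (trans (sym e) q)))))
    where
    next-range : j < i ⊎ i + suc n ≤ j → j < suc i ⊎ suc i + n ≤ j
    next-range (inj₁ p) = inj₁ (m≤n⇒m≤1+n p)
    next-range (inj₂ p) = inj₂ (≤-trans (≡⇒≤ⁿ (sym (+-suc i n))) p)
    differ : j < i ⊎ i + suc n ≤ j → i ≢ j
    differ (inj₁ p) refl = <-irrefl refl p
    differ (inj₂ p) refl = <-irrefl refl (≤-trans (ℕ.m<m+n i (s≤s z≤n)) p)

  filled-in : ∀ {n} (v : Vec ℕ n) σ i → σ 11 0 ≡ i → ∀ l → filled a v σ a (i + toℕ l) ≡ lookup v l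
  filled-in (x ∷ v) σ i e zero    = trans (filled-out v (after σ x) (suc i) (i + 0) (after-counter σ x i e) (inj₁ (s≤s (≡⇒≤ⁿ (+-identityʳ i)))))
    (trans (update-array (update σ a (σ 11 0) x) 11 0 _ a (i + 0) (a≢11 ∘ sym)) (trans (cong (update σ a (σ 11 0) x a) (trans (+-identityʳ i) (sym e))) (update-≡ σ a (σ 11 0) x)))
  filled-in (x ∷ v) σ i e (suc l) = trans (cong (filled a v (after σ x) a) (+-suc i (toℕ l))) (filled-in v (after σ x) (suc i) (after-counter σ x i e) l)

filled-small : ∀ a {n} {Λ} (v : Vec ℕ n) σ i N → a ≢ 11 → σ 11 0 ≡ i → i + n ≡ N → len N ≤ Λ → (∀ l → len (lookup v l) ≤ Λ) → Small Λ σ → Small Λ (filled a v σ)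
filled-small a []      σ i N a≢ e q p h S = S
filled-small a {suc n} {Λ} (x ∷ v) σ i N a≢ e q p h S = filled-small a v _ (suc i) N a≢ c′ (trans (sym (+-suc i n)) q) p (h ∘ suc)
  (update-≤ {P = Control} {σ = update σ a (σ 11 0) x} {11} {0} {c + 1} (≤-trans (len-mono (≤-trans (≡⇒≤ⁿ c′) (≤-trans (m≤m+n (suc i) n) (≡⇒≤ⁿ (trans (sym (+-suc i n)) q))))) p)
    (update-≤ {P = Control} {σ = σ} {a} {σ 11 0} {x} (h zero) S))
  where
  c = update σ a (σ 11 0) x 11 0
  c′ : c + 1 ≡ suc i
  c′ = trans (cong (_+ 1) (trans (update-array σ a (σ 11 0) x 11 0 a≢) e)) (+-comm i 1)

-- The factor m is found by following the structure of a.
record Multiple (W a m : ℕ) : Set where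
  constructor by
  field proof : a ≤ m * W

module Multiples {W : ℕ} where
  infixr 6 _⊞_
  infixr 7 _⊡_

  _⊞_ : ∀ {a b m n} → Multiple W a m → Multiple W b n → Multiple W (a + b) (m + n)
  _⊞_ {m = m} {n} (by p) (by q) = by (≤-trans (+-mono-≤ p q) (≡⇒≤ⁿ (sym (*-distribʳ-+ W m n))))

  _⊡_ : ∀ {a m} c → Multiple W a m → Multiple W (c * a) (c * m)
  _⊡_ {m = m} c (by p) = by (≤-trans (*-monoʳ-≤ c p) (≡⇒≤ⁿ (sym (ℕ.*-assoc c m W))))

  once : ∀ {a} → a ≤ W → Multiple W a 1
  once p = by (≤-trans p (≡⇒≤ⁿ (sym (*-identityˡ W))))

  below : ∀ {a b m} → b ≤ a → Multiple W a m → Multiple W b m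
  below p (by q) = by (≤-trans p q)

open Multiple
open Multiples

module ControlRuns (X : Input) (Λ : ℕ) (1≤Λ : 1 ≤ Λ) (size≤ : len (length X) ≤ Λ) (input≤ : ∀ i → len (nth X i) ≤ Λ) where

  ctlCost : ∀ {σ} s → Small Λ σ → LoadsStep Control s → stepCost X s σ ≤ κₛ s * Λ
  ctlCost {σ} s S l = stepCost≤κ {P = Control} {X = X} {σ = σ} 1≤Λ size≤ input≤ S s l

  step· : ∀ {σ} s → Small Λ σ → LoadsStep Control s → Multiple Λ (stepCost X s σ) (κₛ s)
  step· s S l = by (ctlCost s S l)

  lit≤ : ∀ n → n ≤ n * Λ
  lit≤ n = ≤*ʳ 1≤Λ

  lit· : ∀ n → Multiple Λ n n
  lit· n = by (lit≤ n)

  Det⇒Run : ∀ {c b c′} {A : Set} {xs : List A} {conf : Vec A 0 → Config} (D : Det X c b c′) → conf [] ≡ c′ → Run X c b (Det.delay D) (allVecs xs 0) conf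
  Det⇒Run {c} {b} {c′} {conf = conf} D refl = record
    { cost  = λ n → ℚ.≤-trans (Det.cost D n) (≡⇒≤ (cong (fromℕ b +ℚ_) (sym (mean-single [] (λ v → costWithin X n (conf v))))))
    ; reach = λ {φ} h n → ℚ.≤-trans (≡⇒≤ (mean-single [] (λ v → halt X n φ (conf v)))) (Det.reach D h n) }

  κF : ℕ → Exp → Exp → ℕ
  κF a cnt e = κₛ (fillLoop a cnt e) + (1 + (κₛ (random a (cell 11) e) + κₛ (store 11 (lit 0) (op add (cell 11) (lit 1)))))

  fillDelay : ℕ → ℕ
  fillDelay zero    = 1
  fillDelay (suc n) = (2 + 1) + (1 + fillDelay n)

  module Fill {A : Set} (a : ℕ) (cnt e : Exp) (N : ℕ) (xs : List A) (ι : A → ℕ)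
    (a≢11 : a ≢ 11) (a≢2 : a ≢ 2) (ctl : Loads Control cnt × Loads Control e)
    (cnt-eval : ∀ σ → eval X σ cnt ≡ N) (N≤ : len N ≤ Λ) (M : ℕ)
    (e-mean : ∀ σ → σ 2 0 ≡ M → ∀ f → mean (range (eval X σ e)) f ≡ mean xs (f ∘ ι)) (ι≤ : ∀ x → len (ι x) ≤ Λ) where

    loopRun : ∀ n i σ K → σ 11 0 ≡ i → i + n ≡ N → σ 2 0 ≡ M → Small Λ σ →
      Run X (fillLoop a cnt e ∷ K , σ) (suc n * (κF a cnt e * Λ)) (fillDelay n) (allVecs xs n) (λ v → K , filled a (Vec.map ι v) σ)
    loopRun zero i σ K ei en em S = Run-weaken X
      (≤-trans (≤-trans (≡⇒≤ⁿ (+-identityʳ _)) (ctlCost {σ} (fillLoop a cnt e) S ((_ , _) , proj₁ ctl)))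
        (≤-trans (*-monoˡ-≤ Λ (m≤m+n (κₛ (fillLoop a cnt e)) _)) (≡⇒≤ⁿ (sym (+-identityʳ (κF a cnt e * Λ))))))
      (Det⇒Run {xs = xs} (Det-step X {fillLoop a cnt e} (next-exit X σ (op less (cell 11) cnt) (less-false (≡⇒≤ⁿ (trans (cnt-eval σ) (trans (sym en) (trans (+-identityʳ i) (sym ei))))))) (Det-refl X)) refl)
    loopRun (suc n) i σ K ei en em S = Run-weaken X total
      (Run-vec X (Det-Run X enter (Run-change X (e-mean σ em) (Run-random X {a} {cell 11} {e} {store′ ∷ fillLoop a cnt e ∷ K} {σ})))
        (λ x → Det-Run X (one-store x) (loopRun n (suc i) (σ″ x) K (counter x) (trans (sym (+-suc i n)) en) (trans (update-array (σ′ x) 11 0 (σ′ x 11 0 + 1) 2 0 (λ ())) (trans (update-array σ a (σ 11 0) (ι x) 2 0 a≢2) em)) (small x))))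
      where
      store′ = store 11 (lit 0) (op add (cell 11) (lit 1))
      σ′ σ″ : A → Memory
      σ′ x = update σ a (σ 11 0) (ι x)
      σ″ x = update (σ′ x) 11 0 (σ′ x 11 0 + 1)
      counter : ∀ x → σ″ x 11 0 ≡ suc i
      counter x = trans (cong (_+ 1) (trans (update-array σ a (σ 11 0) (ι x) 11 0 a≢11) ei)) (+-comm i 1)
      i<N : suc i ≤ N
      i<N = ≤-trans (m≤m+n (suc i) n) (≡⇒≤ⁿ (trans (sym (+-suc i n)) en))
      small′ : ∀ x → Small Λ (σ′ x)
      small′ x = update-≤ {P = Control} {σ = σ} {a} {σ 11 0} {ι x} (ι≤ x) S
      small : ∀ x → Small Λ (σ″ x)
      small x = update-≤ {P = Control} {σ = σ′ x} {11} {0} {σ′ x 11 0 + 1} (≤-trans (len-mono (≤-trans (≡⇒≤ⁿ (counter x)) i<N)) N≤) (small′ x)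
      enter : Det X (fillLoop a cnt e ∷ K , σ) (stepCost X (fillLoop a cnt e) σ + (1 + 0)) (random a (cell 11) e ∷ store′ ∷ fillLoop a cnt e ∷ K , σ)
      enter = Det-step X {fillLoop a cnt e} (next-loop X σ (op less (cell 11) cnt) (≡⇒≤ⁿ (sym (less-true (≤-trans (s≤s (≡⇒≤ⁿ ei)) (≤-trans i<N (≡⇒≤ⁿ (sym (cnt-eval σ)))))))))
        (Det-step X {fillStep a e} refl (Det-refl X))
      one-store : ∀ x → Det X (store′ ∷ fillLoop a cnt e ∷ K , σ′ x) (κₛ store′ * Λ) (fillLoop a cnt e ∷ K , σ″ x)
      one-store x = Det-weaken X (≤-trans (≡⇒≤ⁿ (+-identityʳ _)) (ctlCost {σ′ x} store′ (small′ x) _)) (Det-step X {store′} refl (Det-refl X))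
      total : (stepCost X (fillLoop a cnt e) σ + (1 + 0) + stepCost X (random a (cell 11) e) σ) + (κₛ store′ * Λ + suc n * (κF a cnt e * Λ)) ≤ suc (suc n) * (κF a cnt e * Λ)
      total = ≤-trans (+-monoˡ-≤ (κₛ store′ * Λ + rest) (+-mono-≤ (+-mono-≤ (ctlCost {σ} (fillLoop a cnt e) S ((_ , _) , proj₁ ctl)) (lit≤ 1)) (ctlCost {σ} (random a (cell 11) e) S ((_ , _) , proj₂ ctl))))
        (≡⇒≤ⁿ (eq (κₛ (fillLoop a cnt e)) (κₛ (random a (cell 11) e)) (κₛ store′) Λ rest))
        where
        rest = suc n * (κF a cnt e * Λ)
        eq : ∀ x y z l s → (x * l + 1 * l + y * l) + (z * l + s) ≡ (x + (1 + (y + z))) * l + s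
        eq = solve-∀

    σ⁰ : Memory → Memory
    σ⁰ σ = update σ 11 0 0

    fillRun : ∀ σ K → σ 2 0 ≡ M → Small Λ σ →
      Run X (fill a cnt e ∷ K , σ) (4 * Λ + suc N * (κF a cnt e * Λ)) (2 + fillDelay N) (allVecs xs N) (λ v → K , filled a (Vec.map ι v) (σ⁰ σ))
    fillRun σ K em S = Run-weaken X (+-monoˡ-≤ _ (lit≤ 4)) (Det-Run X (Det-step X {fill a cnt e} refl (Det-step X {store 11 (lit 0) (lit 0)} refl (Det-refl X)))
      (loopRun N 0 (σ⁰ σ) K refl refl em (update-≤ {P = Control} {σ = σ} {11} {0} {0} z≤n S)))

    module Filled (σ : Memory) (S : Small Λ σ) (v : Vec A N) where
      σᶠ : Memory
      σᶠ = filled a (Vec.map ι v) (σ⁰ σ)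

      small : Small Λ σᶠ
      small = filled-small a (Vec.map ι v) (σ⁰ σ) 0 N a≢11 refl refl N≤ (λ l → subst (λ z → len z ≤ Λ) (sym (Vec.lookup-map l ι v)) (ι≤ (lookup v l))) (update-≤ {P = Control} {σ = σ} {11} {0} {0} z≤n S)

      at : ∀ l → σᶠ a (toℕ l) ≡ ι (lookup v l)
      at l = trans (filled-in a a≢11 (Vec.map ι v) (σ⁰ σ) 0 refl l) (Vec.lookup-map l ι v)

      beyond : ∀ j → N ≤ j → σᶠ a j ≡ σ a j
      beyond j p = trans (filled-out a a≢11 (Vec.map ι v) (σ⁰ σ) 0 j refl (inj₂ p)) (update-array σ 11 0 0 a j (a≢11 ∘ sym))

      other : ∀ b j → a ≢ b → 11 ≢ b → σᶠ b j ≡ σ b j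
      other b j p q = trans (filled-other a (Vec.map ι v) (σ⁰ σ) b j p q) (update-array σ 11 0 0 b j q)

-- Expressions over tuples of cells

module TupleExpressions (addᴱ : Exp → Exp → Exp) where
  sumᴱ : (ℕ → Exp) → ℕ → Exp
  sumᴱ f zero    = lit 0
  sumᴱ f (suc n) = addᴱ (f 0) (sumᴱ (f ∘ suc) n)

neqᴱ : Exp → Exp → Exp
neqᴱ e f = op add (op less e f) (op less f e)

freshᴱ : Exp → (ℕ → Exp) → ℕ → Exp
freshᴱ e f zero    = lit 1
freshᴱ e f (suc n) = op mul (neqᴱ e (f 0)) (freshᴱ e (f ∘ suc) n)

distinctᴱ : (ℕ → Exp) → ℕ → Exp
distinctᴱ f zero    = lit 1
distinctᴱ f (suc n) = op mul (freshᴱ (f 0) (f ∘ suc) n) (distinctᴱ (f ∘ suc) n)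

module _ (X : Input) (σ : Memory) where
  neq-true : ∀ {m n} e f → eval X σ e ≡ m → eval X σ f ≡ n → m ≢ n → 1 ≤ eval X σ (neqᴱ e f)
  neq-true {m} {n} e f refl refl h with ℕ.<-cmp m n
  ... | tri< p _ _ = ≤-trans (≡⇒≤ⁿ (sym (less-true p))) (m≤m+n _ _)
  ... | tri≈ _ p _ = contradiction p h
  ... | tri> _ _ p = ≤-trans (≡⇒≤ⁿ (sym (less-true p))) (m≤n+m _ (applyOp less m n))

  neq-false : ∀ {m} e f → eval X σ e ≡ m → eval X σ f ≡ m → eval X σ (neqᴱ e f) ≡ 0
  neq-false e f refl q = cong₂ _+_ (less-false (≡⇒≤ⁿ q)) (less-false (≡⇒≤ⁿ (sym q)))

  private
    *-pos : ∀ {x y} → 1 ≤ x * y → 1 ≤ x × 1 ≤ y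
    *-pos {suc x} {suc y} p = s≤s z≤n , s≤s z≤n
    *-pos {suc x} {zero}  p = contradiction (≤-trans p (≡⇒≤ⁿ (ℕ.*-zeroʳ x))) (λ ())

  module _ {r : ℕ} where
    fresh⇒ : ∀ {n} e (x : Fin r) (w : Vec (Fin r) n) f → eval X σ e ≡ toℕ x → (∀ l → eval X σ (f (toℕ l)) ≡ toℕ (lookup w l)) → 1 ≤ eval X σ (freshᴱ e f n) → ¬ In x w
    fresh⇒ e x (y ∷ w) f he hf p (inj₁ refl) = contradiction (≤-trans (proj₁ (*-pos p)) (≡⇒≤ⁿ (neq-false e (f 0) he (hf zero)))) (λ ())
    fresh⇒ e x (y ∷ w) f he hf p (inj₂ q)    = fresh⇒ e x w (f ∘ suc) he (hf ∘ suc) (proj₂ (*-pos {eval X σ (neqᴱ e (f 0))} p)) q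

    fresh⇐ : ∀ {n} e (x : Fin r) (w : Vec (Fin r) n) f → eval X σ e ≡ toℕ x → (∀ l → eval X σ (f (toℕ l)) ≡ toℕ (lookup w l)) → ¬ In x w → 1 ≤ eval X σ (freshᴱ e f n)
    fresh⇐ e x []      f he hf h = s≤s z≤n
    fresh⇐ e x (y ∷ w) f he hf h = 1≤* (neq-true e (f 0) he (hf zero) (λ q → h (inj₁ (Fin.toℕ-injective q)))) (fresh⇐ e x w (f ∘ suc) he (hf ∘ suc) (h ∘ inj₂))

    distinct⇒ : ∀ {n} (w : Vec (Fin r) n) f → (∀ l → eval X σ (f (toℕ l)) ≡ toℕ (lookup w l)) → 1 ≤ eval X σ (distinctᴱ f n) → Distinct w
    distinct⇒ []      f hf p = tt
    distinct⇒ {suc n} (x ∷ w) f hf p =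
      fresh⇒ (f 0) x w (f ∘ suc) (hf zero) (hf ∘ suc) (proj₁ (*-pos p)) ,
      distinct⇒ w (f ∘ suc) (hf ∘ suc) (proj₂ (*-pos {eval X σ (freshᴱ (f 0) (f ∘ suc) n)} p))

    distinct⇐ : ∀ {n} (w : Vec (Fin r) n) f → (∀ l → eval X σ (f (toℕ l)) ≡ toℕ (lookup w l)) → Distinct w → 1 ≤ eval X σ (distinctᴱ f n)
    distinct⇐ []      f hf D       = s≤s z≤n
    distinct⇐ (x ∷ w) f hf (n , D) = 1≤* (fresh⇐ (f 0) x w (f ∘ suc) (hf zero) (hf ∘ suc) n) (distinct⇐ w (f ∘ suc) (hf ∘ suc) D)

module _ {P : ℕ → Set} where
  fresh-loads : ∀ {e f} → Loads P e → (∀ j → Loads P (f j)) → ∀ n → Loads P (freshᴱ e f n)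
  fresh-loads le lf zero    = tt
  fresh-loads le lf (suc n) = ((le , lf 0) , (lf 0 , le)) , fresh-loads le (lf ∘ suc) n

  distinct-loads : ∀ {f} → (∀ j → Loads P (f j)) → ∀ n → Loads P (distinctᴱ f n)
  distinct-loads lf zero    = tt
  distinct-loads lf (suc n) = fresh-loads (lf 0) (lf ∘ suc) n , distinct-loads (lf ∘ suc) n

-- The reduction

record Arith : Set₁ where
  field
    addᴱ      : Exp → Exp → Exp
    negᴱ      : Exp → Exp
    add-loads : ∀ {P : ℕ → Set} {e f} → P 2 → Loads P e → Loads P f → Loads P (addᴱ e f)
    neg-loads : ∀ {P : ℕ → Set} {e} → P 2 → Loads P e → Loads P (negᴱ e)
    kᵃᵈᵈ      : ℕ
    add-cost  : ∀ X σ L e f → 1 ≤ L → len (σ 2 0) ≤ L → expCost X σ (addᴱ e f) ≤ kᵃᵈᵈ * (L + (expCost X σ e + expCost X σ f))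

record Coded (R : Arith) (G : FiniteGroup) (M : ℕ) : Set where
  open Arith R
  open FiniteGroup G
  field
    code-ε         : code ε ≡ 0
    code-injective : ∀ {x y} → code x ≡ code y → x ≡ y
    code<          : ∀ x → code x < M
    code-mean      : ∀ f → mean (range M) f ≡ mean elements (f ∘ code)
    order≡         : length elements ≡ M
    add-eval       : ∀ X σ e f {x y} → σ 2 0 ≡ M → eval X σ e ≡ code x → eval X σ f ≡ code y → eval X σ (addᴱ e f) ≡ code (x ∙ y)
    neg-eval       : ∀ X σ e {x} → σ 2 0 ≡ M → eval X σ e ≡ code x → eval X σ (negᴱ e) ≡ code (x ⁻¹)

powᴱ : ℕ → Exp
powᴱ zero    = lit 1
powᴱ (suc n) = op mul size (powᴱ n)

powᴱ-eval : ∀ X σ n → eval X σ (powᴱ n) ≡ length X ^ n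
powᴱ-eval X σ zero    = refl
powᴱ-eval X σ (suc n) = cong (length X *_) (powᴱ-eval X σ n)

powᴱ-loads : ∀ {P} n → Loads P (powᴱ n)
powᴱ-loads zero    = tt
powᴱ-loads (suc n) = tt , powᴱ-loads n

-- The natural numbers are variables because Agda normalises fromℕ of a
-- concrete one.
add-cost₀ : ∀ {x y z} a b → x ≤ℚ fromℕ a +ℚ y → y ≤ℚ fromℕ b +ℚ z → x ≤ℚ fromℕ (a + b) +ℚ z
add-cost₀ {z = z} a b p q = ℚ.≤-trans p (ℚ.≤-trans (ℚ.+-monoʳ-≤ (fromℕ a) q)
  (≡⇒≤ (fromℕ-merge a b z)))

merge-cost : ∀ {x y} a b t → x ≤ℚ y → a + b ≤ t → fromℕ a +ℚ (fromℕ b +ℚ x) ≤ℚ fromℕ t +ℚ y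
merge-cost {x} a b t p q = ℚ.≤-trans (≡⇒≤ (fromℕ-merge a b x)) (ℚ.+-mono-≤ (fromℕ-mono q) p)

add-cost₁ : ∀ {x y z} a t → x ≤ℚ fromℕ a +ℚ y → y ≤ℚ z → a ≤ t → x ≤ℚ fromℕ t +ℚ z
add-cost₁ a t p q le = ℚ.≤-trans p (ℚ.+-mono-≤ (fromℕ-mono le) q)

add-cost₂ : ∀ {x y z} a b c t → x ≤ℚ fromℕ a +ℚ y → y ≤ℚ fromℕ b +ℚ (fromℕ c +ℚ z) → a + b + c ≤ t → x ≤ℚ fromℕ t +ℚ z
add-cost₂ {z = z} a b c t p q le = ℚ.≤-trans (add-cost₀ a b p q) (ℚ.≤-trans (≡⇒≤ (fromℕ-merge (a + b) c z)) (ℚ.+-monoˡ-≤ z (fromℕ-mono le)))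

module Programs (R : Arith) (j u : ℕ) (p : Program) where
  open Arith R
  open TupleExpressions addᴱ public

  k k′ : ℕ
  k  = suc j
  k′ = u + k

  entry : ℕ → Exp
  entry i = load 0 (lit i)

  solᴱ : Exp
  solᴱ = op mul (distinctᴱ entry k′) (op less (sumᴱ (input ∘ entry) k′) (lit 1))

  inp₁ inp₂ : Exp → Exp
  inp₁ e = load 10 e
  inp₂ e = addᴱ (input e) (op mul (load 9 e) (cell 7))

  module C₁ = Clocked inp₁
  module C₂ = Clocked inp₂

  -- An output of the simulated program, or 0 if it is not an index.
  outᴱ : ℕ → Exp
  outᴱ i = op mul (load 0 (lit i)) (op less (load 0 (lit i)) size)

  fetch put : ℕ → Program
  fetch i = store 1 (lit (suc i)) C₂.⟦ outᴱ i ⟧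
  put i   = store 0 (lit (u + i)) (load 1 (lit (suc i)))

  seq : (ℕ → Program) → ℕ → ℕ → Program
  seq s i zero    = skip
  seq s i (suc n) = s i ⨾ seq s (suc i) n

  inc check : Program
  inc   = store 4 (lit 0) (op add (cell 4) (lit 1))
  check = branch solᴱ (store 8 (lit 0) (lit 0)) skip

  rounds : Program → Program
  rounds body = while (op less (cell 4) (cell 8)) (body ⨾ inc ⨾ check)

  guess attempt shiftBy resetClock : Program
  guess      = fill 0 (lit k′) size
  shiftBy    = store 7 (lit 0) (sumᴱ (input ∘ entry) u)
  resetClock = store 5 (lit 0) (lit 0)
  attempt    = fill 0 (lit u) size ⨾ shiftBy ⨾ resetClock ⨾ C₂.T⟦ p ⟧ ⨾ seq fetch 0 k ⨾ seq put 0 k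

  doubling plantᴾ bruteForce search decide : Program
  doubling   = while (op less (cell 2) (powᴱ k′)) (store 2 (lit 0) (op mul (lit 2) (cell 2)))
  plantᴾ     = store 10 (entry 0) (negᴱ (sumᴱ (λ i → load 10 (entry (suc i))) j))
  bruteForce = store 8 (lit 0) (op add (powᴱ k′) (lit 1)) ⨾ rounds guess
  search     = store 6 (lit 0) (cell 5) ⨾ store 8 (lit 0) (cell 3) ⨾ rounds attempt
  decide     = store 4 (lit 0) (lit 1) ⨾ branch (op less (cell 6) (cell 5)) bruteForce search

  reduction : Program
  reduction =
    store 2 (lit 0) (lit 1) ⨾ doubling ⨾ store 3 (lit 0) (op add (powᴱ u) (lit 1)) ⨾ store 6 (lit 0) (powᴱ k′) ⨾
    fill 9 size (lit 2) ⨾ fill 10 size (cell 2) ⨾ fill 0 (lit k) size ⨾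
    branch (distinctᴱ entry k) (plantᴾ ⨾ C₁.T⟦ p ⟧ ⨾ decide) skip

  sum-loads : ∀ {P : ℕ → Set} {f} → P 2 → (∀ i → Loads P (f i)) → ∀ n → Loads P (sumᴱ f n)
  sum-loads p2 lf zero    = tt
  sum-loads p2 lf (suc n) = add-loads p2 (lf 0) (sum-loads p2 (lf ∘ suc) n)

  solᴱ-loads : Loads Control solᴱ
  solᴱ-loads = distinct-loads (λ i → tt , tt) k′ , sum-loads tt (λ i → tt , tt) k′ , tt

nth-lookup : ∀ {r} (v : Vec ℕ r) i → nth (Vec.toList v) (toℕ i) ≡ lookup v i
nth-lookup (x ∷ v) zero    = refl
nth-lookup (x ∷ v) (suc i) = nth-lookup v i

nth-beyond : ∀ {r} (v : Vec ℕ r) i → r ≤ i → nth (Vec.toList v) i ≡ 0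
nth-beyond []      i       p       = refl
nth-beyond (x ∷ v) (suc i) (s≤s p) = nth-beyond v i p

nth-≤ : ∀ {r L} (v : Vec ℕ r) → (∀ i → len (lookup v i) ≤ L) → ∀ i → len (nth (Vec.toList v) i) ≤ L
nth-≤ []      h i       = z≤n
nth-≤ (x ∷ v) h zero    = h zero
nth-≤ (x ∷ v) h (suc i) = nth-≤ v (h ∘ suc) i

bit : Bool → ℕ
bit b = if b then 1 else 0

-- One instance of the problem solved by the reduction, with the bounds on
-- the lengths of all numbers in the control arrays.
record Instance : Set₁ where
  field
    arith   : Arith
    G       : FiniteGroup
    abelian : Abelian G
    M       : ℕ
    coded   : Coded arith G M
    j u r   : ℕ
    p       : Program
    X       : Vec (FiniteGroup.Carrier G) r
    Λ       : ℕ
  open Programs arith j u p public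
  field
    1≤r     : 1 ≤ r
    1≤Λ     : 1 ≤ Λ
    M≤      : len M ≤ Λ
    power≤  : len (r ^ k′ + 1) ≤ Λ
    k′≤     : len k′ ≤ Λ

  open Arith arith public
  open FiniteGroup G public using (Carrier; _∙_; ε; _⁻¹; elements; code)
  open Coded coded public
  open Abelian abelian public
  open Counting G abelian r public

  inst : Input
  inst = encode G X

  stride : ℕ
  stride = r ^ u + 1

module Rounds (I : Instance) where
  open Instance I

  length-encode : ∀ Y → length (encode G {r} Y) ≡ r
  length-encode Y = Vec.length-toList (Vec.map code Y)

  nth-encode : ∀ (Y : Vec Carrier r) i → nth (encode G Y) (toℕ i) ≡ code (lookup Y i)
  nth-encode Y i = trans (nth-lookup (Vec.map code Y) i) (Vec.lookup-map i code Y)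

  code≤ : ∀ x → len (code x) ≤ Λ
  code≤ x = ≤-trans (len-mono (<⇒≤ (code< x))) M≤

  nth≤ : ∀ (Y : Vec Carrier r) i → len (nth (encode G Y) i) ≤ Λ
  nth≤ Y = nth-≤ (Vec.map code Y) (λ i → subst (λ z → len z ≤ Λ) (sym (Vec.lookup-map i code Y)) (code≤ (lookup Y i)))

  r≢0 : NonZero r
  r≢0 = ℕ.>-nonZero 1≤r

  ^≤ : ∀ {m} → m ≤ k′ → r ^ m ≤ r ^ k′
  ^≤ q = ^-monoʳ-≤ r {{r≢0}} q

  k≤k′ : k ≤ k′
  k≤k′ = m≤n+m k u

  u≤k′ : u ≤ k′
  u≤k′ = m≤m+n u k

  stride≤ : stride ≤ r ^ k′ + 1
  stride≤ = +-monoˡ-≤ 1 (^≤ u≤k′)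

  r≤power : r ≤ r ^ k′ + 1
  r≤power = ≤-trans (≡⇒≤ⁿ (sym (ℕ.^-identityʳ r))) (≤-trans (^≤ (≤-trans (s≤s z≤n) k≤k′)) (m≤m+n _ 1))

  r≤ : len r ≤ Λ
  r≤ = ≤-trans (len-mono r≤power) power≤

  size≤ : len (length inst) ≤ Λ
  size≤ = ≤-trans (≡⇒≤ⁿ (cong len (length-encode X))) r≤

  open ControlRuns inst Λ 1≤Λ size≤ (nth≤ X) public

  index≤ : ∀ (i : Fin r) → len (toℕ i) ≤ Λ
  index≤ i = ≤-trans (len-mono (<⇒≤ (Fin.toℕ<n i))) r≤

  size-mean : ∀ f → mean (range (length inst)) f ≡ mean (allFin r) (f ∘ toℕ)
  size-mean f = trans (cong (λ n → mean (range n) f) (length-encode X)) (trans (mean-range r f) (go r 1≤r f))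
    where
    go : ∀ r → 1 ≤ r → ∀ f → mean (allFin (rng r)) (f ∘ toℕ) ≡ mean (allFin r) (f ∘ toℕ)
    go (suc r) _ f = refl

  sum-eval : ∀ σ {n} (w : Vec (Fin r) n) (Y : Vec Carrier r) f → σ 2 0 ≡ M → (∀ l → eval inst σ (f (toℕ l)) ≡ code (lookup Y (lookup w l))) →
    eval inst σ (sumᴱ f n) ≡ code (sumT w Y)
  sum-eval σ []      Y f m h = sym code-ε
  sum-eval σ (x ∷ w) Y f m h = add-eval inst σ (f 0) _ m (h zero) (sum-eval σ w Y (f ∘ suc) m (h ∘ suc))

  Tuple : ∀ {n} → Vec (Fin r) n → Memory → Set
  Tuple w σ = ∀ l → σ 0 (toℕ l) ≡ toℕ (lookup w l)

  sol-eval : ∀ σ (w : Vec (Fin r) k′) → σ 2 0 ≡ M → Tuple w σ → (Sol w X → 1 ≤ eval inst σ solᴱ) × (¬ Sol w X → eval inst σ solᴱ ≡ 0)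
  sol-eval σ w m t = yes-case , no-case
    where
    D = eval inst σ (distinctᴱ entry k′)
    sum≡ : eval inst σ (sumᴱ (input ∘ entry) k′) ≡ code (sumT w X)
    sum≡ = sum-eval σ w X (input ∘ entry) m (λ l → trans (cong (nth inst) (t l)) (nth-encode X (lookup w l)))
    yes-case : Sol w X → 1 ≤ eval inst σ solᴱ
    yes-case (d , e) = 1≤* (distinct⇐ inst σ w entry t d) (≡⇒≤ⁿ (sym (less-true (s≤s (≡⇒≤ⁿ (trans sum≡ (trans (cong code e) code-ε)))))))
    no-case : ¬ Sol w X → eval inst σ solᴱ ≡ 0
    no-case n with Distinct? w
    ... | yes d = trans (cong (D *_) (less-false (ℕ.n≢0⇒n>0 (λ q → n (d , code-injective (trans (sym sum≡) (trans q (sym code-ε)))))))) (ℕ.*-zeroʳ D)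
    ... | no d  = cong (_* eval inst σ (op less (sumᴱ (input ∘ entry) k′) (lit 1))) (ℕ.n<1⇒n≡0 (≰⇒> (λ q → d (distinct⇒ inst σ w entry t q))))

  bcode : Vec Bool r → ℕ → ℕ
  bcode B = nth (Vec.toList (Vec.map bit B))

  -- The state between rounds; c is the number of the round.
  module _ (limit cnt : ℕ) (B : Vec Bool r) where
    record Ctl (c : ℕ) (σ : Memory) : Set where
      field
        order-cell   : σ 2 0 ≡ M
        stride-cell  : σ 3 0 ≡ stride
        counter-cell : σ 4 0 ≡ c
        limit-cell   : σ 6 0 ≡ limit
        bound-cell   : σ 8 0 ≡ cnt
        shift-cells      : ∀ i → σ 9 i ≡ bcode B i
        small        : Small Λ σ

    Fresh : ℕ → Memory → Set
    Fresh c σ = ∀ a i d → c ≤ d → d < stride → σ (12 + a) (i * stride + d) ≡ 0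

    Inv : ℕ → Memory → Set
    Inv c σ = Ctl c σ × Fresh c σ

    Done : ℕ → Vec (Fin r) k′ → Memory → Set
    Done c w σ = Ctl c σ × Fresh (suc c) σ × Tuple w σ

    module _ (body : Program) (cnt≤ : cnt ≤ r ^ k′ + 1) where
      private
        lp = rounds body

      cnt-len : len cnt ≤ Λ
      cnt-len = ≤-trans (len-mono cnt≤) power≤

      inc-σ : Memory → Memory
      inc-σ σ = update σ 4 0 (σ 4 0 + 1)

      inc-Ctl : ∀ {c σ} → Ctl c σ → c < cnt → Ctl (suc c) (inc-σ σ)
      inc-Ctl {c} {σ} I c< = record
        { order-cell = order-cell ; stride-cell = stride-cell ; counter-cell = e ; limit-cell = limit-cell ; bound-cell = bound-cell
        ; shift-cells = shift-cells
        ; small = update-≤ {P = Control} {σ = σ} {4} {0} {σ 4 0 + 1} (≤-trans (len-mono (≤-trans (≡⇒≤ⁿ e) c<)) cnt-len) small }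
        where
        open Ctl I
        e : σ 4 0 + 1 ≡ suc c
        e = trans (cong (_+ 1) counter-cell) (+-comm c 1)

      κ-round : ℕ
      κ-round = κₛ lp + (2 + (κₛ inc + (κₛ check + 3)))

      enter : ∀ {c σ K} → Ctl c σ → c < cnt → Det inst (lp ∷ K , σ) ((κₛ lp + 1) * Λ) (body ∷ (inc ⨾ check) ∷ lp ∷ K , σ)
      enter {c} {σ} {K} I c< = Det-weaken inst (proof (step· {σ} lp (Ctl.small I) _ ⊞ lit· 1))
        (Det-step inst {lp} (next-loop inst σ (op less (cell 4) (cell 8)) (≡⇒≤ⁿ (sym (less-true (subst₂ _<_ (sym (Ctl.counter-cell I)) (sym (Ctl.bound-cell I)) c<)))))
          (Det-step inst {body ⨾ inc ⨾ check} refl (Det-refl inst)))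

      leave : ∀ {c σ K} → Ctl c σ → cnt ≤ c → Det inst (lp ∷ K , σ) (κₛ lp * Λ) (K , σ)
      leave {c} {σ} I c≥ = Det-weaken inst (≤-trans (≡⇒≤ⁿ (+-identityʳ _)) (ctlCost {σ} lp (Ctl.small I) _))
        (Det-step inst {lp} (next-exit inst σ (op less (cell 4) (cell 8)) (less-false (subst₂ _≤_ (sym (Ctl.bound-cell I)) (sym (Ctl.counter-cell I)) c≥))) (Det-refl inst))

      private
        check-cost : ∀ {σ} → Small Λ σ → stepCost inst check σ ≤ κₛ check * Λ
        check-cost {σ} S = ctlCost {σ} check S solᴱ-loads

      again : ∀ {c w σ K} → Done c w σ → c < cnt → ¬ Sol w X → ∃[ σ′ ] Inv (suc c) σ′ × Det inst ((inc ⨾ check) ∷ lp ∷ K , σ) ((1 + (κₛ inc + (κₛ check + 3))) * Λ) (lp ∷ K , σ′)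
      again {c} {w} {σ} (I , F , t) c< n = inc-σ σ , (I′ , F) , Det-weaken inst
        (proof (lit· 1 ⊞ step· {σ} inc (Ctl.small I) _ ⊞ by {m = κₛ check} (check-cost (Ctl.small I′)) ⊞ below (s≤s z≤n) (lit· 3)))
        (Det-step inst {inc ⨾ check} refl (Det-step inst {inc} refl (Det-step inst {check} (next-false inst (inc-σ σ) solᴱ (proj₂ (sol-eval (inc-σ σ) w (Ctl.order-cell I) t) n)) (Det-step inst {skip} refl (Det-refl inst)))))
        where I′ = inc-Ctl I c<

      found : ∀ {c w σ K} → Done c w σ → c < cnt → Sol w X → ∃[ σ′ ] Tuple w σ′ × Det inst ((inc ⨾ check) ∷ lp ∷ K , σ) ((1 + (κₛ inc + (κₛ check + 3)) + κₛ lp) * Λ) (K , σ′)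
      found {c} {w} {σ} {K} (I , F , t) c< s = σ′ , t , Det-weaken inst
        (proof ((lit· 1 ⊞ step· {σ} inc (Ctl.small I) _ ⊞ by {m = κₛ check} (check-cost (Ctl.small I′)) ⊞ lit· 3) ⊞ step· {σ′} lp small′ _))
        (Det-weaken inst (≡⇒≤ⁿ (arrange 1 (stepCost inst inc σ) (stepCost inst check (inc-σ σ)) (stepCost inst lp σ′)))
        (Det-step inst {inc ⨾ check} refl (Det-step inst {inc} refl (Det-step inst {check} (next-true inst (inc-σ σ) solᴱ (proj₁ (sol-eval (inc-σ σ) w (Ctl.order-cell I) t) s)) (Det-step inst {store 8 (lit 0) (lit 0)} refl
          (Det-step inst {lp} (next-exit inst σ′ (op less (cell 4) (cell 8)) {body ⨾ inc ⨾ check} {K} (less-false {σ′ 4 0} {0} z≤n)) (Det-refl inst)))))))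
        where
        I′ = inc-Ctl I c<
        σ′ = update (inc-σ σ) 8 0 0
        small′ : Small Λ σ′
        small′ = update-≤ {P = Control} {σ = inc-σ σ} {8} {0} {0} z≤n (Ctl.small I′)
        arrange : ∀ a b c d → a + (b + (c + (3 + (d + 0)))) ≡ a + (b + (c + 3)) + d
        arrange = solve-∀

      rounds-cost : ∀ {K} (β : ℕ) (v : ℕ → ℚ) → NonNeg v →
        (∀ n σ → costWithin inst n (K , σ) ≤ℚ v n) →
        (∀ c σ K′ n x → 0ℚ ≤ℚ x → Inv c σ → c < cnt → (∀ w σ′ → Done c w σ′ → costWithin inst n (K′ , σ′) ≤ℚ x) → costWithin inst n (body ∷ K′ , σ) ≤ℚ fromℕ β +ℚ x) →
        ∀ m c σ n → Inv c σ → c + m ≡ cnt → costWithin inst n (lp ∷ K , σ) ≤ℚ fromℕ (m * (κ-round * Λ + β) + κ-round * Λ) +ℚ v n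
      rounds-cost {K} β v v≥0 hK hB = go
        where
        F : ℕ → ℕ
        F m = m * (κ-round * Λ + β) + κ-round * Λ
        go : ∀ m c σ n → Inv c σ → c + m ≡ cnt → costWithin inst n (lp ∷ K , σ) ≤ℚ fromℕ (F m) +ℚ v n
        go zero c σ n (I , _) e = add-cost₁ (κₛ lp * Λ) (F 0) (Det.cost (leave {K = K} I (≡⇒≤ⁿ (trans (sym e) (+-identityʳ c)))) n) (hK n σ)
          (*-monoˡ-≤ Λ (m≤m+n (κₛ lp) (2 + (κₛ inc + (κₛ check + 3)))))
        go (suc m) c σ n (I , fr) e = add-cost₂ a₁ β (a₂ + F m) (F (suc m)) (Det.cost (enter {K = K} I c<) n)
            (hB c σ ((inc ⨾ check) ∷ lp ∷ K) n (fromℕ (a₂ + F m) +ℚ v n) (0≤+ (0≤fromℕ (a₂ + F m)) (v≥0 n)) (I , fr) c< rest)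
            (≡⇒≤ⁿ (eq (κₛ lp) (κₛ inc) (κₛ check) Λ β m))
          where
          c< : c < cnt
          c< = ≤-trans (m≤m+n (suc c) m) (≡⇒≤ⁿ (trans (sym (+-suc c m)) e))
          a₁ = (κₛ lp + 1) * Λ
          a₂ = (1 + (κₛ inc + (κₛ check + 3))) * Λ
          eq : ∀ p i q l b m → let f = m * ((p + (2 + (i + (q + 3)))) * l + b) + (p + (2 + (i + (q + 3)))) * l in
            (p + 1) * l + b + ((1 + (i + (q + 3))) * l + f) ≡ suc m * ((p + (2 + (i + (q + 3)))) * l + b) + (p + (2 + (i + (q + 3)))) * l
          eq = solve-∀
          rest : ∀ w σ′ → Done c w σ′ → costWithin inst n ((inc ⨾ check) ∷ lp ∷ K , σ′) ≤ℚ fromℕ (a₂ + F m) +ℚ v n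
          rest w σ′ d with Sol? w X
          ... | yes s = let (σ″ , _ , D) = found {K = K} d c< s in
            add-cost₁ ((1 + (κₛ inc + (κₛ check + 3)) + κₛ lp) * Λ) (a₂ + F m) (Det.cost D n) (hK n σ″)
              (≤-trans (≡⇒≤ⁿ (*-distribʳ-+ Λ (1 + (κₛ inc + (κₛ check + 3))) (κₛ lp))) (+-monoʳ-≤ a₂ (≤-trans (*-monoˡ-≤ Λ (m≤m+n (κₛ lp) (2 + (κₛ inc + (κₛ check + 3))))) (m≤n+m (κ-round * Λ) (m * (κ-round * Λ + β))))))
          ... | no s  = let (σ″ , I″ , D) = again {K = K} d c< s in
            add-cost₀ a₂ (F m) (Det.cost D n) (go m (suc c) σ″ n I″ (trans (sym (+-suc c m)) e))

      module _ {φ : Memory → ℚ} (φ≥0 : NonNeg φ) (φ-sol : ∀ σ (w : Vec (Fin r) k′) → Tuple w σ → Sol w X → 1ℚ ≤ℚ φ σ)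
               {ℓ : ℚ} (0≤ℓ : 0ℚ ≤ℚ ℓ) (ℓ≤½ : ℓ ≤ℚ ½) where
        open Quadratic ℓ 0≤ℓ ℓ≤½

        rounds-reach : (f : ℚ) → 0ℚ ≤ℚ f → f ≤ℚ 1ℚ →
          (∀ c σ K d → 0ℚ ≤ℚ d → d ≤ℚ 1ℚ → Inv c σ → c < cnt → (∀ w σ′ → Done c w σ′ → Reaches inst φ (K , σ′) (d +ℚ (1ℚ -ℚ d) *ℚ sol w X)) → Reaches inst φ (body ∷ K , σ) (d +ℚ (1ℚ -ℚ d) *ℚ f)) →
          ∀ m c σ → Inv c σ → c + m ≡ cnt → Reaches inst φ (lp ∷ [] , σ) (h⁺ (fromℕ m *ℚ f))
        rounds-reach f 0≤f f≤1 hB zero c σ (I , _) e = Reaches-≤ inst {φ} {lp ∷ [] , σ} (≡⇒≤ (trans (cong h⁺ (ℚ.*-zeroˡ f)) h⁺-zero)) (0 , ℚ.≤-refl)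
        rounds-reach f 0≤f f≤1 hB (suc m) c σ (I , fr) e =
          Reaches-≤ inst {φ} {lp ∷ [] , σ} split (Reaches-det inst φ≥0 (enter I c<) (hB c σ ((inc ⨾ check) ∷ lp ∷ []) d (h⁺≥0 z) (h⁺≤1 z) (I , fr) c< rest))
          where
          z = fromℕ m *ℚ f
          d = h⁺ z
          c< : c < cnt
          c< = ≤-trans (m≤m+n (suc c) m) (≡⇒≤ⁿ (trans (sym (+-suc c m)) e))
          split : h⁺ (fromℕ (suc m) *ℚ f) ≤ℚ d +ℚ (1ℚ -ℚ d) *ℚ f
          split = ℚ.≤-trans (≡⇒≤ (cong h⁺ (trans (cong (_*ℚ f) (fromℕ-+ 1 m)) (trans (ℚ.*-distribʳ-+ f 1ℚ (fromℕ m)) (trans (cong (_+ℚ z) (ℚ.*-identityˡ f)) (ℚ.+-comm f z)))))) (h⁺-step 0≤f f≤1 (0≤* (0≤fromℕ m) 0≤f))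
          rest : ∀ w σ′ → Done c w σ′ → Reaches inst φ ((inc ⨾ check) ∷ lp ∷ [] , σ′) (d +ℚ (1ℚ -ℚ d) *ℚ sol w X)
          rest w σ′ D = [ yes-case , no-case ]′ (toSum (Sol? w X))
            where
            yes-case : Sol w X → Reaches inst φ ((inc ⨾ check) ∷ lp ∷ [] , σ′) (d +ℚ (1ℚ -ℚ d) *ℚ sol w X)
            yes-case s = let (σ″ , t , E) = found {K = []} D c< s in
              Reaches-≤ inst {φ} {(inc ⨾ check) ∷ lp ∷ [] , σ′} (≡⇒≤ (trans (cong (λ y → d +ℚ (1ℚ -ℚ d) *ℚ y) (indicator-true (Sol? w X) s)) (solve 1 (λ d → d :+ (con 1ℚ :- d) :* con 1ℚ := con 1ℚ) refl d)))
                (Reaches-det inst φ≥0 E (0 , φ-sol σ″ w t s))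
            no-case : ¬ Sol w X → Reaches inst φ ((inc ⨾ check) ∷ lp ∷ [] , σ′) (d +ℚ (1ℚ -ℚ d) *ℚ sol w X)
            no-case s = let (σ″ , I″ , E) = again {K = []} D c< s in
              Reaches-≤ inst {φ} {(inc ⨾ check) ∷ lp ∷ [] , σ′} (≡⇒≤ (trans (cong (λ y → d +ℚ (1ℚ -ℚ d) *ℚ y) (indicator-false (Sol? w X) s)) (solve 1 (λ d → d :+ (con 1ℚ :- d) :* con 0ℚ := d) refl d)))
                (Reaches-det inst φ≥0 E (rounds-reach f 0≤f f≤1 hB m (suc c) σ″ I″ (trans (sym (+-suc c m)) e)))

mean-height : (K : List Program) (τ : Memory) (g : ℕ → ℚ) → mean {Config} ((K , τ) ∷ []) (λ c → g (length (proj₁ c))) ≡ g (length K)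
mean-height K τ g = mean-single {Config} (K , τ) (λ c → g (length (proj₁ c)))

next-height : ∀ X s Ks τ (g : ℕ → ℚ) → (∀ {m n} → m ≤ n → g m ≤ℚ g n) → mean (next X s Ks τ) (λ c → g (length (proj₁ c))) ≤ℚ g (2 + length Ks)
next-height X skip           Ks τ g mono = ℚ.≤-trans (≡⇒≤ (mean-height (Ks) (τ) g)) (mono (m≤n+m (length Ks) 2))
next-height X (store a i e)  Ks τ g mono = ℚ.≤-trans (≡⇒≤ (mean-height (Ks) (update τ a (eval X τ i) (eval X τ e)) g)) (mono (m≤n+m (length Ks) 2))
next-height X (random a i e) Ks τ g mono = ℚ.≤-trans (≡⇒≤ (trans (mean-map (range (eval X τ e)) _ (λ c → g (length (proj₁ c)))) (mean-const (range (eval X τ e)) {{range-nonZero (eval X τ e)}} (g (length Ks))))) (mono (m≤n+m (length Ks) 2))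
next-height X (p ⨾ q)        Ks τ g mono = ≡⇒≤ (mean-height (p ∷ q ∷ Ks) (τ) g)
next-height X (branch e p q) Ks τ g mono with eval X τ e
... | zero  = ℚ.≤-trans (≡⇒≤ (mean-height (q ∷ Ks) (τ) g)) (mono (n≤1+n (1 + length Ks)))
... | suc _ = ℚ.≤-trans (≡⇒≤ (mean-height (p ∷ Ks) (τ) g)) (mono (n≤1+n (1 + length Ks)))
next-height X (while e p)    Ks τ g mono with eval X τ e
... | zero  = ℚ.≤-trans (≡⇒≤ (mean-height (Ks) (τ) g)) (mono (m≤n+m (length Ks) 2))
... | suc _ = ≡⇒≤ (mean-height (p ∷ while e p ∷ Ks) (τ) g)

module SimulationCosts (S : Setup) (N : ℕ) (K : List Program) where
  open Setup S
  open Simulation S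
  open SimulationRuns S N K

  rate : ℕ
  rate = (N + dead) * Λ

  private
    split : ∀ N d Λ c L → 1 ≤ c → N * (Λ * c) + d * Λ * (2 + L) ≤ (N + d) * Λ * c + d * Λ * (1 + L)
    split N d Λ c L q = ≤-trans (≡⇒≤ⁿ (e₁ N d Λ c L)) (≤-trans (+-monoˡ-≤ (d * Λ * (1 + L)) (+-monoʳ-≤ (N * Λ * c) (*-monoʳ-≤ (d * Λ) q))) (≡⇒≤ⁿ (e₂ N d Λ c L)))
      where
      e₁ : ∀ N d Λ c L → N * (Λ * c) + d * Λ * (2 + L) ≡ N * Λ * c + d * Λ * 1 + d * Λ * (1 + L)
      e₁ = solve-∀
      e₂ : ∀ N d Λ c L → N * Λ * c + d * Λ * c + d * Λ * (1 + L) ≡ (N + d) * Λ * c + d * Λ * (1 + L)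
      e₂ = solve-∀

  -- A run whose limit bounds the total cost, followed by something cheap.
  limited-cost : ∀ n x → 0ℚ ≤ℚ x → (∀ τ clk σ → Sim σ τ clk → costWithin X n (K , σ) ≤ℚ x) →
    ∀ {Ks τ clk Qs σ} → Related Ks τ clk Qs σ → costWithin X n (Qs ++ K , σ) ≤ℚ fromℕ (rate * (overrun ∸ clk) + dead * Λ * length Ks) +ℚ x
  limited-cost n₀ x 0≤x fin = upper n₀ Ψ Ψ≥0 live deadΨ finΨ n₀ ≤-refl
    where
    P : ℕ → ℕ → ℕ
    P clk L = rate * (overrun ∸ clk) + dead * Λ * L
    Ψ : ℕ → List Program → Memory → ℕ → ℚ
    Ψ n Ks τ clk = fromℕ (P clk (length Ks)) +ℚ x
    Ψ≥0 : ∀ n Ks τ clk → 0ℚ ≤ℚ Ψ n Ks τ clk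
    Ψ≥0 n Ks τ clk = 0≤+ (0≤fromℕ (P clk (length Ks))) 0≤x
    finΨ : ∀ n τ clk σ → n ≤ n₀ → Sim σ τ clk → costWithin X n (K , σ) ≤ℚ Ψ n [] τ clk
    finΨ n τ clk σ le I = ℚ.≤-trans (cost-mono X le (K , σ)) (ℚ.≤-trans (fin τ clk σ I) (≤+ˡ (0≤fromℕ (P clk 0))))
    deadΨ : ∀ n s Ks τ clk → limit < clk → fromℕ (dead * Λ) +ℚ Ψ n Ks τ clk ≤ℚ Ψ n (s ∷ Ks) τ clk
    deadΨ n s Ks τ clk _ = merge-cost (dead * Λ) (P clk (length Ks)) (P clk (suc (length Ks))) ℚ.≤-refl (≡⇒≤ⁿ (eq (dead * Λ) (rate * (overrun ∸ clk)) (length Ks)))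
      where
      eq : ∀ d a L → d + (a + d * L) ≡ a + d * suc L
      eq = solve-∀
    live : ∀ n s Ks τ clk → clk ≤ limit → clk + stepCost X′ s τ ≤ overrun →
       fromℕ (N * (Λ * stepCost X′ s τ)) +ℚ mean (next X′ s Ks τ) (λ (Ks′ , τ′) → Ψ n Ks′ τ′ (clk + stepCost X′ s τ)) ≤ℚ Ψ (suc n) (s ∷ Ks) τ clk
    live n s Ks τ clk _ le = combine (N * (Λ * c)) (P (clk + c) (2 + length Ks)) (P clk (1 + length Ks))
      (next-height X′ s Ks τ (λ L → fromℕ (P (clk + c) L) +ℚ x) (λ {l} {m} q → ℚ.+-monoˡ-≤ x (fromℕ-mono (+-monoʳ-≤ (rate * (overrun ∸ (clk + c))) (*-monoʳ-≤ (dead * Λ) q)))))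
      (≤-trans (≡⇒≤ⁿ (swap (N * (Λ * c)) (rate * (overrun ∸ (clk + c))) (dead * Λ * (2 + length Ks))))
        (≤-trans (+-monoʳ-≤ (rate * (overrun ∸ (clk + c))) (split N dead Λ c (length Ks) (1≤stepCost X′ s τ)))
          (≡⇒≤ⁿ (trans (merge rate (overrun ∸ (clk + c)) c (dead * Λ * (1 + length Ks))) (cong (λ z → rate * z + dead * Λ * (1 + length Ks)) gap)))))
      where
      c = stepCost X′ s τ
      gap : (overrun ∸ (clk + c)) + c ≡ overrun ∸ clk
      gap = trans (cong (_+ c) (sym (ℕ.∸-+-assoc overrun clk c))) (m∸n+n≡m (ℕ.m+n≤o⇒m≤o∸n c (≤-trans (≡⇒≤ⁿ (+-comm c clk)) le)))
      swap : ∀ a b d → a + (b + d) ≡ b + (a + d)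
      swap = solve-∀
      merge : ∀ R o c d → R * o + (R * c + d) ≡ R * (o + c) + d
      merge = solve-∀
      combine : ∀ {m} a b t → m ≤ℚ fromℕ b +ℚ x → a + b ≤ t → fromℕ a +ℚ m ≤ℚ fromℕ t +ℚ x
      combine a b t p q = ℚ.≤-trans (ℚ.+-monoʳ-≤ (fromℕ a) p) (ℚ.≤-trans (≡⇒≤ (fromℕ-merge a b x)) (ℚ.+-monoˡ-≤ x (fromℕ-mono q)))

  -- A run charged to the simulated program, followed by something whose cost
  -- is linear in the clock.
  charged-cost : ∀ n E D₀ → (∀ τ clk σ → Sim σ τ clk → costWithin X n (K , σ) ≤ℚ fromℕ (E * clk + D₀)) →
    ∀ {Ks τ clk Qs σ} → Related Ks τ clk Qs σ →
    costWithin X n (Qs ++ K , σ) ≤ℚ fromℕ (E * clk + dead * Λ * length Ks + D₀) +ℚ fromℕ (E + rate) *ℚ costWithin X′ n (Ks , τ)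
  charged-cost n₀ E D₀ fin {Ks} {τ} {clk} R = ℚ.≤-trans (upper n₀ Ψ Ψ≥0 live deadΨ finΨ n₀ ≤-refl R) (Ψ≤ n₀ Ks τ clk)
    where
    P : ℕ → ℕ → ℕ
    P clk L = E * clk + dead * Λ * L + D₀
    F = fromℕ (E + rate)
    alive : ℕ → ℕ → Config → ℚ
    alive n clk c = indicator (clk ℕ.≤? limit) *ℚ costWithin X′ n c
    Ψ : ℕ → List Program → Memory → ℕ → ℚ
    Ψ n Ks τ clk = fromℕ (P clk (length Ks)) +ℚ F *ℚ alive n clk (Ks , τ)
    alive≥0 : ∀ n clk c → 0ℚ ≤ℚ alive n clk c
    alive≥0 n clk c = 0≤* (0≤indicator (clk ℕ.≤? limit)) (cost-nonNeg X′ n c)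
    alive≤ : ∀ n clk c → alive n clk c ≤ℚ costWithin X′ n c
    alive≤ n clk c = ℚ.≤-trans (*-monoʳ (cost-nonNeg X′ n c) (indicator≤1 (clk ℕ.≤? limit))) (≡⇒≤ (ℚ.*-identityˡ (costWithin X′ n c)))
    Ψ≤ : ∀ n Ks τ clk → Ψ n Ks τ clk ≤ℚ fromℕ (P clk (length Ks)) +ℚ F *ℚ costWithin X′ n (Ks , τ)
    Ψ≤ n Ks τ clk = ℚ.+-monoʳ-≤ (fromℕ (P clk (length Ks))) (*-monoˡ (0≤fromℕ (E + rate)) (alive≤ n clk (Ks , τ)))
    Ψ≥0 : ∀ n Ks τ clk → 0ℚ ≤ℚ Ψ n Ks τ clk
    Ψ≥0 n Ks τ clk = 0≤+ (0≤fromℕ (P clk (length Ks))) (0≤* (0≤fromℕ (E + rate)) (alive≥0 n clk (Ks , τ)))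
    finΨ : ∀ n τ clk σ → n ≤ n₀ → Sim σ τ clk → costWithin X n (K , σ) ≤ℚ Ψ n [] τ clk
    finΨ n τ clk σ le I = ℚ.≤-trans (cost-mono X le (K , σ)) (ℚ.≤-trans (fin τ clk σ I) (ℚ.≤-trans (fromℕ-mono (≡⇒≤ⁿ (eq (E * clk) (dead * Λ) D₀))) (≤+ʳ (0≤* (0≤fromℕ (E + rate)) (alive≥0 n clk ([] , τ))))))
      where
      eq : ∀ a d D → a + D ≡ a + d * 0 + D
      eq = solve-∀
    deadΨ : ∀ n s Ks τ clk → limit < clk → fromℕ (dead * Λ) +ℚ Ψ n Ks τ clk ≤ℚ Ψ n (s ∷ Ks) τ clk
    deadΨ n s Ks τ clk over = merge-cost (dead * Λ) (P clk (length Ks)) (P clk (suc (length Ks)))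
        (≡⇒≤ (cong (F *ℚ_) (trans (gone (Ks , τ)) (sym (gone (s ∷ Ks , τ)))))) (≡⇒≤ⁿ (eq (dead * Λ) (E * clk) (length Ks) D₀))
      where
      gone : ∀ c → alive n clk c ≡ 0ℚ
      gone c = trans (cong (_*ℚ costWithin X′ n c) (indicator-false (clk ℕ.≤? limit) (ℕ.<⇒≱ over))) (ℚ.*-zeroˡ (costWithin X′ n c))
      eq : ∀ d a L D → d + (a + d * L + D) ≡ a + d * suc L + D
      eq = solve-∀
    live : ∀ n s Ks τ clk → clk ≤ limit → clk + stepCost X′ s τ ≤ overrun →
       fromℕ (N * (Λ * stepCost X′ s τ)) +ℚ mean (next X′ s Ks τ) (λ (Ks′ , τ′) → Ψ n Ks′ τ′ (clk + stepCost X′ s τ)) ≤ℚ Ψ (suc n) (s ∷ Ks) τ clk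
    live n s Ks τ clk below _ = combine (N * (Λ * c)) (P (clk + c) (2 + L)) (P clk (1 + L)) ((E + rate) * c) c (≡⇒≤ (fromℕ-* (E + rate) c)) after
        (≤-trans (≡⇒≤ⁿ (e₁ (N * (Λ * c)) E clk c (dead * Λ * (2 + L)) D₀)) (≤-trans (+-monoˡ-≤ (E * clk + E * c + D₀) (split N dead Λ c L (1≤stepCost X′ s τ))) (≡⇒≤ⁿ (e₂ rate E clk c (dead * Λ * (1 + L)) D₀))))
        (trans (cong (_*ℚ costWithin X′ (suc n) (s ∷ Ks , τ)) (indicator-true (clk ℕ.≤? limit) below)) (ℚ.*-identityˡ (costWithin X′ (suc n) (s ∷ Ks , τ))))
      where
      c = stepCost X′ s τ
      L = length Ks
      m = mean (next X′ s Ks τ) (costWithin X′ n)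
      S′ = FinSum-mean (next X′ s Ks τ)
      after : mean (next X′ s Ks τ) (λ (Ks′ , τ′) → Ψ n Ks′ τ′ (clk + c)) ≤ℚ fromℕ (P (clk + c) (2 + L)) +ℚ F *ℚ m
      after = ℚ.≤-trans (mean-mono (next X′ s Ks τ) (λ (Ks′ , τ′) → Ψ≤ n Ks′ τ′ (clk + c)))
        (ℚ.≤-trans (≡⇒≤ (Φ-+ S′ (λ (Ks′ , τ′) → fromℕ (P (clk + c) (length Ks′))) (λ c′ → F *ℚ costWithin X′ n c′)))
          (ℚ.+-mono-≤ (next-height X′ s Ks τ (λ L → fromℕ (P (clk + c) L)) (λ {l} {m} q → fromℕ-mono (+-monoˡ-≤ D₀ (+-monoʳ-≤ (E * (clk + c)) (*-monoʳ-≤ (dead * Λ) q)))))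
            (≡⇒≤ (Φ-*ˡ S′ F (costWithin X′ n)))))
      e₁ : ∀ a E k c d D → a + (E * (k + c) + d + D) ≡ (a + d) + (E * k + E * c + D)
      e₁ = solve-∀
      e₂ : ∀ R E k c d D → (R * c + d) + (E * k + E * c + D) ≡ (E * k + d + D) + (E + R) * c
      e₂ = solve-∀
      combine : ∀ {x y} a b t f c → fromℕ f ≤ℚ F *ℚ fromℕ c → x ≤ℚ fromℕ b +ℚ F *ℚ m → a + b ≤ t + f → y ≡ fromℕ c +ℚ m → fromℕ a +ℚ x ≤ℚ fromℕ t +ℚ F *ℚ y
      combine {x} a b t f c h p q refl = ℚ.≤-trans (ℚ.+-monoʳ-≤ (fromℕ a) p) (ℚ.≤-trans (≡⇒≤ (fromℕ-merge a b (F *ℚ m)))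
        (ℚ.≤-trans (ℚ.+-monoˡ-≤ (F *ℚ m) (fromℕ-mono q)) (ℚ.≤-trans (≡⇒≤ (trans (cong (_+ℚ F *ℚ m) (fromℕ-+ t f)) (ℚ.+-assoc (fromℕ t) (fromℕ f) (F *ℚ m))))
          (ℚ.+-monoʳ-≤ (fromℕ t) (ℚ.≤-trans (ℚ.+-monoˡ-≤ (F *ℚ m) h) (≡⇒≤ (sym (ℚ.*-distribˡ-+ F (fromℕ c) m))))))))

-- The bodies of the two searches

outᴱ-clamp : ℕ → ℕ → ℕ
outᴱ-clamp r x = x * applyOp less x r

clamp : ∀ {r} → 1 ≤ r → ℕ → Fin r
clamp {r} 1≤r x with x ℕ.<? r
... | yes p = fromℕ< p
... | no _  = fromℕ< 1≤r

toℕ-clamp : ∀ {r} (1≤r : 1 ≤ r) x → outᴱ-clamp r x ≡ toℕ (clamp 1≤r x)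
toℕ-clamp {r} 1≤r x with x ℕ.<? r
... | yes p = trans (trans (cong (x *_) (less-true p)) (ℕ.*-identityʳ x)) (sym (Fin.toℕ-fromℕ< p))
... | no p  = trans (trans (cong (x *_) (less-false (≮⇒≥ p))) (ℕ.*-zeroʳ x)) (sym (Fin.toℕ-fromℕ< 1≤r))

clamp-toℕ : ∀ {r} (1≤r : 1 ≤ r) (i : Fin r) → clamp 1≤r (toℕ i) ≡ i
clamp-toℕ {r} 1≤r i with toℕ i ℕ.<? r
... | yes p = Fin.fromℕ<-toℕ i p
... | no p  = contradiction (Fin.toℕ<n i) p

tuple-++ : ∀ {r i n} (f : ℕ → ℕ) (U : Vec (Fin r) i) (v : Vec (Fin r) n) → (∀ l → f (toℕ l) ≡ toℕ (lookup U l)) → (∀ l → f (i + toℕ l) ≡ toℕ (lookup v l)) →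
  ∀ l → f (toℕ l) ≡ toℕ (lookup (U Vec.++ v) l)
tuple-++ f []      v h g l       = g l
tuple-++ f (x ∷ U) v h g zero    = h zero
tuple-++ f (x ∷ U) v h g (suc l) = tuple-++ (f ∘ suc) U v (h ∘ suc) g l

kinOf : Arith → ℕ
kinOf R = 2 + 11 * Arith.kᵃᵈᵈ R

total : (ℕ → ℕ) → ℕ → ℕ → ℕ
total f i zero    = 1
total f i (suc n) = 1 + f i + total f (suc i) n

module AttemptCost (R : Arith) (j u : ℕ) (p : Program) where
  open Programs R j u p

  κfetch : ℕ → ℕ
  κfetch i = (2 + len (suc i)) + Overhead.kᴱ (kinOf R) (outᴱ i) * κ (outᴱ i)

  abstract
    κcopy : ℕ
    κcopy = 1 + (total κfetch 0 k + total (κₛ ∘ put) 0 k)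

    κcopy≡ : κcopy ≡ 1 + (total κfetch 0 k + total (κₛ ∘ put) 0 k)
    κcopy≡ = refl

-- The constants of the clocked program, and room for the longest number that
-- it can write before its limit stops it
Fits : Instance → ℕ → ℕ → Set
Fits I C Nₛ = AllSub (Overhead.D (kinOf arith)) Nₛ p × AllSub κₛ C p
  where open Instance I

Roomy : Instance → ℕ → Set
Roomy I C = len (r ^ k′ + C * (r ^ k′ + Λ)) ≤ Λ
  where open Instance I

module Bodies (I : Instance) (C Nₛ : ℕ) (fits : Fits I C Nₛ) (over≤ : Roomy I C) where
  open Instance I
  open Rounds I
  open AttemptCost arith j u p

  module FillG = Fill 0 (lit k′) size k′ (allFin r) toℕ (λ ()) (λ ()) _ (λ _ → refl) k′≤ M (λ _ _ → size-mean) index≤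
  u≤Λ : len u ≤ Λ
  u≤Λ = ≤-trans (len-mono u≤k′) k′≤
  module FillU = Fill 0 (lit u) size u (allFin r) toℕ (λ ()) (λ ()) _ (λ _ → refl) u≤Λ M (λ _ _ → size-mean) index≤

  guess-cost : ℕ
  guess-cost = 4 * Λ + suc k′ * (κF 0 (lit k′) size * Λ)

  tuples≢0 : ∀ n → NonZero (length (tuples r n))
  tuples≢0 n = allVecs-nonZero (allFin r) {{subst NonZero (sym (length-allFin r)) r≢0}} n

  mean-affine : ∀ {A : Set} (xs : List A) → NonZero (length xs) → ∀ d e f → mean xs (λ x → d +ℚ e *ℚ f x) ≡ d +ℚ e *ℚ mean xs f
  mean-affine xs nz d e f = trans (Φ-+ (FinSum-mean xs) (λ _ → d) (λ x → e *ℚ f x)) (cong₂ _+ℚ_ (mean-const xs {{nz}} d) (Φ-*ˡ (FinSum-mean xs) e f))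

  shifted : Vec Bool r → Vec (Fin r) u → Vec Carrier r
  shifted B U = shift B (sumT U X) X

  outputs : Memory → Vec (Fin r) k
  outputs τ = Vec.tabulate (λ l → clamp 1≤r (τ 0 (toℕ l)))

  module _ {limit cnt : ℕ} {B : Vec Bool r} where
    guess-done : ∀ {c σ} → Inv limit cnt B c σ → ∀ w → Done limit cnt B c w (filled 0 (Vec.map toℕ w) (FillG.σ⁰ σ))
    guess-done {c} {σ} (I₀ , F) w = record
        { order-cell = trans (other 2 0 (λ ()) (λ ())) order-cell ; stride-cell = trans (other 3 0 (λ ()) (λ ())) stride-cell
        ; counter-cell = trans (other 4 0 (λ ()) (λ ())) counter-cell ; limit-cell = trans (other 6 0 (λ ()) (λ ())) limit-cell
        ; bound-cell = trans (other 8 0 (λ ()) (λ ())) bound-cell ; shift-cells = λ i → trans (other 9 i (λ ()) (λ ())) (shift-cells i)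
        ; small = FillG.Filled.small σ small w }
      , (λ a i d p q → trans (other (12 + a) (i * stride + d) (λ ()) (λ ())) (F a i d (≤-trans (n≤1+n c) p) q))
      , at
      where
      open Ctl I₀
      open FillG.Filled σ small w using (at; other)

    guess-body-cost : ∀ c σ K n x → 0ℚ ≤ℚ x → Inv limit cnt B c σ → c < cnt → (∀ w σ′ → Done limit cnt B c w σ′ → costWithin inst n (K , σ′) ≤ℚ x) →
      costWithin inst n (guess ∷ K , σ) ≤ℚ fromℕ guess-cost +ℚ x
    guess-body-cost c σ K n x 0≤x I₀ _ h = ℚ.≤-trans (Run.cost R n) (ℚ.+-monoʳ-≤ (fromℕ guess-cost)
        (ℚ.≤-trans (mean-mono (tuples r k′) (λ w → h w (filled 0 (Vec.map toℕ w) (FillG.σ⁰ σ)) (guess-done I₀ w))) (mean-const-≤ (tuples r k′) 0≤x)))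
      where R = FillG.fillRun σ K (Ctl.order-cell (proj₁ I₀)) (Ctl.small (proj₁ I₀))

    guess-body-reach : ∀ {φ} → NonNeg φ → ∀ c σ K d → 0ℚ ≤ℚ d → d ≤ℚ 1ℚ → Inv limit cnt B c σ → c < cnt →
      (∀ w σ′ → Done limit cnt B c w σ′ → Reaches inst φ (K , σ′) (d +ℚ (1ℚ -ℚ d) *ℚ sol w X)) →
      Reaches inst φ (guess ∷ K , σ) (d +ℚ (1ℚ -ℚ d) *ℚ mean (tuples r k′) (λ w → sol w X))
    guess-body-reach {φ} φ≥0 c σ K d _ _ I₀ _ h = Reaches-≤ inst {φ} {guess ∷ K , σ} (≡⇒≤ (sym (mean-affine (tuples r k′) (tuples≢0 k′) d (1ℚ -ℚ d) (λ w → sol w X))))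
      (Reaches-run inst (λ w → d +ℚ (1ℚ -ℚ d) *ℚ sol w X) φ≥0 R (λ w → h w _ (guess-done I₀ w)))
      where R = FillG.fillRun σ K (Ctl.order-cell (proj₁ I₀)) (Ctl.small (proj₁ I₀))

    module Attempt (limit≤ : limit ≤ r ^ k′) (cnt≡ : cnt ≡ stride) {c : ℕ} {σ₀ : Memory} (I₀ : Inv limit cnt B c σ₀) (c< : c < cnt) (U : Vec (Fin r) u) where
      open Ctl (proj₁ I₀)
      open FillU.Filled σ₀ small U renaming (small to small₁)
      s : Carrier
      s = sumT U X
      σ₁ σ₂ σ₃ : Memory
      σ₁ = σᶠ
      σ₂ = update σ₁ 7 0 (eval inst σ₁ (sumᴱ (input ∘ entry) u))
      σ₃ = update σ₂ 5 0 0

      m₁ : σ₁ 2 0 ≡ M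
      m₁ = trans (other 2 0 (λ ()) (λ ())) order-cell

      s-eval : eval inst σ₁ (sumᴱ (input ∘ entry) u) ≡ code s
      s-eval = sum-eval σ₁ U X (input ∘ entry) m₁ (λ l → trans (cong (nth inst) (at l)) (nth-encode X (lookup U l)))

      small₂ : Small Λ σ₂
      small₂ = update-≤ {P = Control} {σ = σ₁} {7} {0} {eval inst σ₁ (sumᴱ (input ∘ entry) u)} (≤-trans (≡⇒≤ⁿ (cong len s-eval)) (code≤ s)) small₁

      small₃ : Small Λ σ₃
      small₃ = update-≤ {P = Control} {σ = σ₂} {5} {0} {0} z≤n small₂

      Y : Vec Carrier r
      Y = shifted B U

      cells : ∀ b j → 0 ≢ b → 11 ≢ b → 7 ≢ b → 5 ≢ b → σ₃ b j ≡ σ₀ b j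
      cells b j n₀ n₁₁ n₇ n₅ = trans (update-array σ₂ 5 0 0 b j n₅) (trans (update-array σ₁ 7 0 _ b j n₇) (other b j n₀ n₁₁))

      inp-eval′ : ∀ σ′ → (∀ b j → Frozen b → σ′ b j ≡ σ₃ b j) → ∀ e → eval inst σ′ (inp₂ e) ≡ nth (encode G Y) (eval inst σ′ e)
      inp-eval′ σ′ fr e = go (eval inst σ′ e) refl
        where
        m′ : σ′ 2 0 ≡ M
        m′ = trans (fr 2 0 tt) m₁
        b′ : ∀ i → σ′ 9 i ≡ bcode B i
        b′ i = trans (fr 9 i tt) (trans (other 9 i (λ ()) (λ ())) (shift-cells i))
        s′ : σ′ 7 0 ≡ code s
        s′ = trans (fr 7 0 tt) s-eval
        scaled : ∀ b → bit b * code s ≡ code (if b then s else ε)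
        scaled true  = +-identityʳ (code s)
        scaled false = sym code-ε
        go : ∀ i → eval inst σ′ e ≡ i → eval inst σ′ (inp₂ e) ≡ nth (encode G Y) (eval inst σ′ e)
        go i h with i ℕ.<? r
        ... | yes q = trans (add-eval inst σ′ (input e) (op mul (load 9 e) (cell 7)) {lookup X l} {if lookup B l then s else ε} m′
                (trans (cong (nth inst) h′) (nth-encode X l))
                (trans (cong₂ _*_ (trans (b′ (eval inst σ′ e)) (trans (cong (bcode B) h′) (trans (nth-lookup (Vec.map bit B) l) (Vec.lookup-map l bit B)))) s′) (scaled (lookup B l))))
              (trans (cong code (sym (lookup-shift B s X l))) (trans (sym (nth-encode Y l)) (cong (nth (encode G Y)) (sym h′))))
          where
          l = fromℕ< q
          h′ : eval inst σ′ e ≡ toℕ l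
          h′ = trans h (sym (Fin.toℕ-fromℕ< q))
        ... | no q  = trans (add-eval inst σ′ (input e) (op mul (load 9 e) (cell 7)) {ε} {ε} m′
                (trans (trans (cong (nth inst) h) (nth-beyond (Vec.map code X) i (≮⇒≥ q))) (sym code-ε))
                (trans (cong₂ _*_ (trans (b′ (eval inst σ′ e)) (trans (cong (bcode B) h) (nth-beyond (Vec.map bit B) i (≮⇒≥ q)))) s′) (sym code-ε)))
              (trans (trans (cong code (ε-idˡ ε)) code-ε) (sym (trans (cong (nth (encode G Y)) h) (nth-beyond (Vec.map code Y) i (≮⇒≥ q)))))

      inp-cost′ : ∀ σ′ → (∀ b j → Frozen b → σ′ b j ≡ σ₃ b j) → Small Λ σ′ → ∀ e → expCost inst σ′ (inp₂ e) ≤ kinOf arith * (Λ + expCost inst σ′ e)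
      inp-cost′ σ′ fr S e = ≤-trans (add-cost inst σ′ Λ (input e) (op mul (load 9 e) (cell 7)) 1≤Λ (S 2 0 tt)) (≤-trans (*-monoʳ-≤ kᵃᵈᵈ inner)
          (≤-trans (≡⇒≤ⁿ (assoc kᵃᵈᵈ (Λ + ce))) (*-monoˡ-≤ (Λ + ce) (m≤n+m (11 * kᵃᵈᵈ) 2))))
        where
        ce = expCost inst σ′ e
        assoc : ∀ k x → k * (11 * x) ≡ 11 * k * x
        assoc = solve-∀
        inner : Λ + (suc (len (nth inst (eval inst σ′ e)) + ce) + suc (len (σ′ 9 (eval inst σ′ e) * σ′ 7 0) + (suc (len (σ′ 9 (eval inst σ′ e)) + ce) + suc (len (σ′ 7 0) + 1)))) ≤ 11 * (Λ + ce)
        inner = ≤-trans (+-monoʳ-≤ Λ (+-mono-≤ (s≤s (+-monoˡ-≤ ce (nth≤ X _))) (s≤s (+-mono-≤ (≤-trans (len-* (σ′ 9 (eval inst σ′ e)) (σ′ 7 0)) (+-mono-≤ (S 9 _ tt) (S 7 0 tt))) (+-mono-≤ (s≤s (+-monoˡ-≤ ce (S 9 _ tt))) (s≤s (+-monoˡ-≤ 1 (S 7 0 tt))))))))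
          (≤-trans (≡⇒≤ⁿ (e₁ Λ ce)) (≤-trans (+-monoʳ-≤ (6 * Λ + 2 * ce) (*-monoʳ-≤ 5 1≤Λ)) (≤-trans (m≤m+n _ (9 * ce)) (≡⇒≤ⁿ (e₂ Λ ce)))))
          where
          e₁ : ∀ l c → l + (suc (l + c) + suc (l + l + (suc (l + c) + suc (l + 1)))) ≡ 6 * l + 2 * c + 5 * 1
          e₁ = solve-∀
          e₂ : ∀ l c → 6 * l + 2 * c + 5 * l + 9 * c ≡ 11 * (l + c)
          e₂ = solve-∀

      setup : Setup
      setup = record
        { inp = inp₂ ; X = inst ; X′ = encode G Y ; σ₀ = σ₃ ; stride = stride ; this = c ; limit = limit ; Λ = Λ ; C = C ; kin = kinOf arith
        ; 1≤Λ = 1≤Λ ; this< = subst (c <_) cnt≡ c<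
        ; stride≡ = trans (cells 3 0 (λ ()) (λ ()) (λ ()) (λ ())) stride-cell ; this≡ = trans (cells 4 0 (λ ()) (λ ()) (λ ()) (λ ())) counter-cell
        ; limit≡ = trans (cells 6 0 (λ ()) (λ ()) (λ ()) (λ ())) limit-cell
        ; size≡ = trans (length-encode X) (sym (length-encode Y)) ; size≤ = size≤ ; input≤ = nth≤ X ; input≤′ = nth≤ Y
        ; overrun≤ = ≤-trans (len-mono (+-mono-≤ limit≤ (*-monoʳ-≤ C (+-monoˡ-≤ Λ limit≤)))) over≤
        ; inp-eval = inp-eval′ ; inp-cost = inp-cost′ }

      open Setup setup using (overrun; View; module View; module Expressions)
      open Simulation setup using (Sim; module Sim; View-ctl; []; tr)

      start : ∀ {K} → let open SimulationRuns setup Nₛ K in Related (p ∷ []) emptyMemory 0 (C₂.T⟦ p ⟧ ∷ []) σ₃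
      start = tr fits [] , record
        { view = record
          { mem = λ a i → trans (cells (12 + a) _ (λ ()) (λ ()) (λ ()) (λ ())) (proj₂ I₀ a i c ≤-refl (subst (c <_) cnt≡ c<))
          ; others = λ _ _ _ _ _ → refl ; ctl = λ _ _ _ → refl ; small = small₃ }
        ; clock = refl ; bits = λ _ _ → z≤n ; bound = z≤n }

      module Copy {σ τ clk} (S : Sim σ τ clk) where
        W : ℕ
        W = Λ * (clk + Λ)

        1≤W : 1 ≤ W
        1≤W = 1≤* 1≤Λ (≤-trans 1≤Λ (m≤n+m Λ clk))

        fetch-eval : ∀ {σ} → Sim σ τ clk → ∀ i → eval inst σ C₂.⟦ outᴱ i ⟧ ≡ toℕ (clamp 1≤r (τ 0 i))
        fetch-eval {σ} S i = trans (Expressions.⟦⟧-eval (Sim.view S) (outᴱ i)) (trans (cong (outᴱ-clamp′ i) (length-encode Y)) (toℕ-clamp 1≤r (τ 0 i)))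
          where
          outᴱ-clamp′ : ℕ → ℕ → ℕ
          outᴱ-clamp′ i r = τ 0 i * applyOp less (τ 0 i) r

        fetch-cost : ∀ {σ} → Sim σ τ clk → ∀ i → stepCost inst (fetch i) σ ≤ κfetch i * W
        fetch-cost {σ} S i = ≤-trans (+-mono-≤ {2 + (len (suc i) + 0)} (≤-trans (≡⇒≤ⁿ (cong (λ z → 2 + z) (+-identityʳ (len (suc i))))) (≤*ʳ 1≤W))
            (≤-trans (Expressions.⟦⟧-cost (Sim.view S) (outᴱ i)) (≤-trans (*-monoʳ-≤ (Setup.kᴱ setup (outᴱ i)) (*-monoʳ-≤ Λ expr)) (≡⇒≤ⁿ (eq (Setup.kᴱ setup (outᴱ i)) Λ (κ (outᴱ i)) (clk + Λ))))))
            (≡⇒≤ⁿ (sym (*-distribʳ-+ W (2 + len (suc i)) (Setup.kᴱ setup (outᴱ i) * κ (outᴱ i)))))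
          where
          expr : expCost (encode G Y) τ (outᴱ i) ≤ κ (outᴱ i) * (clk + Λ)
          expr = cost≤κ {P = λ _ → ⊤} {X = encode G Y} {σ = τ} {L = clk + Λ} (≤-trans 1≤Λ (m≤n+m Λ clk))
            (≤-trans (≡⇒≤ⁿ (cong len (length-encode Y))) (≤-trans r≤ (m≤n+m Λ clk))) (λ i → ≤-trans (nth≤ Y i) (m≤n+m Λ clk))
            (λ a i _ → ≤-trans (Sim.bits S a i) (m≤m+n clk Λ)) (outᴱ i) (LoadsAny (outᴱ i))
          eq : ∀ k l x y → k * (l * (x * y)) ≡ k * x * (l * y)
          eq = solve-∀

        fetched : ℕ → ℕ → Memory → Memory
        fetched i zero    σ = σ
        fetched i (suc n) σ = fetched (suc i) n (update σ 1 (suc i) (eval inst σ C₂.⟦ outᴱ i ⟧))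

        fetched-sim : ∀ i n {σ} → Sim σ τ clk → Sim (fetched i n σ) τ clk
        fetched-step : ∀ i {σ} → Sim σ τ clk → Sim (update σ 1 (suc i) (eval inst σ C₂.⟦ outᴱ i ⟧)) τ clk
        fetched-step i {σ} S = record { view = View-ctl 1 (suc i) (inj₁ refl) (Sim.view S) (≤-trans (≡⇒≤ⁿ (cong len (fetch-eval S i))) (index≤ (clamp 1≤r (τ 0 i)))) ; clock = Sim.clock S ; bits = Sim.bits S ; bound = Sim.bound S }
        fetched-sim i zero    S = S
        fetched-sim i (suc n) S = fetched-sim (suc i) n (fetched-step i S)

        fetched-other : ∀ i n σ b l → 1 ≢ b → fetched i n σ b l ≡ σ b l
        fetched-other i zero    σ b l q = refl
        fetched-other i (suc n) σ b l q = trans (fetched-other (suc i) n _ b l q) (update-array σ 1 (suc i) _ b l q)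

        fetched-out : ∀ i n σ l → l < suc i → fetched i n σ 1 l ≡ σ 1 l
        fetched-out i zero    σ l q = refl
        fetched-out i (suc n) σ l q = trans (fetched-out (suc i) n _ l (m≤n⇒m≤1+n q)) (update-≢ σ 1 (suc i) _ 1 l (inj₂ (λ e → <-irrefl (sym e) q)))

        fetched-in : ∀ i n {σ} → Sim σ τ clk → ∀ (l : Fin n) → fetched i n σ 1 (suc (i + toℕ l)) ≡ toℕ (clamp 1≤r (τ 0 (i + toℕ l)))
        fetched-in i (suc n) {σ} S zero    = trans (cong (λ z → fetched i (suc n) σ 1 (suc z)) (+-identityʳ i))
          (trans (fetched-out (suc i) n _ (suc i) (s≤s ≤-refl)) (trans (update-≡ σ 1 (suc i) _) (trans (fetch-eval S i) (cong (λ z → toℕ (clamp 1≤r (τ 0 z))) (sym (+-identityʳ i))))))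
        fetched-in i (suc n) {σ} S (suc l) = trans (cong (λ z → fetched i (suc n) σ 1 (suc z)) (+-suc i (toℕ l)))
          (trans (fetched-in (suc i) n (fetched-step i S) l) (cong (λ z → toℕ (clamp 1≤r (τ 0 z))) (sym (+-suc i (toℕ l)))))

        fetch-det : ∀ i n {σ} K → Sim σ τ clk → Det inst (seq fetch i n ∷ K , σ) (total κfetch i n * W) (K , fetched i n σ)
        fetch-det i zero    {σ} K S = Det-weaken inst (+-mono-≤ 1≤W z≤n) (Det-step inst {skip} refl (Det-refl inst))
        fetch-det i (suc n) {σ} K S = Det-weaken inst (≤-trans (+-mono-≤ 1≤W (+-monoˡ-≤ _ (fetch-cost S i))) (≡⇒≤ⁿ (eq (κfetch i) (total κfetch (suc i) n) W)))
          (Det-step inst {seq fetch i (suc n)} refl (Det-step inst {fetch i} refl (fetch-det (suc i) n K (fetched-step i S))))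
          where
          eq : ∀ a b w → w + (a * w + b * w) ≡ (1 + a + b) * w
          eq = solve-∀

        placed : ℕ → ℕ → Memory → Memory
        placed i zero    σ = σ
        placed i (suc n) σ = placed (suc i) n (update σ 0 (u + i) (σ 1 (suc i)))

        placed-other : ∀ i n σ b l → 0 ≢ b → placed i n σ b l ≡ σ b l
        placed-other i zero    σ b l q = refl
        placed-other i (suc n) σ b l q = trans (placed-other (suc i) n _ b l q) (update-array σ 0 (u + i) _ b l q)

        placed-out : ∀ i n σ l → l < u + i → placed i n σ 0 l ≡ σ 0 l
        placed-out i zero    σ l q = refl
        placed-out i (suc n) σ l q = trans (placed-out (suc i) n _ l (≤-trans q (+-monoʳ-≤ u (n≤1+n i)))) (update-≢ σ 0 (u + i) _ 0 l (inj₂ (λ e → <-irrefl (sym e) q)))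

        placed-in : ∀ i n σ (l : Fin n) → placed i n σ 0 (u + (i + toℕ l)) ≡ σ 1 (suc (i + toℕ l))
        placed-in i (suc n) σ zero    = trans (cong (λ z → placed i (suc n) σ 0 (u + z)) (+-identityʳ i))
          (trans (placed-out (suc i) n _ (u + i) (ℕ.+-monoʳ-< u ≤-refl)) (trans (update-≡ σ 0 (u + i) _) (cong (λ z → σ 1 (suc z)) (sym (+-identityʳ i)))))
        placed-in i (suc n) σ (suc l) = trans (cong (λ z → placed i (suc n) σ 0 (u + z)) (+-suc i (toℕ l)))
          (trans (placed-in (suc i) n _ l) (cong (λ z → σ 1 (suc z)) (sym (+-suc i (toℕ l)))))

        placed-small : ∀ i n σ → Small Λ σ → Small Λ (placed i n σ)
        placed-small i zero    σ S = S
        placed-small i (suc n) σ S = placed-small (suc i) n _ (update-≤ {P = Control} {σ = σ} {0} {u + i} {σ 1 (suc i)} (S 1 (suc i) tt) S)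

        put-det : ∀ i n {σ} K → Small Λ σ → Det inst (seq put i n ∷ K , σ) (total (κₛ ∘ put) i n * W) (K , placed i n σ)
        put-det i zero    {σ} K S = Det-weaken inst (+-mono-≤ 1≤W z≤n) (Det-step inst {skip} refl (Det-refl inst))
        put-det i (suc n) {σ} K S = Det-weaken inst (≤-trans (+-mono-≤ 1≤W (+-monoˡ-≤ _ (≤-trans (ctlCost {σ} (put i) S _) (*-monoʳ-≤ (κₛ (put i)) (≤*ʳ {Λ} {clk + Λ} (≤-trans 1≤Λ (m≤n+m Λ clk))))))) (≡⇒≤ⁿ (eq (κₛ (put i)) (total (κₛ ∘ put) (suc i) n) W)))
          (Det-step inst {seq put i (suc n)} refl (Det-step inst {put i} refl (put-det (suc i) n K (update-≤ {P = Control} {σ = σ} {0} {u + i} {σ 1 (suc i)} (S 1 (suc i) tt) S))))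
          where
          eq : ∀ a b w → w + (a * w + b * w) ≡ (1 + a + b) * w
          eq = solve-∀

        σᵉ : Memory
        σᵉ = placed 0 k (fetched 0 k σ)

        copy-det : ∀ K → Det inst ((seq fetch 0 k ⨾ seq put 0 k) ∷ K , σ) (κcopy * W) (K , σᵉ)
        copy-det K = Det-weaken inst (≤-trans (+-monoˡ-≤ _ 1≤W) (≡⇒≤ⁿ (trans (eq (total κfetch 0 k) (total (κₛ ∘ put) 0 k) W) (cong (_* W) (sym κcopy≡)))))
          (Det-step inst {seq fetch 0 k ⨾ seq put 0 k} refl (Det-trans inst (fetch-det 0 k (seq put 0 k ∷ K) S) (put-det 0 k K (Sim.small (fetched-sim 0 k S)))))
          where
          eq : ∀ a b w → w + (a * w + b * w) ≡ (1 + (a + b)) * w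
          eq = solve-∀

        copied-other : ∀ b l → 0 ≢ b → 1 ≢ b → σᵉ b l ≡ σ b l
        copied-other b l q₀ q₁ = trans (placed-other 0 k (fetched 0 k σ) b l q₀) (fetched-other 0 k σ b l q₁)

        kept : ∀ b l → Frozen b → 0 ≢ b → 1 ≢ b → 11 ≢ b → 7 ≢ b → 5 ≢ b → σᵉ b l ≡ σ₀ b l
        kept b l fz q₀ q₁ q₁₁ q₇ q₅ = trans (copied-other b l q₀ q₁) (trans (Sim.ctl S b l fz) (cells b l q₀ q₁₁ q₇ q₅))

        copy-done : Done limit cnt B c (U Vec.++ outputs τ) σᵉ
        copy-done = record
            { order-cell = trans (kept 2 0 tt (λ ()) (λ ()) (λ ()) (λ ()) (λ ())) order-cell
            ; stride-cell = trans (kept 3 0 tt (λ ()) (λ ()) (λ ()) (λ ()) (λ ())) stride-cell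
            ; counter-cell = trans (kept 4 0 tt (λ ()) (λ ()) (λ ()) (λ ()) (λ ())) counter-cell
            ; limit-cell = trans (kept 6 0 tt (λ ()) (λ ()) (λ ()) (λ ()) (λ ())) limit-cell
            ; bound-cell = trans (kept 8 0 tt (λ ()) (λ ()) (λ ()) (λ ()) (λ ())) bound-cell
            ; shift-cells = λ i → trans (kept 9 i tt (λ ()) (λ ()) (λ ()) (λ ()) (λ ())) (shift-cells i)
            ; small = placed-small 0 k (fetched 0 k σ) (Sim.small (fetched-sim 0 k S)) }
          , (λ a i d q q′ → trans (copied-other (12 + a) (i * stride + d) (λ ()) (λ ())) (trans (Sim.others S a i d q′ (λ e → <-irrefl (sym e) q))
              (trans (cells (12 + a) (i * stride + d) (λ ()) (λ ()) (λ ()) (λ ())) (proj₂ I₀ a i d (≤-trans (n≤1+n c) q) q′))))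
          , tuple-++ (σᵉ 0) U (outputs τ)
              (λ l → trans (placed-out 0 k (fetched 0 k σ) (toℕ l) (≤-trans (Fin.toℕ<n l) (m≤m+n u 0))) (trans (fetched-other 0 k σ 0 (toℕ l) (λ ())) (trans (Sim.ctl S 0 (toℕ l) tt) (at l))))
              (λ l → trans (placed-in 0 k (fetched 0 k σ) l) (trans (fetched-in 0 k S l) (cong toℕ (sym (Vec.lookup∘tabulate (λ l → clamp 1≤r (τ 0 (toℕ l))) l)))))

      prepare : ∀ K → Det inst ((shiftBy ⨾ resetClock ⨾ C₂.T⟦ p ⟧ ⨾ seq fetch 0 k ⨾ seq put 0 k) ∷ K , σ₁) ((κₛ shiftBy + 6) * Λ) (C₂.T⟦ p ⟧ ∷ (seq fetch 0 k ⨾ seq put 0 k) ∷ K , σ₃)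
      prepare K = Det-weaken inst (≤-trans (≡⇒≤ⁿ (eq (stepCost inst shiftBy σ₁))) (proof (step· {σ₁} shiftBy small₁ (tt , sum-loads tt (λ i → tt , tt) u) ⊞ lit· 6)))
        (Det-step inst {shiftBy ⨾ resetClock ⨾ C₂.T⟦ p ⟧ ⨾ seq fetch 0 k ⨾ seq put 0 k} refl (Det-step inst {shiftBy} refl
          (Det-step inst {resetClock ⨾ C₂.T⟦ p ⟧ ⨾ seq fetch 0 k ⨾ seq put 0 k} refl (Det-step inst {resetClock} refl (Det-step inst {C₂.T⟦ p ⟧ ⨾ seq fetch 0 k ⨾ seq put 0 k} refl (Det-refl inst))))))
        where
        eq : ∀ a → 1 + (a + (1 + (3 + (1 + 0)))) ≡ a + 6
        eq = solve-∀

      run-cost : ∀ K n x → 0ℚ ≤ℚ x → (∀ w σ′ → Done limit cnt B c w σ′ → costWithin inst n (K , σ′) ≤ℚ x) →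
        costWithin inst n (C₂.T⟦ p ⟧ ∷ (seq fetch 0 k ⨾ seq put 0 k) ∷ K , σ₃) ≤ℚ fromℕ ((Nₛ + dead) * Λ * overrun + dead * Λ * 1) +ℚ (fromℕ (κcopy * (Λ * (overrun + Λ))) +ℚ x)
      run-cost K n x 0≤x h = SimulationCosts.limited-cost setup Nₛ ((seq fetch 0 k ⨾ seq put 0 k) ∷ K) n (fromℕ D +ℚ x) (0≤+ (0≤fromℕ D) 0≤x)
          (λ τ clk σ S → add-cost₁ (κcopy * (Λ * (clk + Λ))) D (Det.cost (Copy.copy-det S K) n) (h (U Vec.++ outputs τ) (Copy.σᵉ S) (Copy.copy-done S)) (*-monoʳ-≤ κcopy (*-monoʳ-≤ Λ (+-monoˡ-≤ Λ (Sim.bound S)))))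
          (start {(seq fetch 0 k ⨾ seq put 0 k) ∷ K})
        where
        D = κcopy * (Λ * (overrun + Λ))

      won : ℕ → ℚ
      won n = outcome (encode G Y) n 0 (p ∷ [] , emptyMemory) (λ (τ , t) → sol (U Vec.++ outputs τ) X *ℚ indicator (t ℕ.≤? limit))

      run-reach : ∀ {φ} → NonNeg φ → ∀ K d → d ≤ℚ 1ℚ → ∀ n →
        (∀ w σ′ → Done limit cnt B c w σ′ → Reaches inst φ (K , σ′) (d +ℚ (1ℚ -ℚ d) *ℚ sol w X)) →
        Reaches inst φ (C₂.T⟦ p ⟧ ∷ (seq fetch 0 k ⨾ seq put 0 k) ∷ K , σ₃) (d +ℚ (1ℚ -ℚ d) *ℚ won n)
      run-reach {φ} φ≥0 K d d≤1 n h = Reaches-≤ inst {φ} {C₂.T⟦ p ⟧ ∷ (seq fetch 0 k ⨾ seq put 0 k) ∷ K , σ₃}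
          (clocked-terminates (encode G Y) limit (λ τ → sol (U Vec.++ outputs τ) X) d (λ τ → 0≤sol (U Vec.++ outputs τ) X) d≤1 n (suc limit) 0 (p ∷ [] , emptyMemory) (s≤s (≡⇒≤ⁿ (sym (+-identityʳ limit)))))
          (SimulationRuns.lower setup Nₛ ((seq fetch 0 k ⨾ seq put 0 k) ∷ K) φ≥0 (λ τ _ → d +ℚ (1ℚ -ℚ d) *ℚ sol (U Vec.++ outputs τ) X) d
            (λ τ clk σ S _ → Reaches-det inst φ≥0 (Copy.copy-det S K) (h (U Vec.++ outputs τ) (Copy.σᵉ S) (Copy.copy-done S)))
            (λ τ clk σ S _ → Reaches-≤ inst {φ} {(seq fetch 0 k ⨾ seq put 0 k) ∷ K , σ} (≤+ʳ (0≤* (diff≥0 d≤1) (0≤sol (U Vec.++ outputs τ) X))) (Reaches-det inst φ≥0 (Copy.copy-det S K) (h (U Vec.++ outputs τ) (Copy.σᵉ S) (Copy.copy-done S))))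
            (suc limit) (start {(seq fetch 0 k ⨾ seq put 0 k) ∷ K}))

-- Searching after the measurement

∑-mean : ∀ r n (f : Vec (Fin r) n → ℚ) → NonZero r → fromℕ (r ^ n) *ℚ mean (tuples r n) f ≡ ∑ (tuples r n) f
∑-mean r n f r≢0 = begin
  fromℕ (r ^ n) *ℚ mean (tuples r n) f ≡⟨ cong (fromℕ (r ^ n) *ℚ_) (trans (mean-∑ (tuples r n) f) (cong (λ l → inv l *ℚ ∑ (tuples r n) f) (trans (length-allVecs (allFin r) n) (cong (_^ n) (length-allFin r))))) ⟩
  fromℕ (r ^ n) *ℚ (inv (r ^ n) *ℚ ∑ (tuples r n) f) ≡⟨ sym (ℚ.*-assoc (fromℕ (r ^ n)) (inv (r ^ n)) (∑ (tuples r n) f)) ⟩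
  fromℕ (r ^ n) *ℚ inv (r ^ n) *ℚ ∑ (tuples r n) f ≡⟨ cong (_*ℚ ∑ (tuples r n) f) (fromℕ*inv (r ^ n) {{m^n≢0 r n {{r≢0}}}}) ⟩
  1ℚ *ℚ ∑ (tuples r n) f ≡⟨ ℚ.*-identityˡ _ ⟩
  ∑ (tuples r n) f ∎
  where open ≡-Reasoning

module Searches (I : Instance) (C Nₛ : ℕ) (fits : Fits I C Nₛ) (over≤ : Roomy I C) where
  open Instance I
  open Rounds I
  open AttemptCost arith j u p
  open Bodies I C Nₛ fits over≤

  attempt-cost : ℕ → ℕ
  attempt-cost limit = 1 + fill-cost + ((κₛ shiftBy + 6) * Λ + (((Nₛ + dead) * Λ * over + dead * Λ * 1) + κcopy * (Λ * (over + Λ))))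
    where
    fill-cost = 4 * Λ + suc u * (κF 0 (lit u) size * Λ)
    over = limit + C * (limit + Λ)

  module _ {limit : ℕ} {B : Vec Bool r} (limit≤ : limit ≤ r ^ k′) where
    private
      rest : Program
      rest = shiftBy ⨾ resetClock ⨾ C₂.T⟦ p ⟧ ⨾ seq fetch 0 k ⨾ seq put 0 k

      open-attempt : ∀ {σ K} → Det inst (attempt ∷ K , σ) 1 (fill 0 (lit u) size ∷ rest ∷ K , σ)
      open-attempt {σ} {K} = Det-step inst {attempt} refl (Det-refl inst)

    attempt-body-cost : ∀ c σ K n x → 0ℚ ≤ℚ x → Inv limit stride B c σ → c < stride → (∀ w σ′ → Done limit stride B c w σ′ → costWithin inst n (K , σ′) ≤ℚ x) →
      costWithin inst n (attempt ∷ K , σ) ≤ℚ fromℕ (attempt-cost limit) +ℚ x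
    attempt-body-cost c σ K n x 0≤x I₀ c< h = ℚ.≤-trans (Det.cost (open-attempt {σ} {K}) n) (finish 1 fc rest-cost (ℚ.≤-trans (Run.cost R n)
          (ℚ.+-monoʳ-≤ (fromℕ fc) (ℚ.≤-trans (mean-mono (tuples r u) each) (mean-const-≤ (tuples r u) (0≤+ (0≤fromℕ rest-cost) 0≤x))))))
      where
      R = FillU.fillRun σ (rest ∷ K) (Ctl.order-cell (proj₁ I₀)) (Ctl.small (proj₁ I₀))
      over = limit + C * (limit + Λ)
      fc = 4 * Λ + suc u * (κF 0 (lit u) size * Λ)
      run₁ = (Nₛ + dead) * Λ * over + dead * Λ * 1
      run₂ = κcopy * (Λ * (over + Λ))
      rest-cost = (κₛ shiftBy + 6) * Λ + (run₁ + run₂)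
      each : ∀ U → costWithin inst n (rest ∷ K , filled 0 (Vec.map toℕ U) (FillU.σ⁰ σ)) ≤ℚ fromℕ rest-cost +ℚ x
      each U = add-cost₀ ((κₛ shiftBy + 6) * Λ) (run₁ + run₂) (Det.cost (prepare K) n) (ℚ.≤-trans (run-cost K n x 0≤x h) (≡⇒≤ (fromℕ-merge run₁ run₂ x)))
        where
        open Attempt limit≤ refl I₀ c< U
      finish : ∀ {y} a b c → y ≤ℚ fromℕ b +ℚ (fromℕ c +ℚ x) → fromℕ a +ℚ y ≤ℚ fromℕ (a + b + c) +ℚ x
      finish {y} a b c q = add-cost₂ a b c (a + b + c) ℚ.≤-refl q ≤-refl

    wins : ℕ → Vec (Fin r) u → ℚ
    wins n U = outcome (encode G (shifted B U)) n 0 (p ∷ [] , emptyMemory) (λ (τ , t) → sol (U Vec.++ outputs τ) X *ℚ indicator (t ℕ.≤? limit))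

    attempt-body-reach : ∀ {φ} → NonNeg φ → ∀ n c σ K d → 0ℚ ≤ℚ d → d ≤ℚ 1ℚ → Inv limit stride B c σ → c < stride →
      (∀ w σ′ → Done limit stride B c w σ′ → Reaches inst φ (K , σ′) (d +ℚ (1ℚ -ℚ d) *ℚ sol w X)) →
      Reaches inst φ (attempt ∷ K , σ) (d +ℚ (1ℚ -ℚ d) *ℚ mean (tuples r u) (wins n))
    attempt-body-reach {φ} φ≥0 n c σ K d _ d≤1 I₀ c< h = Reaches-≤ inst {φ} {attempt ∷ K , σ} (≡⇒≤ (sym (mean-affine (tuples r u) (tuples≢0 u) d (1ℚ -ℚ d) (wins n))))
      (Reaches-det inst φ≥0 (open-attempt {σ} {K}) (Reaches-run inst (λ U → d +ℚ (1ℚ -ℚ d) *ℚ wins n U) φ≥0 R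
        (λ U → let open Attempt limit≤ refl I₀ c< U in Reaches-det inst φ≥0 (prepare K) (run-reach φ≥0 K d d≤1 n h))))
      where R = FillU.fillRun σ (rest ∷ K) (Ctl.order-cell (proj₁ I₀)) (Ctl.small (proj₁ I₀))

  record Measured (B : Vec Bool r) (t : ℕ) (σ : Memory) : Set where
    field
      order-cell  : σ 2 0 ≡ M
      stride-cell : σ 3 0 ≡ stride
      clock-cell  : σ 5 0 ≡ t
      limit-cell  : σ 6 0 ≡ r ^ k′
      shift-cells : ∀ i → σ 9 i ≡ bcode B i
      small       : Small Λ σ
      fresh       : ∀ a i d → 1 ≤ d → d < stride → σ (12 + a) (i * stride + d) ≡ 0

  power-eval : ∀ σ n → eval inst σ (powᴱ n) ≡ r ^ n
  power-eval σ n = trans (powᴱ-eval inst σ n) (cong (_^ n) (length-encode X))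

  module Decide {B : Vec Bool r} {t : ℕ} {σ : Memory} (D : Measured B t σ) where
    open Measured D
    σ₁ σ₂ σ₃ σ₄ : Memory
    σ₁ = update σ 4 0 1
    σ₂ = update σ₁ 6 0 (σ₁ 5 0)
    σ₃ = update σ₂ 8 0 (σ₂ 3 0)
    σ₄ = update σ₁ 8 0 (eval inst σ₁ (op add (powᴱ k′) (lit 1)))

    stepsᴾ stepsˢ stepsᵇ : Program
    stepsᴾ = store 4 (lit 0) (lit 1)
    stepsˢ = store 6 (lit 0) (cell 5)
    stepsᵇ = store 8 (lit 0) (op add (powᴱ k′) (lit 1))

    small₁ : Small Λ σ₁
    small₁ = update-≤ {P = Control} {σ = σ} {4} {0} {1} (≤-trans (len≤n 1) 1≤Λ) small

    small₂ : Small Λ σ₂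
    small₂ = update-≤ {P = Control} {σ = σ₁} {6} {0} {σ₁ 5 0} (small 5 0 tt) small₁

    small₃ : Small Λ σ₃
    small₃ = update-≤ {P = Control} {σ = σ₂} {8} {0} {σ₂ 3 0} (small 3 0 tt) small₂

    bound₄ : eval inst σ₁ (op add (powᴱ k′) (lit 1)) ≡ r ^ k′ + 1
    bound₄ = cong (_+ 1) (power-eval σ₁ k′)

    small₄ : Small Λ σ₄
    small₄ = update-≤ {P = Control} {σ = σ₁} {8} {0} {eval inst σ₁ (op add (powᴱ k′) (lit 1))} (≤-trans (≡⇒≤ⁿ (cong len bound₄)) power≤) small₁

    search-inv : Inv t stride B 1 σ₃
    search-inv = record { order-cell = order-cell ; stride-cell = stride-cell ; counter-cell = refl ; limit-cell = clock-cell ; bound-cell = stride-cell ; shift-cells = shift-cells ; small = small₃ } , fresh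

    brute-inv : Inv (r ^ k′) (r ^ k′ + 1) B 1 σ₄
    brute-inv = record { order-cell = order-cell ; stride-cell = stride-cell ; counter-cell = refl ; limit-cell = limit-cell ; bound-cell = bound₄ ; shift-cells = shift-cells ; small = small₄ } , fresh

    chooser : Program
    chooser = branch (op less (cell 6) (cell 5)) bruteForce search

    search-pre brute-pre : ℕ
    search-pre = 1 + (κₛ stepsᴾ + (κₛ chooser + (1 + (κₛ stepsˢ + (1 + κₛ (store 8 (lit 0) (cell 3)))))))
    brute-pre  = 1 + (κₛ stepsᴾ + (κₛ chooser + (1 + κₛ stepsᵇ)))

    to-search : t ≤ r ^ k′ → Det inst (decide ∷ [] , σ) (search-pre * Λ) (rounds attempt ∷ [] , σ₃)
    to-search le = Det-weaken inst (≤-trans (≡⇒≤ⁿ (eq 1 (stepCost inst stepsᴾ σ) (stepCost inst chooser σ₁) (stepCost inst stepsˢ σ₁) (stepCost inst (store 8 (lit 0) (cell 3)) σ₂)))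
        (proof (lit· 1 ⊞ step· {σ} stepsᴾ small _ ⊞ step· {σ₁} chooser small₁ _ ⊞ lit· 1 ⊞ step· {σ₁} stepsˢ small₁ _ ⊞ lit· 1 ⊞ step· {σ₂} (store 8 (lit 0) (cell 3)) small₂ _)))
      (Det-step inst {decide} refl (Det-step inst {stepsᴾ} refl (Det-step inst {chooser} (next-false inst σ₁ (op less (cell 6) (cell 5)) (less-false (≤-trans (≡⇒≤ⁿ clock-cell) (≤-trans le (≡⇒≤ⁿ (sym limit-cell))))))
        (Det-step inst {search} refl (Det-step inst {stepsˢ} refl (Det-step inst {store 8 (lit 0) (cell 3) ⨾ rounds attempt} refl (Det-step inst {store 8 (lit 0) (cell 3)} refl (Det-refl inst))))))))
      where
      eq : ∀ a b c d e → a + (b + (c + (1 + (d + (1 + (e + 0)))))) ≡ a + (b + (c + (1 + (d + (1 + e)))))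
      eq = solve-∀

    to-brute : r ^ k′ < t → Det inst (decide ∷ [] , σ) (brute-pre * Λ) (rounds guess ∷ [] , σ₄)
    to-brute lt = Det-weaken inst (≤-trans (≡⇒≤ⁿ (eq 1 (stepCost inst stepsᴾ σ) (stepCost inst chooser σ₁) (stepCost inst stepsᵇ σ₁)))
        (proof (lit· 1 ⊞ step· {σ} stepsᴾ small _ ⊞ step· {σ₁} chooser small₁ _ ⊞ lit· 1 ⊞ step· {σ₁} stepsᵇ small₁ (tt , powᴱ-loads k′ , tt))))
      (Det-step inst {decide} refl (Det-step inst {stepsᴾ} refl (Det-step inst {chooser} (next-true inst σ₁ (op less (cell 6) (cell 5)) (≡⇒≤ⁿ (sym (less-true (≤-trans (s≤s (≡⇒≤ⁿ limit-cell)) (≤-trans lt (≡⇒≤ⁿ (sym clock-cell))))))))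
        (Det-step inst {bruteForce} refl (Det-step inst {stepsᵇ} refl (Det-refl inst))))))
      where
      eq : ∀ a b c d → a + (b + (c + (1 + (d + 0)))) ≡ a + (b + (c + (1 + d)))
      eq = solve-∀

    search-m : 1 + r ^ u ≡ stride
    search-m = +-comm 1 (r ^ u)

    brute-m : 1 + r ^ k′ ≡ r ^ k′ + 1
    brute-m = +-comm 1 (r ^ k′)

    κʳ κᵍ : ℕ
    κʳ = κ-round t stride B attempt stride≤
    κᵍ = κ-round (r ^ k′) (r ^ k′ + 1) B guess ≤-refl

    halted : ∀ n σ → costWithin inst n ([] , σ) ≤ℚ 0ℚ
    halted zero    σ = ℚ.≤-refl
    halted (suc n) σ = ℚ.≤-refl

    search-cost : t ≤ r ^ k′ → ∀ n → costWithin inst n (decide ∷ [] , σ) ≤ℚ fromℕ (search-pre * Λ + (r ^ u * (κʳ * Λ + attempt-cost t) + κʳ * Λ))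
    search-cost le n = ℚ.≤-trans (add-cost₀ (search-pre * Λ) (r ^ u * (κʳ * Λ + attempt-cost t) + κʳ * Λ) (Det.cost (to-search le) n)
        (rounds-cost t stride B attempt stride≤ {[]} (attempt-cost t) (λ _ → 0ℚ) (λ _ → ℚ.≤-refl) halted (attempt-body-cost {t} {B} le) (r ^ u) 1 σ₃ n search-inv search-m)) (≡⇒≤ (ℚ.+-identityʳ _))

    brute-cost : r ^ k′ < t → ∀ n → costWithin inst n (decide ∷ [] , σ) ≤ℚ fromℕ (brute-pre * Λ + (r ^ k′ * (κᵍ * Λ + guess-cost) + κᵍ * Λ))
    brute-cost lt n = ℚ.≤-trans (add-cost₀ (brute-pre * Λ) (r ^ k′ * (κᵍ * Λ + guess-cost) + κᵍ * Λ) (Det.cost (to-brute lt) n)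
        (rounds-cost (r ^ k′) (r ^ k′ + 1) B guess ≤-refl {[]} guess-cost (λ _ → 0ℚ) (λ _ → ℚ.≤-refl) halted guess-body-cost (r ^ k′) 1 σ₄ n brute-inv brute-m)) (≡⇒≤ (ℚ.+-identityʳ _))

    module _ {φ : Memory → ℚ} (φ≥0 : NonNeg φ) (φ-sol : ∀ σ (w : Vec (Fin r) k′) → Tuple w σ → Sol w X → 1ℚ ≤ℚ φ σ)
             {ℓ : ℚ} (0≤ℓ : 0ℚ ≤ℚ ℓ) (ℓ≤½ : ℓ ≤ℚ ½) where
      open Quadratic ℓ 0≤ℓ ℓ≤½

      search-reach : (le : t ≤ r ^ k′) → ∀ n → Reaches inst φ (decide ∷ [] , σ) (h⁺ (∑ (tuples r u) (wins {t} {B} le n)))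
      search-reach le n = Reaches-det inst φ≥0 (to-search le) (Reaches-≤ inst {φ} {rounds attempt ∷ [] , σ₃} (≡⇒≤ (cong h⁺ (sym (∑-mean r u (wins {t} {B} le n) r≢0))))
        (rounds-reach t stride B attempt stride≤ φ≥0 φ-sol 0≤ℓ ℓ≤½ (mean (tuples r u) (wins {t} {B} le n))
          (mean-nonNeg (tuples r u) wins≥0) (ℚ.≤-trans (mean-mono (tuples r u) wins≤1) (mean-const-≤ (tuples r u) 0≤1))
          (attempt-body-reach {t} {B} le φ≥0 n) (r ^ u) 1 σ₃ search-inv search-m))
        where
        f≥0 : ∀ U (o : Memory × ℕ) → 0ℚ ≤ℚ sol (U Vec.++ outputs (proj₁ o)) X *ℚ indicator (proj₂ o ℕ.≤? t)
        f≥0 U (τ , s) = 0≤* (0≤sol (U Vec.++ outputs τ) X) (0≤indicator (s ℕ.≤? t))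
        f≤1 : ∀ U (o : Memory × ℕ) → sol (U Vec.++ outputs (proj₁ o)) X *ℚ indicator (proj₂ o ℕ.≤? t) ≤ℚ 1ℚ
        f≤1 U (τ , s) = ℚ.≤-trans (*-mono (0≤sol (U Vec.++ outputs τ) X) 0≤1 (indicator≤1 (Sol? (U Vec.++ outputs τ) X)) (indicator≤1 (s ℕ.≤? t))) (≡⇒≤ (ℚ.*-identityˡ 1ℚ))
        wins≥0 : ∀ U → 0ℚ ≤ℚ wins {t} {B} le n U
        wins≥0 U = Φ-nonNeg (FinSum-outcome (encode G (shifted B U)) n 0 (p ∷ [] , emptyMemory)) (f≥0 U)
        wins≤1 : ∀ U → wins {t} {B} le n U ≤ℚ 1ℚ
        wins≤1 U = ℚ.≤-trans (Φ-mono (FinSum-outcome (encode G (shifted B U)) n 0 (p ∷ [] , emptyMemory)) (f≤1 U)) (outcome≤1 (encode G (shifted B U)) n 0 (p ∷ [] , emptyMemory))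

      brute-reach : r ^ k′ < t → Reaches inst φ (decide ∷ [] , σ) (h⁺ (N k′ X))
      brute-reach lt = Reaches-det inst φ≥0 (to-brute lt) (Reaches-≤ inst {φ} {rounds guess ∷ [] , σ₄} (≡⇒≤ (cong h⁺ (sym (∑-mean r k′ (λ w → sol w X) r≢0))))
        (rounds-reach (r ^ k′) (r ^ k′ + 1) B guess ≤-refl φ≥0 φ-sol 0≤ℓ ℓ≤½ (mean (tuples r k′) (λ w → sol w X))
          (mean-nonNeg (tuples r k′) (λ w → 0≤sol w X)) (ℚ.≤-trans (mean-mono (tuples r k′) (λ w → indicator≤1 (Sol? w X))) (mean-const-≤ (tuples r k′) 0≤1))
          (guess-body-reach φ≥0) (r ^ k′) 1 σ₄ brute-inv brute-m))

-- The whole run of the reduction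

module WholeRun (I : Instance) (C Nₛ : ℕ) (fits : Fits I C Nₛ) (over≤ : Roomy I C) (M≡ : Instance.M I ≡ 2 ^ ⌈log₂ Instance.r I ^ Instance.k′ I ⌉) where
  open Instance I
  open Rounds I
  open Searches I C Nₛ fits over≤

  record Ready (B : Vec Bool r) (Y : Vec Carrier r) (S : Vec (Fin r) k) (σ : Memory) : Set where
    field
      order-cell     : σ 2 0 ≡ M
      stride-cell    : σ 3 0 ≡ stride
      counter-cell   : σ 4 0 ≡ 0
      clock-cell     : σ 5 0 ≡ 0
      limit-cell     : σ 6 0 ≡ r ^ k′
      shift-cells    : ∀ i → σ 9 i ≡ bcode B i
      instance-cells : ∀ i → σ 10 i ≡ nth (encode G Y) i
      tuple          : Tuple S σ
      small          : Small Λ σ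
      zeros          : ∀ a i → σ (12 + a) i ≡ 0

  chosen : Program
  chosen = plantᴾ ⨾ C₁.T⟦ p ⟧ ⨾ decide

  κ-plant : ℕ
  κ-plant = κₛ (branch (distinctᴱ entry k) chosen skip) + (1 + (κₛ plantᴾ + 1))

  test-loads : LoadsStep Control (branch (distinctᴱ entry k) chosen skip)
  test-loads = distinct-loads {f = entry} (λ i → tt , tt) k

  module Measure {B : Vec Bool r} {Y : Vec Carrier r} {S : Vec (Fin r) k} {σ₀ : Memory} (R : Ready B Y S σ₀) where
    open Ready R
    i₀ : Fin r
    i₀ = Vec.head S
    S′ : Vec (Fin r) j
    S′ = Vec.tail S

    S≡ : S ≡ i₀ ∷ S′
    S≡ = η S
      where
      η : ∀ {A : Set} {n} (v : Vec A (suc n)) → v ≡ Vec.head v ∷ Vec.tail v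
      η (x ∷ w) = refl

    negsum : Exp
    negsum = negᴱ (sumᴱ (λ i → load 10 (entry (suc i))) j)

    σ₁ : Memory
    σ₁ = update σ₀ 10 (σ₀ 0 0) (eval inst σ₀ negsum)

    Y′ : Vec Carrier r
    Y′ = plantT S Y

    Y′≡ : Y′ ≡ Y Vec.[ i₀ ]≔ (sumT S′ Y ⁻¹)
    Y′≡ = cong (λ S → plantT S Y) S≡

    tuple′ : ∀ l → σ₀ 0 (toℕ l) ≡ toℕ (lookup (i₀ ∷ S′) l)
    tuple′ = subst (λ S → Tuple S σ₀) S≡ tuple

    negsum-eval : eval inst σ₀ negsum ≡ code (sumT S′ Y ⁻¹)
    negsum-eval = neg-eval inst σ₀ (sumᴱ (λ i → load 10 (entry (suc i))) j) order-cell (sum-eval σ₀ S′ Y (λ i → load 10 (entry (suc i))) order-cell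
      (λ l → trans (instance-cells (σ₀ 0 (suc (toℕ l)))) (trans (cong (nth (encode G Y)) (tuple′ (suc l))) (nth-encode Y (lookup S′ l)))))

    small₁ : Small Λ σ₁
    small₁ = update-≤ {P = Control} {σ = σ₀} {10} {σ₀ 0 0} {eval inst σ₀ negsum} (≤-trans (≡⇒≤ⁿ (cong len negsum-eval)) (code≤ (sumT S′ Y ⁻¹))) small

    planted-cells : ∀ i → σ₁ 10 i ≡ nth (encode G Y′) i
    planted-cells i with i ℕ.≟ σ₀ 0 0
    ... | yes e = trans (cong (σ₁ 10) e) (trans (update-≡ σ₀ 10 (σ₀ 0 0) (eval inst σ₀ negsum)) (trans negsum-eval
        (sym (trans (cong (nth (encode G Y′)) (trans e (tuple′ zero))) (trans (nth-encode Y′ i₀) (cong code (trans (cong (λ Z → lookup Z i₀) Y′≡) (Vec.lookup∘update i₀ Y (sumT S′ Y ⁻¹)))))))))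
    ... | no n with i ℕ.<? r
    ...   | yes q = trans (update-≢ σ₀ 10 (σ₀ 0 0) (eval inst σ₀ negsum) 10 i (inj₂ (λ e → n (sym e)))) (trans (instance-cells i)
        (trans (cong (nth (encode G Y)) i≡) (trans (nth-encode Y l) (trans (cong code (sym (trans (cong (λ Z → lookup Z l) Y′≡) (Vec.lookup∘update′ (λ e → n (trans i≡ (trans (cong toℕ e) (sym (tuple′ zero))))) Y (sumT S′ Y ⁻¹)))))
          (trans (sym (nth-encode Y′ l)) (cong (nth (encode G Y′)) (sym i≡)))))))
      where
      l = fromℕ< q
      i≡ : i ≡ toℕ l
      i≡ = sym (Fin.toℕ-fromℕ< q)
    ...   | no q = trans (update-≢ σ₀ 10 (σ₀ 0 0) (eval inst σ₀ negsum) 10 i (inj₂ (λ e → n (sym e)))) (trans (instance-cells i)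
        (trans (nth-beyond (Vec.map code Y) i (≮⇒≥ q)) (sym (nth-beyond (Vec.map code Y′) i (≮⇒≥ q)))))

    setup : Setup
    setup = record
      { inp = inp₁ ; X = inst ; X′ = encode G Y′ ; σ₀ = σ₁ ; stride = stride ; this = 0 ; limit = r ^ k′ ; Λ = Λ ; C = C ; kin = kinOf arith
      ; 1≤Λ = 1≤Λ ; this< = ≤-trans (s≤s z≤n) (≡⇒≤ⁿ (+-comm 1 (r ^ u))) ; stride≡ = stride-cell ; this≡ = counter-cell ; limit≡ = limit-cell
      ; size≡ = trans (length-encode X) (sym (length-encode Y′)) ; size≤ = size≤ ; input≤ = nth≤ X ; input≤′ = nth≤ Y′
      ; overrun≤ = over≤
      ; inp-eval = λ σ fr e → trans (fr 10 (eval inst σ e) tt) (planted-cells (eval inst σ e))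
      ; inp-cost = λ σ fr s e → ≤-trans (+-mono-≤ {1} 1≤Λ (+-monoˡ-≤ (expCost inst σ e) (s 10 (eval inst σ e) tt))) (bound (expCost inst σ e)) }
      where
      bound : ∀ ce → Λ + (Λ + ce) ≤ kinOf arith * (Λ + ce)
      bound ce = ≤-trans (m≤m+n _ ce) (≤-trans (≡⇒≤ⁿ (eq Λ ce)) (*-monoˡ-≤ (Λ + ce) (m≤m+n 2 (11 * kᵃᵈᵈ))))
        where
        eq : ∀ l c → l + (l + c) + c ≡ 2 * (l + c)
        eq = solve-∀

    open Simulation setup using (Sim; module Sim; []; tr)

    start : ∀ {K} → let open SimulationRuns setup Nₛ K in Related (p ∷ []) emptyMemory 0 (C₁.T⟦ p ⟧ ∷ []) σ₁
    start = tr fits [] , record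
      { view = record { mem = λ a i → zeros a (i * stride + 0) ; others = λ _ _ _ _ _ → refl ; ctl = λ _ _ _ → refl ; small = small₁ }
      ; clock = clock-cell ; bits = λ _ _ → z≤n ; bound = z≤n }

    measured : ∀ {σ τ t} → Sim σ τ t → Measured B t σ
    measured S = record
      { order-cell = trans (Sim.ctl S 2 0 tt) order-cell ; stride-cell = trans (Sim.ctl S 3 0 tt) stride-cell ; clock-cell = Sim.clock S
      ; limit-cell = trans (Sim.ctl S 6 0 tt) limit-cell ; shift-cells = λ i → trans (Sim.ctl S 9 i tt) (shift-cells i) ; small = Sim.small S
      ; fresh = λ a i d q q′ → trans (Sim.others S a i d q′ (λ e → <-irrefl (sym e) q)) (zeros a (i * stride + d)) }

    to-run : Distinct S → Det inst (branch (distinctᴱ entry k) chosen skip ∷ [] , σ₀) (κ-plant * Λ) (C₁.T⟦ p ⟧ ∷ decide ∷ [] , σ₁)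
    to-run D = Det-weaken inst (≤-trans (≡⇒≤ⁿ (eq (stepCost inst (branch (distinctᴱ entry k) chosen skip) σ₀) (stepCost inst plantᴾ σ₀)))
        (proof (step· {σ₀} (branch (distinctᴱ entry k) chosen skip) small test-loads ⊞ lit· 1 ⊞ step· {σ₀} plantᴾ small ((tt , tt) , neg-loads tt (sum-loads tt (λ i → tt , tt , tt) j)) ⊞ lit· 1)))
      (Det-step inst {branch (distinctᴱ entry k) chosen skip} (next-true inst σ₀ (distinctᴱ entry k) (distinct⇐ inst σ₀ S entry tuple D))
        (Det-step inst {chosen} refl (Det-step inst {plantᴾ} refl (Det-step inst {C₁.T⟦ p ⟧ ⨾ decide} refl (Det-refl inst)))))
      where
      eq : ∀ a b → a + (1 + (b + (1 + 0))) ≡ a + (1 + (b + 1))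
      eq = solve-∀

    no-run : ¬ Distinct S → Det inst (branch (distinctᴱ entry k) chosen skip ∷ [] , σ₀) (κ-plant * Λ) ([] , σ₀)
    no-run n = Det-weaken inst (proof (step· {σ₀} (branch (distinctᴱ entry k) chosen skip) small test-loads ⊞ below (s≤s z≤n) (lit· (1 + (κₛ plantᴾ + 1)))))
      (Det-step inst {branch (distinctᴱ entry k) chosen skip} (next-false inst σ₀ (distinctᴱ entry k) (ℕ.n<1⇒n≡0 (≰⇒> (λ q → n (distinct⇒ inst σ₀ S entry tuple q))))) (Det-step inst {skip} refl (Det-refl inst)))

    module _ (n E D₀ : ℕ) (hyp : ∀ B t σ → Measured B t σ → costWithin inst n (decide ∷ [] , σ) ≤ℚ fromℕ (E * t + D₀)) where
      rate : ℕ
      rate = E + (Nₛ + dead) * Λ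

      branch-cost : costWithin inst n (branch (distinctᴱ entry k) chosen skip ∷ [] , σ₀) ≤ℚ
        fromℕ (κ-plant * Λ + (dead * Λ * 1 + D₀)) +ℚ indicator (Distinct? S) *ℚ (fromℕ rate *ℚ costWithin (encode G Y′) n (initial p))
      branch-cost = [ good , bad ]′ (toSum (Distinct? S))
        where
        x = fromℕ rate *ℚ costWithin (encode G Y′) n (initial p)
        drop : ∀ a b E → fromℕ (E * 0 + a + b) ≡ fromℕ (a + b)
        drop a b E = cong (λ z → fromℕ (z + a + b)) (ℕ.*-zeroʳ E)
        good : Distinct S → costWithin inst n (branch (distinctᴱ entry k) chosen skip ∷ [] , σ₀) ≤ℚ fromℕ (κ-plant * Λ + (dead * Λ * 1 + D₀)) +ℚ indicator (Distinct? S) *ℚ x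
        good D = ℚ.≤-trans (add-cost₀ (κ-plant * Λ) (dead * Λ * 1 + D₀) (Det.cost (to-run D) n)
            (ℚ.≤-trans (SimulationCosts.charged-cost setup Nₛ (decide ∷ []) n E D₀ (λ τ t σ S → hyp B t σ (measured S)) (start {decide ∷ []})) (≡⇒≤ (cong (_+ℚ x) (drop (dead * Λ * 1) D₀ E)))))
          (≡⇒≤ (cong (fromℕ (κ-plant * Λ + (dead * Λ * 1 + D₀)) +ℚ_) (sym (trans (cong (_*ℚ x) (indicator-true (Distinct? S) D)) (ℚ.*-identityˡ x)))))
        bad : ¬ Distinct S → costWithin inst n (branch (distinctᴱ entry k) chosen skip ∷ [] , σ₀) ≤ℚ fromℕ (κ-plant * Λ + (dead * Λ * 1 + D₀)) +ℚ indicator (Distinct? S) *ℚ x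
        bad m = add-cost₁ (κ-plant * Λ) (κ-plant * Λ + (dead * Λ * 1 + D₀)) (Det.cost (no-run m) n) (ℚ.≤-trans (halted n) (≡⇒≤ (sym (trans (cong (_*ℚ x) (indicator-false (Distinct? S) m)) (ℚ.*-zeroˡ x))))) (m≤m+n (κ-plant * Λ) (dead * Λ * 1 + D₀))
          where
          halted : ∀ n → costWithin inst n ([] , σ₀) ≤ℚ 0ℚ
          halted zero    = ℚ.≤-refl
          halted (suc n) = ℚ.≤-refl

    module _ {φ : Memory → ℚ} (φ≥0 : NonNeg φ) (w : ℕ → ℚ) (w≥0 : NonNeg w) (wᵇ : ℚ) (wᵇ≥0 : 0ℚ ≤ℚ wᵇ) (w-over : ∀ t → r ^ k′ < t → w t ≡ wᵇ)
             (hyp : ∀ t σ → Measured B t σ → Reaches inst φ (decide ∷ [] , σ) (w t)) where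
      branch-reach : ∀ n (s : Memory → ℚ) → NonNeg s → (∀ τ → s τ ≤ℚ 1ℚ) →
        Reaches inst φ (branch (distinctᴱ entry k) chosen skip ∷ [] , σ₀) (indicator (Distinct? S) *ℚ outcome (encode G Y′) n 0 (initial p) (λ (τ , t) → s τ *ℚ w t))
      branch-reach n s s≥0 s≤1 = [ good , bad ]′ (toSum (Distinct? S))
        where
        F : Memory × ℕ → ℚ
        F (τ , t) = s τ *ℚ w t
        O = outcome (encode G Y′) n 0 (initial p) F
        F≤ : ∀ τ t → F (τ , t) ≤ℚ w t
        F≤ τ t = ℚ.≤-trans (*-monoʳ (w≥0 t) (s≤1 τ)) (≡⇒≤ (ℚ.*-identityˡ (w t)))
        c₀ = branch (distinctᴱ entry k) chosen skip ∷ [] , σ₀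
        good : Distinct S → Reaches inst φ c₀ (indicator (Distinct? S) *ℚ O)
        good D = Reaches-≤ inst {φ} {c₀} (≡⇒≤ (trans (cong (_*ℚ O) (indicator-true (Distinct? S) D)) (ℚ.*-identityˡ O))) (Reaches-det inst φ≥0 (to-run D)
          (Reaches-≤ inst {φ} {C₁.T⟦ p ⟧ ∷ decide ∷ [] , σ₁} (outcome≤clocked (encode G Y′) (r ^ k′) (λ _ → w) wᵇ F wᵇ≥0 (λ τ t _ → F≤ τ t) (λ τ t q → ℚ.≤-trans (F≤ τ t) (≡⇒≤ (w-over t q))) n 0 (initial p))
            (SimulationRuns.lower setup Nₛ (decide ∷ []) φ≥0 (λ _ → w) wᵇ (λ τ t σ S _ → hyp t σ (measured S))
              (λ τ t σ S q → Reaches-≤ inst {φ} {decide ∷ [] , σ} (≡⇒≤ (sym (w-over t q))) (hyp t σ (measured S))) n (start {decide ∷ []}))))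
        bad : ¬ Distinct S → Reaches inst φ c₀ (indicator (Distinct? S) *ℚ O)
        bad m = Reaches-≤ inst {φ} {c₀} (≡⇒≤ (trans (cong (_*ℚ O) (indicator-false (Distinct? S) m)) (ℚ.*-zeroˡ O))) (0 , ℚ.≤-refl)

  m : ℕ
  m = ⌈log₂ r ^ k′ ⌉

  doubling-loads : LoadsStep Control doubling
  doubling-loads = (tt , tt) , powᴱ-loads k′

  κ-double : ℕ
  κ-double = κₛ doubling + κₛ (store 2 (lit 0) (op mul (lit 2) (cell 2)))

  doubling-det : ∀ d i σ K → σ 2 0 ≡ 2 ^ i → i + d ≡ m → Small Λ σ →
    ∃[ σ′ ] σ′ 2 0 ≡ M × (∀ b l → 2 ≢ b → σ′ b l ≡ σ b l) × Small Λ σ′ × Det inst (doubling ∷ K , σ) (suc d * (κ-double * Λ)) (K , σ′)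
  doubling-det zero i σ K e q S = σ , trans e (trans (cong (2 ^_) (trans (sym (+-identityʳ i)) q)) (sym M≡)) , (λ _ _ _ → refl) , S ,
    Det-weaken inst (≤-trans (≡⇒≤ⁿ (+-identityʳ _)) (≤-trans (ctlCost {σ} doubling S doubling-loads) (≤-trans (*-monoˡ-≤ Λ (m≤m+n (κₛ doubling) _)) (m≤m+n (κ-double * Λ) 0))))
      (Det-step inst {doubling} (next-exit inst σ (op less (cell 2) (powᴱ k′)) (less-false (≤-trans (≡⇒≤ⁿ (power-eval σ k′)) (≤-trans (n≤2^⌈log⌉ (r ^ k′)) (≡⇒≤ⁿ (sym (trans e (cong (2 ^_) (trans (sym (+-identityʳ i)) q)))))))))
        (Det-refl inst))
  doubling-det (suc d) i σ K e q S =
    let (σ′ , m′ , o , S′ , D) = doubling-det d (suc i) σ″ K e″ (trans (sym (+-suc i d)) q) S″ in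
    σ′ , m′ , (λ b l n → trans (o b l n) (update-array σ 2 0 (2 * σ 2 0) b l n)) , S′ ,
    Det-weaken inst (≤-trans (≡⇒≤ⁿ (sym (ℕ.+-assoc (stepCost inst doubling σ) (stepCost inst dbl σ) _))) (+-monoˡ-≤ (suc d * (κ-double * Λ)) (proof (step· {σ} doubling S doubling-loads ⊞ step· {σ} dbl S _))))
      (Det-step inst {doubling} (next-loop inst σ (op less (cell 2) (powᴱ k′)) (≡⇒≤ⁿ (sym (less-true small-power)))) (Det-step inst {dbl} refl D))
    where
    dbl = store 2 (lit 0) (op mul (lit 2) (cell 2))
    σ″ = update σ 2 0 (2 * σ 2 0)
    e″ : σ″ 2 0 ≡ 2 ^ suc i
    e″ = cong (2 *_) e
    i<m : suc i ≤ m
    i<m = ≤-trans (m≤m+n (suc i) d) (≡⇒≤ⁿ (trans (sym (+-suc i d)) q))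
    S″ : Small Λ σ″
    S″ = update-≤ {P = Control} {σ = σ} {2} {0} {2 * σ 2 0} (≤-trans (len-mono (≤-trans (≡⇒≤ⁿ e″) (≤-trans (^-monoʳ-≤ 2 i<m) (≡⇒≤ⁿ (sym M≡))))) M≤) S
    small-power : σ 2 0 < eval inst σ (powᴱ k′)
    small-power = ≰⇒> (λ le → <-irrefl refl (≤-trans i<m (⌈log⌉-≤ {r ^ k′} {i} (≤-trans (≡⇒≤ⁿ (sym (power-eval σ k′))) (≤-trans le (≡⇒≤ⁿ e))))))

  record Base (σ : Memory) : Set where
    field
      order-cell  : σ 2 0 ≡ M
      stride-cell : σ 3 0 ≡ stride
      limit-cell  : σ 6 0 ≡ r ^ k′
      small       : Small Λ σ
      others      : ∀ b l → 2 ≢ b → 3 ≢ b → 6 ≢ b → σ b l ≡ 0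

  chosenᴾ fillsᴾ : Program
  chosenᴾ = branch (distinctᴱ entry k) chosen skip
  fillsᴾ = fill 9 size (lit 2) ⨾ fill 10 size (cell 2) ⨾ fill 0 (lit k) size ⨾ chosenᴾ

  base-cost : ℕ
  base-cost = (1 + (κₛ (store 2 (lit 0) (lit 1)) + 1)) * Λ + (suc m * (κ-double * Λ) + (1 + (κₛ (store 3 (lit 0) (op add (powᴱ u) (lit 1))) + (1 + κₛ (store 6 (lit 0) (powᴱ k′))))) * Λ)

  base : ∃[ σ ] Base σ × Det inst (initial reduction) base-cost (fillsᴾ ∷ [] , σ)
  base = σ₂ , B₂ , Det-trans inst start-det (Det-trans inst D rest-det)
    where
    s₁ = store 2 (lit 0) (lit 1)
    s₃ = store 3 (lit 0) (op add (powᴱ u) (lit 1))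
    s₆ = store 6 (lit 0) (powᴱ k′)
    R₁ = s₃ ⨾ s₆ ⨾ fillsᴾ
    σ⁰ = update emptyMemory 2 0 1
    S⁰ : Small Λ σ⁰
    S⁰ = update-≤ {P = Control} {σ = emptyMemory} {2} {0} {1} (≤-trans (len≤n 1) 1≤Λ) (λ _ _ _ → z≤n)
    start-det : Det inst (initial reduction) ((1 + (κₛ s₁ + 1)) * Λ) (doubling ∷ R₁ ∷ [] , σ⁰)
    start-det = Det-weaken inst (≤-trans (≡⇒≤ⁿ (eq (stepCost inst s₁ emptyMemory))) (proof (lit· 1 ⊞ step· {emptyMemory} s₁ (λ _ _ _ → z≤n) _ ⊞ lit· 1)))
      (Det-step inst {reduction} refl (Det-step inst {s₁} refl (Det-step inst {doubling ⨾ R₁} refl (Det-refl inst))))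
      where
      eq : ∀ a → 1 + (a + (1 + 0)) ≡ 1 + (a + 1)
      eq = solve-∀
    doubled = doubling-det m 0 σ⁰ (R₁ ∷ []) refl refl S⁰
    σ′ = proj₁ doubled
    m′ = proj₁ (proj₂ doubled)
    o = proj₁ (proj₂ (proj₂ doubled))
    S′ = proj₁ (proj₂ (proj₂ (proj₂ doubled)))
    D = proj₂ (proj₂ (proj₂ (proj₂ doubled)))
    σ₁ = update σ′ 3 0 (eval inst σ′ (op add (powᴱ u) (lit 1)))
    σ₂ = update σ₁ 6 0 (eval inst σ₁ (powᴱ k′))
    e₃ : eval inst σ′ (op add (powᴱ u) (lit 1)) ≡ stride
    e₃ = cong (_+ 1) (power-eval σ′ u)
    e₆ : eval inst σ₁ (powᴱ k′) ≡ r ^ k′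
    e₆ = power-eval σ₁ k′
    S₁ : Small Λ σ₁
    S₁ = update-≤ {P = Control} {σ = σ′} {3} {0} {eval inst σ′ (op add (powᴱ u) (lit 1))} (≤-trans (len-mono (≤-trans (≡⇒≤ⁿ e₃) stride≤)) power≤) S′
    S₂ : Small Λ σ₂
    S₂ = update-≤ {P = Control} {σ = σ₁} {6} {0} {eval inst σ₁ (powᴱ k′)} (≤-trans (len-mono (≤-trans (≡⇒≤ⁿ e₆) (m≤m+n (r ^ k′) 1))) power≤) S₁
    B₂ : Base σ₂
    B₂ = record { order-cell = m′ ; stride-cell = e₃ ; limit-cell = e₆ ; small = S₂
      ; others = λ b l n₂ n₃ n₆ → trans (update-array σ₁ 6 0 (eval inst σ₁ (powᴱ k′)) b l n₆) (trans (update-array σ′ 3 0 (eval inst σ′ (op add (powᴱ u) (lit 1))) b l n₃) (trans (o b l n₂) (update-array emptyMemory 2 0 1 b l n₂))) }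
    rest-det : Det inst (R₁ ∷ [] , σ′) ((1 + (κₛ s₃ + (1 + κₛ s₆))) * Λ) (fillsᴾ ∷ [] , σ₂)
    rest-det = Det-weaken inst (≤-trans (≡⇒≤ⁿ (eq (stepCost inst s₃ σ′) (stepCost inst s₆ σ₁)))
        (proof (lit· 1 ⊞ step· {σ′} s₃ S′ (tt , powᴱ-loads u , tt) ⊞ lit· 1 ⊞ step· {σ₁} s₆ S₁ (tt , powᴱ-loads k′))))
      (Det-step inst {R₁} refl (Det-step inst {s₃} refl (Det-step inst {s₆ ⨾ fillsᴾ} refl (Det-step inst {s₆} refl (Det-refl inst)))))
      where
      eq : ∀ a b → 1 + (a + (1 + (b + 0))) ≡ 1 + (a + (1 + b))
      eq = solve-∀

module Total (I : Instance) (C Nₛ : ℕ) (fits : Fits I C Nₛ) (over≤ : Roomy I C) (M≡ : Instance.M I ≡ 2 ^ ⌈log₂ Instance.r I ^ Instance.k′ I ⌉) where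
  open Instance I
  open Rounds I
  open Searches I C Nₛ fits over≤
  open WholeRun I C Nₛ fits over≤ M≡

  bit≤ : ∀ b → len (bit b) ≤ Λ
  bit≤ true  = ≤-trans (len≤n 1) 1≤Λ
  bit≤ false = z≤n

  k≤Λ : len k ≤ Λ
  k≤Λ = ≤-trans (len-mono k≤k′) k′≤

  module F₉  = Fill 9 size (lit 2) r bools bit (λ ()) (λ ()) _ (λ _ → length-encode X) r≤ M (λ _ _ _ → refl) bit≤
  module F₁₀ = Fill 10 size (cell 2) r elements code (λ ()) (λ ()) _ (λ _ → length-encode X) r≤ M (λ σ e f → trans (cong (λ n → mean (range n) f) e) (code-mean f)) code≤
  module F₀  = Fill 0 (lit k) size k (allFin r) toℕ (λ ()) (λ ()) _ (λ _ → refl) k≤Λ M (λ _ _ → size-mean) index≤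

  private
    c₉ c₁₀ c₀ : ℕ
    c₉  = 4 * Λ + suc r * (κF 9 size (lit 2) * Λ)
    c₁₀ = 4 * Λ + suc r * (κF 10 size (cell 2) * Λ)
    c₀  = 4 * Λ + suc k * (κF 0 (lit k) size * Λ)

  fills-cost : ℕ
  fills-cost = (1 + c₉) + ((1 + c₁₀) + (1 + c₀))

  init-cost : ℕ
  init-cost = base-cost + (fills-cost + (κ-plant * Λ + dead * Λ * 1))

  module _ {σ : Memory} (A : Base σ) where
    open Base A
    σ₉ : Vec Bool r → Memory
    σ₉ B = filled 9 (Vec.map bit B) (F₉.σ⁰ σ)
    σ₁₀ : Vec Bool r → Vec Carrier r → Memory
    σ₁₀ B Y = filled 10 (Vec.map code Y) (F₁₀.σ⁰ (σ₉ B))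
    σ₀ : Vec Bool r → Vec Carrier r → Vec (Fin r) k → Memory
    σ₀ B Y S = filled 0 (Vec.map toℕ S) (F₀.σ⁰ (σ₁₀ B Y))

    small₉ : ∀ B → Small Λ (σ₉ B)
    small₉ B = F₉.Filled.small σ small B
    small₁₀ : ∀ B Y → Small Λ (σ₁₀ B Y)
    small₁₀ B Y = F₁₀.Filled.small (σ₉ B) (small₉ B) Y
    order₉ : ∀ B → σ₉ B 2 0 ≡ M
    order₉ B = trans (F₉.Filled.other σ small B 2 0 (λ ()) (λ ())) order-cell
    order₁₀ : ∀ B Y → σ₁₀ B Y 2 0 ≡ M
    order₁₀ B Y = trans (F₁₀.Filled.other (σ₉ B) (small₉ B) Y 2 0 (λ ()) (λ ())) (order₉ B)

    ready : ∀ B Y S → Ready B Y S (σ₀ B Y S)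
    ready B Y S = record
      { order-cell = trans (at₀ 2 0 (λ ()) (λ ())) (order₁₀ B Y)
      ; stride-cell = trans (all 3 0 (λ ()) (λ ()) (λ ()) (λ ())) stride-cell
      ; counter-cell = trans (all 4 0 (λ ()) (λ ()) (λ ()) (λ ())) (others 4 0 (λ ()) (λ ()) (λ ()))
      ; clock-cell = trans (all 5 0 (λ ()) (λ ()) (λ ()) (λ ())) (others 5 0 (λ ()) (λ ()) (λ ()))
      ; limit-cell = trans (all 6 0 (λ ()) (λ ()) (λ ()) (λ ())) limit-cell
      ; shift-cells = λ i → trans (at₀ 9 i (λ ()) (λ ())) (trans (F₁₀.Filled.other (σ₉ B) (small₉ B) Y 9 i (λ ()) (λ ())) (cells₉ i))
      ; instance-cells = λ i → trans (at₀ 10 i (λ ()) (λ ())) (cells₁₀ i)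
      ; tuple = F₀.Filled.at (σ₁₀ B Y) (small₁₀ B Y) S
      ; small = F₀.Filled.small (σ₁₀ B Y) (small₁₀ B Y) S
      ; zeros = λ a i → trans (all (12 + a) i (λ ()) (λ ()) (λ ()) (λ ())) (others (12 + a) i (λ ()) (λ ()) (λ ())) }
      where
      at₀ : ∀ b l → 0 ≢ b → 11 ≢ b → σ₀ B Y S b l ≡ σ₁₀ B Y b l
      at₀ = F₀.Filled.other (σ₁₀ B Y) (small₁₀ B Y) S
      all : ∀ b l → 0 ≢ b → 11 ≢ b → 10 ≢ b → 9 ≢ b → σ₀ B Y S b l ≡ σ b l
      all b l n₀ n₁₁ n₁₀ n₉ = trans (at₀ b l n₀ n₁₁) (trans (F₁₀.Filled.other (σ₉ B) (small₉ B) Y b l n₁₀ n₁₁) (F₉.Filled.other σ small B b l n₉ n₁₁))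
      cells₉ : ∀ i → σ₉ B 9 i ≡ bcode B i
      cells₉ i with i ℕ.<? r
      ... | yes q = trans (cong (σ₉ B 9) (sym (Fin.toℕ-fromℕ< q))) (trans (F₉.Filled.at σ small B (fromℕ< q))
          (sym (trans (cong (bcode B) (sym (Fin.toℕ-fromℕ< q))) (trans (nth-lookup (Vec.map bit B) (fromℕ< q)) (Vec.lookup-map (fromℕ< q) bit B)))))
      ... | no q  = trans (F₉.Filled.beyond σ small B i (≮⇒≥ q)) (trans (others 9 i (λ ()) (λ ()) (λ ())) (sym (nth-beyond (Vec.map bit B) i (≮⇒≥ q))))
      cells₁₀ : ∀ i → σ₁₀ B Y 10 i ≡ nth (encode G Y) i
      cells₁₀ i with i ℕ.<? r
      ... | yes q = trans (cong (σ₁₀ B Y 10) (sym (Fin.toℕ-fromℕ< q))) (trans (F₁₀.Filled.at (σ₉ B) (small₉ B) Y (fromℕ< q))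
          (sym (trans (cong (nth (encode G Y)) (sym (Fin.toℕ-fromℕ< q))) (nth-encode Y (fromℕ< q)))))
      ... | no q  = trans (F₁₀.Filled.beyond (σ₉ B) (small₉ B) Y i (≮⇒≥ q)) (trans (F₉.Filled.other σ small B 10 i (λ ()) (λ ())) (trans (others 10 i (λ ()) (λ ()) (λ ())) (sym (nth-beyond (Vec.map code Y) i (≮⇒≥ q)))))

    private
      tail₁₀ tail₀ : Program
      tail₁₀ = fill 10 size (cell 2) ⨾ fill 0 (lit k) size ⨾ chosenᴾ
      tail₀  = fill 0 (lit k) size ⨾ chosenᴾ

      split : ∀ p q {K σ} → Det inst ((p ⨾ q) ∷ K , σ) 1 (p ∷ q ∷ K , σ)
      split p q = Det-step inst {p ⨾ q} refl (Det-refl inst)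

      R₉ = Det-Run inst (split (fill 9 size (lit 2)) tail₁₀ {[]} {σ}) (F₉.fillRun σ (tail₁₀ ∷ []) order-cell small)
      R₁₀ = λ B → Det-Run inst (split (fill 10 size (cell 2)) tail₀ {[]} {σ₉ B}) (F₁₀.fillRun (σ₉ B) (tail₀ ∷ []) (order₉ B) (small₉ B))
      R₀ = λ B Y → Det-Run inst (split (fill 0 (lit k) size) chosenᴾ {[]} {σ₁₀ B Y}) (F₀.fillRun (σ₁₀ B Y) (chosenᴾ ∷ []) (order₁₀ B Y) (small₁₀ B Y))

      through : ∀ {A : Set} (xs : List A) {x : ℚ} {g h : A → ℚ} a b → x ≤ℚ fromℕ a +ℚ mean xs g → (∀ y → g y ≤ℚ fromℕ b +ℚ h y) → x ≤ℚ fromℕ (a + b) +ℚ mean xs h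
      through xs {h = h} a b q s = add-cost₀ a b q (ℚ.≤-trans (mean-mono xs s) (ℚ.≤-trans (≡⇒≤ (Φ-+ (FinSum-mean xs) (λ _ → fromℕ b) h)) (ℚ.+-monoˡ-≤ (mean xs h) (mean-const-≤ xs (0≤fromℕ b)))))

    fills-run-cost : ∀ n b (Z : Vec Carrier r → Vec (Fin r) k → ℚ) →
      (∀ B Y S → costWithin inst n (chosenᴾ ∷ [] , σ₀ B Y S) ≤ℚ fromℕ b +ℚ Z Y S) →
      costWithin inst n (fillsᴾ ∷ [] , σ) ≤ℚ fromℕ (fills-cost + b) +ℚ mean Bs (λ B → mean Xs (λ Y → mean (tuples r k) (Z Y)))
    fills-run-cost n b Z h = ℚ.≤-trans (through Bs (1 + c₉) ((1 + c₁₀) + ((1 + c₀) + b)) (Run.cost R₉ n) (λ B → through Xs (1 + c₁₀) ((1 + c₀) + b) (Run.cost (R₁₀ B) n) (λ Y → through (tuples r k) (1 + c₀) b (Run.cost (R₀ B Y) n) (h B Y))))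
      (≡⇒≤ (regroup (1 + c₉) (1 + c₁₀) (1 + c₀) b))
      where
      regroup : ∀ {x} a₁ a₂ a₃ b → fromℕ (a₁ + (a₂ + (a₃ + b))) +ℚ x ≡ fromℕ (a₁ + (a₂ + a₃) + b) +ℚ x
      regroup {x} a₁ a₂ a₃ b = cong (λ z → fromℕ z +ℚ x) (eq a₁ a₂ a₃ b)
        where
        eq : ∀ a₁ a₂ a₃ b → a₁ + (a₂ + (a₃ + b)) ≡ a₁ + (a₂ + a₃) + b
        eq = solve-∀

    fills-run-reach : ∀ {φ} → NonNeg φ → (v : Vec Bool r → Vec Carrier r → Vec (Fin r) k → ℚ) → (∀ B Y S → Reaches inst φ (chosenᴾ ∷ [] , σ₀ B Y S) (v B Y S)) →
      Reaches inst φ (fillsᴾ ∷ [] , σ) (mean Bs (λ B → mean Xs (λ Y → mean (tuples r k) (v B Y))))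
    fills-run-reach φ≥0 v h = Reaches-run inst (λ B → mean Xs (λ Y → mean (tuples r k) (v B Y))) φ≥0 R₉
      (λ B → Reaches-run inst (λ Y → mean (tuples r k) (v B Y)) φ≥0 (R₁₀ B) (λ Y → Reaches-run inst (v B Y) φ≥0 (R₀ B Y) (h B Y)))

  planted-swap : ∀ (f : Vec Carrier r → ℚ) → mean Xs (λ Y → mean (tuples r k) (λ S → indicator (Distinct? S) *ℚ f (plantT S Y))) ≡ plantedT G abelian j r f
  planted-swap f = trans (FinSum-swap (FinSum-mean Xs) (FinSum-mean (tuples r k)) (λ Y S → indicator (Distinct? S) *ℚ f (plantT S Y))) (mean-cong (tuples r k) (λ S → Φ-*ˡ (FinSum-mean Xs) (indicator (Distinct? S)) (f ∘ plantT S)))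

  total-cost : ∀ n E D₀ → (∀ B t σ → Measured B t σ → costWithin inst n (decide ∷ [] , σ) ≤ℚ fromℕ (E * t + D₀)) →
    costWithin inst n (initial reduction) ≤ℚ fromℕ (init-cost + D₀) +ℚ fromℕ (E + (Nₛ + dead) * Λ) *ℚ plantedT G abelian j r (λ Y → costWithin (encode G Y) n (initial p))
  total-cost n E D₀ hyp = ℚ.≤-trans (add-cost₀ base-cost (fills-cost + b) (Det.cost D n) (fills-run-cost A n b Z (λ B Y S → Measure.branch-cost (ready A B Y S) n E D₀ hyp)))
      (ℚ.≤-trans (≡⇒≤ (cong (λ z → fromℕ z +ℚ mean Bs (λ B → mean Xs (λ Y → mean (tuples r k) (Z Y)))) (eq base-cost fills-cost (κ-plant * Λ) (dead * Λ * 1) D₀)))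
        (ℚ.+-monoʳ-≤ (fromℕ (init-cost + D₀)) (ℚ.≤-trans (≡⇒≤ (mean-const Bs {{allVecs-nonZero bools r}} _)) (≡⇒≤ collect))))
    where
    σᵇ = proj₁ base
    A = proj₁ (proj₂ base)
    D = proj₂ (proj₂ base)
    b = κ-plant * Λ + (dead * Λ * 1 + D₀)
    F = fromℕ (E + (Nₛ + dead) * Λ)
    f : Vec Carrier r → ℚ
    f Y = costWithin (encode G Y) n (initial p)
    Z : Vec Carrier r → Vec (Fin r) k → ℚ
    Z Y S = indicator (Distinct? S) *ℚ (F *ℚ f (plantT S Y))
    eq : ∀ a b c d e → a + (b + (c + (d + e))) ≡ a + (b + (c + d)) + e
    eq = solve-∀
    collect : mean Xs (λ Y → mean (tuples r k) (Z Y)) ≡ F *ℚ plantedT G abelian j r f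
    collect = trans (planted-swap (λ Y → F *ℚ f Y)) (trans (mean-cong (tuples r k) (λ S → trans (cong (indicator (Distinct? S) *ℚ_) (Φ-*ˡ (FinSum-mean Xs) F (f ∘ plantT S))) (swap (indicator (Distinct? S)) F (mean Xs (f ∘ plantT S))))) (Φ-*ˡ (FinSum-mean (tuples r k)) F _))
      where
      swap : ∀ a b c → a *ℚ (b *ℚ c) ≡ b *ℚ (a *ℚ c)
      swap = solve 3 (λ a b c → a :* (b :* c) := b :* (a :* c)) refl

  total-reach : ∀ {φ} → NonNeg φ → (w : Vec Bool r → ℕ → ℚ) → (∀ B t → 0ℚ ≤ℚ w B t) → (wᵇ : ℚ) → 0ℚ ≤ℚ wᵇ → (∀ B t → r ^ k′ < t → w B t ≡ wᵇ) →
    (∀ B t σ → Measured B t σ → Reaches inst φ (decide ∷ [] , σ) (w B t)) →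
    ∀ n (s : Vec Carrier r → Memory → ℚ) → (∀ Y τ → 0ℚ ≤ℚ s Y τ) → (∀ Y τ → s Y τ ≤ℚ 1ℚ) →
    Reaches inst φ (initial reduction) (mean Bs (λ B → plantedT G abelian j r (λ Y → outcome (encode G Y) n 0 (initial p) (λ (τ , t) → s Y τ *ℚ w B t))))
  total-reach {φ} φ≥0 w w≥0 wᵇ wᵇ≥0 w-over hyp n s s≥0 s≤1 = Reaches-≤ inst {φ} {initial reduction} (≡⇒≤ (mean-cong Bs (λ B → sym (planted-swap (V B)))))
    (Reaches-det inst φ≥0 (proj₂ (proj₂ base)) (fills-run-reach A φ≥0 (λ B Y S → indicator (Distinct? S) *ℚ V B (plantT S Y))
      (λ B Y S → Measure.branch-reach (ready A B Y S) φ≥0 (w B) (w≥0 B) wᵇ wᵇ≥0 (w-over B) (hyp B) n (s (plantT S Y)) (s≥0 (plantT S Y)) (s≤1 (plantT S Y)))))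
    where
    A = proj₁ (proj₂ base)
    V : Vec Bool r → Vec Carrier r → ℚ
    V B Y = outcome (encode G Y) n 0 (initial p) (λ (τ , t) → s Y τ *ℚ w B t)

-- The success probability of the reduction

∑-tuples-++ : ∀ {r} i n (f : Vec (Fin r) (i + n) → ℚ) → ∑ (tuples r (i + n)) f ≡ ∑ (tuples r i) (λ U → ∑ (tuples r n) (λ v → f (U Vec.++ v)))
∑-tuples-++ zero    n f = sym (ℚ.+-identityʳ _)
∑-tuples-++ {r} (suc i) n f = trans (∑-cartesian _∷_ (allFin r) (tuples r (i + n)) f) (trans (∑-cong (allFin r) (λ x → ∑-tuples-++ i n (λ w → f (x ∷ w))))
  (sym (∑-cartesian _∷_ (allFin r) (tuples r i) _)))

outcome≤const : ∀ X n clk c {f : Memory × ℕ → ℚ} {v} → 0ℚ ≤ℚ v → (∀ o → f o ≤ℚ v) → outcome X n clk c f ≤ℚ v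
outcome≤const X n clk c {f} {v} 0≤v h = ℚ.≤-trans (Φ-mono (FinSum-outcome X n clk c) (λ o → ℚ.≤-trans (h o) (≡⇒≤ (sym (ℚ.*-identityʳ v)))))
  (ℚ.≤-trans (≡⇒≤ (Φ-*ˡ (FinSum-outcome X n clk c) v (λ _ → 1ℚ))) (ℚ.≤-trans (*-monoˡ 0≤v (outcome≤1 X n clk c)) (≡⇒≤ (ℚ.*-identityʳ v))))

mean-common : ∀ {A : Set} (xs : List A) (X : A → Input) (φ : A → Memory → ℚ) → (∀ a → NonNeg (φ a)) → (c : A → Config) (v : A → ℚ) →
  (∀ a → ∃[ n ] v a ≤ℚ halt (X a) n (φ a) (c a)) → ∃[ n ] mean xs v ≤ℚ mean xs (λ a → halt (X a) n (φ a) (c a))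
mean-common xs X φ φ≥0 c v h = let (n , q) = common xs in n , subst₂ _≤ℚ_ (sym (mean-∑ xs v)) (sym (mean-∑ xs _)) (*-monoˡ (0≤inv (length xs)) q)
  where
  common : ∀ xs → ∃[ n ] ∑ xs v ≤ℚ ∑ xs (λ a → halt (X a) n (φ a) (c a))
  common []       = 0 , ℚ.≤-refl
  common (x ∷ xs) =
    let (n , q) = common xs ; (m , q′) = h x in
    m ⊔ n , ℚ.+-mono-≤ (ℚ.≤-trans q′ (halt-mono (X x) (φ≥0 x) (ℕ.m≤m⊔n m n) (c x))) (ℚ.≤-trans q (∑-mono xs (λ a → halt-mono (X a) (φ≥0 a) (ℕ.m≤n⊔m m n) (c a))))

-- Everything about an instance but its elements.
record Size : Set₁ where
  field
    arith   : Arith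
    G       : FiniteGroup
    abelian : Abelian G
    M       : ℕ
    coded   : Coded arith G M
    j u r   : ℕ
    p       : Program
    Λ C Nₛ  : ℕ
  open Programs arith j u p public
  field
    1≤r     : 1 ≤ r
    1≤Λ     : 1 ≤ Λ
    M≤      : len M ≤ Λ
    power≤  : len (r ^ k′ + 1) ≤ Λ
    k′≤     : len k′ ≤ Λ
    fits    : AllSub (Overhead.D (kinOf arith)) Nₛ p × AllSub κₛ C p
    over≤   : len (r ^ k′ + C * (r ^ k′ + Λ)) ≤ Λ
    M≡      : M ≡ 2 ^ ⌈log₂ r ^ k′ ⌉

  open FiniteGroup G public using (Carrier; ε; elements; code)

  theInstance : Vec Carrier r → Instance
  theInstance X = record { arith = arith ; G = G ; abelian = abelian ; M = M ; coded = coded ; j = j ; u = u ; r = r ; p = p ; X = X ; Λ = Λ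
                         ; 1≤r = 1≤r ; 1≤Λ = 1≤Λ ; M≤ = M≤ ; power≤ = power≤ ; k′≤ = k′≤ }

module Success (Z : Size) (r-large : Size.k′ Z + Size.k′ Z ≤ Size.r Z) (n : ℕ) where
  open Size Z
  open Abelian abelian using (order)
  open Counting G abelian r

  success : Vec Carrier r → Memory → ℚ
  success Y τ = indicator (isSolution? G k Y (outputSet k r τ))

  0≤success : ∀ Y τ → 0ℚ ≤ℚ success Y τ
  0≤success Y τ = 0≤indicator (isSolution? G k Y (outputSet k r τ))

  success≤1 : ∀ Y τ → success Y τ ≤ℚ 1ℚ
  success≤1 Y τ = indicator≤1 (isSolution? G k Y (outputSet k r τ))

  out : Memory → Vec (Fin r) k
  out τ = Vec.tabulate (λ l → clamp 1≤r (τ 0 (toℕ l)))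

  success≤sol : ∀ Y τ → success Y τ ≤ℚ sol (out τ) Y
  success≤sol Y τ = indicator-mono (isSolution? G k Y (outputSet k r τ)) (Sol? (out τ) Y) go
    where
    g : Fin k → ℕ
    g l = τ 0 (toℕ l)
    go : IsSolution G k Y (outputSet k r τ) → Sol (out τ) Y
    go (c , s) =
      let (w , D , h) = setOf-full G abelian {r} g c
          e = trans (Vec.tabulate-cong (λ l → trans (cong (clamp 1≤r) (h l)) (clamp-toℕ 1≤r (lookup w l)))) (Vec.tabulate∘lookup w)
      in subst (λ w → Sol w Y) (sym e) (D , trans (sym (proj₂ (setOf-Distinct G abelian g w D h) Y)) s)

  run : Vec Carrier r → (Memory × ℕ → ℚ) → ℚ
  run Y = outcome (encode G Y) n 0 (initial p)

  FinSum-run : ∀ Y → FinSum (run Y)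
  FinSum-run Y = FinSum-outcome (encode G Y) n 0 (initial p)

  within : ℕ → ℕ → ℚ
  within t s = indicator (s ℕ.≤? t)

  -- The sum of the success probabilities of the rounds
  z : Vec Carrier r → Vec Bool r → ℕ → ℚ
  z X B t = ∑ (tuples r u) (λ U → run (shift B (sumT U X) X) (λ (τ , s) → sol (U Vec.++ out τ) X *ℚ within t s))

  0≤z : ∀ X B t → 0ℚ ≤ℚ z X B t
  0≤z X B t = ∑-nonNeg (tuples r u) (λ U → Φ-nonNeg (FinSum-run (shift B (sumT U X) X)) (λ (τ , s) → 0≤* (0≤sol (U Vec.++ out τ) X) (0≤indicator (s ℕ.≤? t))))

  z≤N : ∀ X B t → z X B t ≤ℚ N k′ X
  z≤N X B t = ℚ.≤-trans (∑-mono (tuples r u) each) (≡⇒≤ (sym (∑-tuples-++ u k (λ w → sol w X))))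
    where
    each : ∀ U → run (shift B (sumT U X) X) (λ (τ , s) → sol (U Vec.++ out τ) X *ℚ within t s) ≤ℚ ∑ (tuples r k) (λ v → sol (U Vec.++ v) X)
    each U = outcome≤const (encode G (shift B (sumT U X) X)) n 0 (initial p) (∑-nonNeg (tuples r k) (λ v → 0≤sol (U Vec.++ v) X))
      (λ (τ , s) → ℚ.≤-trans (*-monoˡ (0≤sol (U Vec.++ out τ) X) (indicator≤1 (s ℕ.≤? t))) (ℚ.≤-trans (≡⇒≤ (ℚ.*-identityʳ (sol (U Vec.++ out τ) X)))
        (Enum.term≤∑ (Enum-allVecs (Enum-allFin r) k) (out τ) (λ v → 0≤sol (U Vec.++ v) X))))

  Ψ : (Vec Carrier r × Memory × ℕ → ℚ) → ℚ
  Ψ g = plantedT G abelian j r (λ Y → run Y (λ o → g (Y , o)))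

  FinSum-Ψ : FinSum Ψ
  FinSum-Ψ = FinSum-bind (FinSum-plantedT G abelian j r) (λ Y → FinSum-map (λ o → Y , o) (FinSum-run Y))

  succ : Vec Carrier r × Memory × ℕ → ℚ
  succ (Y , τ , t) = success Y τ

  time : Vec Carrier r × Memory × ℕ → ℕ
  time (Y , τ , t) = t

  α : ℕ → ℚ
  α t = Ψ (λ o → succ o *ℚ within t (time o))

  plantedT≤1 : ∀ {f : Vec Carrier r → ℚ} → (∀ Y → f Y ≤ℚ 1ℚ) → plantedT G abelian j r f ≤ℚ 1ℚ
  plantedT≤1 {f} h = ℚ.≤-trans (mean-mono (tuples r k) each) (mean-const-≤ (tuples r k) 0≤1)
    where
    each : ∀ w → indicator (Distinct? w) *ℚ mean Xs (f ∘ plantT w) ≤ℚ 1ℚ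
    each w = ℚ.≤-trans (*-monoˡ (0≤indicator (Distinct? w)) (ℚ.≤-trans (mean-mono Xs (λ X → h (plantT w X))) (mean-const-≤ Xs 0≤1)))
      (ℚ.≤-trans (≡⇒≤ (ℚ.*-identityʳ (indicator (Distinct? w)))) (indicator≤1 (Distinct? w)))

  Ψsucc≤1 : Ψ succ ≤ℚ 1ℚ
  Ψsucc≤1 = plantedT≤1 (λ Y → outcome≤const (encode G Y) n 0 (initial p) 0≤1 (λ (τ , t) → success≤1 Y τ))

  Sₜ : ℕ → Vec Carrier r → ℚ
  Sₜ t Y = run Y (λ (τ , s) → success Y τ *ℚ within t s)

  0≤Sₜ : ∀ t Y → 0ℚ ≤ℚ Sₜ t Y
  0≤Sₜ t Y = Φ-nonNeg (FinSum-run Y) (λ (τ , s) → 0≤* (0≤success Y τ) (0≤indicator (s ℕ.≤? t)))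

  Sₜ≤1 : ∀ t Y → Sₜ t Y ≤ℚ 1ℚ
  Sₜ≤1 t Y = outcome≤const (encode G Y) n 0 (initial p) 0≤1 (λ (τ , s) → ℚ.≤-trans (*-mono (0≤success Y τ) 0≤1 (success≤1 Y τ) (indicator≤1 (s ℕ.≤? t))) (≡⇒≤ (ℚ.*-identityˡ 1ℚ)))

  r^k⁻¹ ρ : ℚ
  r^k⁻¹ = inv (r ^ k)
  ρ = fromℕ (r ^ k) *ℚ q⁻¹

  r^k≢0 : NonZero (r ^ k)
  r^k≢0 = m^n≢0 r k {{ℕ.>-nonZero 1≤r}}

  α≡ : ∀ t → α t ≡ (fromℕ order *ℚ r^k⁻¹) *ℚ mean Xs (λ Y → N k Y *ℚ Sₜ t Y)
  α≡ t = begin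
    mean (tuples r k) (λ w → indicator (Distinct? w) *ℚ mean Xs (Sₜ t ∘ plantT w)) ≡⟨ mean-cong (tuples r k) (λ w → [ good w , bad w ]′ (toSum (Distinct? w))) ⟩
    mean (tuples r k) (λ w → fromℕ order *ℚ mean Xs (λ Y → sol w Y *ℚ Sₜ t Y)) ≡⟨ Φ-*ˡ (FinSum-mean (tuples r k)) (fromℕ order) _ ⟩
    fromℕ order *ℚ mean (tuples r k) (λ w → mean Xs (λ Y → sol w Y *ℚ Sₜ t Y)) ≡⟨ cong (fromℕ order *ℚ_) (trans (mean-∑ (tuples r k) _) (cong₂ _*ℚ_ (cong inv (trans (length-allVecs (allFin r) k) (cong (_^ k) (length-allFin r)))) (sym (𝔼-swap (tuples r k) (λ Y w → sol w Y *ℚ Sₜ t Y))))) ⟩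
    fromℕ order *ℚ (r^k⁻¹ *ℚ mean Xs (λ Y → ∑ (tuples r k) (λ w → sol w Y *ℚ Sₜ t Y))) ≡⟨ sym (ℚ.*-assoc (fromℕ order) r^k⁻¹ _) ⟩
    (fromℕ order *ℚ r^k⁻¹) *ℚ mean Xs (λ Y → ∑ (tuples r k) (λ w → sol w Y *ℚ Sₜ t Y)) ≡⟨ cong ((fromℕ order *ℚ r^k⁻¹) *ℚ_) (mean-cong Xs (λ Y → ∑-*ʳ (tuples r k) (Sₜ t Y) (λ w → sol w Y))) ⟩
    (fromℕ order *ℚ r^k⁻¹) *ℚ mean Xs (λ Y → N k Y *ℚ Sₜ t Y) ∎
    where
    open ≡-Reasoning
    good : ∀ w → Distinct w → indicator (Distinct? w) *ℚ mean Xs (Sₜ t ∘ plantT w) ≡ fromℕ order *ℚ mean Xs (λ Y → sol w Y *ℚ Sₜ t Y)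
    good w D = trans (cong (_*ℚ mean Xs (Sₜ t ∘ plantT w)) (indicator-true (Distinct? w) D)) (trans (ℚ.*-identityˡ (mean Xs (Sₜ t ∘ plantT w))) (trans (mean-plantT w D (Sₜ t))
      (cong (fromℕ order *ℚ_) (mean-cong Xs (λ Y → cong (_*ℚ Sₜ t Y) (sym (trans (sol≡ w Y) (trans (cong (_*ℚ hits w Y) (indicator-true (Distinct? w) D)) (ℚ.*-identityˡ (hits w Y))))))))))
    bad : ∀ w → ¬ Distinct w → indicator (Distinct? w) *ℚ mean Xs (Sₜ t ∘ plantT w) ≡ fromℕ order *ℚ mean Xs (λ Y → sol w Y *ℚ Sₜ t Y)
    bad w m = trans (cong (_*ℚ mean Xs (Sₜ t ∘ plantT w)) (indicator-false (Distinct? w) m)) (trans (ℚ.*-zeroˡ (mean Xs (Sₜ t ∘ plantT w)))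
      (sym (trans (cong (fromℕ order *ℚ_) (trans (mean-cong Xs (λ Y → trans (cong (_*ℚ Sₜ t Y) (indicator-false (Sol? w Y) (m ∘ proj₁))) (ℚ.*-zeroˡ (Sₜ t Y)))) (𝔼-const 0ℚ))) (ℚ.*-zeroʳ (fromℕ order)))))

  -- In J t the tuple found within time t is weighted.
  J : ℕ → Vec Carrier r → (Vec (Fin r) k → ℚ) → ℚ
  J t Y g = run Y (λ (τ , s) → g (out τ) *ℚ within t s)

  FinSum-J : ∀ t Y → FinSum (J t Y)
  FinSum-J t Y = FinSum-bind (FinSum-run Y) (λ (τ , s) → FinSum-resp (λ g → ℚ.*-comm (g (out τ)) (within t s)) (FinSum-scale (0≤indicator (s ℕ.≤? t)) (FinSum-point (out τ))))

  a : ℕ → ℚ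
  a t = mean Xs (λ Y → J t Y (λ v → sol v Y))

  0≤a : ∀ t → 0ℚ ≤ℚ a t
  0≤a t = mean-nonNeg Xs (λ Y → Φ-nonNeg (FinSum-J t Y) (λ v → 0≤sol v Y))

  Sₜ≤a : ∀ t → mean Xs (Sₜ t) ≤ℚ a t
  Sₜ≤a t = mean-mono Xs (λ Y → Φ-mono (FinSum-run Y) (λ (τ , s) → *-monoʳ (0≤indicator (s ℕ.≤? t)) (success≤sol Y τ)))

  K : ℚ
  K = fromℕ (k ^ k)

  α≤ : ∀ t → α t ≤ℚ (fromℕ order *ℚ r^k⁻¹) *ℚ (K *ℚ a t) +ℚ ρ
  α≤ t = begin
    α t ≡⟨ α≡ t ⟩
    O *ℚ mean Xs (λ Y → N k Y *ℚ Sₜ t Y) ≤⟨ *-monoˡ 0≤O (mean-mono Xs (λ Y → N-few k Y (s≤s z≤n) (0≤Sₜ t Y) (Sₜ≤1 t Y))) ⟩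
    O *ℚ mean Xs (λ Y → K *ℚ Sₜ t Y +ℚ P k Y) ≡⟨ cong (O *ℚ_) (trans (Φ-+ (FinSum-mean Xs) (λ Y → K *ℚ Sₜ t Y) (P k)) (cong (_+ℚ mean Xs (P k)) (Φ-*ˡ (FinSum-mean Xs) K (Sₜ t)))) ⟩
    O *ℚ (K *ℚ mean Xs (Sₜ t) +ℚ mean Xs (P k)) ≤⟨ *-monoˡ 0≤O (ℚ.+-mono-≤ (*-monoˡ (0≤fromℕ (k ^ k)) (Sₜ≤a t)) (𝔼-P j)) ⟩
    O *ℚ (K *ℚ a t +ℚ ρ *ℚ ρ) ≡⟨ ℚ.*-distribˡ-+ O (K *ℚ a t) (ρ *ℚ ρ) ⟩
    O *ℚ (K *ℚ a t) +ℚ O *ℚ (ρ *ℚ ρ) ≡⟨ cong (O *ℚ (K *ℚ a t) +ℚ_) cancel-O ⟩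
    O *ℚ (K *ℚ a t) +ℚ ρ ∎
    where
    open ℚ.≤-Reasoning
    O = fromℕ order *ℚ r^k⁻¹
    0≤O = 0≤* (0≤fromℕ order) (0≤inv (r ^ k))
    cancel-O : O *ℚ (ρ *ℚ ρ) ≡ ρ
    cancel-O = trans (solve 4 (λ o i x q → (o :* i) :* ((x :* q) :* (x :* q)) := (o :* q) :* ((i :* x) :* (x :* q))) refl (fromℕ order) r^k⁻¹ (fromℕ (r ^ k)) q⁻¹)
      (trans (cong₂ (λ x y → x *ℚ (y *ℚ ρ)) order*q⁻¹ (inv*fromℕ (r ^ k) {{r^k≢0}})) (trans (ℚ.*-identityˡ (1ℚ *ℚ ρ)) (ℚ.*-identityˡ ρ)))

  Z̄ : ℕ → ℚ
  Z̄ t = mean Xs (λ X → mean Bs (λ B → z X B t))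

  m : ℕ
  m = r ∸ k′

  c : ℚ
  c = inv (2 ^ k′) *ℚ fromℕ (m ^ u)

  c*a≤Z̄ : ∀ t → c *ℚ a t ≤ℚ Z̄ t
  c*a≤Z̄ t = Completion.completion {j} {u} {m} (≡⇒≤ⁿ (m∸n+n≡m (≤-trans (m≤m+n k′ k′) r-large))) (J t) (FinSum-J t)

  κ₀ : ℚ
  κ₀ = (inv (2 ^ k′) *ℚ inv (2 ^ u)) *ℚ (½ *ℚ inv (k ^ k))

  κ₀≥0 : 0ℚ ≤ℚ κ₀
  κ₀≥0 = 0≤* (0≤* (0≤inv (2 ^ k′)) (0≤inv (2 ^ u))) (0≤* (ℚ.nonNegative⁻¹ ½) (0≤inv (k ^ k)))

  module _ (order≤ : order ≤ 2 * r ^ k′) where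
    κ₀*O≤c : κ₀ *ℚ ((fromℕ order *ℚ r^k⁻¹) *ℚ K) ≤ℚ c
    κ₀*O≤c = begin
      κ₀ *ℚ ((fromℕ order *ℚ r^k⁻¹) *ℚ K) ≡⟨ solve 7 (λ A B h i o x K → ((A :* B) :* (h :* i)) :* ((o :* x) :* K) := (A :* (B :* ((h :* o) :* x))) :* (i :* K)) refl (inv (2 ^ k′)) (inv (2 ^ u)) ½ (inv (k ^ k)) (fromℕ order) r^k⁻¹ K ⟩
      (inv (2 ^ k′) *ℚ (inv (2 ^ u) *ℚ ((½ *ℚ fromℕ order) *ℚ r^k⁻¹))) *ℚ (inv (k ^ k) *ℚ K) ≡⟨ cong ((inv (2 ^ k′) *ℚ (inv (2 ^ u) *ℚ ((½ *ℚ fromℕ order) *ℚ r^k⁻¹))) *ℚ_) (inv*fromℕ (k ^ k) {{m^n≢0 k k}}) ⟩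
      (inv (2 ^ k′) *ℚ (inv (2 ^ u) *ℚ ((½ *ℚ fromℕ order) *ℚ r^k⁻¹))) *ℚ 1ℚ ≡⟨ ℚ.*-identityʳ _ ⟩
      inv (2 ^ k′) *ℚ (inv (2 ^ u) *ℚ ((½ *ℚ fromℕ order) *ℚ r^k⁻¹)) ≤⟨ *-monoˡ (0≤inv (2 ^ k′)) (*-monoˡ (0≤inv (2 ^ u)) (*-monoʳ (0≤inv (r ^ k)) half-order)) ⟩
      inv (2 ^ k′) *ℚ (inv (2 ^ u) *ℚ (fromℕ (r ^ k′) *ℚ r^k⁻¹)) ≡⟨ cong (λ y → inv (2 ^ k′) *ℚ (inv (2 ^ u) *ℚ y)) powers ⟩
      inv (2 ^ k′) *ℚ (inv (2 ^ u) *ℚ fromℕ (r ^ u)) ≤⟨ *-monoˡ (0≤inv (2 ^ k′)) (*-monoˡ (0≤inv (2 ^ u)) (half-power {k′} {r} {u} r-large)) ⟩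
      inv (2 ^ k′) *ℚ (inv (2 ^ u) *ℚ (fromℕ (2 ^ u) *ℚ fromℕ (m ^ u))) ≡⟨ cong (inv (2 ^ k′) *ℚ_) (trans (sym (ℚ.*-assoc (inv (2 ^ u)) (fromℕ (2 ^ u)) (fromℕ (m ^ u)))) (trans (cong (_*ℚ fromℕ (m ^ u)) (inv*fromℕ (2 ^ u) {{m^n≢0 2 u}})) (ℚ.*-identityˡ (fromℕ (m ^ u))))) ⟩
      c ∎
      where
      open ℚ.≤-Reasoning
      half-order : ½ *ℚ fromℕ order ≤ℚ fromℕ (r ^ k′)
      half-order = ℚ.≤-trans (*-monoˡ (ℚ.nonNegative⁻¹ ½) (ℚ.≤-trans (fromℕ-mono order≤) (≡⇒≤ (fromℕ-* 2 (r ^ k′))))) (≡⇒≤ (trans (sym (ℚ.*-assoc ½ (fromℕ 2) (fromℕ (r ^ k′)))) (ℚ.*-identityˡ (fromℕ (r ^ k′)))))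
      powers : fromℕ (r ^ k′) *ℚ r^k⁻¹ ≡ fromℕ (r ^ u)
      powers = trans (cong (_*ℚ r^k⁻¹) (trans (cong fromℕ (ℕ.^-distribˡ-+-* r u k)) (fromℕ-* (r ^ u) (r ^ k)))) (trans (ℚ.*-assoc (fromℕ (r ^ u)) (fromℕ (r ^ k)) r^k⁻¹) (trans (cong (fromℕ (r ^ u) *ℚ_) (fromℕ*inv (r ^ k) {{r^k≢0}})) (ℚ.*-identityʳ (fromℕ (r ^ u)))))

    κ₀*α≤Z̄ : ∀ t → κ₀ *ℚ α t ≤ℚ Z̄ t +ℚ κ₀ *ℚ ρ
    κ₀*α≤Z̄ t = begin
      κ₀ *ℚ α t ≤⟨ *-monoˡ κ₀≥0 (α≤ t) ⟩
      κ₀ *ℚ ((fromℕ order *ℚ r^k⁻¹) *ℚ (K *ℚ a t) +ℚ ρ) ≡⟨ solve 5 (λ k o K a r → k :* (o :* (K :* a) :+ r) := (k :* (o :* K)) :* a :+ k :* r) refl κ₀ (fromℕ order *ℚ r^k⁻¹) K (a t) ρ ⟩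
      (κ₀ *ℚ ((fromℕ order *ℚ r^k⁻¹) *ℚ K)) *ℚ a t +ℚ κ₀ *ℚ ρ ≤⟨ ℚ.+-monoˡ-≤ (κ₀ *ℚ ρ) (ℚ.≤-trans (*-monoʳ (0≤a t) κ₀*O≤c) (c*a≤Z̄ t)) ⟩
      Z̄ t +ℚ κ₀ *ℚ ρ ∎
      where
      open ℚ.≤-Reasoning

module SuccessBound (Z : Size) (r-large : Size.k′ Z + Size.k′ Z ≤ Size.r Z) (n : ℕ)
  {ℓ : ℚ} (0≤ℓ : 0ℚ ≤ℚ ℓ) (ℓ≤½ : ℓ ≤ℚ ½) where
  open Size Z
  open Abelian abelian using (order)
  open Counting G abelian r
  open Success Z r-large n
  open Quadratic ℓ 0≤ℓ ℓ≤½

  w : Vec Carrier r → Vec Bool r → ℕ → ℚ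
  w X B t with t ℕ.≤? r ^ k′
  ... | yes _ = h⁺ (z X B t)
  ... | no _  = h⁺ (N k′ X)

  0≤w : ∀ X B t → 0ℚ ≤ℚ w X B t
  0≤w X B t with t ℕ.≤? r ^ k′
  ... | yes _ = h⁺≥0 (z X B t)
  ... | no _  = h⁺≥0 (N k′ X)

  w-over : ∀ X B t → r ^ k′ < t → w X B t ≡ h⁺ (N k′ X)
  w-over X B t p with t ℕ.≤? r ^ k′
  ... | yes q = contradiction q (ℕ.<⇒≱ p)
  ... | no _  = refl

  φ : Vec Carrier r → Memory → ℚ
  φ X σ = indicator (isSolution? G k′ X (outputSet k′ r σ))

  reaches : ∀ X → Reaches (encode G X) (φ X) (initial reduction) (mean Bs (λ B → plantedT G abelian j r (λ Y → run Y (λ (τ , t) → success Y τ *ℚ w X B t))))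
  reaches X = total-reach φ≥0 (w X) (0≤w X) (h⁺ (N k′ X)) (h⁺≥0 (N k′ X)) (w-over X) hyp n success 0≤success success≤1
    where
    open Total (theInstance X) C Nₛ fits over≤ M≡ using (total-reach)
    open Searches (theInstance X) C Nₛ fits over≤ using (Measured; module Decide)
    φ≥0 : NonNeg (φ X)
    φ≥0 σ = 0≤indicator (isSolution? G k′ X (outputSet k′ r σ))
    φ-sol : ∀ σ (w : Vec (Fin r) k′) → (∀ l → σ 0 (toℕ l) ≡ toℕ (lookup w l)) → Sol w X → 1ℚ ≤ℚ φ X σ
    φ-sol σ w t (D , e) = ≡⇒≤ (sym (indicator-true (isSolution? G k′ X (outputSet k′ r σ)) (let (c , s) = setOf-Distinct G abelian (λ l → σ 0 (toℕ l)) w D t in c , trans (s X) e)))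
    hyp : ∀ B t σ → Measured B t σ → Reaches (encode G X) (φ X) (decide ∷ [] , σ) (w X B t)
    hyp B t σ D with t ℕ.≤? r ^ k′
    ... | yes le = Decide.search-reach D φ≥0 φ-sol 0≤ℓ ℓ≤½ le n
    ... | no q   = Decide.brute-reach D φ≥0 φ-sol 0≤ℓ ℓ≤½ (≰⇒> q)

  c₁ : ℚ
  c₁ = fromℕ (k′ ^ k′) +ℚ 1ℚ

  module _ (r^k′≤order : r ^ k′ ≤ order) (order≤ : order ≤ 2 * r ^ k′) where
    ratio≤1 : fromℕ (r ^ k′) *ℚ q⁻¹ ≤ℚ 1ℚ
    ratio≤1 = ℚ.≤-trans (*-monoʳ 0≤q⁻¹ (fromℕ-mono r^k′≤order)) (≡⇒≤ order*q⁻¹)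

    𝔼N²≤ : mean Xs (λ X → N k′ X *ℚ N k′ X) ≤ℚ c₁
    𝔼N²≤ = go k′ (≤-trans (s≤s z≤n) (m≤n+m k u)) ratio≤1
      where
      go : ∀ i → 1 ≤ i → fromℕ (r ^ i) *ℚ q⁻¹ ≤ℚ 1ℚ → mean Xs (λ X → N i X *ℚ N i X) ≤ℚ fromℕ (i ^ i) +ℚ 1ℚ
      go (suc i) _ le = begin
        mean Xs (λ X → N (suc i) X *ℚ N (suc i) X) ≤⟨ mean-mono Xs (N² (suc i)) ⟩
        mean Xs (λ X → K′ *ℚ N (suc i) X +ℚ P (suc i) X) ≡⟨ trans (Φ-+ (FinSum-mean Xs) (λ X → K′ *ℚ N (suc i) X) (P (suc i))) (cong (_+ℚ mean Xs (P (suc i))) (Φ-*ˡ (FinSum-mean Xs) K′ (N (suc i)))) ⟩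
        K′ *ℚ mean Xs (N (suc i)) +ℚ mean Xs (P (suc i)) ≤⟨ ℚ.+-mono-≤ (ℚ.≤-trans (*-monoˡ (0≤fromℕ (suc i ^ suc i)) (ℚ.≤-trans (𝔼-N≤ i) le)) (≡⇒≤ (ℚ.*-identityʳ K′)))
                                                                            (ℚ.≤-trans (𝔼-P i) (ℚ.≤-trans (*-mono (0≤* (0≤fromℕ (r ^ suc i)) 0≤q⁻¹) 0≤1 le le) (≡⇒≤ (ℚ.*-identityˡ 1ℚ)))) ⟩
        K′ +ℚ 1ℚ ∎
        where
        open ℚ.≤-Reasoning
        K′ = fromℕ (suc i ^ suc i)

    w̄ : ℕ → ℚ
    w̄ t = mean Xs (λ X → mean Bs (λ B → w X B t))

    w≥ : ∀ X B t → ℓ *ℚ z X B t -ℚ (ℓ *ℚ ℓ) *ℚ (N k′ X *ℚ N k′ X) ≤ℚ w X B t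
    w≥ X B t with t ℕ.≤? r ^ k′
    ... | yes _ = ℚ.≤-trans (ℚ.+-monoʳ-≤ (ℓ *ℚ z X B t) (ℚ.neg-antimono-≤ (*-monoˡ (0≤* 0≤ℓ 0≤ℓ) (*-mono (0≤z X B t) (0≤N k′ X) (z≤N X B t) (z≤N X B t))))) (h≤h⁺ (z X B t))
    ... | no _  = ℚ.≤-trans (ℚ.+-monoˡ-≤ (-ℚ ((ℓ *ℚ ℓ) *ℚ (N k′ X *ℚ N k′ X))) (*-monoˡ 0≤ℓ (z≤N X B t))) (h≤h⁺ (N k′ X))

    e : ℚ
    e = ℓ *ℚ (κ₀ *ℚ ρ) +ℚ (ℓ *ℚ ℓ) *ℚ c₁

    w̄≥ : ∀ t → (ℓ *ℚ κ₀) *ℚ α t ≤ℚ w̄ t +ℚ e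
    w̄≥ t = begin
      (ℓ *ℚ κ₀) *ℚ α t ≡⟨ ℚ.*-assoc ℓ κ₀ (α t) ⟩
      ℓ *ℚ (κ₀ *ℚ α t) ≤⟨ *-monoˡ 0≤ℓ (κ₀*α≤Z̄ order≤ t) ⟩
      ℓ *ℚ (Z̄ t +ℚ κ₀ *ℚ ρ) ≡⟨ solve 4 (λ l z k q → l :* (z :+ k) := (l :* z :- q) :+ (l :* k :+ q)) refl ℓ (Z̄ t) (κ₀ *ℚ ρ) ((ℓ *ℚ ℓ) *ℚ 𝔼N²) ⟩
      (ℓ *ℚ Z̄ t -ℚ (ℓ *ℚ ℓ) *ℚ 𝔼N²) +ℚ (ℓ *ℚ (κ₀ *ℚ ρ) +ℚ (ℓ *ℚ ℓ) *ℚ 𝔼N²) ≤⟨ ℚ.+-mono-≤ lower-w (ℚ.+-monoʳ-≤ (ℓ *ℚ (κ₀ *ℚ ρ)) (*-monoˡ (0≤* 0≤ℓ 0≤ℓ) 𝔼N²≤)) ⟩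
      w̄ t +ℚ e ∎
      where
      open ℚ.≤-Reasoning
      𝔼N² = mean Xs (λ X → N k′ X *ℚ N k′ X)
      lin : ∀ {A : Set} {Φ : (A → ℚ) → ℚ} → FinSum Φ → ∀ c (f g : A → ℚ) → Φ (λ x → c *ℚ f x -ℚ g x) ≡ c *ℚ Φ f -ℚ Φ g
      lin {Φ = Φ} S c f g = trans (Φ-+ S (λ x → c *ℚ f x) (λ x → -ℚ g x)) (cong₂ _+ℚ_ (Φ-*ˡ S c f)
        (trans (Φ-cong S (λ x → solve 1 (λ y → :- y := (:- con 1ℚ) :* y) refl (g x))) (trans (Φ-*ˡ S (-ℚ 1ℚ) g) (solve 1 (λ y → (:- con 1ℚ) :* y := :- y) refl (Φ g)))))
      lower-w : ℓ *ℚ Z̄ t -ℚ (ℓ *ℚ ℓ) *ℚ 𝔼N² ≤ℚ w̄ t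
      lower-w = begin
        ℓ *ℚ Z̄ t -ℚ (ℓ *ℚ ℓ) *ℚ 𝔼N² ≡⟨ cong (λ y → ℓ *ℚ Z̄ t -ℚ y) (sym (Φ-*ˡ (FinSum-mean Xs) (ℓ *ℚ ℓ) (λ X → N k′ X *ℚ N k′ X))) ⟩
        ℓ *ℚ Z̄ t -ℚ mean Xs (λ X → (ℓ *ℚ ℓ) *ℚ (N k′ X *ℚ N k′ X)) ≡⟨ sym (lin (FinSum-mean Xs) ℓ (λ X → mean Bs (λ B → z X B t)) (λ X → (ℓ *ℚ ℓ) *ℚ (N k′ X *ℚ N k′ X))) ⟩
        mean Xs (λ X → ℓ *ℚ mean Bs (λ B → z X B t) -ℚ (ℓ *ℚ ℓ) *ℚ (N k′ X *ℚ N k′ X)) ≡⟨ mean-cong Xs (λ X → cong (λ y → ℓ *ℚ mean Bs (λ B → z X B t) -ℚ y) (sym (mean-const Bs {{allVecs-nonZero bools r}} ((ℓ *ℚ ℓ) *ℚ (N k′ X *ℚ N k′ X))))) ⟩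
        mean Xs (λ X → ℓ *ℚ mean Bs (λ B → z X B t) -ℚ mean Bs (λ B → (ℓ *ℚ ℓ) *ℚ (N k′ X *ℚ N k′ X))) ≡⟨ mean-cong Xs (λ X → sym (lin (FinSum-mean Bs) ℓ (λ B → z X B t) (λ B → (ℓ *ℚ ℓ) *ℚ (N k′ X *ℚ N k′ X)))) ⟩
        mean Xs (λ X → mean Bs (λ B → ℓ *ℚ z X B t -ℚ (ℓ *ℚ ℓ) *ℚ (N k′ X *ℚ N k′ X))) ≤⟨ mean-mono Xs (λ X → mean-mono Bs (λ B → w≥ X B t)) ⟩
        w̄ t ∎

    0≤e : 0ℚ ≤ℚ e
    0≤e = 0≤+ (0≤* 0≤ℓ (0≤* κ₀≥0 (0≤* (0≤fromℕ (r ^ k)) 0≤q⁻¹))) (0≤* (0≤* 0≤ℓ 0≤ℓ) (0≤+ (0≤fromℕ (k′ ^ k′)) 0≤1))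

    success-bound : ∃[ n′ ] (ℓ *ℚ κ₀) *ℚ (½ *ℚ (Ψ succ *ℚ Ψ succ)) -ℚ e ≤ℚ successWithin G k′ (uniform G r) reduction n′
    success-bound =
      let (n′ , q) = mean-common Xs (encode G) φ (λ X σ → 0≤indicator (isSolution? G k′ X (outputSet k′ r σ))) (λ _ → initial reduction) v reaches in
      n′ , ℚ.≤-trans lower (ℚ.≤-trans q (≡⇒≤ (mean-cong Xs (λ X → sym (haltWithin≡halt (λ σ → isSolution? G k′ X (outputSet k′ r σ)) (encode G X) n′ (initial reduction))))))
      where
      open ℚ.≤-Reasoning
      v : Vec Carrier r → ℚ
      v X = mean Bs (λ B → plantedT G abelian j r (λ Y → run Y (λ (τ , t) → success Y τ *ℚ w X B t)))
      v̄≡ : mean Xs v ≡ Ψ (λ o → succ o *ℚ w̄ (time o))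
      v̄≡ = trans (FinSum-swap (FinSum-bind (FinSum-mean Xs) (λ X → FinSum-map (λ B → X , B) (FinSum-mean Bs))) FinSum-Ψ (λ (X , B) o → succ o *ℚ w X B (time o)))
        (Φ-cong FinSum-Ψ (λ o → trans (mean-cong Xs (λ X → Φ-*ˡ (FinSum-mean Bs) (succ o) (λ B → w X B (time o)))) (Φ-*ˡ (FinSum-mean Xs) (succ o) (λ X → mean Bs (λ B → w X B (time o))))))
      0≤succ : ∀ o → 0ℚ ≤ℚ succ o
      0≤succ (Y , τ , t) = 0≤success Y τ
      lower : (ℓ *ℚ κ₀) *ℚ (½ *ℚ (Ψ succ *ℚ Ψ succ)) -ℚ e ≤ℚ mean Xs v
      lower = begin
        (ℓ *ℚ κ₀) *ℚ (½ *ℚ (Ψ succ *ℚ Ψ succ)) -ℚ e ≤⟨ ℚ.+-monoˡ-≤ (-ℚ e) (*-monoˡ (0≤* 0≤ℓ κ₀≥0) (no-slower FinSum-Ψ succ time 0≤succ)) ⟩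
        (ℓ *ℚ κ₀) *ℚ Ψ (λ o → succ o *ℚ α (time o)) -ℚ e ≤⟨ ℚ.+-monoˡ-≤ (-ℚ e) main ⟩
        (mean Xs v +ℚ e) -ℚ e ≡⟨ solve 2 (λ x e → (x :+ e) :- e := x) refl (mean Xs v) e ⟩
        mean Xs v ∎
        where
        main : (ℓ *ℚ κ₀) *ℚ Ψ (λ o → succ o *ℚ α (time o)) ≤ℚ mean Xs v +ℚ e
        main = begin
          (ℓ *ℚ κ₀) *ℚ Ψ (λ o → succ o *ℚ α (time o)) ≡⟨ sym (Φ-*ˡ FinSum-Ψ (ℓ *ℚ κ₀) (λ o → succ o *ℚ α (time o))) ⟩
          Ψ (λ o → (ℓ *ℚ κ₀) *ℚ (succ o *ℚ α (time o))) ≤⟨ Φ-mono FinSum-Ψ (λ o → ℚ.≤-trans (≡⇒≤ (solve 3 (λ a b c → a :* (b :* c) := b :* (a :* c)) refl (ℓ *ℚ κ₀) (succ o) (α (time o)))) (ℚ.≤-trans (*-monoˡ (0≤succ o) (w̄≥ (time o))) (≡⇒≤ (ℚ.*-distribˡ-+ (succ o) (w̄ (time o)) e)))) ⟩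
          Ψ (λ o → succ o *ℚ w̄ (time o) +ℚ succ o *ℚ e) ≡⟨ trans (Φ-+ FinSum-Ψ (λ o → succ o *ℚ w̄ (time o)) (λ o → succ o *ℚ e)) (cong₂ _+ℚ_ (sym v̄≡) (Φ-*ʳ FinSum-Ψ e succ)) ⟩
          mean Xs v +ℚ Ψ succ *ℚ e ≤⟨ ℚ.+-monoʳ-≤ (mean Xs v) (ℚ.≤-trans (*-monoʳ 0≤e Ψsucc≤1) (≡⇒≤ (ℚ.*-identityˡ e))) ⟩
          mean Xs v +ℚ e ∎

  planted-success : successWithin G k (planted G k r) p n ≤ℚ (fromℕ (2 ^ k) *ℚ fromℕ (k ^ k)) *ℚ Ψ succ
  planted-success = ℚ.≤-trans (SetsAndTuples.planted≤plantedT G abelian j r f f≥0 (≤-trans (+-mono-≤ (m≤n+m k u) (m≤n+m k u)) r-large))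
      (*-monoˡ (0≤* (0≤fromℕ (2 ^ k)) (0≤fromℕ (k ^ k))) (Φ-mono (FinSum-plantedT G abelian j r) same))
    where
    f : Vec Carrier r → ℚ
    f Y = haltWithin (λ τ → isSolution? G k Y (outputSet k r τ)) (encode G Y) n (initial p)
    f≡ : ∀ Y → f Y ≡ run Y (λ (τ , t) → success Y τ)
    f≡ Y = trans (haltWithin≡halt (λ τ → isSolution? G k Y (outputSet k r τ)) (encode G Y) n (initial p)) (sym (outcome-halt (encode G Y) n 0 (initial p) (success Y)))
    f≥0 : NonNeg f
    f≥0 Y = respʳ (sym (f≡ Y)) (Φ-nonNeg (FinSum-run Y) (λ (τ , t) → 0≤success Y τ))
    same : ∀ Y → f Y ≤ℚ run Y (λ o → succ (Y , o))
    same Y = ≡⇒≤ (f≡ Y)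

-- The running time of the reduction

module Constants (R : Arith) (j u : ℕ) (p : Program) (C Nₛ : ℕ) where
  open Programs R j u p
  open AttemptCost R j u p

  round-constant : Program → ℕ
  round-constant body = κₛ (rounds body) + (2 + (κₛ inc + (κₛ check + 3)))

  fill-constant : ℕ → Exp → Exp → ℕ
  fill-constant a cnt e = κₛ (fillLoop a cnt e) + (1 + (κₛ (random a (cell 11) e) + κₛ (store 11 (lit 0) (op add (cell 11) (lit 1)))))

  search-constant brute-constant attempt-constant guess-constant search-total brute-total decide-constant
    begin-constant double-constant marks-constant plant-constant init-constant time-constant : ℕ
  search-constant  = 1 + (κₛ (store 4 (lit 0) (lit 1)) + (κₛ (branch (op less (cell 6) (cell 5)) bruteForce search) + (1 + (κₛ (store 6 (lit 0) (cell 5)) + (1 + κₛ (store 8 (lit 0) (cell 3)))))))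
  brute-constant   = 1 + (κₛ (store 4 (lit 0) (lit 1)) + (κₛ (branch (op less (cell 6) (cell 5)) bruteForce search) + (1 + κₛ (store 8 (lit 0) (op add (powᴱ k′) (lit 1))))))
  attempt-constant = (1 + (4 * 1 + suc u * (fill-constant 0 (lit u) size * 1))) + ((κₛ shiftBy + 6) * 1 + (((Nₛ + dead) * (1 + C) + dead * 1) + κcopy * ((1 + C) + 1)))
  guess-constant   = 4 * 1 + suc k′ * (fill-constant 0 (lit k′) size * 1)
  search-total     = search-constant * 1 + ((round-constant attempt * 1 + attempt-constant) + round-constant attempt * 1)
  brute-total      = brute-constant * 1 + ((round-constant guess * 1 + guess-constant) + round-constant guess * 1)
  decide-constant  = search-total + brute-total
  begin-constant   = 1 + (κₛ (store 2 (lit 0) (lit 1)) + 1)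
  double-constant  = κₛ (while (op less (cell 2) (powᴱ k′)) (store 2 (lit 0) (op mul (lit 2) (cell 2)))) + κₛ (store 2 (lit 0) (op mul (lit 2) (cell 2)))
  marks-constant   = 1 + (κₛ (store 3 (lit 0) (op add (powᴱ u) (lit 1))) + (1 + κₛ (store 6 (lit 0) (powᴱ k′))))
  plant-constant   = κₛ (branch (distinctᴱ entry k) (plantᴾ ⨾ C₁.T⟦ p ⟧ ⨾ decide) skip) + (1 + (κₛ plantᴾ + 1))
  init-constant    = (begin-constant * 1 + (double-constant * 2 + marks-constant * 1))
    + (((1 + (4 * 1 + fill-constant 9 size (lit 2) * 2)) + ((1 + (4 * 1 + fill-constant 10 size (cell 2) * 2)) + (1 + (4 * 1 + suc k * (fill-constant 0 (lit k) size * 1)))))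
      + (plant-constant * 1 + dead * 1))
  time-constant = init-constant + decide-constant + (decide-constant + (Nₛ + dead)) * k ^ k

module Costs (Z : Size) (1≤u : 1 ≤ Size.u Z) (k+k≤r : Size.k Z + Size.k Z ≤ Size.r Z) where
  open Size Z
  open Constants arith j u p C Nₛ
  open AttemptCost arith j u p

  r≢0 : NonZero r
  r≢0 = ℕ.>-nonZero 1≤r

  1≤r^u : 1 ≤ r ^ u
  1≤r^u = m^n>0 r {{r≢0}} u

  swap : ∀ c x y → c * (x * y) ≡ x * (c * y)
  swap = solve-∀

  module _ (X : Vec Carrier r) where
    I : Instance
    I = theInstance X
    open Rounds I using (module Ctl; κF)
    open Bodies I C Nₛ fits over≤ using (guess-cost)
    open Searches I C Nₛ fits over≤ using (attempt-cost; Measured; module Decide)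
    open Total I C Nₛ fits over≤ M≡ using (init-cost; total-cost)

    module _ (t : ℕ) where
      W : ℕ
      W = Λ * (t + Λ)

      Λ≤W : Λ ≤ W
      Λ≤W = ≤*ʳ (≤-trans 1≤Λ (m≤n+m Λ t))

      Λ· : Multiple W Λ 1
      Λ· = once Λ≤W

      attempt-≤ : Multiple W (attempt-cost t) attempt-constant
      attempt-≤ = (once (≤-trans 1≤Λ Λ≤W) ⊞ (4 ⊡ Λ· ⊞ suc u ⊡ fill-constant 0 (lit u) size ⊡ Λ·))
        ⊞ (κₛ shiftBy + 6) ⊡ Λ· ⊞ (below (≡⇒≤ⁿ (ℕ.*-assoc (Nₛ + dead) Λ over)) ((Nₛ + dead) ⊡ Λ*over) ⊞ below (≡⇒≤ⁿ (ℕ.*-identityʳ (dead * Λ))) (dead ⊡ Λ·))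
        ⊞ κcopy ⊡ below (≡⇒≤ⁿ (ℕ.*-distribˡ-+ Λ over Λ)) (Λ*over ⊞ once (*-monoʳ-≤ Λ (m≤n+m Λ t)))
        where
        over = t + C * (t + Λ)
        Λ*over : Multiple W (Λ * over) (1 + C)
        Λ*over = below (≡⇒≤ⁿ (trans (ℕ.*-distribˡ-+ Λ t (C * (t + Λ))) (cong (λ z → Λ * t + z) (sym (swap C Λ (t + Λ)))))) (once (*-monoʳ-≤ Λ (m≤m+n t Λ)) ⊞ by ≤-refl)

    guess-≤ : Multiple Λ guess-cost guess-constant
    guess-≤ = 4 ⊡ once ≤-refl ⊞ suc k′ ⊡ fill-constant 0 (lit k′) size ⊡ once ≤-refl

    decide-cost : ∀ n B t σ → Measured B t σ → costWithin (encode G X) n (decide ∷ [] , σ) ≤ℚ fromℕ ((decide-constant * (r ^ u * Λ)) * t + decide-constant * (r ^ u * (Λ * Λ)))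
    decide-cost n B t σ D = bound (t ℕ.≤? r ^ k′)
      where
      V = r ^ u * W t
      V· : ∀ {a m} → Multiple (W t) a m → Multiple V (r ^ u * a) m
      V· {m = m} (by q) = by (≤-trans (*-monoʳ-≤ (r ^ u) q) (≡⇒≤ⁿ (sym (swap m (r ^ u) (W t)))))
      Λ≤V : Λ ≤ V
      Λ≤V = ≤-trans (Λ≤W t) (≤*ˡ 1≤r^u)
      search-≤ : Multiple V (search-constant * Λ + (r ^ u * (round-constant attempt * Λ + attempt-cost t) + round-constant attempt * Λ)) search-total
      search-≤ = search-constant ⊡ once Λ≤V ⊞ V· (round-constant attempt ⊡ Λ· t ⊞ attempt-≤ t) ⊞ round-constant attempt ⊡ once Λ≤V
      brute-≤ : r ^ k′ < t → Multiple V (brute-constant * Λ + (r ^ k′ * (round-constant guess * Λ + guess-cost) + round-constant guess * Λ)) brute-total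
      brute-≤ lt = brute-constant ⊡ once Λ≤V ⊞ P· (round-constant guess ⊡ once ≤-refl ⊞ guess-≤) ⊞ round-constant guess ⊡ once Λ≤V
        where
        P· : ∀ {a m} → Multiple Λ a m → Multiple V (r ^ k′ * a) m
        P· {m = m} (by q) = by (≤-trans (ℕ.*-mono-≤ (<⇒≤ lt) q) (≤-trans (≡⇒≤ⁿ (eq t m Λ)) (*-monoʳ-≤ m (≤-trans (*-monoʳ-≤ Λ (m≤m+n t Λ)) (≤*ˡ 1≤r^u)))))
          where
          eq : ∀ t m l → t * (m * l) ≡ m * (l * t)
          eq = solve-∀
      finish : ∀ {x a m} → m ≤ decide-constant → x ≤ℚ fromℕ a → Multiple V a m → x ≤ℚ fromℕ ((decide-constant * (r ^ u * Λ)) * t + decide-constant * (r ^ u * (Λ * Λ)))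
      finish {m = m} le p (by q) = ℚ.≤-trans p (fromℕ-mono (≤-trans q (≤-trans (*-monoˡ-≤ V le) (≡⇒≤ⁿ (eq decide-constant (r ^ u) Λ t)))))
        where
        eq : ∀ d R l t → d * (R * (l * (t + l))) ≡ d * (R * l) * t + d * (R * (l * l))
        eq = solve-∀
      bound : Dec (t ≤ r ^ k′) → costWithin (encode G X) n (decide ∷ [] , σ) ≤ℚ fromℕ ((decide-constant * (r ^ u * Λ)) * t + decide-constant * (r ^ u * (Λ * Λ)))
      bound (yes le) = finish (m≤m+n search-total brute-total) (Decide.search-cost D le n) search-≤
      bound (no ¬le) = finish (m≤n+m brute-total search-total) (Decide.brute-cost D (≰⇒> ¬le) n) (brute-≤ (≰⇒> ¬le))

    Zₜ : ℕ
    Zₜ = r ^ u * (Λ * Λ)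

    Λ≤Z : Λ ≤ Zₜ
    Λ≤Z = ≤-trans (≤*ʳ 1≤Λ) (≤*ˡ 1≤r^u)

    init-≤ : Multiple Zₜ init-cost init-constant
    init-≤ = (begin-constant ⊡ Λ¹ ⊞ below (≡⇒≤ⁿ (swap (suc m) double-constant Λ)) (double-constant ⊡ m·) ⊞ marks-constant ⊡ Λ¹)
      ⊞ ((1· ⊞ 4 ⊡ Λ¹ ⊞ r· (fill-constant 9 size (lit 2))) ⊞ (1· ⊞ 4 ⊡ Λ¹ ⊞ r· (fill-constant 10 size (cell 2))) ⊞ (1· ⊞ 4 ⊡ Λ¹ ⊞ suc k ⊡ fill-constant 0 (lit k) size ⊡ Λ¹))
      ⊞ plant-constant ⊡ Λ¹ ⊞ below (≡⇒≤ⁿ (ℕ.*-identityʳ (dead * Λ))) (dead ⊡ Λ¹)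
      where
      Λ¹ = once Λ≤Z
      1· = once (≤-trans 1≤Λ Λ≤Z)
      m = ⌈log₂ r ^ k′ ⌉
      m≤Λ : m ≤ Λ
      m≤Λ = ≤-trans (Log.⌈log₂⌉-mono-≤ (≤-trans (m≤m+n (r ^ k′) 1) (n≤1+n _))) power≤
      m· : Multiple Zₜ (suc m * Λ) 2
      m· = below (≤-trans (*-monoˡ-≤ Λ (+-mono-≤ 1≤Λ m≤Λ)) (≡⇒≤ⁿ (eq Λ))) (2 ⊡ once (≤*ˡ 1≤r^u))
        where
        eq : ∀ l → (l + l) * l ≡ 2 * (l * l)
        eq = solve-∀
      r≤r^u : r ≤ r ^ u
      r≤r^u = ≤-trans (≡⇒≤ⁿ (sym (ℕ.^-identityʳ r))) (^-monoʳ-≤ r {{r≢0}} 1≤u)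
      r· : ∀ c → Multiple Zₜ (suc r * (c * Λ)) (c * 2)
      r· c = below (≡⇒≤ⁿ (swap (suc r) c Λ)) (c ⊡ below (≤-trans (*-monoˡ-≤ Λ (+-mono-≤ 1≤r^u r≤r^u)) (≡⇒≤ⁿ (eq (r ^ u) Λ))) (2 ⊡ once (*-monoʳ-≤ (r ^ u) (≤*ʳ 1≤Λ))))
        where
        eq : ∀ R l → (R + R) * l ≡ 2 * (R * l)
        eq = solve-∀

    rate-≤ : Multiple Zₜ (decide-constant * (r ^ u * Λ) + (Nₛ + dead) * Λ) (decide-constant * 1 + (Nₛ + dead) * 1)
    rate-≤ = decide-constant ⊡ once (*-monoʳ-≤ (r ^ u) (≤*ʳ 1≤Λ)) ⊞ (Nₛ + dead) ⊡ once Λ≤Z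

  module _ (n : ℕ) where
    τ⁻ τ⁺ : ℚ
    τ⁻ = timeWithin G (planted G k r) p n
    τ⁺ = timeWithin G (planted G k r) p (suc n)

    planted-mono : ∀ {f g : Vec Carrier r → ℚ} → (∀ Y → f Y ≤ℚ g Y) → planted G k r f ≤ℚ planted G k r g
    planted-mono h = mean-mono (subsetsOfSize k r) (λ S → mean-mono (allVecs elements r) (λ Y → h (plant G S Y)))

    τ⁻≤τ⁺ : τ⁻ ≤ℚ τ⁺
    τ⁻≤τ⁺ = planted-mono {λ Y → costWithin (encode G Y) n (initial p)} {λ Y → costWithin (encode G Y) (suc n) (initial p)} (λ Y → cost-mono (encode G Y) (n≤1+n n) (initial p))

    1≤τ⁺ : 1ℚ ≤ℚ τ⁺
    1≤τ⁺ = ℚ.≤-trans (≡⇒≤ (sym (trans (mean-cong (subsetsOfSize k r) (λ S → Counting.𝔼-const G abelian r 1ℚ)) (mean-const (subsetsOfSize k r) {{SetsAndTuples.subs≢0 G abelian j r k+k≤r}} 1ℚ))))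
      (planted-mono {λ _ → 1ℚ} {λ Y → costWithin (encode G Y) (suc n) (initial p)} (λ Y → ℚ.≤-trans (fromℕ-mono {1} (1≤stepCost (encode G Y) p emptyMemory)) (≤+ʳ (Φ-nonNeg (FinSum-mean (next (encode G Y) p [] emptyMemory)) (cost-nonNeg (encode G Y) n)))))

    time-bound : timeWithin G (uniform G r) reduction n ≤ℚ fromℕ (time-constant * (r ^ u * (Λ * Λ))) *ℚ τ⁺
    time-bound = ℚ.≤-trans (mean-mono (allVecs elements r) each) (mean-const-≤ (allVecs elements r) (0≤* (0≤fromℕ (time-constant * (r ^ u * (Λ * Λ)))) (ℚ.≤-trans 0≤1 1≤τ⁺)))
      where
      Z₀ = r ^ u * (Λ * Λ)
      D = decide-constant
      f : Vec Carrier r → ℚ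
      f Y = costWithin (encode G Y) n (initial p)
      plantedT≤ : plantedT G abelian j r f ≤ℚ fromℕ (k ^ k) *ℚ τ⁺
      plantedT≤ = ℚ.≤-trans (SetsAndTuples.plantedT≤planted G abelian j r f (λ Y → cost-nonNeg (encode G Y) n (initial p)) k+k≤r) (*-monoˡ (0≤fromℕ (k ^ k)) τ⁻≤τ⁺)
      join : ∀ a b c d x → x ≤ℚ fromℕ c *ℚ τ⁺ → a ≤ d * Z₀ → ∀ e → b ≤ e * Z₀ → fromℕ a +ℚ fromℕ b *ℚ x ≤ℚ fromℕ ((d + e * c) * Z₀) *ℚ τ⁺
      join a b c d x h p e q = begin
        fromℕ a +ℚ fromℕ b *ℚ x ≤⟨ ℚ.+-mono-≤ (ℚ.≤-trans (≡⇒≤ (sym (ℚ.*-identityʳ (fromℕ a)))) (*-mono (0≤fromℕ a) (ℚ.≤-trans 0≤1 1≤τ⁺) (fromℕ-mono p) 1≤τ⁺))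
                                                                                (*-mono (0≤fromℕ b) (0≤* (0≤fromℕ c) (ℚ.≤-trans 0≤1 1≤τ⁺)) (fromℕ-mono q) h) ⟩
        fromℕ (d * Z₀) *ℚ τ⁺ +ℚ fromℕ (e * Z₀) *ℚ (fromℕ c *ℚ τ⁺) ≡⟨ solve 4 (λ a b c t → a :* t :+ b :* (c :* t) := (a :+ b :* c) :* t) refl (fromℕ (d * Z₀)) (fromℕ (e * Z₀)) (fromℕ c) τ⁺ ⟩
        (fromℕ (d * Z₀) +ℚ fromℕ (e * Z₀) *ℚ fromℕ c) *ℚ τ⁺ ≡⟨ cong (_*ℚ τ⁺) (trans (cong (fromℕ (d * Z₀) +ℚ_) (sym (fromℕ-* (e * Z₀) c))) (trans (sym (fromℕ-+ (d * Z₀) (e * Z₀ * c))) (cong fromℕ (eq d e c Z₀)))) ⟩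
        fromℕ ((d + e * c) * Z₀) *ℚ τ⁺ ∎
        where
        open ℚ.≤-Reasoning
        eq : ∀ d e c z → d * z + e * z * c ≡ (d + e * c) * z
        eq = solve-∀
      each : ∀ X → costWithin (encode G X) n (initial reduction) ≤ℚ fromℕ (time-constant * Z₀) *ℚ τ⁺
      each X = ℚ.≤-trans (Total.total-cost (theInstance X) C Nₛ fits over≤ M≡ n (D * (r ^ u * Λ)) (D * Z₀) (decide-cost X n))
        (join (Total.init-cost (theInstance X) C Nₛ fits over≤ M≡ + D * Z₀) (D * (r ^ u * Λ) + (Nₛ + dead) * Λ) (k ^ k) (init-constant + D) (plantedT G abelian j r f) plantedT≤ (proof (init-≤ X ⊞ by {Z₀} {D * Z₀} {D} ≤-refl)) (D + (Nₛ + dead))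
          (≤-trans (proof (rate-≤ X)) (≡⇒≤ⁿ (cong (_* Z₀) (cong₂ _+_ (ℕ.*-identityʳ D) (ℕ.*-identityʳ (Nₛ + dead)))))))

-- The groups ℤ/2^m and 𝔽₂^m

op-cost : ∀ X σ o e f → expCost X σ (op o e f) ≤ 2 * (1 + expCost X σ e + expCost X σ f)
op-cost X σ o e f = ≤-trans (s≤s (+-monoˡ-≤ (c + d) (≤-trans (len-op o (eval X σ e) (eval X σ f)) (s≤s (+-mono-≤ (len≤cost X σ e) (len≤cost X σ f)))))) (≡⇒≤ⁿ (eq c d))
  where
  c = expCost X σ e
  d = expCost X σ f
  eq : ∀ c d → suc (suc (c + d) + (c + d)) ≡ 2 * (1 + c + d)
  eq = solve-∀

mean-sums : ∀ {A B : Set} (xs : List A) (ys : List B) {f g} → length xs ≡ length ys → ∑ xs f ≡ ∑ ys g → mean xs f ≡ mean ys g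
mean-sums xs ys p q = trans (mean-∑ xs _) (trans (cong₂ _*ℚ_ (cong inv p) q) (sym (mean-∑ ys _)))

modᴱ : Exp → Exp
modᴱ e = op monus e (op mul (op quot e (cell 2)) (cell 2))

quot-mod : ∀ s M .{{_ : NonZero M}} → s ∸ quotℕ s M * M ≡ s % M
quot-mod s M@(suc _) = sym (DivMod.m%n≡m∸m/n*n s M)

modular : Arith
modular = record
  { addᴱ = λ e f → modᴱ (op add e f) ; negᴱ = λ e → modᴱ (op monus (cell 2) e)
  ; add-loads = λ p l l′ → (l , l′) , ((l , l′) , p , tt) , p , tt
  ; neg-loads = λ p l → ((p , tt) , l) , (((p , tt) , l) , p , tt) , p , tt
  ; kᵃᵈᵈ = 70 ; add-cost = cost }
  where
  cost : ∀ X σ L e f → 1 ≤ L → len (σ 2 0) ≤ L → expCost X σ (modᴱ (op add e f)) ≤ 70 * (L + (expCost X σ e + expCost X σ f))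
  cost X σ L e f 1≤L M≤ = ≤-trans (op-cost X σ monus s (op mul (op quot s (cell 2)) (cell 2))) (≤-trans (*-monoʳ-≤ 2 (+-mono-≤ (s≤s s≤)
      (≤-trans (op-cost X σ mul (op quot s (cell 2)) (cell 2)) (*-monoʳ-≤ 2 (+-mono-≤ (s≤s (≤-trans (op-cost X σ quot s (cell 2)) (*-monoʳ-≤ 2 (+-mono-≤ (s≤s s≤) c≤)))) c≤)))))
    (≤-trans (≡⇒≤ⁿ (eq₁ a L)) (≤-trans (+-monoˡ-≤ (20 * a + 36 * L) (*-monoʳ-≤ 34 1≤L)) (≤-trans (m≤m+n _ (50 * a)) (≡⇒≤ⁿ (eq₂ a L))))))
    where
    s = op add e f
    a = expCost X σ e + expCost X σ f
    s≤ : expCost X σ s ≤ 2 * (1 + a)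
    s≤ = op-cost X σ add e f
    c≤ : expCost X σ (cell 2) ≤ 3 * L
    c≤ = ≤-trans (+-mono-≤ 1≤L (+-mono-≤ M≤ 1≤L)) (≡⇒≤ⁿ (eq L))
      where
      eq : ∀ l → l + (l + l) ≡ 3 * l
      eq = solve-∀
    eq₁ : ∀ a l → 2 * (suc (2 * (1 + a)) + 2 * (suc (2 * (suc (2 * (1 + a)) + 3 * l)) + 3 * l)) ≡ 34 * 1 + (20 * a + 36 * l)
    eq₁ = solve-∀
    eq₂ : ∀ a l → 34 * l + (20 * a + 36 * l) + 50 * a ≡ 70 * (l + a)
    eq₂ = solve-∀

module _ (m : ℕ) where
  private
    M = 2 ^ m
    instance
      M≢0 : NonZero M
      M≢0 = m^n≢0 2 m

    mod-+ˡ : ∀ a b → (a % M + b) % M ≡ (a + b) % M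
    mod-+ˡ a b = trans (DivMod.%-distribˡ-+ (a % M) b M) (trans (cong (λ z → (z + b % M) % M) (DivMod.m%n%n≡m%n a M)) (sym (DivMod.%-distribˡ-+ a b M)))

    toℕ-mod : ∀ a → toℕ (DivMod._mod_ a M) ≡ a % M
    toℕ-mod a = Fin.toℕ-fromℕ< _

  ℤ2^-abelian : Abelian (ℤ2^ m)
  ℤ2^-abelian = record
    { ∙-assoc = λ x y z → Fin.toℕ-injective (trans (sum (toℕ (x ∙ y)) (toℕ z)) (trans (cong (λ w → (w + toℕ z) % M) (sum (toℕ x) (toℕ y)))
        (trans (mod-+ˡ (toℕ x + toℕ y) (toℕ z)) (trans (cong (_% M) (rotate (toℕ x) (toℕ y) (toℕ z)))
        (sym (trans (sum (toℕ x) (toℕ (y ∙ z))) (trans (cong (λ w → (toℕ x + w) % M) (sum (toℕ y) (toℕ z))) (trans (cong (_% M) (+-comm (toℕ x) _)) (mod-+ˡ (toℕ y + toℕ z) (toℕ x))))))))))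
    ; ∙-comm = λ x y → cong (λ n → DivMod._mod_ n M) (+-comm (toℕ x) (toℕ y))
    ; ε-idˡ = λ x → Fin.toℕ-injective (trans (sum (toℕ ε) (toℕ x)) (trans (cong (λ w → (w + toℕ x) % M) (toℕ-mod 0)) (trans (mod-+ˡ 0 (toℕ x)) (DivMod.m<n⇒m%n≡m (Fin.toℕ<n x)))))
    ; ⁻¹-invˡ = λ x → Fin.toℕ-injective (trans (sum (toℕ (x ⁻¹)) (toℕ x)) (trans (cong (λ w → (w + toℕ x) % M) (toℕ-mod (M ∸ toℕ x)))
        (trans (mod-+ˡ (M ∸ toℕ x) (toℕ x)) (trans (cong (_% M) (m∸n+n≡m (<⇒≤ (Fin.toℕ<n x)))) (trans (DivMod.n%n≡0 M) (sym (trans (toℕ-mod 0) (DivMod.m<n⇒m%n≡m (m^n>0 2 m)))))))))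
    ; all-once = Enum.once (Enum-allFin M) }
    where
    open FiniteGroup (ℤ2^ m)
    sum : ∀ a b → toℕ (DivMod._mod_ (a + b) M) ≡ (a + b) % M
    sum a b = toℕ-mod (a + b)
    rotate : ∀ x y z → x + y + z ≡ y + z + x
    rotate = solve-∀

  ℤ2^-coded : Coded modular (ℤ2^ m) M
  ℤ2^-coded = record
    { code-ε = trans (toℕ-mod 0) (DivMod.m<n⇒m%n≡m (m^n>0 2 m)) ; code-injective = Fin.toℕ-injective ; code< = Fin.toℕ<n
    ; code-mean = λ f → trans (mean-range M f) (go M (m^n>0 2 m) f) ; order≡ = length-allFin M
    ; add-eval = λ { X σ e f {x} {y} m p q → trans (reduce (eval X σ (op add e f)) (σ 2 0) m) (trans (cong₂ (λ a b → (a + b) % M) p q) (sym (toℕ-mod (toℕ x + toℕ y)))) }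
    ; neg-eval = λ { X σ e {x} m p → trans (reduce (eval X σ (op monus (cell 2) e)) (σ 2 0) m) (trans (cong₂ (λ a b → (a ∸ b) % M) m p) (sym (toℕ-mod (M ∸ toℕ x)))) } }
    where
    reduce : ∀ s c → c ≡ M → s ∸ quotℕ s c * c ≡ s % M
    reduce s c refl = quot-mod s M
    go : ∀ r → 1 ≤ r → ∀ f → mean (allFin (rng r)) (f ∘ toℕ) ≡ mean (allFin r) (f ∘ toℕ)
    go (suc r) _ f = refl

bitwise : Arith
bitwise = record
  { addᴱ = op Op.xor ; negᴱ = id ; add-loads = λ _ l l′ → l , l′ ; neg-loads = λ _ l → l ; kᵃᵈᵈ = 2
  ; add-cost = λ X σ L e f 1≤L _ → ≤-trans (op-cost X σ Op.xor e f) (*-monoʳ-≤ 2 (+-monoˡ-≤ (expCost X σ e + expCost X σ f) 1≤L)) }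

∑< : ℕ → (ℕ → ℚ) → ℚ
∑< zero    f = 0ℚ
∑< (suc n) f = f 0 +ℚ ∑< n (f ∘ suc)

∑<-cong : ∀ n {f g} → (∀ i → f i ≡ g i) → ∑< n f ≡ ∑< n g
∑<-cong zero    h = refl
∑<-cong (suc n) h = cong₂ _+ℚ_ (h 0) (∑<-cong n (h ∘ suc))

∑-upTo : ∀ n (g : ℕ → ℕ) f → ∑ (applyUpTo g n) f ≡ ∑< n (f ∘ g)
∑-upTo zero    g f = refl
∑-upTo (suc n) g f = cong (f (g 0) +ℚ_) (∑-upTo n (g ∘ suc) f)

∑<-parity : ∀ n f → ∑< (2 * n) f ≡ ∑< n (λ i → f (2 * i)) +ℚ ∑< n (λ i → f (1 + 2 * i))
∑<-parity zero    f = sym (ℚ.+-identityˡ 0ℚ)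
∑<-parity (suc n) f = begin
  ∑< (2 * suc n) f ≡⟨ cong (λ z → ∑< z f) (double n) ⟩
  f 0 +ℚ (f 1 +ℚ ∑< (2 * n) (λ i → f (2 + i))) ≡⟨ cong (λ z → f 0 +ℚ (f 1 +ℚ z)) (trans (∑<-parity n (λ i → f (2 + i))) (cong₂ _+ℚ_ (∑<-cong n (λ i → cong f (sym (double i)))) (∑<-cong n (λ i → cong (λ z → f (suc z)) (sym (double i)))))) ⟩
  f 0 +ℚ (f 1 +ℚ (a +ℚ b)) ≡⟨ solve 4 (λ x y a b → x :+ (y :+ (a :+ b)) := (x :+ a) :+ (y :+ b)) refl (f 0) (f 1) a b ⟩
  (f 0 +ℚ a) +ℚ (f 1 +ℚ b) ∎
  where
  open ≡-Reasoning
  double : ∀ i → 2 * suc i ≡ suc (suc (2 * i))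
  double = solve-∀
  a = ∑< n (λ i → f (2 * suc i))
  b = ∑< n (λ i → f (1 + 2 * suc i))

∑-bits : ∀ m f → ∑ (allVecs bools m) (f ∘ fromBits) ≡ ∑< (2 ^ m) f
∑-bits zero    f = refl
∑-bits (suc m) f = trans (∑-cartesian _∷_ bools (allVecs bools m) (f ∘ fromBits)) (trans (cong₂ _+ℚ_ (∑-bits m (λ i → f (2 * i))) (trans (ℚ.+-identityʳ _) (∑-bits m (λ i → f (1 + 2 * i))))) (sym (∑<-parity (2 ^ m) f)))

bit+2* : ∀ b x → (bit b + 2 * x) ℕ./ 2 ≡ x
bit+2* b x = trans (cong (λ z → (bit b + z) ℕ./ 2) (ℕ.*-comm 2 x)) (trans (DivMod.+-distrib-/-∣ʳ (bit b) (divides x refl)) (trans (cong (_+ x * 2 ℕ./ 2) (half b)) (DivMod.m*n/n≡m x 2)))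
  where
  half : ∀ b → bit b ℕ./ 2 ≡ 0
  half true  = refl
  half false = refl

xor-bits : ∀ f {m} (v w : Vec Bool m) → fromBits v ≤ f → fromBits w ≤ f → xorℕ-fuel f (fromBits v) (fromBits w) ≡ fromBits (Vec.zipWith _xor_ v w)
xor-bits zero    []          []          p q = refl
xor-bits zero    (false ∷ v) (false ∷ w) p q = cong (2 *_) (xor-bits zero v w (≤-trans (m≤m+n _ _) p) (≤-trans (m≤m+n _ _) q))
xor-bits (suc f) []          []          p q = cong (2 *_) (xor-bits f [] [] z≤n z≤n)
xor-bits (suc f) (b ∷ v)     (c ∷ w)     p q = cong₂ (λ x y → x + 2 * y) low
    (trans (cong₂ (xorℕ-fuel f) (bit+2* b x) (bit+2* c y)) (xor-bits f v w (half (bit b) x p) (half (bit c) y q)))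
  where
  x = fromBits v
  y = fromBits w
  low : ((bit b + 2 * x) + (bit c + 2 * y)) % 2 ≡ bit (_xor_ b c)
  low = trans (cong (_% 2) (eq (bit b) x (bit c) y)) (trans (DivMod.[m+kn]%n≡m%n (bit b + bit c) (x + y) 2) (table b c))
    where
    eq : ∀ a x c y → (a + 2 * x) + (c + 2 * y) ≡ (a + c) + (x + y) * 2
    eq = solve-∀
    table : ∀ b c → (bit b + bit c) % 2 ≡ bit (_xor_ b c)
    table true  true  = refl
    table true  false = refl
    table false true  = refl
    table false false = refl
  half : ∀ a x {f} → a + 2 * x ≤ suc f → x ≤ f
  half a zero    p = z≤n
  half a (suc x) p = ℕ.s≤s⁻¹ (≤-trans (≡⇒≤ⁿ (+-comm 1 (suc x))) (≤-trans (+-monoʳ-≤ (suc x) (s≤s z≤n)) (≤-trans (m≤n+m (2 * suc x) a) p)))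

fromBits-injective : ∀ {m} {v w : Vec Bool m} → fromBits v ≡ fromBits w → v ≡ w
fromBits-injective {v = []}        {[]}        e = refl
fromBits-injective {v = false ∷ v} {false ∷ w} e = cong (false ∷_) (fromBits-injective (ℕ.*-cancelˡ-≡ _ _ 2 e))
fromBits-injective {v = true ∷ v}  {true ∷ w}  e = cong (true ∷_) (fromBits-injective (ℕ.*-cancelˡ-≡ _ _ 2 (ℕ.suc-injective e)))
fromBits-injective {v = false ∷ v} {true ∷ w}  e = contradiction e (ℕ.even≢odd (fromBits v) (fromBits w))
fromBits-injective {v = true ∷ v}  {false ∷ w} e = contradiction (sym e) (ℕ.even≢odd (fromBits w) (fromBits v))

fromBits< : ∀ {m} (v : Vec Bool m) → fromBits v < 2 ^ m
fromBits< []      = s≤s z≤n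
fromBits< {suc m} (b ∷ v) = ≤-trans (s≤s (+-monoˡ-≤ (2 * fromBits v) (bit≤1 b))) (≤-trans (≡⇒≤ⁿ (eq (fromBits v))) (*-monoʳ-≤ 2 (fromBits< v)))
  where
  bit≤1 : ∀ b → bit b ≤ 1
  bit≤1 true  = ≤-refl
  bit≤1 false = z≤n
  eq : ∀ x → suc (1 + 2 * x) ≡ 2 * suc x
  eq = solve-∀

module _ (m : ℕ) where
  𝔽₂^-abelian : Abelian (𝔽₂^ m)
  𝔽₂^-abelian = record
    { ∙-assoc = Vec.zipWith-assoc Bool.xor-assoc ; ∙-comm = Vec.zipWith-comm Bool.xor-comm ; ε-idˡ = Vec.zipWith-identityˡ Bool.xor-identityˡ
    ; ⁻¹-invˡ = self ; all-once = Enum.once (Enum-allVecs Enum-bools m) }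
    where
    self : ∀ {m} (v : Vec Bool m) → Vec.zipWith _xor_ v v ≡ Vec.replicate m false
    self []      = refl
    self (b ∷ v) = cong₂ _∷_ (Bool.xor-same b) (self v)

  𝔽₂^-coded : Coded bitwise (𝔽₂^ m) (2 ^ m)
  𝔽₂^-coded = record
    { code-ε = zeros m ; code-injective = fromBits-injective ; code< = fromBits< ; code-mean = λ f → go (2 ^ m) (m^n>0 2 m) f (length-allVecs bools m) (∑-bits m f)
    ; order≡ = length-allVecs bools m
    ; add-eval = λ { X σ e f {x} {y} _ p q → trans (cong₂ xorℕ p q) (xor-bits (fromBits x + fromBits y) x y (m≤m+n _ _) (m≤n+m _ _)) }
    ; neg-eval = λ _ _ _ _ p → p }
    where
    zeros : ∀ m → fromBits (Vec.replicate m false) ≡ 0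
    zeros zero    = refl
    zeros (suc m) = cong (2 *_) (zeros m)
    go : ∀ n → 1 ≤ n → ∀ f → length (allVecs bools m) ≡ n → ∑ (allVecs bools m) (f ∘ fromBits) ≡ ∑< n f → mean (range n) f ≡ mean (allVecs bools m) (f ∘ fromBits)
    go (suc n) _ f l s = mean-sums (range (suc n)) (allVecs bools m) {f} {f ∘ fromBits} (trans (List.length-applyUpTo id (suc n)) (sym l)) (trans (∑-upTo (suc n) id f) (sym s))

-- The reduction for all r

record FamilyData : Set₁ where
  field
    arith   : Arith
    𝔾       : ℕ → FiniteGroup
    abelian : ∀ m → Abelian (𝔾 m)
    coded   : ∀ m → Coded arith (𝔾 m) (2 ^ m)

fraction : ∀ n d → + n ℚ./ suc d ≡ fromℕ n *ℚ inv (suc d)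
fraction n d = ℚ.toℚᵘ-injective (begin
  ℚ.toℚᵘ (+ n ℚ./ suc d)                            ≈⟨ ℚ.toℚᵘ-fromℚᵘ (ℚᵘ.mkℚᵘ (+ n) d) ⟩
  ℚᵘ.mkℚᵘ (+ n) d                                   ≈⟨ ℚᵘ.*≡* (trans (cong (λ z → + n ℤ.* + z) (+-identityʳ (suc d))) (cong (ℤ._* + suc d) (sym (ℤ.*-identityʳ (+ n))))) ⟩
  ℚᵘ.mkℚᵘ (+ n) 0 ℚᵘ.* ℚᵘ.mkℚᵘ (+ 1) d              ≈⟨ ℚᵘ.*-cong (ℚᵘ.≃-sym (ℚ.toℚᵘ-fromℚᵘ (ℚᵘ.mkℚᵘ (+ n) 0))) (ℚᵘ.≃-sym (ℚ.toℚᵘ-fromℚᵘ (ℚᵘ.mkℚᵘ (+ 1) d))) ⟩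
  ℚ.toℚᵘ (fromℕ n) ℚᵘ.* ℚ.toℚᵘ (inv (suc d))        ≈⟨ ℚᵘ.≃-sym (ℚ.toℚᵘ-homo-* (fromℕ n) (inv (suc d))) ⟩
  ℚ.toℚᵘ (fromℕ n *ℚ inv (suc d)) ∎)
  where open ℚᵘ.≃-Reasoning

archimedean : ∀ q → 0ℚ <ℚ q → ∃[ N ] NonZero N × (∀ r → N ≤ r → inv r ≤ℚ q)
archimedean q 0<q = go q (ℚ.positive 0<q)
  where
  go : ∀ q → ℚ.Positive q → ∃[ N ] NonZero N × (∀ r → N ≤ r → inv r ≤ℚ q)
  go q@(ℚ.mkℚ ℤ.+[1+ a ] d _) _ = suc d , _ , λ r le → ℚ.≤-trans (inv-anti (suc d) r _ (fromℕ-mono le))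
    (ℚ.≤-trans (≡⇒≤ (sym (ℚ.*-identityˡ (inv (suc d))))) (ℚ.≤-trans (*-monoʳ (0≤inv (suc d)) (1≤fromℕ (suc a))) (≡⇒≤ (trans (sym (fraction (suc a) d)) (ℚ.↥p/↧p≡p q)))))

0<* : ∀ {p q} → 0ℚ <ℚ p → 0ℚ <ℚ q → 0ℚ <ℚ p *ℚ q
0<* {p} {q} 0<p 0<q = ℚ.positive⁻¹ (p *ℚ q) {{ℚ.pos*pos⇒pos p {{ℚ.positive 0<p}} q {{ℚ.positive 0<q}}}}

inv≤1 : ∀ n → inv n ≤ℚ 1ℚ
inv≤1 zero    = 0≤1
inv≤1 (suc n) = inv-anti 1 (suc n) _ (fromℕ-mono {1} {suc n} (s≤s z≤n))

*≤1 : ∀ {p q} → 0ℚ ≤ℚ p → p ≤ℚ 1ℚ → q ≤ℚ 1ℚ → p *ℚ q ≤ℚ 1ℚ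
*≤1 0≤p p≤1 q≤1 = ℚ.≤-trans (*-mono 0≤p 0≤1 p≤1 q≤1) (≡⇒≤ (ℚ.*-identityˡ 1ℚ))

ratio≤inv : ∀ a o r → NonZero o → NonZero r → r * a ≤ o → fromℕ a *ℚ inv o ≤ℚ inv r
ratio≤inv a o r o≢0 r≢0 le = begin
  fromℕ a *ℚ inv o ≡⟨ sym (ℚ.*-identityˡ _) ⟩
  1ℚ *ℚ (fromℕ a *ℚ inv o) ≡⟨ cong (_*ℚ (fromℕ a *ℚ inv o)) (sym (inv*fromℕ r {{r≢0}})) ⟩
  inv r *ℚ fromℕ r *ℚ (fromℕ a *ℚ inv o) ≡⟨ solve 4 (λ i r a o → i :* r :* (a :* o) := i :* ((r :* a) :* o)) refl (inv r) (fromℕ r) (fromℕ a) (inv o) ⟩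
  inv r *ℚ (fromℕ r *ℚ fromℕ a *ℚ inv o) ≤⟨ *-monoˡ (0≤inv r) (*-monoʳ (0≤inv o) (ℚ.≤-trans (≡⇒≤ (sym (fromℕ-* r a))) (fromℕ-mono le))) ⟩
  inv r *ℚ (fromℕ o *ℚ inv o) ≡⟨ trans (cong (inv r *ℚ_) (fromℕ*inv o {{o≢0}})) (ℚ.*-identityʳ (inv r)) ⟩
  inv r ∎
  where
  open ℚ.≤-Reasoning

len-^ : ∀ r n → len (r ^ n) ≤ 1 + n * len r
len-^ r zero    = ≤-refl
len-^ r (suc n) = ≤-trans (len-* r (r ^ n)) (≤-trans (+-monoʳ-≤ (len r) (len-^ r n)) (≡⇒≤ⁿ (+-suc (len r) (n * len r))))

module Family (𝔽 : FamilyData) (j u : ℕ) (1≤u : 1 ≤ u) (p : Program)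
  (m : ℕ → ℕ) (m≡ : ∀ r → m r ≡ ⌈log₂ r ^ (u + suc j) ⌉) where
  open FamilyData 𝔽
  open Programs arith j u p

  G : ℕ → FiniteGroup
  G r = 𝔾 (m r)

  C Nₛ B : ℕ
  C  = maxSub κₛ p
  Nₛ = maxSub (Overhead.D (kinOf arith)) p
  B  = len (1 + C) + 5 + k′ + len k′

  Λ : ℕ → ℕ
  Λ r = 4 * (B * len r)

  module _ (r : ℕ) (1≤r : 1 ≤ r) where
    private
      ℓ = len r
      b = B * ℓ
      P = r ^ k′
      M = 2 ^ m r
      1≤P : 1 ≤ P
      1≤P = m^n>0 r {{ℕ.>-nonZero 1≤r}} k′
      const : ∀ {c d} → c ≤ d → Multiple ℓ c d
      const {c} p = by (≤-trans p (≤*ʳ (1≤len 1≤r)))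
      P· : Multiple ℓ (len P) (1 + k′)
      P· = below (len-^ r k′) (const {1} {1} ≤-refl ⊞ by {ℓ} {k′ * ℓ} {k′} ≤-refl)
      within : ∀ {a n} → Multiple ℓ a n → n ≤ B → a ≤ b
      within (by p) q = ≤-trans p (*-monoˡ-≤ ℓ q)
      b≤Λ : b ≤ Λ r
      b≤Λ = m≤m+n b _
      drop₁ : ∀ L k → 3 + k ≤ L + 5 + k + len k
      drop₁ L k = ≤-trans (m≤m+n (3 + k) (L + 2 + len k)) (≡⇒≤ⁿ (eq L k (len k)))
        where
        eq : ∀ L k l → 3 + k + (L + 2 + l) ≡ L + 5 + k + l
        eq = solve-∀
    M≡ : M ≡ 2 ^ ⌈log₂ P ⌉
    M≡ = cong (2 ^_) (m≡ r)

    P≤M : P ≤ M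
    P≤M = ≤-trans (n≤2^⌈log⌉ P) (≡⇒≤ⁿ (sym M≡))

    M≤2P : M ≤ 2 * P
    M≤2P = ≤-trans (≡⇒≤ⁿ M≡) (2^⌈log⌉≤2n P 1≤P)

    size-data : Size
    size-data = record
      { arith = arith ; G = G r ; abelian = abelian (m r) ; M = M ; coded = coded (m r) ; j = j ; u = u ; r = r ; p = p ; Λ = Λ r ; C = C ; Nₛ = Nₛ
      ; 1≤r = 1≤r ; 1≤Λ = ≤-trans (≤-trans (s≤s z≤n) (within (const {3 + k′} ≤-refl) (drop₁ (len (1 + C)) k′))) b≤Λ
      ; M≤ = ≤-trans (within (below (≤-trans (len-mono M≤2P) (len-* 2 P)) (const {2} ≤-refl ⊞ P·)) (drop₁ (len (1 + C)) k′)) b≤Λ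
      ; power≤ = ≤-trans (within (below (≤-trans (len-+ P 1) (≡⇒≤ⁿ (+-comm (1 + len P) 1))) (const {2} ≤-refl ⊞ P·)) (drop₁ (len (1 + C)) k′)) b≤Λ
      ; k′≤ = ≤-trans (within (const ≤-refl) (m≤n+m (len k′) (len (1 + C) + 5 + k′))) b≤Λ
      ; fits = AllSub-max (Overhead.D (kinOf arith)) p , AllSub-max κₛ p ; over≤ = over ; M≡ = M≡ }
      where
      over : len (P + C * (P + Λ r)) ≤ Λ r
      over = begin
        len (P + C * (P + Λ r)) ≤⟨ len-mono (+-monoˡ-≤ (C * (P + Λ r)) (m≤m+n P (Λ r))) ⟩
        len ((1 + C) * (P + Λ r)) ≤⟨ ≤-trans (len-* (1 + C) (P + Λ r)) (+-monoʳ-≤ (len (1 + C)) (≤-trans (len-+ P (Λ r)) (s≤s (+-monoʳ-≤ (len P) (≤-trans (len-* 4 b) (+-monoʳ-≤ 3 (len≤n b))))))) ⟩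
        len (1 + C) + suc (len P + (3 + b)) ≡⟨ eq (len (1 + C)) (len P) b ⟩
        (len (1 + C) + 4) + len P + b ≤⟨ +-monoˡ-≤ b (within {n = len (1 + C) + 4 + (1 + k′)} (const ≤-refl ⊞ P·) (≤-trans (≡⇒≤ⁿ (eq₂ (len (1 + C)) k′)) (m≤m+n _ (len k′)))) ⟩
        b + b ≤⟨ m≤m+n (b + b) (b + b) ⟩
        b + b + (b + b) ≡⟨ eq₁ b ⟩
        4 * b ∎
        where
        open ℕ.≤-Reasoning
        eq : ∀ c p b → c + suc (p + (3 + b)) ≡ c + 4 + p + b
        eq = solve-∀
        eq₁ : ∀ b → b + b + (b + b) ≡ 4 * b
        eq₁ = solve-∀
        eq₂ : ∀ c k → c + 4 + (1 + k) ≡ c + 5 + k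
        eq₂ = solve-∀

  reduction-time : ∀ r (1≤r : 1 ≤ r) → k + k ≤ r → ∀ n →
    timeWithin (G r) (uniform (G r) r) reduction n ≤ℚ fromℕ (Constants.time-constant arith j u p C Nₛ * (r ^ u * (Λ r * Λ r))) *ℚ timeWithin (G r) (planted (G r) k r) p (suc n)
  reduction-time r 1≤r = Costs.time-bound (size-data r 1≤r) 1≤u

  κ₀ : ℚ
  κ₀ = (inv (2 ^ k′) *ℚ inv (2 ^ u)) *ℚ (½ *ℚ inv (k ^ k))

  0<κ₀ : 0ℚ <ℚ κ₀
  0<κ₀ = 0<* (0<* (0<inv (2 ^ k′) {{m^n≢0 2 k′}}) (0<inv (2 ^ u) {{m^n≢0 2 u}})) (0<* (ℚ.positive⁻¹ ½) (0<inv (k ^ k) {{m^n≢0 k k}}))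

  κ₀≤1 : κ₀ ≤ℚ 1ℚ
  κ₀≤1 = *≤1 (0≤* (0≤inv (2 ^ k′)) (0≤inv (2 ^ u))) (*≤1 (0≤inv (2 ^ k′)) (inv≤1 (2 ^ k′)) (inv≤1 (2 ^ u))) (*≤1 (ℚ.nonNegative⁻¹ ½) (inv≤1 2) (inv≤1 (k ^ k)))

  reduction-success : BoundedBelow (λ r → successWithin (G r) k (planted (G r) k r) p) → BoundedBelow (λ r → successWithin (G r) k′ (uniform (G r) r) reduction)
  reduction-success (ε₀ , 0<ε₀ , r₀ , h) = (ℓ *ℚ κ₀) *ℚ (½ *ℚ η) , 0<* (0<* 0<ℓ 0<κ₀) (0<* (ℚ.positive⁻¹ ½) 0<η) , r₁ , bound
    where
    K = fromℕ (2 ^ k) *ℚ fromℕ (k ^ k)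
    K⁻¹ = inv (2 ^ k) *ℚ inv (k ^ k)
    ε₁ = ε₀ *ℚ K⁻¹
    η = ½ *ℚ (ε₁ *ℚ ε₁)
    ℓ = κ₀ *ℚ (inv 4 *ℚ η) *ℚ inv (k′ ^ k′ + 1)
    0<ε₁ : 0ℚ <ℚ ε₁
    0<ε₁ = 0<* 0<ε₀ (0<* (0<inv (2 ^ k) {{m^n≢0 2 k}}) (0<inv (k ^ k) {{m^n≢0 k k}}))
    0<η : 0ℚ <ℚ η
    0<η = 0<* (ℚ.positive⁻¹ ½) (0<* 0<ε₁ 0<ε₁)
    instance
      c≢0 : NonZero (k′ ^ k′ + 1)
      c≢0 = ℕ.>-nonZero (m≤n+m 1 (k′ ^ k′))
    0<ℓ : 0ℚ <ℚ ℓ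
    0<ℓ = 0<* (0<* 0<κ₀ (0<* (0<inv 4) 0<η)) (0<inv (k′ ^ k′ + 1))
    arch = archimedean (inv 4 *ℚ η) (0<* (0<inv 4) 0<η)
    r₁ = r₀ + (proj₁ arch + (k′ + k′))
    bound : ∀ r → r₁ ≤ r → ∃[ n ] (ℓ *ℚ κ₀) *ℚ (½ *ℚ η) ≤ℚ successWithin (G r) k′ (uniform (G r) r) reduction n
    bound r le = n′ , ℚ.≤-trans (≡⇒≤ split) (ℚ.≤-trans (ℚ.+-mono-≤ (*-monoˡ 0≤ℓκ₀ (*-monoˡ (ℚ.nonNegative⁻¹ ½) (*-mono 0≤ε₁ (ℚ.≤-trans 0≤ε₁ ε₁≤Ψ) ε₁≤Ψ ε₁≤Ψ))) (ℚ.neg-antimono-≤ e≤)) q)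
      where
      r-large : k′ + k′ ≤ r
      r-large = ≤-trans (m≤n+m (k′ + k′) (proj₁ arch)) (≤-trans (m≤n+m _ r₀) le)
      1≤r : 1 ≤ r
      1≤r = ≤-trans (≤-trans (s≤s z≤n) (m≤n+m k u)) (≤-trans (m≤m+n k′ k′) r-large)
      Z = size-data r 1≤r
      planted-run = h r (≤-trans (m≤m+n r₀ _) le)
      n = proj₁ planted-run
      module S = Success Z r-large n
      Ψ = S.Ψ S.succ
      0≤ε₁ = ℚ.<⇒≤ 0<ε₁
      0≤κ₀ = ℚ.<⇒≤ 0<κ₀
      0≤ℓ = ℚ.<⇒≤ 0<ℓ
      0≤ℓκ₀ = 0≤* 0≤ℓ 0≤κ₀
      K*K⁻¹ : K *ℚ K⁻¹ ≡ 1ℚ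
      K*K⁻¹ = trans (solve 4 (λ a b c d → (a :* b) :* (c :* d) := (a :* c) :* (b :* d)) refl (fromℕ (2 ^ k)) (fromℕ (k ^ k)) (inv (2 ^ k)) (inv (k ^ k)))
        (trans (cong₂ _*ℚ_ (fromℕ*inv (2 ^ k) {{m^n≢0 2 k}}) (fromℕ*inv (k ^ k) {{m^n≢0 k k}})) (ℚ.*-identityˡ 1ℚ))
      ε₀≤ : ε₀ ≤ℚ K *ℚ Ψ
      ε₀≤ = ℚ.≤-trans (proj₂ planted-run) (SuccessBound.planted-success Z r-large n {½} (ℚ.nonNegative⁻¹ ½) ℚ.≤-refl)
      ε₁≤Ψ : ε₁ ≤ℚ Ψ
      ε₁≤Ψ = ℚ.≤-trans (*-monoʳ (0≤* (0≤inv (2 ^ k)) (0≤inv (k ^ k))) ε₀≤) (≡⇒≤ (trans (solve 3 (λ a b c → (a :* b) :* c := (a :* c) :* b) refl K Ψ K⁻¹) (trans (cong (_*ℚ Ψ) K*K⁻¹) (ℚ.*-identityˡ Ψ))))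
      ε₁≤1 : ε₁ ≤ℚ 1ℚ
      ε₁≤1 = ℚ.≤-trans ε₁≤Ψ S.Ψsucc≤1
      η≤½ : η ≤ℚ ½
      η≤½ = ℚ.≤-trans (*-monoˡ (ℚ.nonNegative⁻¹ ½) (*≤1 0≤ε₁ ε₁≤1 ε₁≤1)) (≡⇒≤ (ℚ.*-identityʳ ½))
      ℓ≤½ : ℓ ≤ℚ ½
      ℓ≤½ = begin
        κ₀ *ℚ (inv 4 *ℚ η) *ℚ inv (k′ ^ k′ + 1) ≡⟨ solve 4 (λ k q e i → k :* (q :* e) :* i := ((k :* q) :* i) :* e) refl κ₀ (inv 4) η (inv (k′ ^ k′ + 1)) ⟩
        ((κ₀ *ℚ inv 4) *ℚ inv (k′ ^ k′ + 1)) *ℚ η ≤⟨ *-mono (0≤* (0≤* 0≤κ₀ (0≤inv 4)) (0≤inv (k′ ^ k′ + 1))) (ℚ.nonNegative⁻¹ ½) (*≤1 (0≤* 0≤κ₀ (0≤inv 4)) (*≤1 0≤κ₀ κ₀≤1 (inv≤1 4)) (inv≤1 (k′ ^ k′ + 1))) η≤½ ⟩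
        1ℚ *ℚ ½ ≡⟨ ℚ.*-identityˡ ½ ⟩
        ½ ∎
        where
        open ℚ.≤-Reasoning
      order≡ = Coded.order≡ (coded (m r))
      result = SuccessBound.success-bound Z r-large n 0≤ℓ ℓ≤½ (≤-trans (P≤M r 1≤r) (≡⇒≤ⁿ (sym order≡))) (≤-trans (≡⇒≤ⁿ order≡) (M≤2P r 1≤r))
      n′ = proj₁ result
      q = proj₂ result
      ρ≤ : S.ρ ≤ℚ inv 4 *ℚ η
      ρ≤ = ℚ.≤-trans (ratio≤inv (r ^ k) _ r (subst NonZero (sym order≡) (m^n≢0 2 (m r))) (ℕ.>-nonZero 1≤r) small) (proj₂ (proj₂ arch) r (≤-trans (m≤m+n (proj₁ arch) _) (≤-trans (m≤n+m _ r₀) le)))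
        where
        small : r * r ^ k ≤ Abelian.order (abelian (m r))
        small = ≤-trans (^-monoʳ-≤ r {{ℕ.>-nonZero 1≤r}} (+-monoˡ-≤ k 1≤u)) (≤-trans (P≤M r 1≤r) (≡⇒≤ⁿ (sym order≡)))
      c₁ = fromℕ (k′ ^ k′) +ℚ 1ℚ
      ℓc₁ : ℓ *ℚ c₁ ≡ κ₀ *ℚ (inv 4 *ℚ η)
      ℓc₁ = trans (cong (ℓ *ℚ_) (sym (fromℕ-+ (k′ ^ k′) 1))) (trans (ℚ.*-assoc (κ₀ *ℚ (inv 4 *ℚ η)) (inv (k′ ^ k′ + 1)) (fromℕ (k′ ^ k′ + 1))) (trans (cong (κ₀ *ℚ (inv 4 *ℚ η) *ℚ_) (inv*fromℕ (k′ ^ k′ + 1))) (ℚ.*-identityʳ _)))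
      e≤ : ℓ *ℚ (κ₀ *ℚ S.ρ) +ℚ (ℓ *ℚ ℓ) *ℚ c₁ ≤ℚ (ℓ *ℚ κ₀) *ℚ (½ *ℚ η)
      e≤ = begin
        ℓ *ℚ (κ₀ *ℚ S.ρ) +ℚ (ℓ *ℚ ℓ) *ℚ c₁ ≤⟨ ℚ.+-mono-≤ (*-monoˡ 0≤ℓ (*-monoˡ 0≤κ₀ ρ≤)) (≡⇒≤ (trans (ℚ.*-assoc ℓ ℓ c₁) (cong (ℓ *ℚ_) ℓc₁))) ⟩
        ℓ *ℚ (κ₀ *ℚ (inv 4 *ℚ η)) +ℚ ℓ *ℚ (κ₀ *ℚ (inv 4 *ℚ η)) ≡⟨ solve 4 (λ l k q e → l :* (k :* (q :* e)) :+ l :* (k :* (q :* e)) := (l :* k) :* ((q :+ q) :* e)) refl ℓ κ₀ (inv 4) η ⟩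
        (ℓ *ℚ κ₀) *ℚ (½ *ℚ η) ∎
        where
        open ℚ.≤-Reasoning
      split : (ℓ *ℚ κ₀) *ℚ (½ *ℚ η) ≡ (ℓ *ℚ κ₀) *ℚ η -ℚ (ℓ *ℚ κ₀) *ℚ (½ *ℚ η)
      split = solve 2 (λ x y → x :* (con ½ :* y) := x :* y :- x :* (con ½ :* y)) refl (ℓ *ℚ κ₀) η

-- Inequalities with rational exponents

fromℕ-^ℚ : ∀ r n → fromℕ (r ^ n) ≡ fromℕ r ^ℚ n
fromℕ-^ℚ r zero    = refl
fromℕ-^ℚ r (suc n) = trans (fromℕ-* r (r ^ n)) (cong (fromℕ r *ℚ_) (fromℕ-^ℚ r n))

fromℕ-reflects-≤ : ∀ {m n} → fromℕ m ≤ℚ fromℕ n → m ≤ n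
fromℕ-reflects-≤ {m} {n} p = ≮⇒≥ λ n<m → ℚ.<-irrefl refl (ℚ.<-≤-trans (step n) (ℚ.≤-trans (fromℕ-mono n<m) p))
  where
  step : ∀ n → fromℕ n <ℚ fromℕ (suc n)
  step n = subst₂ _<ℚ_ (ℚ.+-identityˡ (fromℕ n)) (sym (fromℕ-+ 1 n)) (ℚ.+-monoˡ-< (fromℕ n) (ℚ.positive⁻¹ 1ℚ))

^ℚ-nonNeg : ∀ {x} n → 0ℚ ≤ℚ x → 0ℚ ≤ℚ x ^ℚ n
^ℚ-nonNeg zero    p = 0≤1
^ℚ-nonNeg (suc n) p = 0≤* p (^ℚ-nonNeg n p)

^ℚ-pos : ∀ {x} n → 0ℚ <ℚ x → 0ℚ <ℚ x ^ℚ n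
^ℚ-pos zero    p = ℚ.positive⁻¹ 1ℚ
^ℚ-pos (suc n) p = 0<* p (^ℚ-pos n p)

^ℚ-mono : ∀ {x y} n → 0ℚ ≤ℚ x → x ≤ℚ y → x ^ℚ n ≤ℚ y ^ℚ n
^ℚ-mono zero    p q = ℚ.≤-refl
^ℚ-mono (suc n) p q = *-mono p (^ℚ-nonNeg n (ℚ.≤-trans p q)) q (^ℚ-mono n p q)

^ℚ-cancel : ∀ {x y} n → NonZero n → 0ℚ ≤ℚ y → x ^ℚ n ≤ℚ y ^ℚ n → x ≤ℚ y
^ℚ-cancel {x} {y} (suc n) _ 0≤y p = ℚ.≮⇒≥ λ y<x → ℚ.<-irrefl refl (ℚ.<-≤-trans (strict y<x) p)
  where
  strict : y <ℚ x → y ^ℚ suc n <ℚ x ^ℚ suc n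
  strict y<x = ℚ.≤-<-trans (*-monoˡ 0≤y (^ℚ-mono n 0≤y (ℚ.<⇒≤ y<x))) (ℚ.*-monoˡ-<-pos (x ^ℚ n) {{ℚ.positive (^ℚ-pos n (ℚ.≤-<-trans 0≤y y<x))}} y<x)

pos neg : ℚ → ℕ
pos (ℚ.mkℚ (+ a) _ _)      = a
pos (ℚ.mkℚ -[1+ _ ] _ _)   = 0
neg (ℚ.mkℚ (+ _) _ _)      = 0
neg (ℚ.mkℚ -[1+ a ] _ _)   = suc a

pos-neg : ∀ x → x *ℚ fromℕ (ℚ.↧ₙ x) ≡ fromℕ (pos x) -ℚ fromℕ (neg x)
pos-neg x@(ℚ.mkℚ (+ a) d _) = begin
  x *ℚ fromℕ (suc d) ≡⟨ cong (_*ℚ fromℕ (suc d)) (trans (sym (ℚ.↥p/↧p≡p x)) (fraction a d)) ⟩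
  fromℕ a *ℚ inv (suc d) *ℚ fromℕ (suc d) ≡⟨ trans (ℚ.*-assoc (fromℕ a) _ _) (trans (cong (fromℕ a *ℚ_) (inv*fromℕ (suc d))) (ℚ.*-identityʳ (fromℕ a))) ⟩
  fromℕ a ≡⟨ sym (ℚ.+-identityʳ (fromℕ a)) ⟩
  fromℕ a -ℚ fromℕ 0 ∎
  where open ≡-Reasoning
pos-neg (ℚ.mkℚ -[1+ a ] d c) = begin
  (-ℚ x) *ℚ fromℕ (suc d) ≡⟨ sym (ℚ.neg-distribˡ-* x (fromℕ (suc d))) ⟩
  -ℚ (x *ℚ fromℕ (suc d)) ≡⟨ cong -ℚ_ (trans (pos-neg x) (ℚ.+-identityʳ (fromℕ (suc a)))) ⟩
  -ℚ fromℕ (suc a) ≡⟨ sym (ℚ.+-identityˡ _) ⟩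
  fromℕ 0 -ℚ fromℕ (suc a) ∎
  where
  open ≡-Reasoning
  x = ℚ.mkℚ ℤ.+[1+ a ] d c

module Exponents (r : ℕ) (1≤r : 1 ≤ r) where
  R : ℚ
  R = fromℕ r

  1≤R : 1ℚ ≤ℚ R
  1≤R = fromℕ-mono {1} 1≤r

  0<R : 0ℚ <ℚ R
  0<R = ℚ.<-≤-trans (ℚ.positive⁻¹ 1ℚ) 1≤R

  0≤R^ : ∀ n → 0ℚ ≤ℚ R ^ℚ n
  0≤R^ n = ^ℚ-nonNeg n (ℚ.<⇒≤ 0<R)

  R^-mono : ∀ {m n} → m ≤ n → R ^ℚ m ≤ℚ R ^ℚ n
  R^-mono {m} {n} p = subst₂ _≤ℚ_ (fromℕ-^ℚ r m) (fromℕ-^ℚ r n) (fromℕ-mono (^-monoʳ-≤ r {{ℕ.>-nonZero 1≤r}} p))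

  unfold : ∀ x {y} → r ^⟨ x ⟩≤ y → R ^ℚ pos x ≤ℚ R ^ℚ neg x *ℚ y ^ℚ (ℚ.↧ₙ x)
  unfold (ℚ.mkℚ (+ a) d _)    h = ℚ.≤-trans (≡⇒≤ (sym (fromℕ-^ℚ r a))) (ℚ.≤-trans h (≡⇒≤ (sym (ℚ.*-identityˡ _))))
  unfold (ℚ.mkℚ -[1+ a ] d _) h = ℚ.≤-trans h (≡⇒≤ (cong (_*ℚ _) (fromℕ-^ℚ r (suc a))))

  fold : ∀ x {y} → R ^ℚ pos x ≤ℚ R ^ℚ neg x *ℚ y ^ℚ (ℚ.↧ₙ x) → r ^⟨ x ⟩≤ y
  fold (ℚ.mkℚ (+ a) d _)    h = ℚ.≤-trans (≡⇒≤ (fromℕ-^ℚ r a)) (ℚ.≤-trans h (≡⇒≤ (ℚ.*-identityˡ _)))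
  fold (ℚ.mkℚ -[1+ a ] d _) h = ℚ.≤-trans h (≡⇒≤ (cong (_*ℚ _) (sym (fromℕ-^ℚ r (suc a)))))

  -- The exponent (p - q) / b is at most (p₀ - q₀) / d.
  rescale : ∀ {y} p₀ q₀ d p q b → NonZero d → 0ℚ ≤ℚ y → p * d + q₀ * b ≤ p₀ * b + q * d → R ^ℚ p₀ ≤ℚ R ^ℚ q₀ *ℚ y ^ℚ d → R ^ℚ p ≤ℚ R ^ℚ q *ℚ y ^ℚ b
  rescale {y} p₀ q₀ d p q b d≢0 0≤y le h = ^ℚ-cancel d d≢0 (0≤* (0≤R^ q) (^ℚ-nonNeg b 0≤y)) (ℚ.*-cancelˡ-≤-pos (R ^ℚ (q₀ * b)) {{ℚ.positive (^ℚ-pos (q₀ * b) 0<R)}} (begin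
    R ^ℚ (q₀ * b) *ℚ (R ^ℚ p) ^ℚ d ≡⟨ trans (ℚ.*-comm _ ((R ^ℚ p) ^ℚ d)) (trans (cong (_*ℚ R ^ℚ (q₀ * b)) (^-assocʳ R p d)) (sym (^-homo-* R (p * d) (q₀ * b)))) ⟩
    R ^ℚ (p * d + q₀ * b) ≤⟨ R^-mono le ⟩
    R ^ℚ (p₀ * b + q * d) ≡⟨ trans (^-homo-* R (p₀ * b) (q * d)) (cong₂ _*ℚ_ (sym (^-assocʳ R p₀ b)) (sym (^-assocʳ R q d))) ⟩
    (R ^ℚ p₀) ^ℚ b *ℚ (R ^ℚ q) ^ℚ d ≤⟨ *-monoʳ (^ℚ-nonNeg d (0≤R^ q)) (^ℚ-mono b (0≤R^ p₀) h) ⟩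
    (R ^ℚ q₀ *ℚ y ^ℚ d) ^ℚ b *ℚ (R ^ℚ q) ^ℚ d ≡⟨ cong (_*ℚ (R ^ℚ q) ^ℚ d) (trans (^-distrib-* (R ^ℚ q₀) (y ^ℚ d) b) (cong₂ _*ℚ_ (^-assocʳ R q₀ b) (trans (^-assocʳ y d b) (trans (cong (y ^ℚ_) (ℕ.*-comm d b)) (sym (^-assocʳ y b d)))))) ⟩
    R ^ℚ (q₀ * b) *ℚ (y ^ℚ b) ^ℚ d *ℚ (R ^ℚ q) ^ℚ d ≡⟨ solve 3 (λ a b c → a :* b :* c := a :* (c :* b)) refl (R ^ℚ (q₀ * b)) ((y ^ℚ b) ^ℚ d) ((R ^ℚ q) ^ℚ d) ⟩
    R ^ℚ (q₀ * b) *ℚ ((R ^ℚ q) ^ℚ d *ℚ (y ^ℚ b) ^ℚ d) ≡⟨ cong (R ^ℚ (q₀ * b) *ℚ_) (sym (^-distrib-* (R ^ℚ q) (y ^ℚ b) d)) ⟩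
    R ^ℚ (q₀ * b) *ℚ (R ^ℚ q *ℚ y ^ℚ b) ^ℚ d ∎))
    where
    open ℚ.≤-Reasoning

  lower-exponent : ∀ {x x′ y Y a} u s t → NonZero t → 0ℚ ≤ℚ y → 0ℚ ≤ℚ Y → 0ℚ ≤ℚ a → a ^ℚ t ≤ℚ R ^ℚ s → Y ≤ℚ R ^ℚ u *ℚ a *ℚ y →
    x′ ≤ℚ x -ℚ fromℕ u -ℚ fromℕ s *ℚ inv t → r ^⟨ x ⟩≤ Y → r ^⟨ x′ ⟩≤ y
  lower-exponent {x} {x′} {y} {Y} {a} u s t t≢0 0≤y 0≤Y 0≤a a≤ Y≤ x′≤ h = fold x′ (rescale p₁ q₁ d₁ p′ q′ d′ (ℕ.m*n≢0 d t {{_}} {{t≢0}}) 0≤y exponents main)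
    where
    p₀ = pos x
    q₀ = neg x
    d = ℚ.↧ₙ x
    p′ = pos x′
    q′ = neg x′
    d′ = ℚ.↧ₙ x′
    p₁ = p₀ * t
    q₁ = (q₀ + u * d) * t + s * d
    d₁ = d * t
    main : R ^ℚ p₁ ≤ℚ R ^ℚ q₁ *ℚ y ^ℚ d₁
    main = begin
      R ^ℚ (p₀ * t) ≡⟨ sym (^-assocʳ R p₀ t) ⟩
      (R ^ℚ p₀) ^ℚ t ≤⟨ ^ℚ-mono t (0≤R^ p₀) (ℚ.≤-trans (unfold x h) (*-monoˡ (0≤R^ q₀) (^ℚ-mono d 0≤Y Y≤))) ⟩
      (R ^ℚ q₀ *ℚ (R ^ℚ u *ℚ a *ℚ y) ^ℚ d) ^ℚ t ≡⟨ cong (_^ℚ t) (trans (cong (R ^ℚ q₀ *ℚ_) (trans (^-distrib-* (R ^ℚ u *ℚ a) y d) (cong (_*ℚ y ^ℚ d) (trans (^-distrib-* (R ^ℚ u) a d) (cong (_*ℚ a ^ℚ d) (^-assocʳ R u d))))))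
                                                                                   (trans (solve 4 (λ q u a y → q :* (u :* a :* y) := (q :* u) :* a :* y) refl (R ^ℚ q₀) (R ^ℚ (u * d)) (a ^ℚ d) (y ^ℚ d)) (cong (λ z → z *ℚ a ^ℚ d *ℚ y ^ℚ d) (sym (^-homo-* R q₀ (u * d)))))) ⟩
      (R ^ℚ (q₀ + u * d) *ℚ a ^ℚ d *ℚ y ^ℚ d) ^ℚ t ≡⟨ trans (^-distrib-* (R ^ℚ (q₀ + u * d) *ℚ a ^ℚ d) (y ^ℚ d) t) (cong₂ _*ℚ_ (trans (^-distrib-* (R ^ℚ (q₀ + u * d)) (a ^ℚ d) t) (cong₂ _*ℚ_ (^-assocʳ R (q₀ + u * d) t)
                                                                                   (trans (^-assocʳ a d t) (trans (cong (a ^ℚ_) (ℕ.*-comm d t)) (sym (^-assocʳ a t d)))))) (^-assocʳ y d t)) ⟩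
      R ^ℚ ((q₀ + u * d) * t) *ℚ (a ^ℚ t) ^ℚ d *ℚ y ^ℚ d₁ ≤⟨ *-monoʳ (^ℚ-nonNeg d₁ 0≤y) (*-monoˡ (0≤R^ ((q₀ + u * d) * t)) (ℚ.≤-trans (^ℚ-mono d (^ℚ-nonNeg t 0≤a) a≤) (≡⇒≤ (^-assocʳ R s d)))) ⟩
      R ^ℚ ((q₀ + u * d) * t) *ℚ R ^ℚ (s * d) *ℚ y ^ℚ d₁ ≡⟨ cong (_*ℚ y ^ℚ d₁) (sym (^-homo-* R ((q₀ + u * d) * t) (s * d))) ⟩
      R ^ℚ q₁ *ℚ y ^ℚ d₁ ∎
      where open ℚ.≤-Reasoning
    x₁ = x -ℚ fromℕ u -ℚ fromℕ s *ℚ inv t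
    x₁≡ : x₁ *ℚ fromℕ d₁ ≡ fromℕ p₁ -ℚ fromℕ q₁
    x₁≡ = begin
      x₁ *ℚ fromℕ (d * t) ≡⟨ cong (x₁ *ℚ_) (fromℕ-* d t) ⟩
      x₁ *ℚ (D *ℚ τ) ≡⟨ solve 6 (λ x u s i d t → (x :- u :- s :* i) :* (d :* t) := x :* d :* t :- (u :* d :* t :+ s :* d :* (i :* t))) refl x U S (inv t) D τ ⟩
      x *ℚ D *ℚ τ -ℚ (U *ℚ D *ℚ τ +ℚ S *ℚ D *ℚ (inv t *ℚ τ)) ≡⟨ cong₂ (λ z w → z *ℚ τ -ℚ (U *ℚ D *ℚ τ +ℚ S *ℚ D *ℚ w)) (pos-neg x) (inv*fromℕ t {{t≢0}}) ⟩
      (P -ℚ Q) *ℚ τ -ℚ (U *ℚ D *ℚ τ +ℚ S *ℚ D *ℚ 1ℚ) ≡⟨ solve 6 (λ p q u d t s → (p :- q) :* t :- (u :* d :* t :+ s :* d :* con 1ℚ) := p :* t :- ((q :+ u :* d) :* t :+ s :* d)) refl P Q U D τ S ⟩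
      P *ℚ τ -ℚ ((Q +ℚ U *ℚ D) *ℚ τ +ℚ S *ℚ D) ≡⟨ sym (cong₂ _-ℚ_ (fromℕ-* p₀ t) (trans (fromℕ-+ ((q₀ + u * d) * t) (s * d)) (cong₂ _+ℚ_ (trans (fromℕ-* (q₀ + u * d) t) (cong (_*ℚ τ) (trans (fromℕ-+ q₀ (u * d)) (cong (Q +ℚ_) (fromℕ-* u d))))) (fromℕ-* s d)))) ⟩
      fromℕ p₁ -ℚ fromℕ q₁ ∎
      where
      open ≡-Reasoning
      D = fromℕ d
      τ = fromℕ t
      U = fromℕ u
      S = fromℕ s
      P = fromℕ p₀
      Q = fromℕ q₀
    exponents : p′ * d₁ + q₁ * d′ ≤ p₁ * d′ + q′ * d₁
    exponents = fromℕ-reflects-≤ (≤-from-diff (diff≥0 cross) (trans (split p₁ d′ q′ d₁) (trans (solve 4 (λ a b c d → a :+ b := (c :+ d) :+ ((a :- d) :- (c :- b))) refl (fromℕ p₁ *ℚ fromℕ d′) (fromℕ q′ *ℚ fromℕ d₁) (fromℕ p′ *ℚ fromℕ d₁) (fromℕ q₁ *ℚ fromℕ d′)) (cong₂ _+ℚ_ (sym (split p′ d₁ q₁ d′))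
        (cong₂ _-ℚ_ (solve 3 (λ a b c → a :* c :- b :* c := (a :- b) :* c) refl (fromℕ p₁) (fromℕ q₁) (fromℕ d′)) (solve 3 (λ a b c → a :* c :- b :* c := (a :- b) :* c) refl (fromℕ p′) (fromℕ q′) (fromℕ d₁)))))))
      where
      split : ∀ a b c d → fromℕ (a * b + c * d) ≡ fromℕ a *ℚ fromℕ b +ℚ fromℕ c *ℚ fromℕ d
      split a b c d = trans (fromℕ-+ (a * b) (c * d)) (cong₂ _+ℚ_ (fromℕ-* a b) (fromℕ-* c d))
      cross : (fromℕ p′ -ℚ fromℕ q′) *ℚ fromℕ d₁ ≤ℚ (fromℕ p₁ -ℚ fromℕ q₁) *ℚ fromℕ d′
      cross = begin
        (fromℕ p′ -ℚ fromℕ q′) *ℚ fromℕ d₁ ≡⟨ cong (_*ℚ fromℕ d₁) (sym (pos-neg x′)) ⟩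
        x′ *ℚ fromℕ d′ *ℚ fromℕ d₁ ≤⟨ *-monoʳ (0≤fromℕ d₁) (*-monoʳ (0≤fromℕ d′) x′≤) ⟩
        x₁ *ℚ fromℕ d′ *ℚ fromℕ d₁ ≡⟨ solve 3 (λ a b c → a :* b :* c := a :* c :* b) refl x₁ (fromℕ d′) (fromℕ d₁) ⟩
        x₁ *ℚ fromℕ d₁ *ℚ fromℕ d′ ≡⟨ cong (_*ℚ fromℕ d′) x₁≡ ⟩
        (fromℕ p₁ -ℚ fromℕ q₁) *ℚ fromℕ d′ ∎
        where open ℚ.≤-Reasoning

-- (len r)² = r ^ o(1)

module _ (r : ℕ) where
  log-height log-width : ℕ
  log-height = ℕ.pred (len r)
  log-width  = 2 * len (len r)

  log-exponent : ℚ
  log-exponent = fromℕ log-width *ℚ inv log-height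

module LogExponent {r : ℕ} (2≤r : 2 ≤ r) where
  private
    ℓ = len r
    t = log-height r
    L = len ℓ
    2≤ℓ : 2 ≤ ℓ
    2≤ℓ = len-mono {2} {r} 2≤r
    suc-t : suc t ≡ ℓ
    suc-t = ℕ.suc-pred ℓ {{ℕ.>-nonZero (≤-trans (s≤s z≤n) 2≤ℓ)}}

  log-height≢0 : NonZero t
  log-height≢0 = ℕ.>-nonZero (ℕ.s≤s⁻¹ (≤-trans 2≤ℓ (≡⇒≤ⁿ (sym suc-t))))

  2^t≤r : 2 ^ t ≤ r
  2^t≤r = ≮⇒≥ λ r<2^t → <-irrefl refl (≤-trans (≡⇒≤ⁿ suc-t) (len-≤ {r} {t} r<2^t))

  log-power : (ℓ * ℓ) ^ t ≤ r ^ log-width r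
  log-power = begin
    (ℓ * ℓ) ^ t ≤⟨ ℕ.^-monoˡ-≤ t (ℕ.*-mono-≤ (<⇒≤ (n<2^len ℓ)) (<⇒≤ (n<2^len ℓ))) ⟩
    (2 ^ L * 2 ^ L) ^ t ≡⟨ cong (_^ t) (trans (sym (ℕ.^-distribˡ-+-* 2 L L)) (cong (λ z → 2 ^ (L + z)) (sym (+-identityʳ L)))) ⟩
    (2 ^ (2 * L)) ^ t ≡⟨ trans (ℕ.^-*-assoc 2 (2 * L) t) (trans (cong (2 ^_) (ℕ.*-comm (2 * L) t)) (sym (ℕ.^-*-assoc 2 t (2 * L)))) ⟩
    (2 ^ t) ^ (2 * L) ≤⟨ ℕ.^-monoˡ-≤ (2 * L) 2^t≤r ⟩
    r ^ (2 * L) ∎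
    where open ℕ.≤-Reasoning

  log-exponent-small : ∀ N → NonZero N → 24 * N ≤ L → log-exponent r ≤ℚ inv N
  log-exponent-small N N≢0 le = ratio≤inv (log-width r) t N log-height≢0 N≢0 (ℕ.*-cancelˡ-≤ 12 (begin
    12 * (N * (2 * L)) ≡⟨ eq N L ⟩
    24 * N * L ≤⟨ *-monoˡ-≤ L le ⟩
    L * L ≤⟨ square≤ L ⟩
    2 * 2 ^ L ≤⟨ *-monoʳ-≤ 2 (2^⌈log⌉≤2n (suc ℓ) (s≤s z≤n)) ⟩
    2 * (2 * suc ℓ) ≡⟨ cong (λ z → 2 * (2 * suc z)) (sym suc-t) ⟩
    2 * (2 * suc (suc t)) ≤⟨ *-monoʳ-≤ 2 (*-monoʳ-≤ 2 (+-monoˡ-≤ t (*-monoʳ-≤ 2 (ℕ.>-nonZero⁻¹ t {{log-height≢0}})))) ⟩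
    2 * (2 * (2 * t + t)) ≡⟨ eq′ t ⟩
    12 * t ∎))
    where
    open ℕ.≤-Reasoning
    eq : ∀ N L → 12 * (N * (2 * L)) ≡ 24 * N * L
    eq = solve-∀
    eq′ : ∀ t → 2 * (2 * (2 * t + t)) ≡ 12 * t
    eq′ = solve-∀
    square≤ : ∀ n → n * n ≤ 2 * 2 ^ n
    square≤ zero    = z≤n
    square≤ (suc n) = begin
      suc n * suc n ≡⟨ e n ⟩
      n * n + suc (2 * n) ≤⟨ +-mono-≤ (square≤ n) (≤-trans (n≤1+n _) (≤-trans (≡⇒≤ⁿ (e₁ n)) (*-monoʳ-≤ 2 (n<2^n n)))) ⟩
      2 * 2 ^ n + 2 * 2 ^ n ≡⟨ e₂ (2 ^ n) ⟩
      2 * 2 ^ suc n ∎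
      where
      e : ∀ n → suc n * suc n ≡ n * n + suc (2 * n)
      e = solve-∀
      e₁ : ∀ n → suc (suc (2 * n)) ≡ 2 * suc n
      e₁ = solve-∀
      e₂ : ∀ x → 2 * x + 2 * x ≡ 2 * (2 * x)
      e₂ = solve-∀

log-exponent-vanishing : Vanishing log-exponent
log-exponent-vanishing δ 0<δ = 2 ^ (2 ^ (24 * N)) + 2 , λ r le → ℚ.≤-<-trans (bound r le) half
  where
  arch = archimedean (½ *ℚ δ) (0<* (ℚ.positive⁻¹ ½) 0<δ)
  N = proj₁ arch
  N≢0 = proj₁ (proj₂ arch)
  half : ½ *ℚ δ <ℚ δ
  half = subst (½ *ℚ δ <ℚ_) (ℚ.*-identityˡ δ) (ℚ.*-monoˡ-<-pos δ {{ℚ.positive 0<δ}} {½} {1ℚ} (ℚ.*<* (ℤ.+<+ (s≤s (s≤s z≤n)))))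
  n≤len : ∀ {n r} → 2 ^ n ≤ r → n ≤ len r
  n≤len {n} {r} p = ≮⇒≥ λ q → <-irrefl refl (ℕ.<-≤-trans (n<2^len r) (≤-trans (^-monoʳ-≤ 2 (<⇒≤ q)) p))
  bound : ∀ r → 2 ^ (2 ^ (24 * N)) + 2 ≤ r → ℚ.∣ log-exponent r ∣ ≤ℚ ½ *ℚ δ
  bound r le = ℚ.≤-trans (≡⇒≤ (ℚ.0≤p⇒∣p∣≡p (0≤* (0≤fromℕ (log-width r)) (0≤inv (log-height r)))))
    (ℚ.≤-trans (LogExponent.log-exponent-small (≤-trans (m≤n+m 2 _) le) N N≢0 (n≤len (n≤len (≤-trans (m≤m+n _ 2) le)))) (proj₂ (proj₂ arch) N ≤-refl))

Vanishing-+ : ∀ {f g} → Vanishing f → Vanishing g → Vanishing (λ r → f r +ℚ g r)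
Vanishing-+ {f} {g} F G δ 0<δ =
  let (m , p) = F (½ *ℚ δ) 0<½δ ; (n , q) = G (½ *ℚ δ) 0<½δ in
  m + n , λ r le → ℚ.≤-<-trans (ℚ.∣p+q∣≤∣p∣+∣q∣ (f r) (g r)) (subst (ℚ.∣ f r ∣ +ℚ ℚ.∣ g r ∣ <ℚ_) halves (ℚ.+-mono-< (p r (≤-trans (m≤m+n m n) le)) (q r (≤-trans (m≤n+m n m) le))))
  where
  0<½δ = 0<* (ℚ.positive⁻¹ ½) 0<δ
  halves : ½ *ℚ δ +ℚ ½ *ℚ δ ≡ δ
  halves = trans (sym (ℚ.*-distribʳ-+ δ ½ ½)) (ℚ.*-identityˡ δ)

-- The lower bound

fraction′ : ∀ n d .{{_ : NonZero d}} → + n ℚ./ d ≡ fromℕ n *ℚ inv d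
fraction′ n (suc d) = fraction n d

⌈log⌉≡ : ∀ n r → ⌈ fromℕ n log r ⌉ ≡ ⌈log₂ r ^ n ⌉
⌈log⌉≡ n r = trans (cong (λ e → ⌈ e log r ⌉) (ℚ.normalize-coprime {n} {0} (Coprimality.sym (Coprimality.1-coprimeTo n)))) (trans (DivMod.n/1≡n _) (+-identityʳ ⌈log₂ r ^ n ⌉))

module LowerBound (𝔽 : FamilyData) (conjecture : AverageCaseConjecture (FamilyData.𝔾 𝔽)) where
  open FamilyData 𝔽

  module _ (j u : ℕ) (1≤u : 1 ≤ u) where
    k k′ : ℕ
    k  = suc j
    k′ = u + k

    planted-time : ∀ e → e ≤ℚ fromℕ ⌈ k′ /2⌉ -ℚ fromℕ u → TakesTime k (λ r → 𝔾 ⌈ fromℕ k′ log r ⌉) (λ r → planted (𝔾 ⌈ fromℕ k′ log r ⌉) k r) e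
    planted-time e e≤ p success = g′ , Vanishing-+ V log-exponent-vanishing , c *ℚ fromℕ (suc K) , 0<* 0<c (0<fromℕ (suc K)) , r₀ + (k + k + 2) , bound
      where
      open Family 𝔽 j u 1≤u p (λ r → ⌈ fromℕ k′ log r ⌉) (⌈log⌉≡ k′)
      q = Programs.reduction arith j u p
      hypothesis = conjecture k′ q (reduction-success success)
      g = proj₁ hypothesis
      V = proj₁ (proj₂ hypothesis)
      c = proj₁ (proj₂ (proj₂ hypothesis))
      0<c = proj₁ (proj₂ (proj₂ (proj₂ hypothesis)))
      r₀ = proj₁ (proj₂ (proj₂ (proj₂ (proj₂ hypothesis))))
      h = proj₂ (proj₂ (proj₂ (proj₂ (proj₂ hypothesis))))
      g′ : ℕ → ℚ
      g′ r = g r +ℚ log-exponent r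
      τ = Constants.time-constant arith j u p C Nₛ
      K = τ * (16 * (B * B))
      constants : ∀ τ b R ℓ → fromℕ (τ * (R * (4 * (b * ℓ) * (4 * (b * ℓ))))) ≡ fromℕ (τ * (16 * (b * b))) *ℚ (fromℕ R *ℚ fromℕ (ℓ * ℓ))
      constants τ b R ℓ = trans (cong fromℕ (eq τ b R ℓ)) (trans (fromℕ-* (τ * (16 * (b * b))) (R * (ℓ * ℓ))) (cong (fromℕ (τ * (16 * (b * b))) *ℚ_) (fromℕ-* R (ℓ * ℓ))))
        where
        eq : ∀ τ b R ℓ → τ * (R * (4 * (b * ℓ) * (4 * (b * ℓ)))) ≡ τ * (16 * (b * b)) * (R * (ℓ * ℓ))
        eq = solve-∀
      charge : ∀ K R a {x t} → 0ℚ ≤ℚ R → 0ℚ ≤ℚ a → 0ℚ ≤ℚ t → x ≤ℚ fromℕ K *ℚ (R *ℚ a) *ℚ t → c *ℚ x ≤ℚ R *ℚ a *ℚ (c *ℚ fromℕ (suc K) *ℚ t)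
      charge K R a {x} {t} 0≤R 0≤a 0≤t le = ℚ.≤-trans (*-monoˡ (ℚ.<⇒≤ 0<c) (ℚ.≤-trans le (*-monoʳ 0≤t (*-monoʳ (0≤* 0≤R 0≤a) (fromℕ-mono (n≤1+n K))))))
        (≡⇒≤ (solve 5 (λ c k r a t → c :* (k :* (r :* a) :* t) := r :* a :* (c :* k :* t)) refl c (fromℕ (suc K)) R a t))
      bound : ∀ r → r₀ + (k + k + 2) ≤ r → ∃[ n ] r ^⟨ e -ℚ g′ r ⟩≤ (c *ℚ fromℕ (suc K) *ℚ timeWithin (G r) (planted (G r) k r) p n)
      bound r le = suc n , lower-exponent u (log-width r) (log-height r) log-height≢0
          (0≤* (0≤* (ℚ.<⇒≤ 0<c) (0≤fromℕ (suc K))) 0≤T) (0≤* (ℚ.<⇒≤ 0<c) (mean-nonNeg (allVecs (FiniteGroup.elements (G r)) r) (λ X → cost-nonNeg (encode (G r) X) n (initial q)))) (0≤fromℕ (ℓ * ℓ))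
          (subst₂ _≤ℚ_ (fromℕ-^ℚ (ℓ * ℓ) (log-height r)) (fromℕ-^ℚ r (log-width r)) (fromℕ-mono log-power))
          (charge K (fromℕ r ^ℚ u) (fromℕ (ℓ * ℓ)) (0≤R^ u) (0≤fromℕ (ℓ * ℓ)) 0≤T (ℚ.≤-trans (reduction-time r 1≤r k+k≤r n) (≡⇒≤ (cong (_*ℚ T₁) (trans (constants τ B (r ^ u) ℓ) (cong (λ z → fromℕ K *ℚ (z *ℚ fromℕ (ℓ * ℓ))) (fromℕ-^ℚ r u)))))))
          (ℚ.≤-trans (ℚ.+-monoˡ-≤ (-ℚ g′ r) e≤) (≡⇒≤ (solve 4 (λ c u g l → (c :- u) :- (g :+ l) := ((c :- g) :- u) :- l) refl (fromℕ ⌈ k′ /2⌉) (fromℕ u) (g r) (log-exponent r))))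
          (proj₂ run)
        where
        run = h r (≤-trans (m≤m+n r₀ _) le)
        n = proj₁ run
        ℓ = len r
        k+k+2≤r : k + k + 2 ≤ r
        k+k+2≤r = ≤-trans (m≤n+m _ r₀) le
        2≤r : 2 ≤ r
        2≤r = ≤-trans (m≤n+m 2 (k + k)) k+k+2≤r
        1≤r : 1 ≤ r
        1≤r = ≤-trans (s≤s z≤n) 2≤r
        k+k≤r : k + k ≤ r
        k+k≤r = ≤-trans (m≤m+n (k + k) 2) k+k+2≤r
        open Exponents r 1≤r
        open LogExponent 2≤r
        T₁ = timeWithin (G r) (planted (G r) k r) p (suc n)
        0≤T : 0ℚ ≤ℚ T₁
        0≤T = mean-nonNeg (subsetsOfSize k r) (λ S → mean-nonNeg (allVecs (FiniteGroup.elements (G r)) r) (λ X → cost-nonNeg (encode (G r) (plant (G r) S X)) (suc n) (initial p)))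

    module _ (Δ : ℚ) .{{Δ≢0 : ℚ.NonZero Δ}} (Δ≡ : Δ ≡ fromℕ k *ℚ inv k′) where
      k÷Δ≡k′ : fromℕ k ÷ Δ ≡ fromℕ k′
      k÷Δ≡k′ = begin
        fromℕ k *ℚ i ≡⟨ cong (_*ℚ i) (sym (trans (cong (fromℕ k *ℚ_) (inv*fromℕ k′ {{ℕ.>-nonZero (≤-trans 1≤u (m≤m+n u k))}})) (ℚ.*-identityʳ (fromℕ k)))) ⟩
        fromℕ k *ℚ (inv k′ *ℚ fromℕ k′) *ℚ i ≡⟨ solve 4 (λ k v k′ i → k :* (v :* k′) :* i := (k :* v) :* i :* k′) refl (fromℕ k) (inv k′) (fromℕ k′) i ⟩
        fromℕ k *ℚ inv k′ *ℚ i *ℚ fromℕ k′ ≡⟨ cong (_*ℚ fromℕ k′) (trans (cong (_*ℚ i) (sym Δ≡)) (ℚ.*-inverseʳ Δ)) ⟩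
        1ℚ *ℚ fromℕ k′ ≡⟨ ℚ.*-identityˡ (fromℕ k′) ⟩
        fromℕ k′ ∎
        where
        open ≡-Reasoning
        i = ℚ.1/ Δ

      exponent≤ : fromℕ k *ℚ (1ℚ -ℚ ½ ÷ Δ) ≤ℚ fromℕ ⌈ k′ /2⌉ -ℚ fromℕ u
      exponent≤ = ≤-from-diff (diff≥0 half≤) (begin
        c -ℚ fromℕ u ≡⟨ solve 3 (λ c u k → c :- u := (k :- con ½ :* (u :+ k)) :+ (c :- con ½ :* (u :+ k))) refl c (fromℕ u) (fromℕ k) ⟩
        (fromℕ k -ℚ ½ *ℚ (fromℕ u +ℚ fromℕ k)) +ℚ (c -ℚ ½ *ℚ (fromℕ u +ℚ fromℕ k)) ≡⟨ cong (λ z → (fromℕ k -ℚ ½ *ℚ z) +ℚ (c -ℚ ½ *ℚ z)) (sym (fromℕ-+ u k)) ⟩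
        (fromℕ k -ℚ ½ *ℚ fromℕ k′) +ℚ (c -ℚ ½ *ℚ fromℕ k′) ≡⟨ cong (λ z → (fromℕ k -ℚ ½ *ℚ z) +ℚ (c -ℚ ½ *ℚ fromℕ k′)) (sym k÷Δ≡k′) ⟩
        (fromℕ k -ℚ ½ *ℚ (fromℕ k ÷ Δ)) +ℚ (c -ℚ ½ *ℚ fromℕ k′) ≡⟨ cong (_+ℚ (c -ℚ ½ *ℚ fromℕ k′)) (solve 2 (λ k i → k :- con ½ :* (k :* i) := k :* (con 1ℚ :- con ½ :* i)) refl (fromℕ k) (ℚ.1/ Δ)) ⟩
        fromℕ k *ℚ (1ℚ -ℚ ½ ÷ Δ) +ℚ (c -ℚ ½ *ℚ fromℕ k′) ∎)
        where
        open ≡-Reasoning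
        c = fromℕ ⌈ k′ /2⌉
        k′≤2c : k′ ≤ ⌈ k′ /2⌉ + ⌈ k′ /2⌉
        k′≤2c = ≤-trans (≡⇒≤ⁿ (sym (ℕ.⌊n/2⌋+⌈n/2⌉≡n k′))) (+-monoˡ-≤ ⌈ k′ /2⌉ (ℕ.⌊n/2⌋≤⌈n/2⌉ k′))
        half≤ : ½ *ℚ fromℕ k′ ≤ℚ c
        half≤ = ℚ.≤-trans (*-monoˡ (ℚ.nonNegative⁻¹ ½) (ℚ.≤-trans (fromℕ-mono k′≤2c) (≡⇒≤ (fromℕ-+ ⌈ k′ /2⌉ ⌈ k′ /2⌉)))) (≡⇒≤ (solve 1 (λ c → con ½ :* (c :+ c) := c) refl c))

      planted-lower-bound : PlantedTakesTime 𝔾 k Δ (fromℕ k *ℚ (1ℚ -ℚ ½ ÷ Δ))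
      planted-lower-bound = subst (λ q → TakesTime k (λ r → 𝔾 ⌈ q log r ⌉) (λ r → planted (𝔾 ⌈ q log r ⌉) k r) (fromℕ k *ℚ (1ℚ -ℚ ½ ÷ Δ))) (sym k÷Δ≡k′) (planted-time (fromℕ k *ℚ (1ℚ -ℚ ½ ÷ Δ)) exponent≤)

  lower-bound : (k : ℕ) (Δ : ℚ) .{{_ : ℚ.NonZero Δ}} (k' : ℕ) .{{_ : NonZero k'}} → k + 1 ≤ k' → k' ≤ 2 * k ∸ 1 → Δ ≡ + k ℚ./ k' → PlantedTakesTime 𝔾 k Δ (fromℕ k *ℚ (1ℚ -ℚ ½ ÷ Δ))
  lower-bound zero    Δ k' p q e = contradiction (≤-trans p q) (λ ())
  lower-bound (suc j) Δ k' p q e = planted-lower-bound j (k' ∸ suc j) (ℕ.m+n≤o⇒m≤o∸n 1 (≤-trans (≡⇒≤ⁿ (+-comm 1 (suc j))) p)) Δ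
    (trans e (trans (fraction′ (suc j) k') (cong (λ z → fromℕ (suc j) *ℚ inv z) (sym (m∸n+n≡m (≤-trans (m≤m+n (suc j) 1) p))))))

modular-family bitwise-family : FamilyData
modular-family = record { arith = modular ; 𝔾 = ℤ2^ ; abelian = ℤ2^-abelian ; coded = ℤ2^-coded }
bitwise-family = record { arith = bitwise ; 𝔾 = 𝔽₂^ ; abelian = 𝔽₂^-abelian ; coded = 𝔽₂^-coded }

corollary4p11 :
    (AverageCaseSUM →
      (k : ℕ) (Δ : ℚ) .{{_ : ℚ.NonZero Δ}} → ½ ℚ.< Δ → Δ ℚ.< 1ℚ →
      (k' : ℕ) .{{_ : NonZero k'}} → k + 1 ≤ k' → k' ≤ 2 * k ∸ 1 → Δ ≡ + k / k' →
      PlantedTakesTime ℤ2^ k Δ (fromℕ k ℚ.* (1ℚ ℚ.- ½ ÷ Δ)))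
    ×
    (AverageCaseXOR →
      (k : ℕ) (Δ : ℚ) .{{_ : ℚ.NonZero Δ}} → ½ ℚ.< Δ → Δ ℚ.< 1ℚ →
      (k' : ℕ) .{{_ : NonZero k'}} → k + 1 ≤ k' → k' ≤ 2 * k ∸ 1 → Δ ≡ + k / k' →
      PlantedTakesTime 𝔽₂^ k Δ (fromℕ k ℚ.* (1ℚ ℚ.- ½ ÷ Δ)))
corollary4p11 =
  (λ conjecture k Δ _ _ k' → LowerBound.lower-bound modular-family conjecture k Δ k') ,
  (λ conjecture k Δ _ _ k' → LowerBound.lower-bound bitwise-family conjecture k Δ k')
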